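{- (i) For a positive integer $d$, let the types $T_1,T_2,\dots,T_d$ be given, where $$T_i=A_1^{m_1^{(i)}}*A_2^{m_2^{(i)}}*\dots*A_n^{m_n^{(i)}},\quad i=1,2,\dots,j-1,j+1,\dots,d,$$ and $$T_j=B_\alpha*A_1^{m_1^{(j)}}*A_2^{m_2^{(j)}}*\dots*A_n^{m_n^{(j)}}$$ for some $\alpha\ge1$, and let $l,m_1,m_2,\dots,m_l,s_1,s_2,\dots,s_l$ be given non-negative integers with $$\operatorname{rk} T_1+\operatorname{rk} T_2+\dots+\operatorname{rk} T_d+s_1+s_2+\dots+s_l=n.$$ Then the number of factorisations $$c=\sigma_1\sigma_2\cdots \sigma_d\,\sigma_1^{(1)}\sigma_2^{(1)}\cdots \sigma_{m_1}^{(1)}\,\sigma_1^{(2)}\sigma_2^{(2)}\cdots \sigma_{m_2}^{(2)}\cdots\sigma_1^{(l)}\sigma_2^{(l)}\cdots \sigma_{m_l}^{(l)},$$ where $c$ is a Coxeter element in $W(B_n)$, such that the combinatorial type of $\sigma_i$ is $T_i$, $i=1,2,\dots,d$, and such that $$\ell_T( \sigma_1^{(i)})+\ell_T(\sigma_2^{(i)})+\cdots+\ell_T(\sigma_{m_i}^{(i)})=s_i,\quad i=1,2,\dots,l,$$ is given by $$n^{d-1}\binom {n-\operatorname{rk} T_j}{m_1^{(j)},m_2^{(j)},\dots,m_n^{(j)}}\Bigg(\prod_{\substack{i=1\\ i\ne j}}^{d}\frac {1} {n-\operatorname{rk} T_i}\binom {n-\operatorname{rk} T_i}{m_1^{(i)},m_2^{(i)},\dots,m_n^{(i)}}\Bigg)\binom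 {m_1n} {s_1}\binom {m_2n} {s_2}\cdots\binom {m_ln} {s_l}.$$ (ii) For a positive integer $d$, let the types $T_1,T_2,\dots,T_d$ be given, where $$T_i=A_1^{m_1^{(i)}}*A_2^{m_2^{(i)}}*\dots*A_n^{m_n^{(i)}},\quad i=1,2,\dots,d,$$ and let $l,m_1,m_2,\dots,m_l,s_1,s_2,\dots,s_l$ be given non-negative integers. Then the number of factorisations $$c=\sigma_1\sigma_2\cdots \sigma_d\,\sigma_1^{(1)}\cdots \sigma_{m_1}^{(1)}\,\sigma_1^{(2)}\cdots \sigma_{m_2}^{(2)}\cdots\sigma_1^{(l)}\cdots \sigma_{m_l}^{(l)},$$ where $c$ is a Coxeter element in $W(B_n)$, which satisfy $$\ell_T( \sigma_1^{(i)})+\ell_T(\sigma_2^{(i)})+\cdots+\ell_T(\sigma_{m_i}^{(i)})=s_i,\quad i=1,2,\dots,l,$$ plus the condition that the combinatorial type of $\sigma_i$ is $T_i$, $i=1,2,\dots,d$, is given by $$n^{d-1}(n-\operatorname{rk} T_1-\operatorname{rk} T_2-\dots-\operatorname{rk} T_d)\Bigg(\prod _{i=1} ^{d}\frac {1} {n-\operatorname{rk} T_i}\binom {n-\operatorname{rk} T_i}{m_1^{(i)},m_2^{(i)},\dots,m_n^{(i)}}\Bigg)\binom {m_1n} {s_1}\binom {m_2n} {s_2}\cdots\binom {m_ln} {s_l}.$$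
   Context: $W(B_n)$ is realised as the group of permutations $\pi$ of $\{1,\dots,n,\bar 1,\dots,\bar n\}$ with $\pi(\bar i)=\overline{\pi(i)}$ (where $\bar{\bar i}=i$); the Coxeter element is $c=(1,2,\dots,n,\bar1,\dots,\bar n)$. Every element decomposes uniquely (up to order) into "type $A$ cycles" $(a_1,\dots,a_k)(\bar a_1,\dots,\bar a_k)$ of length $k$, said to have combinatorial type $A_{k-1}$, and "type $B$ cycles" $(a_1,\dots,a_k,\bar a_1,\dots,\bar a_k)$ of length $k$, said to have combinatorial type $B_k$ (with $B_1$ distinguished from $A_1$); the combinatorial type of an element is the product of these. $\ell_T$ is the absolute length (minimal number of reflections in a product representation). The rank of a type is the rank of the corresponding root system ($\operatorname{rk} A_k=k$, $\operatorname{rk} B_k=k$, additive over $*$). The multinomial coefficient is $\binom {M}{m_1,\dots,m_r}=\frac {M!} {m_1!\cdots m_r!\,(M-m_1-\dots-m_r)!}$.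
   Formalization: In (ii) the condition rk T_1+…+rk T_d+s_1+…+s_l=n is added (without it n=d=l=m_1=1, T_1 trivial, s_1=0 gives count 0 but formula 1); the factors 1/(n−rk T_i) are cleared, so nothing is claimed in (ii) where some rk T_i=n and the formula divides by zero. -}

module Defs where

open import Data.Nat using (ℕ; zero; suc; _!; _+_; _*_; _∸_; _^_; _≤ᵇ_; _≡ᵇ_; _/_; NonZero)
open import Data.Nat.Properties using (_!≢0; m*n≢0)
open import Data.Nat.Combinatorics using (_C_)
open import Data.Bool using (Bool; true; false; if_then_else_; _∧_; _∨_; not; _xor_)
open import Data.Fin using (Fin; zero; suc; toℕ)
open import Data.Fin.Properties using () renaming (_≟_ to _≟F_)
open import Data.Vec using (Vec; []; _∷_; lookup; tabulate; toList)
open import Data.List using (List; []; _∷_; _++_; map; concat; concatMap; upTo; allFin; length)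
open import Data.Bool.ListAction using (all; any)
open import Data.Nat.ListAction using (sum)
open import Data.Product using (_×_; _,_; proj₁; proj₂)
open import Data.Maybe using (Maybe; just; nothing; maybe)
open import Relation.Nullary.Decidable using (⌊_⌋)

sumF : ∀ {k} → (Fin k → ℕ) → ℕ
sumF {zero}  f = 0
sumF {suc k} f = f zero + sumF (λ i → f (suc i))

prodF : ∀ {k} → (Fin k → ℕ) → ℕ
prodF {zero}  f = 1
prodF {suc k} f = f zero * prodF (λ i → f (suc i))

_==F_ : ∀ {k} → Fin k → Fin k → Bool
i ==F j = ⌊ i ≟F j ⌋

-- Multinomial coefficient  M! / (m_1! ⋯ m_r! (M - m_1 - ⋯ - m_r)!)
-- (taken to be 0 when m_1 + ⋯ + m_r > M, as for binomial coefficients)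

factProd : ∀ {k} → (Fin k → ℕ) → ℕ
factProd {zero}  m = 1
factProd {suc k} m = (m zero) ! * factProd (λ i → m (suc i))

factProd≢0 : ∀ {k} (m : Fin k → ℕ) → NonZero (factProd m)
factProd≢0 {zero}  m = _
factProd≢0 {suc k} m =
  m*n≢0 ((m zero) !) (factProd (λ i → m (suc i)))
    {{(m zero) !≢0}} {{factProd≢0 (λ i → m (suc i))}}

multinomial : ∀ {k} → ℕ → (Fin k → ℕ) → ℕ
multinomial M m =
  if sumF m ≤ᵇ M
  then (M ! / (factProd m * (M ∸ sumF m) !))
         {{m*n≢0 _ _ {{factProd≢0 m}} {{(M ∸ sumF m) !≢0}}}}
  else 0

-- W(B_n) as signed permutations of {1,…,n, 1̄,…,n̄}.
-- A point is (i , b) with i : Fin n; b = false means i, b = true means ī.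
-- An element w is stored by its values on the unbarred points:
-- w (i , false) = lookup w i, and w (i , true) = overline of that.

Pt : ℕ → Set
Pt n = Fin n × Bool

RawW : ℕ → Set
RawW n = Vec (Pt n) n

eqPt : ∀ {n} → Pt n → Pt n → Bool
eqPt (i , b) (j , c) = (i ==F j) ∧ not (b xor c)

eqW : ∀ {n k} → Vec (Pt n) k → Vec (Pt n) k → Bool
eqW []       []       = true
eqW (x ∷ xs) (y ∷ ys) = eqPt x y ∧ eqW xs ys

-- action on all 2n points (respects w(ī) = overline(w(i)))
app : ∀ {n} → RawW n → Pt n → Pt n
app w (i , b) = proj₁ (lookup w i) , (proj₂ (lookup w i) xor b)

isSignedPerm : ∀ {n} → RawW n → Bool
isSignedPerm {n} w =
  all (λ i → all (λ j → (i ==F j) ∨ not (proj₁ (lookup w i) ==F proj₁ (lookup w j)))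
                 (allFin n))
      (allFin n)

_·_ : ∀ {n} → RawW n → RawW n → RawW n
σ · τ = tabulate (λ i → app σ (lookup τ i))

idW : ∀ {n} → RawW n
idW = tabulate (λ i → (i , false))

prodW : ∀ {n} → List (RawW n) → RawW n
prodW []       = idW
prodW (w ∷ ws) = w · prodW ws

allVecs : ∀ {A : Set} (k : ℕ) → List A → List (Vec A k)
allVecs zero    xs = [] ∷ []
allVecs (suc k) xs = concatMap (λ x → map (x ∷_) (allVecs k xs)) xs

allLists : ∀ {A : Set} (k : ℕ) → List A → List (List A)
allLists zero    xs = [] ∷ []
allLists (suc k) xs = concatMap (λ x → map (x ∷_) (allLists k xs)) xs

filterB : ∀ {A : Set} → (A → Bool) → List A → List A
filterB p []       = []
filterB p (x ∷ xs) = if p x then x ∷ filterB p xs else filterB p xs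

countB : ∀ {A : Set} → (A → Bool) → List A → ℕ
countB p xs = length (filterB p xs)

allPts : (n : ℕ) → List (Pt n)
allPts n = concatMap (λ i → (i , false) ∷ (i , true) ∷ []) (allFin n)

WB : (n : ℕ) → List (RawW n)
WB n = filterB isSignedPerm (allVecs n (allPts n))

-- the Coxeter element c = (1, 2, …, n, 1̄, …, n̄):  i ↦ i+1 (i < n), n ↦ 1̄
next : ∀ {k} → Fin (suc k) → Pt (suc k)
next {zero}  zero    = zero , true
next {suc k} zero    = suc zero , false
next {suc k} (suc i) with next {k} i
... | (j , true)  = zero , true
... | (j , false) = suc j , false

cox : (n : ℕ) → RawW n
cox zero    = []
cox (suc k) = tabulate next

-- Reflections of W(B_n):  ((i,j)) = (i j)(ī j̄),  ((i,j̄)) = (i j̄)(ī j)  (i < j),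
-- and [i] = (i ī).  Absolute length ℓ_T = minimal number of reflections.

swapW : ∀ {n} → Fin n → Fin n → Bool → RawW n
swapW i j s = tabulate (λ k → if k ==F i then (j , s)
                              else if k ==F j then (i , s)
                              else (k , false))

barW : ∀ {n} → Fin n → RawW n
barW i = tabulate (λ k → (k , (k ==F i)))

reflections : (n : ℕ) → List (RawW n)
reflections n =
  concatMap (λ i → concatMap (λ j →
      if suc (toℕ i) ≤ᵇ toℕ j then swapW i j false ∷ swapW i j true ∷ [] else [])
    (allFin n)) (allFin n)
  ++ map barW (allFin n)

productsOf : ∀ {n} → ℕ → List (RawW n)
productsOf {n} zero    = idW ∷ []
productsOf {n} (suc k) = concatMap (λ r → map (r ·_) (productsOf k)) (reflections n)

firstTrue : List ℕ → (ℕ → Bool) → ℕ → ℕ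
firstTrue []       p d = d
firstTrue (t ∷ ts) p d = if p t then t else firstTrue ts p d

-- ℓ_T(w) = least k such that w is a product of k reflections
-- (search over k = 0, …, n; every element of W(B_n) has ℓ_T ≤ n)
ℓT : ∀ {n} → RawW n → ℕ
ℓT {n} w = firstTrue (upTo (suc n)) (λ k → any (eqW w) (productsOf k)) n

iterW : ∀ {n} → ℕ → RawW n → Pt n → Pt n
iterW zero    w p = p
iterW (suc t) w p = app w (iterW t w p)

period : ∀ {n} → RawW n → Pt n → ℕ
period {n} w p = firstTrue (map suc (upTo (2 * n))) (λ t → eqPt (iterW t w p) p) 0

-- the cycle through i contains ī  (i.e. it is a type B cycle)
hitsBar : ∀ {n} → RawW n → Fin n → Bool
hitsBar {n} w i = any (λ t → eqPt (iterW t w (i , false)) (i , true)) (upTo (2 * n))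

-- number of type A cycles (a_1,…,a_{k+2})(ā_1,…,ā_{k+2}), i.e. of type A_{k+1}
aMult : ∀ {n} → RawW n → ℕ → ℕ
aMult {n} w k =
  countB (λ i → not (hitsBar w i) ∧ (period w (i , false) ≡ᵇ suc (suc k))) (allFin n)
    / suc (suc k)

-- number of type B cycles of length k+1, i.e. of type B_{k+1}
bMult : ∀ {n} → RawW n → ℕ → ℕ
bMult {n} w k =
  countB (λ i → hitsBar w i ∧ (period w (i , false) ≡ᵇ 2 * suc k)) (allFin n)
    / suc k

-- A combinatorial type: aMul k = multiplicity of A_{k+1} (k = 0,…,n-1), and
-- an optional single factor B_α (bCyc = just α) or none (bCyc = nothing).
record CType (n : ℕ) : Set where
  constructor ctype
  field
    aMul : Fin n → ℕ
    bCyc : Maybe ℕ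
open CType public

rk : ∀ {n} → CType n → ℕ
rk T = sumF (λ k → suc (toℕ k) * aMul T k) + maybe (λ α → α) 0 (bCyc T)

bMulOf : ∀ {n} → CType n → ℕ → ℕ
bMulOf T k = maybe (λ α → if α ≡ᵇ suc k then 1 else 0) 0 (bCyc T)

hasType : ∀ {n} → RawW n → CType n → Bool
hasType {n} w T =
  all (λ k → (aMult w (toℕ k) ≡ᵇ aMul T k) ∧ (bMult w (toℕ k) ≡ᵇ bMulOf T (toℕ k)))
      (allFin n)

enumBlocks : ∀ {n} → (l : ℕ) → (Fin l → ℕ) → List (List (List (RawW n)))
enumBlocks {n} zero    ms = [] ∷ []
enumBlocks {n} (suc l) ms =
  concatMap (λ b → map (b ∷_) (enumBlocks l (λ i → ms (suc i)))) (allLists (ms zero) (WB n))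

blocksOK : ∀ {n} → (l : ℕ) → (Fin l → ℕ) → List (List (RawW n)) → Bool
blocksOK zero    ss []       = true
blocksOK zero    ss (_ ∷ _)  = false
blocksOK (suc l) ss []       = false
blocksOK (suc l) ss (b ∷ bs) =
  (sum (map ℓT b) ≡ᵇ ss zero) ∧ blocksOK l (λ i → ss (suc i)) bs

numFactorisations : (n d : ℕ) → (Fin d → CType n) →
                    (l : ℕ) → (Fin l → ℕ) → (Fin l → ℕ) → ℕ
numFactorisations n d T l ms ss =
  countB (λ { (σs , τs) →
              eqW (prodW (toList σs ++ concat τs)) (cox n)
              ∧ all (λ i → hasType (lookup σs i) (T i)) (allFin d)
              ∧ blocksOK l ss τs })
         (concatMap (λ σs → map (σs ,_) (enumBlocks l ms)) (allVecs d (WB n)))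

{-# OPTIONS --safe #-}
-- Signed relabellings that fix the point 1 act transitively by conjugation on the cycles of length 2n through 1 and 1̄, so
-- it suffices to count the tuples (σ_1, …, σ_r) of prescribed kind whose product is any such cycle.
-- Explore such a tuple from the vertex 1: whenever a vertex already met lies on a cycle of some σ_c that is still
-- unknown, reveal this cycle and append its combinatorial type, as a letter, to the word of σ_c. The ranks add up to n,
-- and the product is transitive, so all the other vertices of a revealed cycle are new; conversely every choice of new
-- vertices can be continued. Therefore the number of tuples is 2^(n-1) (n-1)! G, where G is the number of tuples of words
-- for which the exploration meets all vertices.
-- Let σ_c have K_c cycles and put m_c = n - K_c; a parity argument shows that exactly one σ_c has a cycle of type B, and
-- only one such cycle, so Σ m_c = n - 1. With W_c the number of words allowed for σ_c, exchangeability of the letters of a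
-- word yields by induction along the exploration
--   G ∏ K_c = (n^r - Σ_c m_c n^(r-1)) ∏ W_c = n^(r-1) ∏ W_c.
-- Words of a given type are counted by multinomial coefficients, words of a given rank by binomial coefficients, and
-- Vandermonde's convolution sums over the ranks in a block.

module Submission where

open import Defs
open import Data.Bool using (Bool; true; false; if_then_else_; _∧_; _∨_; not; _xor_; T)
open import Data.Bool.ListAction using (all; any)
import Data.Bool.Properties as BP
open import Data.Empty using (⊥; ⊥-elim)
open import Data.Fin using (Fin; zero; suc; toℕ; fromℕ<; punchOut; splitAt; _↑ˡ_; _↑ʳ_)
open import Data.Fin.Properties using (any?; punchOut-injective; injective⇒≤; pigeonhole; toℕ-injective; toℕ<n; toℕ-fromℕ<; splitAt-↑ˡ; splitAt-↑ʳ; join-splitAt) renaming (_≟_ to _≟F_)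
open import Data.List as List using (List; []; _∷_; _++_; map; concat; concatMap; upTo; applyUpTo; allFin; length)
open import Data.List.Membership.DecPropositional using () renaming (_∈?_ to mem?)
open import Data.List.Membership.Propositional using (_∈_; _∉_)
open import Data.List.Membership.Propositional.Properties using (∈-++⁺ˡ; ∈-++⁺ʳ; ∈-++⁻; ∈-map⁺; ∈-map⁻; ∈-allFin; ∈-concat⁺′; ∈-concat⁻′; ∈-∃++; ∈-upTo⁺; ∈-upTo⁻)
import Data.List.Properties as LP
open import Data.List.Relation.Binary.Permutation.Propositional as ↭ using (_↭_; ↭-refl; ↭-prep; ↭-swap; ↭-sym)
open import Data.List.Relation.Binary.Permutation.Propositional.Properties using (++⁺ʳ; ↭-length) renaming (shift to ↭-shift)
open import Data.List.Relation.Unary.All as All using (All; []; _∷_)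
import Data.List.Relation.Unary.All.Properties as AllP
open import Data.List.Relation.Unary.Any using (here; there)
open import Data.Maybe using (Maybe; just; nothing; maybe)
import Data.Maybe.Properties as MP
open import Data.Nat
open import Data.Nat.Combinatorics using (_C_; nCk+nC[k+1]≡[n+1]C[k+1]; nCn≡1; nCk≡nC[n∸k])
open import Data.Nat.Combinatorics.Specification using (k>n⇒nCk≡0)
open import Data.Nat.DivMod using (m*n/n≡m; /-congˡ)
open import Data.Nat.ListAction using (sum)
open import Data.Nat.Properties
open import Data.Nat.Tactic.RingSolver using (solve-∀)
open import Data.Product using (_×_; _,_; proj₁; proj₂; ∃; ∃₂)
import Data.Product.Properties as PP
open import Data.Sum as Sum using (_⊎_; inj₁; inj₂; [_,_]′)
open import Data.Vec as Vec using (Vec; []; _∷_; lookup; tabulate; toList; _[_]%=_; _[_]≔_)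
import Data.Vec.Properties as VP
open import Function using (_∘_; id)
open import Relation.Binary.Definitions using (DecidableEquality; tri<; tri≈; tri>)
open import Relation.Binary.PropositionalEquality
open import Relation.Nullary using (¬_; Dec; yes; no)
open import Relation.Nullary.Decidable using (⌊_⌋; _×-dec_; ¬?; decidable-stable)

-- The exploration has to know how many letters and how much size each factor has left, so it only
-- handles conditions that fix the number of cycles. A type does this; ℓ_T alone does not, since a
-- type B cycle raises the rank by one more than its size. The factors of a block are therefore
-- sorted by rank and by which of them carries the type B cycle. If some T_j contains that cycle, no
-- choice is left. Otherwise the choice turns C(n, r) into r C(n, r) for one factor, and the sum of
-- these r is the factor n - Σ rk T_i of the second formula. The identity for G needs a form that
-- survives the induction. If in a partial exploration the factor c has k_c letters, size μ_c and
-- hence u_c = k_c + μ_c vertices left, and its word has w_c completions, then G ∏ k_c = (∏ u_c -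
-- Σ_c μ_c ∏ u_e) ∏ w_c, the inner product being over e different from c. At the start all u_c equal
-- n. A letter changes only the terms at c, in which the bracket is affine, so only the mean size of
-- a letter matters.

private variable
  n M N : ℕ
  A B : Set

-- Indicators, finite sums and exact enumerations

⟦_⟧ : Bool → ℕ
⟦ true ⟧ = 1
⟦ false ⟧ = 0

⟦∧⟧ : ∀ a b → ⟦ a ∧ b ⟧ ≡ ⟦ a ⟧ * ⟦ b ⟧
⟦∧⟧ true b = sym (+-identityʳ _)
⟦∧⟧ false b = refl

⌊⌋-yes : ∀ {P : Set} (d : Dec P) → P → ⌊ d ⌋ ≡ true
⌊⌋-yes (yes _) _ = refl
⌊⌋-yes (no ¬p) p = ⊥-elim (¬p p)

⌊⌋-no : ∀ {P : Set} (d : Dec P) → ¬ P → ⌊ d ⌋ ≡ false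
⌊⌋-no (yes p) ¬p = ⊥-elim (¬p p)
⌊⌋-no (no _) _ = refl

⌊⌋-true : ∀ {P : Set} (d : Dec P) → ⌊ d ⌋ ≡ true → P
⌊⌋-true (yes p) _ = p

bool-⇔ : ∀ {a b} → (a ≡ true → b ≡ true) → (b ≡ true → a ≡ true) → a ≡ b
bool-⇔ {true} {b} f g = sym (f refl)
bool-⇔ {false} {true} f g = g refl
bool-⇔ {false} {false} f g = refl

∧-true : ∀ {a b} → a ∧ b ≡ true → a ≡ true × b ≡ true
∧-true {true} {true} _ = refl , refl

∧-intro : ∀ {a b} → a ≡ true → b ≡ true → a ∧ b ≡ true
∧-intro refl refl = refl

⟦⟧*-cong : ∀ b {x y} → (b ≡ true → x ≡ y) → ⟦ b ⟧ * x ≡ ⟦ b ⟧ * y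
⟦⟧*-cong true f = cong (1 *_) (f refl)
⟦⟧*-cong false f = refl

not-true : ∀ {a} → ¬ (a ≡ true) → a ≡ false
not-true {true} f = ⊥-elim (f refl)
not-true {false} f = refl

≡ᵇ-refl : ∀ m → (m ≡ᵇ m) ≡ true
≡ᵇ-refl zero = refl
≡ᵇ-refl (suc m) = ≡ᵇ-refl m

≡ᵇ-true : ∀ m n → (m ≡ᵇ n) ≡ true → m ≡ n
≡ᵇ-true zero zero _ = refl
≡ᵇ-true (suc m) (suc n) e = cong suc (≡ᵇ-true m n e)

≡ᵇ-sym : ∀ m n → (m ≡ᵇ n) ≡ (n ≡ᵇ m)
≡ᵇ-sym zero zero = refl
≡ᵇ-sym zero (suc n) = refl
≡ᵇ-sym (suc m) zero = refl
≡ᵇ-sym (suc m) (suc n) = ≡ᵇ-sym m n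

∑ : List A → (A → ℕ) → ℕ
∑ [] f = 0
∑ (x ∷ xs) f = f x + ∑ xs f

∑-cong : ∀ (xs : List A) {f g : A → ℕ} → (∀ x → f x ≡ g x) → ∑ xs f ≡ ∑ xs g
∑-cong [] e = refl
∑-cong (x ∷ xs) e = cong₂ _+_ (e x) (∑-cong xs e)

∑-mono : ∀ (xs : List A) {f g : A → ℕ} → (∀ x → f x ≤ g x) → ∑ xs f ≤ ∑ xs g
∑-mono [] e = z≤n
∑-mono (x ∷ xs) e = +-mono-≤ (e x) (∑-mono xs e)

∑-0 : ∀ (xs : List A) → ∑ xs (λ _ → 0) ≡ 0
∑-0 [] = refl
∑-0 (x ∷ xs) = ∑-0 xs

∑-zero : ∀ (xs : List A) {f : A → ℕ} → (∀ x → f x ≡ 0) → ∑ xs f ≡ 0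
∑-zero xs e = trans (∑-cong xs e) (∑-0 xs)

interchange : ∀ a b c d → (a + b) + (c + d) ≡ (a + c) + (b + d)
interchange a b c d = begin
  (a + b) + (c + d) ≡⟨ +-assoc a b (c + d) ⟩
  a + (b + (c + d)) ≡⟨ cong (a +_) (sym (+-assoc b c d)) ⟩
  a + ((b + c) + d) ≡⟨ cong (λ z → a + (z + d)) (+-comm b c) ⟩
  a + ((c + b) + d) ≡⟨ cong (a +_) (+-assoc c b d) ⟩
  a + (c + (b + d)) ≡⟨ sym (+-assoc a c (b + d)) ⟩
  (a + c) + (b + d) ∎ where open ≡-Reasoning

∑-+ : ∀ (xs : List A) (f g : A → ℕ) → ∑ xs (λ x → f x + g x) ≡ ∑ xs f + ∑ xs g
∑-+ [] f g = refl
∑-+ (x ∷ xs) f g = trans (cong (f x + g x +_) (∑-+ xs f g)) (interchange (f x) (g x) _ _)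

∑-*ˡ : ∀ (xs : List A) k (f : A → ℕ) → ∑ xs (λ x → k * f x) ≡ k * ∑ xs f
∑-*ˡ [] k f = sym (*-zeroʳ k)
∑-*ˡ (x ∷ xs) k f = trans (cong (k * f x +_) (∑-*ˡ xs k f)) (sym (*-distribˡ-+ k (f x) _))

∑-*ʳ : ∀ (xs : List A) k (f : A → ℕ) → ∑ xs (λ x → f x * k) ≡ ∑ xs f * k
∑-*ʳ [] k f = refl
∑-*ʳ (x ∷ xs) k f = trans (cong (f x * k +_) (∑-*ʳ xs k f)) (sym (*-distribʳ-+ k (f x) _))

∑-const : ∀ (xs : List A) k → ∑ xs (λ _ → k) ≡ length xs * k
∑-const [] k = refl
∑-const (x ∷ xs) k = cong (k +_) (∑-const xs k)

∑-1 : ∀ (xs : List A) → ∑ xs (λ _ → 1) ≡ length xs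
∑-1 xs = trans (∑-const xs 1) (*-identityʳ _)

∑-swap : ∀ (xs : List A) (ys : List B) (f : A → B → ℕ) →
         ∑ xs (λ x → ∑ ys (λ y → f x y)) ≡ ∑ ys (λ y → ∑ xs (λ x → f x y))
∑-swap [] ys f = sym (∑-0 ys)
∑-swap (x ∷ xs) ys f = trans (cong (∑ ys (f x) +_) (∑-swap xs ys f))
  (sym (∑-+ ys (f x) (λ y → ∑ xs (λ x → f x y))))

∑-++ : ∀ (xs ys : List A) (f : A → ℕ) → ∑ (xs ++ ys) f ≡ ∑ xs f + ∑ ys f
∑-++ [] ys f = refl
∑-++ (x ∷ xs) ys f = trans (cong (f x +_) (∑-++ xs ys f)) (sym (+-assoc (f x) _ _))

∑-map : ∀ (g : A → B) (xs : List A) (f : B → ℕ) → ∑ (map g xs) f ≡ ∑ xs (f ∘ g)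
∑-map g [] f = refl
∑-map g (x ∷ xs) f = cong (f (g x) +_) (∑-map g xs f)

∑-concatMap : ∀ (g : A → List B) (xs : List A) (f : B → ℕ) →
              ∑ (concatMap g xs) f ≡ ∑ xs (λ x → ∑ (g x) f)
∑-concatMap g [] f = refl
∑-concatMap g (x ∷ xs) f = trans (∑-++ (g x) (concatMap g xs) f) (cong (∑ (g x) f +_) (∑-concatMap g xs f))

∑-filterB : ∀ (p : A → Bool) (xs : List A) (f : A → ℕ) →
            ∑ (filterB p xs) f ≡ ∑ xs (λ x → ⟦ p x ⟧ * f x)
∑-filterB p [] f = refl
∑-filterB p (x ∷ xs) f with p x
... | true = cong₂ _+_ (sym (+-identityʳ _)) (∑-filterB p xs f)
... | false = ∑-filterB p xs f

countB-∑ : ∀ (p : A → Bool) (xs : List A) → countB p xs ≡ ∑ xs (λ x → ⟦ p x ⟧)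
countB-∑ p xs = trans (sym (∑-1 (filterB p xs))) (trans (∑-filterB p xs _)
  (∑-cong xs (λ x → *-identityʳ _)))

∑-tabulate : ∀ {n} (g : Fin n → A) (f : A → ℕ) → ∑ (List.tabulate g) f ≡ sumF (f ∘ g)
∑-tabulate {n = zero} g f = refl
∑-tabulate {n = suc n} g f = cong (f (g zero) +_) (∑-tabulate (g ∘ suc) f)

∑-allFin : ∀ {n} (f : Fin n → ℕ) → ∑ (allFin n) f ≡ sumF f
∑-allFin = ∑-tabulate id

sumF-cong : ∀ {n} {f g : Fin n → ℕ} → (∀ i → f i ≡ g i) → sumF f ≡ sumF g
sumF-cong {zero} e = refl
sumF-cong {suc n} e = cong₂ _+_ (e zero) (sumF-cong (e ∘ suc))

prodF-cong : ∀ {n} {f g : Fin n → ℕ} → (∀ i → f i ≡ g i) → prodF f ≡ prodF g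
prodF-cong {zero} e = refl
prodF-cong {suc n} e = cong₂ _*_ (e zero) (prodF-cong (e ∘ suc))

sumF-mono : ∀ {n} {f g : Fin n → ℕ} → (∀ i → f i ≤ g i) → sumF f ≤ sumF g
sumF-mono {zero} e = z≤n
sumF-mono {suc n} e = +-mono-≤ (e zero) (sumF-mono (e ∘ suc))

sumF-+ : ∀ {n} (f g : Fin n → ℕ) → sumF (λ i → f i + g i) ≡ sumF f + sumF g
sumF-+ {zero} f g = refl
sumF-+ {suc n} f g = trans (cong (f zero + g zero +_) (sumF-+ (f ∘ suc) (g ∘ suc))) (interchange (f zero) (g zero) _ _)

sumF-const : ∀ {n} k → sumF {n} (λ _ → k) ≡ n * k
sumF-const {zero} k = refl
sumF-const {suc n} k = cong (k +_) (sumF-const {n} k)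

prodF-const : ∀ {n} k → prodF {n} (λ _ → k) ≡ k ^ n
prodF-const {zero} k = refl
prodF-const {suc n} k = cong (k *_) (prodF-const {n} k)

*-interchange : ∀ a b c d → (a * b) * (c * d) ≡ (a * c) * (b * d)
*-interchange a b c d = begin
  (a * b) * (c * d) ≡⟨ *-assoc a b (c * d) ⟩
  a * (b * (c * d)) ≡⟨ cong (a *_) (sym (*-assoc b c d)) ⟩
  a * ((b * c) * d) ≡⟨ cong (λ z → a * (z * d)) (*-comm b c) ⟩
  a * ((c * b) * d) ≡⟨ cong (a *_) (*-assoc c b d) ⟩
  a * (c * (b * d)) ≡⟨ sym (*-assoc a c (b * d)) ⟩
  (a * c) * (b * d) ∎ where open ≡-Reasoning

sumF-single : ∀ {n} (f : Fin n → ℕ) i → f i ≤ sumF f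
sumF-single f zero = m≤m+n _ _
sumF-single f (suc i) = ≤-trans (sumF-single (f ∘ suc) i) (m≤n+m _ (f zero))

sumF-swap∑ : ∀ {n} (xs : List A) (f : A → Fin n → ℕ) →
  ∑ xs (λ x → sumF (f x)) ≡ sumF (λ i → ∑ xs (λ x → f x i))
sumF-swap∑ {n = n} xs f = trans (∑-cong xs (λ x → sym (∑-allFin (f x))))
  (trans (∑-swap xs (allFin n) f) (∑-allFin {n} _))

-- Multiplicity exactly one, phrased as a sum of indicators, so that it can be used directly under
-- other sums; for vectors the indicators simply multiply.
Enum : DecidableEquality A → List A → Set
Enum _≟_ xs = ∀ a → ∑ xs (λ x → ⟦ ⌊ x ≟ a ⌋ ⟧) ≡ 1

∑-pick : (_≟_ : DecidableEquality A) (xs : List A) → Enum _≟_ xs →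
         ∀ a (F : A → ℕ) → ∑ xs (λ x → ⟦ ⌊ x ≟ a ⌋ ⟧ * F x) ≡ F a
∑-pick _≟_ xs en a F = begin
  ∑ xs (λ x → ⟦ ⌊ x ≟ a ⌋ ⟧ * F x) ≡⟨ ∑-cong xs (λ x → ⟦⟧*-cong ⌊ x ≟ a ⌋ (λ e → cong F (⌊⌋-true (x ≟ a) e))) ⟩
  ∑ xs (λ x → ⟦ ⌊ x ≟ a ⌋ ⟧ * F a) ≡⟨ ∑-*ʳ xs (F a) _ ⟩
  ∑ xs (λ x → ⟦ ⌊ x ≟ a ⌋ ⟧) * F a ≡⟨ cong (_* F a) (en a) ⟩
  1 * F a ≡⟨ *-identityˡ _ ⟩
  F a ∎ where open ≡-Reasoning

∑-only : (_≟_ : DecidableEquality A) (xs : List A) → Enum _≟_ xs →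
         ∀ a (F : A → ℕ) → (∀ x → x ≢ a → F x ≡ 0) → ∑ xs F ≡ F a
∑-only _≟_ xs en a F z = trans (∑-cong xs h) (∑-pick _≟_ xs en a F)
  where
  h : ∀ x → F x ≡ ⟦ ⌊ x ≟ a ⌋ ⟧ * F x
  h x with x ≟ a
  ... | yes _ = sym (+-identityʳ _)
  ... | no ne = z x ne

-- The graph of `φ` is summed in both orders: the indicator of y = φ x is also that of x = ψ y.
∑-reindex : (_≟_ : DecidableEquality A) (xs : List A) → Enum _≟_ xs →
            (φ ψ : A → A) → (∀ x → ψ (φ x) ≡ x) → (∀ x → φ (ψ x) ≡ x) →
            ∀ (F : A → ℕ) → ∑ xs (F ∘ φ) ≡ ∑ xs F
∑-reindex _≟_ xs en φ ψ ψφ φψ F = begin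
  ∑ xs (λ x → F (φ x)) ≡⟨ ∑-cong xs (λ x → sym (∑-pick _≟_ xs en (φ x) F)) ⟩
  ∑ xs (λ x → ∑ xs (λ y → ⟦ ⌊ y ≟ φ x ⌋ ⟧ * F y)) ≡⟨ ∑-swap xs xs _ ⟩
  ∑ xs (λ y → ∑ xs (λ x → ⟦ ⌊ y ≟ φ x ⌋ ⟧ * F y)) ≡⟨ ∑-cong xs (λ y → trans (∑-*ʳ xs (F y) _)
     (trans (cong (_* F y) (trans (∑-cong xs (λ x → cong ⟦_⟧ (h x y))) (en (ψ y)))) (*-identityˡ _))) ⟩
  ∑ xs F ∎
  where
  open ≡-Reasoning
  h : ∀ x y → ⌊ y ≟ φ x ⌋ ≡ ⌊ x ≟ ψ y ⌋
  h x y = bool-⇔ (λ e → ⌊⌋-yes (x ≟ ψ y) (trans (sym (ψφ x)) (cong ψ (sym (⌊⌋-true (y ≟ φ x) e)))))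
                 (λ e → ⌊⌋-yes (y ≟ φ x) (trans (sym (φψ y)) (cong φ (sym (⌊⌋-true (x ≟ ψ y) e)))))

sumF-δ : ∀ {n} (i : Fin n) → sumF (λ j → ⟦ ⌊ j ≟F i ⌋ ⟧) ≡ 1
sumF-δ {suc n} zero = cong suc (trans (sumF-const {n} 0) (*-zeroʳ n))
sumF-δ {suc n} (suc i) = trans (sumF-cong h) (sumF-δ i)
  where
  h : ∀ j → ⟦ ⌊ suc j ≟F suc i ⌋ ⟧ ≡ ⟦ ⌊ j ≟F i ⌋ ⟧
  h j with j ≟F i
  ... | yes _ = refl
  ... | no _ = refl

allFin-Enum : ∀ n → Enum _≟F_ (allFin n)
allFin-Enum n a = trans (∑-allFin {n} _) (sumF-δ a)

_≟P_ : ∀ {n} → DecidableEquality (Pt n)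
_≟P_ = PP.≡-dec _≟F_ BP._≟_

_≟V_ : ∀ {n k} → DecidableEquality (Vec (Pt n) k)
_≟V_ = VP.≡-dec _≟P_

×-⌊⌋ : (_≟a_ : DecidableEquality A) (_≟b_ : DecidableEquality B) → ∀ x y u v →
  ⌊ PP.≡-dec _≟a_ _≟b_ (x , y) (u , v) ⌋ ≡ ⌊ x ≟a u ⌋ ∧ ⌊ y ≟b v ⌋
×-⌊⌋ _≟a_ _≟b_ x y u v = bool-⇔
  (λ e → let q = ⌊⌋-true (PP.≡-dec _≟a_ _≟b_ (x , y) (u , v)) e in
         ∧-intro (⌊⌋-yes (x ≟a u) (cong proj₁ q)) (⌊⌋-yes (y ≟b v) (cong proj₂ q)))
  (λ e → ⌊⌋-yes (PP.≡-dec _≟a_ _≟b_ (x , y) (u , v))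
     (cong₂ _,_ (⌊⌋-true (x ≟a u) (proj₁ (∧-true e))) (⌊⌋-true (y ≟b v) (proj₂ (∧-true {⌊ x ≟a u ⌋} e)))))

allPts-Enum : ∀ n → Enum _≟P_ (allPts n)
allPts-Enum n (a , b) = begin
  ∑ (allPts n) (λ p → ⟦ ⌊ p ≟P (a , b) ⌋ ⟧) ≡⟨ ∑-concatMap _ (allFin n) _ ⟩
  ∑ (allFin n) (λ i → ⟦ ⌊ (i , false) ≟P (a , b) ⌋ ⟧ + (⟦ ⌊ (i , true) ≟P (a , b) ⌋ ⟧ + 0))
    ≡⟨ ∑-cong (allFin n) h ⟩
  ∑ (allFin n) (λ i → ⟦ ⌊ i ≟F a ⌋ ⟧) ≡⟨ allFin-Enum n a ⟩
  1 ∎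
  where
  open ≡-Reasoning
  g : ∀ x b → ⟦ x ∧ ⌊ false BP.≟ b ⌋ ⟧ + (⟦ x ∧ ⌊ true BP.≟ b ⌋ ⟧ + 0) ≡ ⟦ x ⟧
  g true true = refl
  g true false = refl
  g false b = refl
  h : ∀ i → ⟦ ⌊ (i , false) ≟P (a , b) ⌋ ⟧ + (⟦ ⌊ (i , true) ≟P (a , b) ⌋ ⟧ + 0) ≡ ⟦ ⌊ i ≟F a ⌋ ⟧
  h i rewrite ×-⌊⌋ _≟F_ BP._≟_ i false a b | ×-⌊⌋ _≟F_ BP._≟_ i true a b = g ⌊ i ≟F a ⌋ b

∷-⌊⌋ : (_≟_ : DecidableEquality A) → ∀ {k} x (xs : Vec A k) y ys →
  ⌊ VP.≡-dec _≟_ (x ∷ xs) (y ∷ ys) ⌋ ≡ ⌊ x ≟ y ⌋ ∧ ⌊ VP.≡-dec _≟_ xs ys ⌋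
∷-⌊⌋ _≟_ x xs y ys = bool-⇔
  (λ e → let q = ⌊⌋-true (VP.≡-dec _≟_ (x ∷ xs) (y ∷ ys)) e in
         ∧-intro (⌊⌋-yes (x ≟ y) (VP.∷-injectiveˡ q)) (⌊⌋-yes (VP.≡-dec _≟_ xs ys) (VP.∷-injectiveʳ q)))
  (λ e → ⌊⌋-yes (VP.≡-dec _≟_ (x ∷ xs) (y ∷ ys))
     (cong₂ _∷_ (⌊⌋-true (x ≟ y) (proj₁ (∧-true e))) (⌊⌋-true (VP.≡-dec _≟_ xs ys) (proj₂ (∧-true {⌊ x ≟ y ⌋} e)))))

∑-allVecs-suc : ∀ k (xs : List A) (f : Vec A (suc k) → ℕ) →
  ∑ (allVecs (suc k) xs) f ≡ ∑ xs (λ x → ∑ (allVecs k xs) (λ v → f (x ∷ v)))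
∑-allVecs-suc k xs f = trans (∑-concatMap _ xs f) (∑-cong xs (λ x → ∑-map (x ∷_) (allVecs k xs) f))

∑-allLists-suc : ∀ k (xs : List A) (f : List A → ℕ) →
  ∑ (allLists (suc k) xs) f ≡ ∑ xs (λ x → ∑ (allLists k xs) (λ v → f (x ∷ v)))
∑-allLists-suc k xs f = trans (∑-concatMap _ xs f) (∑-cong xs (λ x → ∑-map (x ∷_) (allLists k xs) f))

allVecs-Enum : (_≟_ : DecidableEquality A) (xs : List A) → Enum _≟_ xs →
               ∀ k → Enum (VP.≡-dec _≟_) (allVecs k xs)
allVecs-Enum _≟_ xs en zero [] = refl
allVecs-Enum _≟_ xs en (suc k) (a ∷ as) = begin
  ∑ (allVecs (suc k) xs) (λ v → ⟦ ⌊ VP.≡-dec _≟_ v (a ∷ as) ⌋ ⟧) ≡⟨ ∑-allVecs-suc k xs _ ⟩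
  ∑ xs (λ x → ∑ (allVecs k xs) (λ v → ⟦ ⌊ VP.≡-dec _≟_ (x ∷ v) (a ∷ as) ⌋ ⟧))
    ≡⟨ ∑-cong xs (λ x → trans (∑-cong (allVecs k xs) (λ v → trans (cong ⟦_⟧ (∷-⌊⌋ _≟_ x v a as)) (⟦∧⟧ ⌊ x ≟ a ⌋ _)))
        (trans (∑-*ˡ (allVecs k xs) ⟦ ⌊ x ≟ a ⌋ ⟧ _) (cong (⟦ ⌊ x ≟ a ⌋ ⟧ *_) (allVecs-Enum _≟_ xs en k as)))) ⟩
  ∑ xs (λ x → ⟦ ⌊ x ≟ a ⌋ ⟧ * 1) ≡⟨ ∑-pick _≟_ xs en a (λ _ → 1) ⟩
  1 ∎ where open ≡-Reasoning

RawW-Enum : ∀ n → Enum _≟V_ (allVecs n (allPts n))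
RawW-Enum n = allVecs-Enum _≟P_ (allPts n) (allPts-Enum n) n

all-tab : ∀ {n} (g : Fin n → A) (p : A → Bool) → all p (List.tabulate g) ≡ true → ∀ i → p (g i) ≡ true
all-tab {n = suc n} g p e zero = proj₁ (∧-true e)
all-tab {n = suc n} g p e (suc i) = all-tab (g ∘ suc) p (proj₂ (∧-true {p (g zero)} e)) i

tab-all : ∀ {n} (g : Fin n → A) (p : A → Bool) → (∀ i → p (g i) ≡ true) → all p (List.tabulate g) ≡ true
tab-all {n = zero} g p e = refl
tab-all {n = suc n} g p e = ∧-intro (e zero) (tab-all (g ∘ suc) p (e ∘ suc))

all-fin : ∀ {n} (p : Fin n → Bool) → all p (allFin n) ≡ true → ∀ i → p i ≡ true
all-fin = all-tab id

fin-all : ∀ {n} (p : Fin n → Bool) → (∀ i → p i ≡ true) → all p (allFin n) ≡ true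
fin-all = tab-all id

∑-pos : ∀ (xs : List A) (f : A → ℕ) → ∑ xs f ≢ 0 → ∃ λ x → f x ≢ 0
∑-pos [] f ne = ⊥-elim (ne refl)
∑-pos (x ∷ xs) f ne with f x in eq
... | suc k = x , λ e → case (trans (sym eq) e)
  where case : suc k ≡ 0 → ⊥
        case ()
... | zero = ∑-pos xs f ne

-- Signed permutations as a group acting on the points

infixl 7 _⊕_
_⊕_ : Pt n → Bool → Pt n
(i , c) ⊕ b = i , c xor b

⊕-assoc : ∀ (p : Pt n) b c → (p ⊕ b) ⊕ c ≡ p ⊕ (b xor c)
⊕-assoc (i , a) b c = cong (i ,_) (BP.xor-assoc a b c)

⊕-false : ∀ (p : Pt n) → p ⊕ false ≡ p
⊕-false (i , b) = cong (i ,_) (BP.xor-identityʳ b)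

xor-self : ∀ b → b xor b ≡ false
xor-self true = refl
xor-self false = refl

⊕-twice : ∀ (p : Pt n) b → (p ⊕ b) ⊕ b ≡ p
⊕-twice p b = trans (⊕-assoc p b b) (trans (cong (p ⊕_) (xor-self b)) (⊕-false p))

app-⊕ : ∀ (w : RawW n) p b → app w (p ⊕ b) ≡ app w p ⊕ b
app-⊕ w (i , a) b = sym (⊕-assoc (lookup w i) a b)

app-· : ∀ (σ τ : RawW n) p → app (σ · τ) p ≡ app σ (app τ p)
app-· σ τ (i , b) rewrite VP.lookup∘tabulate (λ i → app σ (lookup τ i)) i = sym (app-⊕ σ (lookup τ i) b)

app-lookup : ∀ (w : RawW n) i → app w (i , false) ≡ lookup w i
app-lookup w i = ⊕-false (lookup w i)

app-fin : ∀ (w : RawW n) i b → app w (i , b) ≡ app w (i , false) ⊕ b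
app-fin w i b = app-⊕ w (i , false) b

vec-ext : ∀ {A : Set} {k} {v w : Vec A k} → (∀ i → lookup v i ≡ lookup w i) → v ≡ w
vec-ext {v = []} {[]} e = refl
vec-ext {v = x ∷ v} {y ∷ w} e = cong₂ _∷_ (e zero) (vec-ext (e ∘ suc))

W-ext : ∀ {v w : RawW n} → (∀ i → app v (i , false) ≡ app w (i , false)) → v ≡ w
W-ext {v = v} {w} e = vec-ext (λ i → trans (sym (app-lookup v i)) (trans (e i) (app-lookup w i)))

app-id : ∀ (p : Pt n) → app idW p ≡ p
app-id (i , b) rewrite VP.lookup∘tabulate (λ i → (i , false)) i = refl

·-assoc : ∀ (a b c : RawW n) → (a · b) · c ≡ a · (b · c)
·-assoc a b c = W-ext (λ i → trans (app-· (a · b) c _) (trans (app-· a b _)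
  (sym (trans (app-· a (b · c) _) (cong (app a) (app-· b c _))))))

·-idˡ : ∀ (a : RawW n) → idW · a ≡ a
·-idˡ a = W-ext (λ i → trans (app-· idW a _) (app-id _))

·-idʳ : ∀ (a : RawW n) → a · idW ≡ a
·-idʳ a = W-ext (λ i → trans (app-· a idW _) (cong (app a) (app-id _)))

-- Only the unsigned map has to be injective: the signs are arbitrary, and `app` respects the bar by
-- construction. Being a record, it lets `w` be inferred from a proof.
record Perm (w : RawW n) : Set where
  constructor mkPerm
  field inj : ∀ i j → proj₁ (lookup w i) ≡ proj₁ (lookup w j) → i ≡ j

open Perm public

==F-true : ∀ {k} {i j : Fin k} → (i ==F j) ≡ true → i ≡ j
==F-true {i = i} {j} = ⌊⌋-true (i ≟F j)

==F-refl : ∀ {k} (i : Fin k) → (i ==F i) ≡ true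
==F-refl i = ⌊⌋-yes (i ≟F i) refl

==F-≢ : ∀ {k} {i j : Fin k} → i ≢ j → (i ==F j) ≡ false
==F-≢ {i = i} {j} = ⌊⌋-no (i ≟F j)

isSignedPerm⇒Perm : ∀ (w : RawW n) → isSignedPerm w ≡ true → Perm w
isSignedPerm⇒Perm {n} w e = mkPerm go
  where
  go : ∀ i j → proj₁ (lookup w i) ≡ proj₁ (lookup w j) → i ≡ j
  go i j q with i ≟F j | all-fin _ (all-fin _ e i) j
  ... | yes p | _ = p
  ... | no _ | f rewrite q | ==F-refl (proj₁ (lookup w j)) = ⊥-elim (BP.not-¬ f refl)

Perm⇒isSignedPerm : ∀ (w : RawW n) → Perm w → isSignedPerm w ≡ true
Perm⇒isSignedPerm w pm = fin-all _ (λ i → fin-all _ (λ j → h i j))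
  where
  h : ∀ i j → ((i ==F j) ∨ not (proj₁ (lookup w i) ==F proj₁ (lookup w j))) ≡ true
  h i j with i ≟F j
  ... | yes _ = refl
  ... | no ne rewrite ==F-≢ (ne ∘ inj pm i j) = refl

Perm-inj₁ : ∀ {w : RawW n} → Perm w → ∀ p q → proj₁ (app w p) ≡ proj₁ (app w q) → proj₁ p ≡ proj₁ q
Perm-inj₁ pm (i , _) (j , _) = inj pm i j

xor-cancelˡ : ∀ a b c → a xor b ≡ a xor c → b ≡ c
xor-cancelˡ true true true e = refl
xor-cancelˡ true false false e = refl
xor-cancelˡ false b c e = e

Perm-inj : ∀ {w : RawW n} → Perm w → ∀ p q → app w p ≡ app w q → p ≡ q
Perm-inj {w = w} pm (i , a) (j , b) e with inj pm i j (cong proj₁ e)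
... | refl = cong (i ,_) (xor-cancelˡ (proj₂ (lookup w i)) a b (cong proj₂ e))

injPerm : ∀ {w : RawW n} → (∀ p q → proj₁ (app w p) ≡ proj₁ (app w q) → proj₁ p ≡ proj₁ q) → Perm w
injPerm h = mkPerm (λ i j → h (i , false) (j , false))

·-Perm : ∀ {a b : RawW n} → Perm a → Perm b → Perm (a · b)
·-Perm {a = a} {b} pa pb = injPerm {w = a · b} (λ p q e → Perm-inj₁ pb p q (Perm-inj₁ pa (app b p) (app b q)
  (trans (cong proj₁ (sym (app-· a b p))) (trans e (cong proj₁ (app-· a b q))))))

id-Perm : Perm (idW {n})
id-Perm = injPerm {w = idW} (λ p q e → trans (sym (cong proj₁ (app-id p))) (trans e (cong proj₁ (app-id q))))

-- If j were missed, punching it out would inject n vertices into n - 1.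
surj : ∀ {w : RawW n} → Perm w → ∀ j → ∃ λ i → proj₁ (lookup w i) ≡ j
surj {suc n} {w} pm j with any? (λ i → proj₁ (lookup w i) ≟F j)
... | yes r = r
... | no ¬r = ⊥-elim (1+n≰n (injective⇒≤ {f = λ i → punchOut (ne i)}
    (λ {x} {y} e → inj pm x y (punchOut-injective (ne x) (ne y) e))))
  where
  ne : ∀ i → j ≢ proj₁ (lookup w i)
  ne i e = ¬r (i , sym e)

inv : (w : RawW n) → Perm w → RawW n
inv w pm = tabulate (λ j → proj₁ (surj {w = w} pm j) , proj₂ (lookup w (proj₁ (surj {w = w} pm j))))

inv-right : ∀ (w : RawW n) (pm : Perm w) → w · inv w pm ≡ idW
inv-right w pm = W-ext (λ j → trans (app-· w (inv w pm) (j , false)) (h j))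
  where
  h : ∀ j → app w (app (inv w pm) (j , false)) ≡ app idW (j , false)
  h j rewrite app-id (j , false)
            | VP.lookup∘tabulate (λ j → proj₁ (surj {w = w} pm j) , proj₂ (lookup w (proj₁ (surj {w = w} pm j)))) j
            | BP.xor-identityʳ (proj₂ (lookup w (proj₁ (surj {w = w} pm j))))
            | xor-self (proj₂ (lookup w (proj₁ (surj {w = w} pm j)))) = cong (_, false) (proj₂ (surj {w = w} pm j))

app-inv-right : ∀ (w : RawW n) (pm : Perm w) p → app w (app (inv w pm) p) ≡ p
app-inv-right w pm p = trans (sym (app-· w (inv w pm) p)) (trans (cong (λ z → app z p) (inv-right w pm)) (app-id p))

app-inv-left : ∀ (w : RawW n) (pm : Perm w) p → app (inv w pm) (app w p) ≡ p
app-inv-left w pm p = Perm-inj pm _ _ (app-inv-right w pm (app w p))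

inv-Perm : ∀ (w : RawW n) (pm : Perm w) → Perm (inv w pm)
inv-Perm w pm = injPerm {w = inv w pm} h
  where
  h : ∀ p q → proj₁ (app (inv w pm) p) ≡ proj₁ (app (inv w pm) q) → proj₁ p ≡ proj₁ q
  h (i , a) (j , b) e = trans (cong proj₁ (sym (app-inv-right w pm (i , a))))
     (trans (cong (λ z → proj₁ (lookup w z)) e) (cong proj₁ (app-inv-right w pm (j , b))))

eqPt-true : ∀ (p q : Pt n) → eqPt p q ≡ true → p ≡ q
eqPt-true (i , b) (j , c) e = cong₂ _,_ (==F-true (proj₁ (∧-true {i ==F j} e))) (h b c (proj₂ (∧-true {i ==F j} e)))
  where
  h : ∀ b c → not (b xor c) ≡ true → b ≡ c
  h true true _ = refl
  h false false _ = refl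

eqPt-refl : ∀ (p : Pt n) → eqPt p p ≡ true
eqPt-refl (i , b) rewrite ==F-refl i | xor-self b = refl

eqPt-≢ : ∀ {p q : Pt n} → p ≢ q → eqPt p q ≡ false
eqPt-≢ ne = not-true (ne ∘ eqPt-true _ _)

eqW-true : ∀ {k} (v w : Vec (Pt n) k) → eqW v w ≡ true → v ≡ w
eqW-true [] [] e = refl
eqW-true (x ∷ v) (y ∷ w) e = cong₂ _∷_ (eqPt-true x y (proj₁ (∧-true {eqPt x y} e))) (eqW-true v w (proj₂ (∧-true {eqPt x y} e)))

eqW-refl : ∀ {k} (v : Vec (Pt n) k) → eqW v v ≡ true
eqW-refl [] = refl
eqW-refl (x ∷ v) = ∧-intro (eqPt-refl x) (eqW-refl v)

-- Orbits and decompositions into cycles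

iter-shift : ∀ t (w : RawW n) p → iterW (suc t) w p ≡ iterW t w (app w p)
iter-shift zero w p = refl
iter-shift (suc t) w p = cong (app w) (iter-shift t w p)

iter-+ : ∀ s t (w : RawW n) p → iterW (s + t) w p ≡ iterW s w (iterW t w p)
iter-+ zero t w p = refl
iter-+ (suc s) t w p = cong (app w) (iter-+ s t w p)

iter-⊕ : ∀ t (w : RawW n) p b → iterW t w (p ⊕ b) ≡ iterW t w p ⊕ b
iter-⊕ zero w p b = refl
iter-⊕ (suc t) w p b = trans (cong (app w) (iter-⊕ t w p b)) (app-⊕ w _ b)

iter-inj₁ : ∀ {w : RawW n} → Perm w → ∀ t p q → proj₁ (iterW t w p) ≡ proj₁ (iterW t w q) → proj₁ p ≡ proj₁ q
iter-inj₁ pm zero p q e = e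
iter-inj₁ {w = w} pm (suc t) p q e = iter-inj₁ pm t p q (Perm-inj₁ pm (iterW t w p) (iterW t w q) e)

_∈?_ : ∀ (i : Fin n) xs → Dec (i ∈ xs)
_∈?_ = mem? _≟F_

occ : Fin n → List (Fin n) → ℕ
occ i xs = ∑ xs (λ x → ⟦ i ==F x ⟧)

occ-++ : ∀ (i : Fin n) xs ys → occ i (xs ++ ys) ≡ occ i xs + occ i ys
occ-++ i xs ys = ∑-++ xs ys _

∈⇒occ : ∀ {i : Fin n} {xs} → i ∈ xs → 1 ≤ occ i xs
∈⇒occ {i = i} (here refl) rewrite ==F-refl i = s≤s z≤n
∈⇒occ {i = i} {x ∷ xs} (there m) = ≤-trans (∈⇒occ m) (m≤n+m _ ⟦ i ==F x ⟧)

∉⇒occ : ∀ {i : Fin n} {xs} → i ∉ xs → occ i xs ≡ 0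
∉⇒occ {xs = []} ne = refl
∉⇒occ {i = i} {x ∷ xs} ne with i ≟F x
... | yes e = ⊥-elim (ne (here e))
... | no _ = ∉⇒occ (ne ∘ there)

occ⇒∈ : ∀ {i : Fin n} {xs} → 1 ≤ occ i xs → i ∈ xs
occ⇒∈ {i = i} {xs} le with i ∈? xs
... | yes m = m
... | no ¬m = ⊥-elim (1+n≰n (≤-trans le (≤-reflexive (∉⇒occ ¬m))))

length-occ : ∀ (xs : List (Fin n)) → length xs ≡ sumF (λ i → occ i xs)
length-occ {n} xs = trans (sym (∑-1 xs)) (trans (∑-cong xs (λ x → sym (sumF-δ x))) (sumF-swap∑ {n = n} xs (λ x i → ⟦ i ==F x ⟧)))

record Nodup (xs : List (Fin n)) : Set where
  constructor nodup
  field at : ∀ i → occ i xs ≤ 1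

open Nodup public

nodup-length : ∀ {xs : List (Fin n)} → Nodup xs → length xs ≤ n
nodup-length {n} {xs} nd = ≤-trans (≤-reflexive (length-occ xs)) (≤-trans (sumF-mono (at nd))
  (≤-reflexive (trans (sumF-const {n} 1) (*-identityʳ n))))

∑-complete : ∀ (xs : List (Fin n)) → (∀ i → occ i xs ≡ 1) → ∀ F → ∑ xs F ≡ sumF F
∑-complete {n} xs c F = begin
  ∑ xs F ≡⟨ ∑-cong xs (λ x → sym (trans (sym (∑-allFin {n} _)) (∑-pick _≟F_ (allFin n) (allFin-Enum n) x F))) ⟩
  ∑ xs (λ x → sumF (λ i → ⟦ i ==F x ⟧ * F i)) ≡⟨ sumF-swap∑ {n = n} xs (λ x i → ⟦ i ==F x ⟧ * F i) ⟩
  sumF (λ i → ∑ xs (λ x → ⟦ i ==F x ⟧ * F i)) ≡⟨ sumF-cong (λ i → trans (∑-*ʳ xs (F i) _) (trans (cong (_* F i) (c i)) (*-identityˡ _))) ⟩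
  sumF F ∎ where open ≡-Reasoning

-- The multiplicities are at most 1 and add up to the length; a single 0 would push the sum below n.
nodup-full : ∀ (xs : List (Fin n)) → Nodup xs → n ≤ length xs → ∀ i → occ i xs ≡ 1
nodup-full {n} xs nd le i with occ i xs in eq | at nd i
... | zero | _ = ⊥-elim (<⇒≱ (lem (λ i → occ i xs) (at nd) i eq) (≤-trans le (≤-reflexive (length-occ xs))))
  where
  lem : ∀ {k} (f : Fin k → ℕ) → (∀ i → f i ≤ 1) → ∀ i → f i ≡ 0 → sumF f < k
  lem {suc k} f b zero e rewrite e = s≤s (≤-trans (sumF-mono (b ∘ suc)) (≤-reflexive (trans (sumF-const {k} 1) (*-identityʳ k))))
  lem {suc k} f b (suc i) e = +-mono-≤-< (b zero) (lem (f ∘ suc) (b ∘ suc) i e)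
... | suc zero | _ = refl
... | suc (suc _) | s≤s ()

-- The endpoint is kept apart from the inner points, so that one notion covers cycles that close at
-- v and those that close at v̄.
Chain : RawW n → Pt n → List (Pt n) → Pt n → Set
Chain w p [] e = app w p ≡ e
Chain w p (y ∷ ys) e = app w p ≡ y × Chain w y ys e

-- A cycle  v ↦ us ↦ v (flag false, type A)  or  v ↦ us ↦ v̄ (flag true, type B).
Cycle : ℕ → Set
Cycle n = Fin n × List (Pt n) × Bool

Letter : Set
Letter = ℕ × Bool

letter : Cycle n → Letter
letter (v , us , f) = length us , f

vs : Cycle n → List (Fin n)
vs (v , us , f) = v ∷ map proj₁ us

verts : List (Cycle n) → List (Fin n)
verts = concatMap vs

IsCyc : RawW n → Cycle n → Set
IsCyc w (v , us , f) = Chain w (v , false) us (v , f)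

record Part (w : RawW n) (cs : List (Cycle n)) : Set where
  constructor part
  field
    cyc : All (IsCyc w) cs
    nd : Nodup (verts cs)

open Part public

-- Fixed points are listed too, as cycles with the letter (0, false). Hence the number of cycles
-- plus their total size is n.
record Full (w : RawW n) (cs : List (Cycle n)) : Set where
  constructor full
  field
    cycF : All (IsCyc w) cs
    cover : ∀ i → occ i (verts cs) ≡ 1

open Full public

Full⇒Part : ∀ {w : RawW n} {cs} → Full w cs → Part w cs
Full⇒Part (full c o) = part c (nodup (λ i → ≤-reflexive (o i)))

chain-step : ∀ (w : RawW n) p us e {i} → Chain w p us e → i ∈ (proj₁ p ∷ map proj₁ us) →
             proj₁ (app w (i , false)) ∈ (map proj₁ us ++ proj₁ e ∷ [])
chain-step w p [] e c (here refl) = here (cong proj₁ c)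
chain-step w p (y ∷ us) e (c , cs) (here refl) = here (cong proj₁ c)
chain-step w p (y ∷ us) e (c , cs) (there m) = there (chain-step w y us e cs m)

cyc-closed : ∀ (w : RawW n) z {i} → IsCyc w z → i ∈ vs z → proj₁ (lookup w i) ∈ vs z
cyc-closed w (v , us , f) c m with ∈-++⁻ (map proj₁ us) (chain-step w (v , false) us (v , f) c m)
... | inj₁ a = there a
... | inj₂ (here e) = here e

verts-closed : ∀ (w : RawW n) cs {i} → All (IsCyc w) cs → i ∈ verts cs → proj₁ (lookup w i) ∈ verts cs
verts-closed w (z ∷ cs) (c ∷ a) m with ∈-++⁻ (vs z) m
... | inj₁ x = ∈-++⁺ˡ (cyc-closed w z c x)
... | inj₂ y = ∈-++⁺ʳ (vs z) (verts-closed w cs a y)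

iter-closed : ∀ (w : RawW n) (S : Fin n → Set) → (∀ i → S i → S (proj₁ (lookup w i))) →
              ∀ t p → S (proj₁ p) → S (proj₁ (iterW t w p))
iter-closed w S cl zero p s = s
iter-closed w S cl (suc t) p s = cl _ (iter-closed w S cl t p s)

iters : RawW n → Pt n → ℕ → List (Pt n)
iters w p zero = []
iters w p (suc g) = app w p ∷ iters w (app w p) g

chain-iters : ∀ (w : RawW n) p g → Chain w p (iters w p g) (iterW (suc g) w p)
chain-iters w p zero = refl
chain-iters w p (suc g) = refl , subst (Chain w (app w p) (iters w (app w p) g)) (sym (iter-shift (suc g) w p)) (chain-iters w (app w p) g)

length-iters : ∀ (w : RawW n) p g → length (iters w p g) ≡ g
length-iters w p zero = refl
length-iters w p (suc g) = cong suc (length-iters w _ g)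

∈-iters : ∀ (w : RawW n) p g {i} → i ∈ map proj₁ (iters w p g) → ∃ λ t → t < g × proj₁ (iterW (suc t) w p) ≡ i
∈-iters w p (suc g) (here e) = 0 , s≤s z≤n , sym e
∈-iters w p (suc g) (there m) with ∈-iters w (app w p) g m
... | t , lt , e = suc t , s≤s lt , trans (cong proj₁ (iter-shift (suc t) w p)) e

nodup-cons : ∀ {x : Fin n} {xs} → x ∉ xs → Nodup xs → Nodup (x ∷ xs)
nodup-cons {n} {x} {xs} ne nd = nodup go
  where
  go : ∀ i → occ i (x ∷ xs) ≤ 1
  go i with i ≟F x
  ... | yes refl = s≤s (≤-reflexive (∉⇒occ ne))
  ... | no _ = at nd i

nodup-iters : ∀ {w : RawW n} → Perm w → ∀ p g → (∀ t → t < g → proj₁ (iterW (suc t) w p) ≢ proj₁ p) →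
              Nodup (proj₁ p ∷ map proj₁ (iters w p g))
nodup-iters pm p zero nr = nodup-cons (λ ()) (nodup (λ _ → z≤n))
nodup-iters {w = w} pm p (suc g) nr = nodup-cons
  (λ m → let (t , lt , e) = ∈-iters w p (suc g) m in nr t lt e)
  (nodup-iters pm (app w p) g (λ t lt e → nr t (m<n⇒m<1+n lt)
     (Perm-inj₁ pm (iterW (suc t) w p) p (trans (cong proj₁ (iter-shift (suc t) w p)) e))))

least : ∀ {P : ℕ → Set} → (∀ t → Dec (P t)) → ∀ k → P k → ∃ λ t → P t × (∀ s → s < t → ¬ P s)
least {P} P? k pk = go k 0 (λ s ()) (subst P (sym (+-identityʳ k)) pk)
  where
  go : ∀ k a → (∀ s → s < a → ¬ P s) → P (k + a) → ∃ λ t → P t × (∀ s → s < t → ¬ P s)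
  go zero a lo p = a , p , lo
  go (suc k) a lo p with P? a
  ... | yes pa = a , pa , lo
  ... | no ¬pa = go k (suc a) lo' (subst P (sym (+-suc k a)) p)
    where
    lo' : ∀ s → s < suc a → ¬ P s
    lo' s (s≤s le) with m≤n⇒m<n∨m≡n le
    ... | inj₁ lt = lo s lt
    ... | inj₂ refl = ¬pa

-- Pigeonhole gives two iterates over the same vertex; injectivity cancels the earlier one.
returns : ∀ {w : RawW n} → Perm w → ∀ p → ∃ λ g → proj₁ (iterW (suc g) w p) ≡ proj₁ p
returns {n} {w} pm p with pigeonhole (n<1+n n) (λ (t : Fin (suc n)) → proj₁ (iterW (toℕ t) w p))
... | i , j , lt , e = (toℕ j ∸ suc (toℕ i)) , sym (iter-inj₁ pm (toℕ i) p (iterW (suc (toℕ j ∸ suc (toℕ i))) w p)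
    (trans e (cong proj₁ (trans (cong (λ z → iterW z w p) eq) (iter-+ (toℕ i) _ w p)))))
  where
  eq : toℕ j ≡ toℕ i + suc (toℕ j ∸ suc (toℕ i))
  eq = sym (trans (+-suc (toℕ i) _) (m+[n∸m]≡n lt))

first-return : ∀ {w : RawW n} → Perm w → ∀ p → ∃ λ g → proj₁ (iterW (suc g) w p) ≡ proj₁ p ×
               (∀ t → t < g → proj₁ (iterW (suc t) w p) ≢ proj₁ p)
first-return {w = w} pm p = let (k , e) = returns pm p in
  least (λ t → proj₁ (iterW (suc t) w p) ≟F proj₁ p) k e

nodup-++ : ∀ {xs ys : List (Fin n)} → Nodup xs → Nodup ys → (∀ i → i ∈ xs → i ∉ ys) → Nodup (xs ++ ys)
nodup-++ {n} {xs} {ys} a b d = nodup go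
  where
  go : ∀ i → occ i (xs ++ ys) ≤ 1
  go i with i ∈? xs
  ... | yes m rewrite occ-++ i xs ys | ∉⇒occ (d i m) | +-identityʳ (occ i xs) = at a i
  ... | no ¬m rewrite occ-++ i xs ys | ∉⇒occ ¬m = at b i

-- The walk from v up to its first unsigned return. It never enters the listed cycles: they are
-- closed under `w`, so it could not come back to v, which lies off them. The flag is the sign at
-- the return.
follow : ∀ {w : RawW n} → Perm w → ∀ cs → Part w cs → ∀ v → v ∉ verts cs →
         ∃₂ λ us f → Part w ((v , us , f) ∷ cs)
follow {w = w} pm cs (part c nd) v nv with first-return pm (v , false)
... | g , r , nr = iters w (v , false) g , f , part (ic ∷ c) (nodup-++ (nodup-iters pm (v , false) g nr) nd disj)
  where
  f : Bool
  f = proj₂ (iterW (suc g) w (v , false))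
  ic : IsCyc w (v , iters w (v , false) g , f)
  ic = subst (Chain w (v , false) _) (cong (_, f) r) (chain-iters w (v , false) g)
  cl : ∀ t → t ≤ suc g → proj₁ (iterW t w (v , false)) ∉ verts cs
  cl t le m = nv (subst (_∈ verts cs) (trans (cong proj₁ (trans (sym (iter-+ (suc g ∸ t) t w (v , false)))
       (cong (λ z → iterW z w (v , false)) (m∸n+n≡m le)))) r)
     (iter-closed w (_∈ verts cs) (λ i → verts-closed w cs c) (suc g ∸ t) _ m))
  disj : ∀ i → i ∈ vs (v , iters w (v , false) g , f) → i ∉ verts cs
  disj i (here refl) = nv
  disj i (there m) m' with ∈-iters w (v , false) g m
  ... | t , lt , refl = cl (suc t) (m<n⇒m<1+n lt) m'

length-verts-cons : ∀ (z : Cycle n) cs → length (verts (z ∷ cs)) ≡ suc (length (proj₁ (proj₂ z))) + length (verts cs)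
length-verts-cons (v , us , f) cs = trans (LP.length-++ (vs (v , us , f)))
  (cong (λ k → suc k + length (verts cs)) (LP.length-map proj₁ us))

-- The fuel bounds the number of uncovered vertices, which every further cycle decreases.
complete : ∀ {w : RawW n} → Perm w → ∀ k cs → Part w cs → n ∸ length (verts cs) ≤ k → ∃ λ cs' → Full w cs'
complete {n} {w} pm k cs pt le with any? (λ i → occ i (verts cs) Data.Nat.≟ 0)
complete {n} {w} pm k cs pt le | no ¬e = cs , full (cyc pt) h
  where
  h : ∀ i → occ i (verts cs) ≡ 1
  h i with occ i (verts cs) in eq | at (nd pt) i
  ... | zero | _ = ⊥-elim (¬e (i , eq))
  ... | suc zero | _ = refl
  ... | suc (suc _) | s≤s ()
complete {n} {w} pm k cs pt le | yes (v , e) with follow pm cs pt v (λ m → 1+n≰n (≤-trans (∈⇒occ m) (≤-reflexive e)))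
... | us , f , pt' = go k le
  where
  lt : length (verts cs) < length (verts ((v , us , f) ∷ cs))
  lt = ≤-trans (s≤s (m≤n+m _ (length us))) (≤-reflexive (sym (length-verts-cons (v , us , f) cs)))
  lt2 : n ∸ length (verts ((v , us , f) ∷ cs)) < n ∸ length (verts cs)
  lt2 = ∸-monoʳ-< lt (nodup-length (nd pt'))
  go : ∀ k → n ∸ length (verts cs) ≤ k → ∃ λ cs' → Full w cs'
  go zero le = ⊥-elim (n≮0 (≤-trans lt2 le))
  go (suc k) le = complete pm k _ pt' (s≤s⁻¹ (≤-trans lt2 le))

full-exists : ∀ {w : RawW n} → Perm w → ∃ λ cs → Full w cs
full-exists {n} pm = complete pm n [] (part [] (nodup (λ i → z≤n))) ≤-refl

-- Both paths follow `w` from p, and since v lies on neither list, both end at the first visit to v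
-- after p.
chain-unique : ∀ (w : RawW n) v p us us' f f' → v ∉ map proj₁ us → v ∉ map proj₁ us' →
  Chain w p us (v , f) → Chain w p us' (v , f') → us ≡ us' × f ≡ f'
chain-unique w v p [] [] f f' _ _ c c' = refl , cong proj₂ (trans (sym c) c')
chain-unique w v p [] (y ∷ us') f f' _ n' c (c' , _) = ⊥-elim (n' (here (cong proj₁ (trans (sym c) c'))))
chain-unique w v p (y ∷ us) [] f f' n' _ (c , _) c' = ⊥-elim (n' (here (cong proj₁ (trans (sym c') c))))
chain-unique w v p (y ∷ us) (y' ∷ us') f f' a b (c , cs) (c' , cs') with trans (sym c) c'
... | refl with chain-unique w v y us us' f f' (a ∘ there) (b ∘ there) cs cs'
... | refl , e = refl , e

chain-agree : ∀ (w w' : RawW n) p us e → Chain w p us e → Chain w' p us e →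
  ∀ {i} → i ∈ (proj₁ p ∷ map proj₁ us) → app w (i , false) ≡ app w' (i , false)
chain-agree w w' (i , b) [] e c c' (here refl) = cancel (trans c (sym c'))
  where
  cancel : app w (i , b) ≡ app w' (i , b) → app w (i , false) ≡ app w' (i , false)
  cancel q = trans (sym (⊕-twice _ b)) (trans (cong (_⊕ b) (trans (sym (app-fin w i b)) (trans q (app-fin w' i b)))) (⊕-twice _ b))
chain-agree w w' p us@(_ ∷ _) e (c , cs) (c' , cs') (here refl) = chain-agree w w' p [] _ c c' (here refl)
chain-agree w w' p (y ∷ us) e (c , cs) (c' , cs') (there m) = chain-agree w w' y us e cs cs' m

full-unique : ∀ (w w' : RawW n) cs → All (IsCyc w) cs → All (IsCyc w') cs → (∀ i → i ∈ verts cs) → w ≡ w'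
full-unique {n} w w' cs a a' cov = W-ext (λ i → go cs a a' (cov i))
  where
  go : ∀ cs → All (IsCyc w) cs → All (IsCyc w') cs → ∀ {i} → i ∈ verts cs → app w (i , false) ≡ app w' (i , false)
  go (z@(v , us , f) ∷ cs) (c ∷ a) (c' ∷ a') m with ∈-++⁻ (vs z) m
  ... | inj₁ x = chain-agree w w' (v , false) us (v , f) c c' x
  ... | inj₂ y = go cs a a' y

chain? : ∀ (w : RawW n) p us e → Dec (Chain w p us e)
chain? w p [] e = app w p ≟P e
chain? w p (y ∷ us) e with app w p ≟P y | chain? w y us e
... | yes a | yes b = yes (a , b)
... | no a | _ = no (a ∘ proj₁)
... | _ | no b = no (b ∘ proj₂)

isCyc? : ∀ (w : RawW n) z → Dec (IsCyc w z)
isCyc? w (v , us , f) = chain? w (v , false) us (v , f)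

-- Letters of cycles, and `aMult` and `bMult` in terms of them

_≟L_ : DecidableEquality Letter
_≟L_ = PP.≡-dec Data.Nat._≟_ BP._≟_

#_ins_ : Letter → List Letter → ℕ
# ℓ ins ls = ∑ ls (λ x → ⟦ ⌊ x ≟L ℓ ⌋ ⟧)

letters : List (Cycle n) → List Letter
letters = map letter

∑-cong∈ : ∀ (xs : List A) {f g : A → ℕ} → (∀ x → x ∈ xs → f x ≡ g x) → ∑ xs f ≡ ∑ xs g
∑-cong∈ [] e = refl
∑-cong∈ (x ∷ xs) e = cong₂ _+_ (e x (here refl)) (∑-cong∈ xs (λ y m → e y (there m)))

-- Stated for an arbitrary `h`, because the tail of `applyUpTo h` is `applyUpTo (h ∘ suc)`.
firstTrue-at : ∀ (h : ℕ → ℕ) m (p : ℕ → Bool) d k → k < m → p (h k) ≡ true → (∀ s → s < k → p (h s) ≡ false) →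
  firstTrue (applyUpTo h m) p d ≡ h k
firstTrue-at h (suc m) p d zero lt e lo rewrite e = refl
firstTrue-at h (suc m) p d (suc k) (s≤s lt) e lo rewrite lo 0 (s≤s z≤n) =
  firstTrue-at (h ∘ suc) m p d k lt e (λ s l → lo (suc s) (s≤s l))

any-at : ∀ (h : ℕ → ℕ) m (p : ℕ → Bool) k → k < m → p (h k) ≡ true → any p (applyUpTo h m) ≡ true
any-at h (suc m) p zero lt e rewrite e = refl
any-at h (suc m) p (suc k) (s≤s lt) e with p (h 0)
... | true = refl
... | false = any-at (h ∘ suc) m p k lt e

any-none : ∀ (xs : List A) (p : A → Bool) → (∀ t → p t ≡ false) → any p xs ≡ false
any-none [] p e = refl
any-none (x ∷ xs) p e rewrite e x = any-none xs p e

chain⇒iters : ∀ (w : RawW n) p us e → Chain w p us e → us ≡ iters w p (length us) × iterW (suc (length us)) w p ≡ e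
chain⇒iters w p [] e c = refl , c
chain⇒iters w p (y ∷ us) e (refl , cs) with chain⇒iters w (app w p) us e cs
... | a , b = cong (app w p ∷_) a , trans (iter-shift (suc (length us)) w p) b

iters-∈ : ∀ (w : RawW n) p g t → t < g → proj₁ (iterW (suc t) w p) ∈ map proj₁ (iters w p g)
iters-∈ w p (suc g) zero lt = here refl
iters-∈ w p (suc g) (suc t) (s≤s lt) = there (subst (_∈ map proj₁ (iters w (app w p) g))
  (sym (cong proj₁ (iter-shift (suc t) w p))) (iters-∈ w (app w p) g t lt))

-- First return of the vertex i to itself, after g + 1 steps and with sign f.
record Ret (w : RawW n) (i : Fin n) (g : ℕ) (f : Bool) : Set where
  constructor ret
  field
    hit : iterW (suc g) w (i , false) ≡ (i , f)
    miss : ∀ t → t < g → proj₁ (iterW (suc t) w (i , false)) ≢ i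

open Ret

nodup-head : ∀ {x : Fin n} {xs} → Nodup (x ∷ xs) → x ∉ xs
nodup-head {x = x} {xs} nd m with at nd x
... | le rewrite ==F-refl x = 1+n≰n (≤-trans (s≤s (∈⇒occ m)) le)

-- Any vertex of the cycle is an iterate of v up to a bar, and iterates commute with each other and
-- with the bar. So the time and the sign of the first return are the same all along the cycle.
cycle-ret : ∀ {w : RawW n} → Perm w → ∀ z → IsCyc w z → Nodup (vs z) → ∀ {i} → i ∈ vs z →
            Ret w i (length (proj₁ (proj₂ z))) (proj₂ (proj₂ z))
cycle-ret {w = w} pm (v , us , f) c nd {i} m = subst (λ j → Ret w j g f) (proj₂ (proj₂ (pos i m))) (ret h1 h2)
  where
  g = length us
  v₀ = (v , false)
  eqs : us ≡ iters w v₀ g × iterW (suc g) w v₀ ≡ (v , f)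
  eqs = chain⇒iters w v₀ us (v , f) c
  base : ∀ t → t < g → proj₁ (iterW (suc t) w v₀) ≢ v
  base t lt e = nodup-head nd (subst₂ _∈_ e (cong (map proj₁) (sym (proj₁ eqs))) (iters-∈ w v₀ g t lt))
  pos : ∀ i → i ∈ vs (v , us , f) → ∃ λ t → t ≤ g × proj₁ (iterW t w v₀) ≡ i
  pos i (here e) = 0 , z≤n , sym e
  pos i (there m) with ∈-iters w v₀ g (subst (i ∈_) (cong (map proj₁) (proj₁ eqs)) m)
  ... | t , lt , e = suc t , lt , e
  t = proj₁ (pos i m)
  u = iterW t w v₀
  j = proj₁ u
  b = proj₂ u
  comm : ∀ s p → iterW s w (iterW t w p) ≡ iterW t w (iterW s w p)
  comm s p = trans (sym (iter-+ s t w p)) (trans (cong (λ k → iterW k w p) (+-comm s t)) (iter-+ t s w p))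
  h1 : iterW (suc g) w (j , false) ≡ (j , f)
  h1 = begin
    iterW (suc g) w (j , false) ≡⟨ cong (iterW (suc g) w) (cong (j ,_) (sym (xor-self b))) ⟩
    iterW (suc g) w (u ⊕ b) ≡⟨ iter-⊕ (suc g) w u b ⟩
    iterW (suc g) w u ⊕ b ≡⟨ cong (_⊕ b) (trans (comm (suc g) v₀) (cong (iterW t w) (proj₂ eqs))) ⟩
    iterW t w (v₀ ⊕ f) ⊕ b ≡⟨ cong (_⊕ b) (iter-⊕ t w v₀ f) ⟩
    (u ⊕ f) ⊕ b ≡⟨ cong (j ,_) (trans (cong (_xor b) (BP.xor-comm b f)) (trans (BP.xor-assoc f b b) (trans (cong (f xor_) (xor-self b)) (BP.xor-identityʳ f)))) ⟩
    (j , f) ∎ where open ≡-Reasoning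
  h2 : ∀ s → s < g → proj₁ (iterW (suc s) w (j , false)) ≢ j
  h2 s lt e = base s lt (iter-inj₁ pm t (iterW (suc s) w v₀) v₀
    (trans (cong proj₁ (sym (comm (suc s) v₀))) (trans (cong proj₁ (iter-⊕ (suc s) w (j , false) b)) e)))

period-A : ∀ {w : RawW n} {i g} → suc g ≤ n → Ret w i g false → period w (i , false) ≡ suc g
period-A {n} {w} {i} {g} le r = trans (cong (λ l → firstTrue l (λ t → eqPt (iterW t w (i , false)) (i , false)) 0) (LP.map-applyUpTo id suc (2 * n)))
  (firstTrue-at suc (2 * n) _ 0 g (≤-trans le (m≤m+n n _))
    (trans (cong (λ p → eqPt p (i , false)) (hit r)) (eqPt-refl (i , false)))
    (λ s lt → eqPt-≢ {p = iterW (suc s) w (i , false)} {(i , false)} (miss r s lt ∘ cong proj₁)))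

-- One round ends at the barred point, and two rounds close up. At any other time before that,
-- removing a full round where possible would leave an unsigned return that comes too early.
period-B : ∀ {w : RawW n} {i g} → suc g ≤ n → Ret w i g true → period w (i , false) ≡ 2 * suc g
period-B {n} {w} {i} {g} le r = trans (cong (λ l → firstTrue l (λ t → eqPt (iterW t w (i , false)) (i , false)) 0) (LP.map-applyUpTo id suc (2 * n)))
  (firstTrue-at suc (2 * n) _ 0 (g + (suc g + 0)) (*-monoʳ-≤ 2 le)
    (trans (cong (λ p → eqPt p (i , false)) h) (eqPt-refl (i , false))) lo)
  where
  L = suc g
  again : ∀ t → iterW (t + L) w (i , false) ≡ iterW t w (i , false) ⊕ true
  again t = trans (iter-+ t L w (i , false)) (trans (cong (iterW t w) (hit r)) (iter-⊕ t w (i , false) true))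
  h : iterW (2 * L) w (i , false) ≡ (i , false)
  h = trans (cong (λ k → iterW k w (i , false)) (cong (L +_) (+-identityʳ L))) (trans (again L) (cong (_⊕ true) (hit r)))
  lo : ∀ s → s < g + (suc g + 0) → eqPt (iterW (suc s) w (i , false)) (i , false) ≡ false
  lo s lt with <-cmp s g
  ... | tri< a _ _ = eqPt-≢ {p = iterW (suc s) w (i , false)} {(i , false)} (miss r s a ∘ cong proj₁)
  ... | tri≈ _ refl _ = eqPt-≢ (λ e → BP.not-¬ (cong proj₂ (trans (sym (hit r)) e)) refl)
  ... | tri> _ _ gt = eqPt-≢ {p = iterW (suc s) w (i , false)} {(i , false)} (λ e → miss r (s ∸ suc g) lt' (trans (cong proj₁ (sym e')) (cong proj₁ e)))
    where
    e' : iterW (suc s) w (i , false) ≡ iterW (suc (s ∸ suc g)) w (i , false) ⊕ true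
    e' = trans (cong (λ k → iterW (suc k) w (i , false)) (sym (m∸n+n≡m gt))) (again (suc (s ∸ suc g)))
    lt' : s ∸ suc g < g
    lt' = +-cancelʳ-< (suc g) _ _ (subst₂ _<_ (sym (m∸n+n≡m gt)) (cong (g +_) (+-identityʳ (suc g))) lt)

hits-B : ∀ {w : RawW n} {i g} → suc g ≤ n → Ret w i g true → hitsBar w i ≡ true
hits-B {suc n} {w} {i} {g} le r = any-at id (2 * suc n) _ (suc g)
  (≤-trans (s≤s le) (≤-trans (≤-reflexive (+-comm 1 (suc n))) (+-monoʳ-≤ (suc n) (s≤s z≤n))))
  (trans (cong (λ p → eqPt p (i , true)) (hit r)) (eqPt-refl (i , true)))

-- The time is reduced by full rounds, each of which restores the sign, until it lies within the
-- first round.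
hits-A : ∀ {w : RawW n} {i g} → Ret w i g false → hitsBar w i ≡ false
hits-A {n} {w} {i} {g} r = any-none (upTo (2 * n)) _ (λ t → eqPt-≢ (go t t ≤-refl))
  where
  go : ∀ k t → t ≤ k → iterW t w (i , false) ≢ (i , true)
  go k zero le ()
  go (suc k) (suc t) (s≤s le) e with <-cmp t g
  ... | tri< a _ _ = miss r t a (cong proj₁ e)
  ... | tri≈ _ refl _ = BP.not-¬ (cong proj₂ (trans (sym (hit r)) e)) refl
  ... | tri> _ _ gt = go k (t ∸ g) (≤-trans (m∸n≤m t g) le) (trans (sym e') e)
    where
    e' : iterW (suc t) w (i , false) ≡ iterW (t ∸ g) w (i , false)
    e' = trans (cong (λ k → iterW k w (i , false)) (sym (trans (+-suc (t ∸ g) g) (cong suc (m∸n+n≡m (<⇒≤ gt))))))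
         (trans (iter-+ (t ∸ g) (suc g) w (i , false)) (cong (iterW (t ∸ g) w) (hit r)))

nodup-++ˡ : ∀ {xs ys : List (Fin n)} → Nodup (xs ++ ys) → Nodup xs
nodup-++ˡ {xs = xs} {ys} nd = nodup (λ i → ≤-trans (m≤m+n _ _) (≤-trans (≤-reflexive (sym (occ-++ i xs ys))) (at nd i)))

nodup-++ʳ : ∀ {xs ys : List (Fin n)} → Nodup (xs ++ ys) → Nodup ys
nodup-++ʳ {xs = xs} {ys} nd = nodup (λ i → ≤-trans (m≤n+m _ _) (≤-trans (≤-reflexive (sym (occ-++ i xs ys))) (at nd i)))

cycle-size : ∀ (z : Cycle n) → Nodup (vs z) → suc (length (proj₁ (proj₂ z))) ≤ n
cycle-size (v , us , f) nd = ≤-trans (≤-reflexive (cong suc (sym (LP.length-map proj₁ us)))) (nodup-length nd)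

-- `F` is constant on a cycle, which has one vertex more than the number in its letter. So the
-- vertex counts in `aMult` and `bMult` are exact multiples of the length by which they are divided.
∑-verts-letter : ∀ {w : RawW n} → Perm w → (F : Fin n → ℕ) (ℓ : Letter) →
  (∀ i g f → suc g ≤ n → Ret w i g f → F i ≡ ⟦ ⌊ (g , f) ≟L ℓ ⌋ ⟧) →
  ∀ cs → All (IsCyc w) cs → Nodup (verts cs) → ∑ (verts cs) F ≡ (# ℓ ins letters cs) * suc (proj₁ ℓ)
∑-verts-letter pm F ℓ h [] [] nd = refl
∑-verts-letter {w = w} pm F ℓ h (z@(v , us , f) ∷ cs) (c ∷ a) nd = begin
  ∑ (vs z ++ verts cs) F ≡⟨ ∑-++ (vs z) (verts cs) F ⟩
  ∑ (vs z) F + ∑ (verts cs) F ≡⟨ cong₂ _+_ one (∑-verts-letter pm F ℓ h cs a (nodup-++ʳ {xs = vs z} nd)) ⟩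
  ⟦ ⌊ letter z ≟L ℓ ⌋ ⟧ * suc (proj₁ ℓ) + (# ℓ ins letters cs) * suc (proj₁ ℓ) ≡⟨ sym (*-distribʳ-+ (suc (proj₁ ℓ)) ⟦ ⌊ letter z ≟L ℓ ⌋ ⟧ _) ⟩
  (# ℓ ins letters (z ∷ cs)) * suc (proj₁ ℓ) ∎
  where
  open ≡-Reasoning
  ndz : Nodup (vs z)
  ndz = nodup-++ˡ nd
  one : ∑ (vs z) F ≡ ⟦ ⌊ letter z ≟L ℓ ⌋ ⟧ * suc (proj₁ ℓ)
  one = begin
    ∑ (vs z) F ≡⟨ ∑-cong∈ (vs z) (λ i m → h i (length us) f (cycle-size z ndz) (cycle-ret pm z c ndz m)) ⟩
    ∑ (vs z) (λ _ → ⟦ ⌊ letter z ≟L ℓ ⌋ ⟧) ≡⟨ ∑-const (vs z) _ ⟩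
    length (vs z) * ⟦ ⌊ letter z ≟L ℓ ⌋ ⟧ ≡⟨ *-comm (length (vs z)) _ ⟩
    ⟦ ⌊ letter z ≟L ℓ ⌋ ⟧ * length (vs z) ≡⟨ cong (λ k → ⟦ ⌊ letter z ≟L ℓ ⌋ ⟧ * suc k) (LP.length-map proj₁ us) ⟩
    ⟦ ⌊ letter z ≟L ℓ ⌋ ⟧ * suc (length us) ≡⟨ ⟦⟧*-cong ⌊ letter z ≟L ℓ ⌋ (λ e → cong suc (cong proj₁ (⌊⌋-true (letter z ≟L ℓ) e))) ⟩
    ⟦ ⌊ letter z ≟L ℓ ⌋ ⟧ * suc (proj₁ ℓ) ∎

count-letter : ∀ {w : RawW n} → Perm w → ∀ {cs} → Full w cs → (p : Fin n → Bool) (ℓ : Letter) →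
  (∀ i g f → suc g ≤ n → Ret w i g f → ⟦ p i ⟧ ≡ ⟦ ⌊ (g , f) ≟L ℓ ⌋ ⟧) →
  countB p (allFin n) ≡ (# ℓ ins letters cs) * suc (proj₁ ℓ)
count-letter {n} pm {cs} fl p ℓ h = trans (countB-∑ p (allFin n)) (trans (∑-allFin {n} _)
  (trans (sym (∑-complete (verts cs) (cover fl) (λ i → ⟦ p i ⟧)))
    (∑-verts-letter pm _ ℓ h cs (cycF fl) (nd (Full⇒Part fl)))))

aMult-letters : ∀ {w : RawW n} → Perm w → ∀ {cs} → Full w cs → ∀ k → aMult w k ≡ # (suc k , false) ins letters cs
aMult-letters {n} {w} pm {cs} fl k = trans (cong (_/ suc (suc k)) (count-letter pm fl _ (suc k , false) h)) (m*n/n≡m _ (suc (suc k)))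
  where
  h : ∀ i g f → suc g ≤ n → Ret w i g f → ⟦ not (hitsBar w i) ∧ (period w (i , false) ≡ᵇ suc (suc k)) ⟧ ≡ ⟦ ⌊ (g , f) ≟L (suc k , false) ⌋ ⟧
  h i g true le r rewrite hits-B le r | ×-⌊⌋ Data.Nat._≟_ BP._≟_ g true (suc k) false = cong ⟦_⟧ (sym (BP.∧-zeroʳ ⌊ g Data.Nat.≟ suc k ⌋))
  h i g false le r rewrite hits-A r | period-A le r | ×-⌊⌋ Data.Nat._≟_ BP._≟_ g false (suc k) false | BP.∧-identityʳ ⌊ g Data.Nat.≟ suc k ⌋ =
    cong ⟦_⟧ (bool-⇔ (λ e → ⌊⌋-yes (g Data.Nat.≟ suc k) (≡ᵇ-true g (suc k) e))
                     (λ e → subst (λ x → (g ≡ᵇ x) ≡ true) (⌊⌋-true (g Data.Nat.≟ suc k) e) (≡ᵇ-refl g)))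

bMult-letters : ∀ {w : RawW n} → Perm w → ∀ {cs} → Full w cs → ∀ k → bMult w k ≡ # (k , true) ins letters cs
bMult-letters {n} {w} pm {cs} fl k = trans (cong (_/ suc k) (count-letter pm fl _ (k , true) h)) (m*n/n≡m _ (suc k))
  where
  h : ∀ i g f → suc g ≤ n → Ret w i g f → ⟦ hitsBar w i ∧ (period w (i , false) ≡ᵇ 2 * suc k) ⟧ ≡ ⟦ ⌊ (g , f) ≟L (k , true) ⌋ ⟧
  h i g false le r rewrite hits-A r | ×-⌊⌋ Data.Nat._≟_ BP._≟_ g false k true = cong ⟦_⟧ (sym (BP.∧-zeroʳ ⌊ g Data.Nat.≟ k ⌋))
  h i g true le r rewrite hits-B le r | period-B le r | ×-⌊⌋ Data.Nat._≟_ BP._≟_ g true k true | BP.∧-identityʳ ⌊ g Data.Nat.≟ k ⌋ =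
    cong ⟦_⟧ (bool-⇔ (λ e → ⌊⌋-yes (g Data.Nat.≟ k) (suc-injective (*-cancelˡ-≡ (suc g) (suc k) 2 (≡ᵇ-true (2 * suc g) (2 * suc k) e))))
                     (λ e → subst (λ x → (2 * suc g ≡ᵇ 2 * suc x) ≡ true) (⌊⌋-true (g Data.Nat.≟ k) e) (≡ᵇ-refl (2 * suc g))))

-- Absolute length in terms of cycles

any-true : ∀ (xs : List A) (p : A → Bool) → any p xs ≡ true → ∃ λ x → x ∈ xs × p x ≡ true
any-true (x ∷ xs) p e with p x in eq
... | true = x , here refl , eq
... | false = let (y , m , q) = any-true xs p e in y , there m , q

true-any : ∀ {xs : List A} (p : A → Bool) {x} → x ∈ xs → p x ≡ true → any p xs ≡ true
true-any p (here refl) e rewrite e = refl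
true-any {xs = y ∷ _} p (there m) e with p y
... | true = refl
... | false = true-any p m e

∈-cm⁺ : ∀ (f : A → List B) {xs x y} → x ∈ xs → y ∈ f x → y ∈ concatMap f xs
∈-cm⁺ f m q = ∈-concat⁺′ q (∈-map⁺ f m)

∈-cm⁻ : ∀ (f : A → List B) xs {y} → y ∈ concatMap f xs → ∃ λ x → x ∈ xs × y ∈ f x
∈-cm⁻ f xs m with ∈-concat⁻′ (map f xs) m
... | ys , q , r with ∈-map⁻ f r
... | x , a , refl = x , a , q

-- The absolute length read off the letters: a type A cycle on g + 1 vertices costs g, a type B
-- cycle g + 1.
ρ : List Letter → ℕ
ρ ls = ∑ ls (λ ℓ → proj₁ ℓ + ⟦ proj₂ ℓ ⟧)

data Refl {n} : RawW n → Set where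
  swp : ∀ i j s → i ≢ j → Refl (swapW i j s)
  brr : ∀ i → Refl (barW i)

swap-i : ∀ (i j : Fin n) s b → app (swapW i j s) (i , b) ≡ (j , s xor b)
swap-i i j s b rewrite VP.lookup∘tabulate (λ k → if k ==F i then (j , s) else if k ==F j then (i , s) else (k , false)) i
  | ==F-refl i = refl

swap-j : ∀ (i j : Fin n) s b → i ≢ j → app (swapW i j s) (j , b) ≡ (i , s xor b)
swap-j i j s b ne rewrite VP.lookup∘tabulate (λ k → if k ==F i then (j , s) else if k ==F j then (i , s) else (k , false)) j
  | ==F-≢ (ne ∘ sym) | ==F-refl j = refl

swap-k : ∀ (i j : Fin n) s p → proj₁ p ≢ i → proj₁ p ≢ j → app (swapW i j s) p ≡ p
swap-k i j s (k , b) n1 n2 rewrite VP.lookup∘tabulate (λ k → if k ==F i then (j , s) else if k ==F j then (i , s) else (k , false)) k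
  | ==F-≢ n1 | ==F-≢ n2 = refl

bar-i : ∀ (i : Fin n) b → app (barW i) (i , b) ≡ (i , true xor b)
bar-i i b rewrite VP.lookup∘tabulate (λ k → (k , (k ==F i))) i | ==F-refl i = refl

bar-k : ∀ (i : Fin n) p → proj₁ p ≢ i → app (barW i) p ≡ p
bar-k i (k , b) ne rewrite VP.lookup∘tabulate (λ k → (k , (k ==F i))) k | ==F-≢ ne = refl

swap-sym : ∀ (i j : Fin n) s → i ≢ j → swapW i j s ≡ swapW j i s
swap-sym i j s ne = W-ext h
  where
  h : ∀ k → app (swapW i j s) (k , false) ≡ app (swapW j i s) (k , false)
  h k with k ≟F i | k ≟F j
  ... | yes refl | _ = trans (swap-i i j s false) (sym (swap-j j i s false (ne ∘ sym)))
  ... | no _ | yes refl = trans (swap-j i j s false ne) (sym (swap-i j i s false))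
  ... | no a | no b = trans (swap-k i j s (k , false) a b) (sym (swap-k j i s (k , false) b a))

swap-inv : ∀ (i j : Fin n) s p → i ≢ j → app (swapW i j s) (app (swapW i j s) p) ≡ p
swap-inv i j s (k , b) ne with k ≟F i | k ≟F j
... | yes refl | _ = trans (cong (app (swapW i j s)) (swap-i i j s b)) (trans (swap-j i j s (s xor b) ne)
       (cong (i ,_) (trans (sym (BP.xor-assoc s s b)) (cong (_xor b) (xor-self s)))))
... | no _ | yes refl = trans (cong (app (swapW i j s)) (swap-j i j s b ne)) (trans (swap-i i j s (s xor b))
       (cong (j ,_) (trans (sym (BP.xor-assoc s s b)) (cong (_xor b) (xor-self s)))))
... | no a | no c = trans (cong (app (swapW i j s)) (swap-k i j s (k , b) a c)) (swap-k i j s (k , b) a c)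

bar-inv : ∀ (i : Fin n) p → app (barW i) (app (barW i) p) ≡ p
bar-inv i (k , b) with k ≟F i
... | yes refl = trans (cong (app (barW i)) (bar-i i b)) (trans (bar-i i (true xor b)) (cong (i ,_) (BP.not-involutive b)))
... | no a = trans (cong (app (barW i)) (bar-k i (k , b) a)) (bar-k i (k , b) a)

Refl-inv : ∀ {r : RawW n} → Refl r → ∀ p → app r (app r p) ≡ p
Refl-inv (swp i j s ne) p = swap-inv i j s p ne
Refl-inv (brr i) p = bar-inv i p

involution-Perm : ∀ {r : RawW n} → (∀ p → app r (app r p) ≡ p) → Perm r
involution-Perm {r = r} iv = injPerm (λ p q e → trans (cong proj₁ (sym (iv p))) (trans (cong (λ z → proj₁ (lookup r z)) e) (cong proj₁ (iv q))))

Refl-Perm : ∀ {r : RawW n} → Refl r → Perm r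
Refl-Perm rf = involution-Perm (Refl-inv rf)

∈⇒Refl : ∀ {r : RawW n} → r ∈ reflections n → Refl r
∈⇒Refl {n} {r} m with ∈-++⁻ (concatMap (λ i → concatMap (λ j →
      if suc (toℕ i) ≤ᵇ toℕ j then swapW i j false ∷ swapW i j true ∷ [] else []) (allFin n)) (allFin n)) m
... | inj₂ b with ∈-map⁻ barW b
... | i , _ , refl = brr i
∈⇒Refl {n} {r} m | inj₁ a with ∈-cm⁻ _ (allFin n) a
... | i , _ , a' with ∈-cm⁻ _ (allFin n) a'
... | j , _ , a'' = go (suc (toℕ i) ≤ᵇ toℕ j) refl a''
  where
  ne : (suc (toℕ i) ≤ᵇ toℕ j) ≡ true → i ≢ j
  ne e refl = 1+n≰n (≤ᵇ⇒≤ (suc (toℕ i)) (toℕ i) (subst T (sym e) _))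
  go : ∀ b → (suc (toℕ i) ≤ᵇ toℕ j) ≡ b → r ∈ (if b then swapW i j false ∷ swapW i j true ∷ [] else []) → Refl r
  go true e (here refl) = swp i j false (ne e)
  go true e (there (here refl)) = swp i j true (ne e)

Refl⇒∈ : ∀ {r : RawW n} → Refl r → r ∈ reflections n
Refl⇒∈ {n} (brr i) = ∈-++⁺ʳ _ (∈-map⁺ barW (∈-allFin i))
Refl⇒∈ {n} (swp i j s ne) with <-cmp (toℕ i) (toℕ j)
... | tri< lt _ _ = ∈-++⁺ˡ (∈-cm⁺ _ (∈-allFin i) (∈-cm⁺ _ (∈-allFin j) (lem i j s lt)))
  where
  lem : ∀ i j s → toℕ i < toℕ j → swapW i j s ∈ (if suc (toℕ i) ≤ᵇ toℕ j then swapW i j false ∷ swapW i j true ∷ [] else [])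
  lem i j s lt with suc (toℕ i) ≤ᵇ toℕ j in eq
  lem i j false lt | true = here refl
  lem i j true lt | true = there (here refl)
  lem i j s lt | false with subst T eq (≤⇒≤ᵇ lt)
  ... | ()
... | tri≈ _ e _ = ⊥-elim (ne (toℕ-injective e))
... | tri> _ _ gt = subst (_∈ reflections n) (swap-sym j i s (ne ∘ sym)) (∈-++⁺ˡ (∈-cm⁺ _ (∈-allFin j) (∈-cm⁺ _ (∈-allFin i) (lem j i s gt))))
  where
  lem : ∀ i j s → toℕ i < toℕ j → swapW i j s ∈ (if suc (toℕ i) ≤ᵇ toℕ j then swapW i j false ∷ swapW i j true ∷ [] else [])
  lem i j s lt with suc (toℕ i) ≤ᵇ toℕ j in eq
  lem i j false lt | true = here refl
  lem i j true lt | true = there (here refl)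
  lem i j s lt | false with subst T eq (≤⇒≤ᵇ lt)
  ... | ()

prod-step : ∀ {r w : RawW n} k → Refl r → (r · w) ∈ productsOf k → w ∈ productsOf (suc k)
prod-step {n} {r} {w} k rf m = subst (_∈ productsOf (suc k))
  (W-ext (λ i → trans (app-· r (r · w) _) (trans (cong (app r) (app-· r w _)) (Refl-inv rf _))))
  (∈-cm⁺ (λ r → map (r ·_) (productsOf k)) (Refl⇒∈ rf) (∈-map⁺ (r ·_) m))

prod-unstep : ∀ {w : RawW n} k → w ∈ productsOf (suc k) → ∃₂ λ r w' → Refl r × w' ∈ productsOf k × w ≡ r · w'
prod-unstep {n} {w} k m with ∈-cm⁻ (λ r → map (r ·_) (productsOf k)) (reflections n) m
... | r , a , b with ∈-map⁻ (r ·_) b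
... | w' , c , e = r , w' , ∈⇒Refl a , c , e

chain-left : ∀ (w r : RawW n) p us e e' → Chain w p us e → (∀ y → y ∈ us → app r y ≡ y) → app r e ≡ e' → Chain (r · w) p us e'
chain-left w r p [] e e' c t te = trans (app-· r w p) (trans (cong (app r) c) te)
chain-left w r p (y ∷ us) e e' (c , cs) t te = trans (app-· r w p) (trans (cong (app r) c) (t y (here refl))) ,
  chain-left w r y us e e' cs (λ z m → t z (there m)) te

chain-⊕ : ∀ (w : RawW n) p us e b → Chain w p us e → Chain w (p ⊕ b) (map (_⊕ b) us) (e ⊕ b)
chain-⊕ w p [] e b c = trans (app-⊕ w p b) (cong (_⊕ b) c)
chain-⊕ w p (y ∷ us) e b (c , cs) = trans (app-⊕ w p b) (cong (_⊕ b) c) , chain-⊕ w y us e b cs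

cycs-left : ∀ (w r : RawW n) cs → All (IsCyc w) cs → (∀ p → proj₁ p ∈ verts cs → app r p ≡ p) → All (IsCyc (r · w)) cs
cycs-left w r [] [] t = []
cycs-left w r (z@(v , us , f) ∷ cs) (c ∷ a) t =
  chain-left w r (v , false) us (v , f) (v , f) c (λ y m → t y (there (∈-++⁺ˡ (∈-map⁺ proj₁ m)))) (t (v , f) (here refl))
  ∷ cycs-left w r cs a (λ p m → t p (∈-++⁺ʳ (vs z) m))

nodup-disj : ∀ {xs ys : List (Fin n)} → Nodup (xs ++ ys) → ∀ {i} → i ∈ xs → i ∉ ys
nodup-disj {xs = xs} {ys} nd {i} m m' = 1+n≰n (≤-trans (+-mono-≤ (∈⇒occ m) (∈⇒occ m')) (≤-trans (≤-reflexive (sym (occ-++ i xs ys))) (at nd i)))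

map-⊕ : ∀ (us : List (Pt n)) b → map proj₁ (map (_⊕ b) us) ≡ map proj₁ us
map-⊕ [] b = refl
map-⊕ (x ∷ us) b = cong (proj₁ x ∷_) (map-⊕ us b)

Fixes : RawW n → List (Cycle n) → Set
Fixes {n} w cs = ∀ (i : Fin n) → i ∉ verts cs → app w (i , false) ≡ (i , false)

-- One reflection on the left detaches the first vertex of the first cycle as a fixed point, or
-- turns a type B cycle of length 1 into a fixed point; either way `ρ` drops by one.
upper : ∀ (w : RawW n) cs → All (IsCyc w) cs → Nodup (verts cs) → Fixes w cs → w ∈ productsOf (ρ (letters cs))

upperC : ∀ g (w : RawW n) cs v us f → length us ≡ g → All (IsCyc w) ((v , us , f) ∷ cs) → Nodup (verts ((v , us , f) ∷ cs)) →
         Fixes w ((v , us , f) ∷ cs) → w ∈ productsOf (g + ⟦ f ⟧ + ρ (letters cs))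

upper w [] a nd fx = here (W-ext (λ i → trans (fx i (λ ())) (sym (app-id _))))
upper w ((v , us , f) ∷ cs) a nd fx = upperC (length us) w cs v us f refl a nd fx

upperC zero w cs v [] false e (c ∷ a) nd fx = upper w cs a (nodup-++ʳ {xs = v ∷ []} nd) fx'
  where
  fx' : Fixes w cs
  fx' i m with i ≟F v
  ... | yes refl = c
  ... | no ne = fx i (λ { (here q) → ne q ; (there q) → m q })
upperC zero w cs v [] true e (c ∷ a) nd fx = prod-step (ρ (letters cs)) (brr v) (upper (barW v · w) cs
    (cycs-left w (barW v) cs a (λ p m → bar-k v p (λ q → nodup-disj {xs = v ∷ []} nd (here q) m))) (nodup-++ʳ {xs = v ∷ []} nd) fx')
  where
  fx' : Fixes (barW v · w) cs
  fx' i m with i ≟F v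
  ... | yes refl = trans (app-· (barW v) w (v , false)) (trans (cong (app (barW v)) c) (bar-i v true))
  ... | no ne = trans (app-· (barW v) w (i , false)) (trans (cong (app (barW v)) (fx i (λ { (here q) → ne q ; (there q) → m q }))) (bar-k v (i , false) ne))
upperC (suc g) w cs v ((j , s) ∷ us) f e ((c , ch) ∷ a) nd fx =
  prod-step (g + ⟦ f ⟧ + ρ (letters cs)) (swp v j s v≢j) (upperC g (r · w) cs j us' f (trans (LP.length-map (_⊕ s) us) (suc-injective e))
    (newc ∷ cycs-left w r cs a (λ p m → swap-k v j s p (λ q → nodup-disj {xs = vs (v , (j , s) ∷ us , f)} nd (here q) m) (λ q → nodup-disj {xs = vs (v , (j , s) ∷ us , f)} nd (there (here q)) m)))
    nd' fx')
  where
  r = swapW v j s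
  us' = map (_⊕ s) us
  v≢j : v ≢ j
  v≢j refl = nodup-head nd (here refl)
  tail-nd : Nodup (j ∷ map proj₁ us ++ verts cs)
  tail-nd = nodup-++ʳ {xs = v ∷ []} nd
  nd' : Nodup (verts ((j , us' , f) ∷ cs))
  nd' = subst (λ l → Nodup (j ∷ l ++ verts cs)) (sym (map-⊕ us s)) tail-nd
  -- The rest of the cycle starts at (j, s); shifted by s it starts at the unbarred j, as `IsCyc`
  -- wants.
  flip-s : Chain w (j , s xor s) (map (_⊕ s) us) (v , f xor s)
  flip-s = chain-⊕ w (j , s) us (v , f) s ch
  newc : Chain (r · w) (j , false) us' (j , f)
  newc = chain-left w r (j , false) us' (v , f xor s) (j , f) (subst (λ b → Chain w (j , b) us' (v , f xor s)) (xor-self s) flip-s)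
    (λ y m → swap-k v j s y
      (λ q → nodup-head nd (there (∈-++⁺ˡ (subst (_∈ map proj₁ us) q (subst (proj₁ y ∈_) (map-⊕ us s) (∈-map⁺ proj₁ m))))))
      (λ q → nodup-head tail-nd (∈-++⁺ˡ (subst (_∈ map proj₁ us) q (subst (proj₁ y ∈_) (map-⊕ us s) (∈-map⁺ proj₁ m))))))
    (trans (swap-i v j s (f xor s)) (cong (j ,_) (trans (BP.xor-comm s (f xor s)) (trans (BP.xor-assoc f s s) (trans (cong (f xor_) (xor-self s)) (BP.xor-identityʳ f))))))
  fx' : Fixes (r · w) ((j , us' , f) ∷ cs)
  fx' i m with i ≟F v
  ... | yes refl = trans (app-· r w (v , false)) (trans (cong (app r) c) (trans (swap-j v j s s v≢j) (cong (v ,_) (xor-self s))))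
  ... | no ne = trans (app-· r w (i , false)) (trans (cong (app r) (fx i (λ { (here q) → ne q ; (there q) → m (subst (λ l → i ∈ (j ∷ l ++ verts cs)) (sym (map-⊕ us s)) q) })))
      (swap-k v j s (i , false) ne (λ q → m (here q))))

-- The lower bound for ℓ_T: the identity preserves a labelling of the vertices with n independent labels, and each
-- reflection costs at most one label.
Lab : ℕ → Set
Lab n = Maybe (Fin n × Bool)

shift : Bool → Lab n → Lab n
shift b nothing = nothing
shift b (just (a , s)) = just (a , s xor b)

shift-shift : ∀ a b (x : Lab n) → shift a (shift b x) ≡ shift (b xor a) x
shift-shift a b nothing = refl
shift-shift a b (just (i , s)) = cong (λ z → just (i , z)) (BP.xor-assoc s b a)

shift-false : ∀ (x : Lab n) → shift false x ≡ x
shift-false nothing = refl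
shift-false (just (i , s)) = cong (λ z → just (i , z)) (BP.xor-identityʳ s)

-- A label stands for a coordinate: `just (a , s)` is plus or minus a variable x_a, and `nothing` is
-- 0. This is the substitution of z for x_b.
subL : Fin n → Lab n → Lab n → Lab n
subL b z nothing = nothing
subL b z (just (a , s)) = if a ==F b then shift s z else just (a , s)

subL-shift : ∀ (b : Fin n) z c x → subL b z (shift c x) ≡ shift c (subL b z x)
subL-shift b z c nothing = refl
subL-shift b z c (just (a , s)) with a ==F b
... | true = sym (shift-shift c s z)
... | false = refl

_≟M_ : (x y : Lab n) → Dec (x ≡ y)
_≟M_ = MP.≡-dec _≟P_

-- One equation between different labels eliminates one variable: x_a = 0 and x_a = -x_a both set
-- x_a to 0, and an equation between two variables expresses x_b by x_a.
merge : ∀ (x y : Lab n) → x ≢ y → ∃₂ λ b z → subL b z x ≡ subL b z y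
merge nothing nothing ne = ⊥-elim (ne refl)
merge nothing (just (b , t)) ne = b , nothing , sym h
  where h : subL b nothing (just (b , t)) ≡ nothing
        h rewrite ==F-refl b = refl
merge (just (a , t)) nothing ne = a , nothing , h
  where h : subL a nothing (just (a , t)) ≡ nothing
        h rewrite ==F-refl a = refl
merge (just (a , t)) (just (b , u)) ne with a ≟F b
... | yes refl = a , nothing , h
  where h : subL a nothing (just (a , t)) ≡ subL a nothing (just (a , u))
        h rewrite ==F-refl a = refl
... | no a≢b = b , just (a , t xor u) , h
  where
  h : subL b (just (a , t xor u)) (just (a , t)) ≡ subL b (just (a , t xor u)) (just (b , u))
  h rewrite ==F-refl b | ==F-≢ a≢b = cong (λ z → just (a , z)) (sym (trans (BP.xor-assoc t u u) (trans (cong (t xor_) (xor-self u)) (BP.xor-identityʳ t))))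

Ψ : (Fin n → Lab n) → Pt n → Lab n
Ψ ψ (i , b) = shift b (ψ i)

Ψ-⊕ : ∀ (ψ : Fin n → Lab n) p b → Ψ ψ (p ⊕ b) ≡ shift b (Ψ ψ p)
Ψ-⊕ ψ (i , c) b = sym (shift-shift b c (ψ i))

-- In linear terms: a family of vectors fixed by `w` with at least n - k free parameters, each of
-- which really occurs in some coordinate. It replaces the dimension of the fixed space.
record Labelling (w : RawW n) (k : ℕ) : Set where
  field
    ψ : Fin n → Lab n
    labs : List (Fin n)
    labs-nd : Nodup labs
    many : n ≤ length labs + k
    pres : ∀ p → Ψ ψ (app w p) ≡ Ψ ψ p
    hitL : ∀ a → 1 ≤ occ a labs → ∃₂ λ i s → ψ i ≡ just (a , s)

-- The equation of the mirror: it equates the coordinates at i and ī for [i], and those at i and its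
-- image for a transposition.
pair-of : ∀ {r : RawW n} → Refl r → ∃₂ λ p q → (∀ ψ → Ψ ψ p ≡ Ψ ψ q → ∀ t → Ψ ψ (app r t) ≡ Ψ ψ t)
pair-of {n} (brr i) = (i , false) , (i , true) , h
  where
  h : ∀ ψ → Ψ ψ (i , false) ≡ Ψ ψ (i , true) → ∀ t → Ψ ψ (app (barW i) t) ≡ Ψ ψ t
  h ψ e (k , b) with k ≟F i
  ... | no ne = cong (Ψ ψ) (bar-k i (k , b) ne)
  ... | yes refl = trans (cong (Ψ ψ) (bar-i i b)) (trans (Ψ-⊕ ψ (i , true) b) (trans (cong (shift b) (sym e)) (sym (Ψ-⊕ ψ (i , false) b))))
pair-of {n} (swp i j s ne) = (i , false) , (j , s) , h
  where
  h : ∀ ψ → Ψ ψ (i , false) ≡ Ψ ψ (j , s) → ∀ t → Ψ ψ (app (swapW i j s) t) ≡ Ψ ψ t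
  h ψ e (k , b) with k ≟F i | k ≟F j
  ... | yes refl | _ = trans (cong (Ψ ψ) (swap-i i j s b)) (trans (Ψ-⊕ ψ (j , s) b) (trans (cong (shift b) (sym e)) (sym (Ψ-⊕ ψ (i , false) b))))
  ... | no _ | yes refl = trans (cong (Ψ ψ) (swap-j i j s b ne)) (trans (Ψ-⊕ ψ (i , false) (s xor b)) (trans (cong (shift (s xor b)) e)
        (trans (sym (Ψ-⊕ ψ (j , s) (s xor b))) (cong (λ z → Ψ ψ (j , z)) (trans (sym (BP.xor-assoc s s b)) (cong (_xor b) (xor-self s)))))))
  ... | no a | no c = cong (Ψ ψ) (swap-k i j s (k , b) a c)

labelling-step : ∀ {r w : RawW n} {k} → Refl r → Labelling w k → Labelling (r · w) (suc k)
labelling-step {n} {r} {w} {k} rf L with pair-of rf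
... | p , q , h with Ψ (Labelling.ψ L) p ≟M Ψ (Labelling.ψ L) q
... | yes e = record { ψ = ψ ; labs = labs ; labs-nd = labs-nd ; many = ≤-trans many (+-monoʳ-≤ (length labs) (n≤1+n k))
    ; pres = λ t → trans (cong (Ψ ψ) (app-· r w t)) (trans (h ψ e (app w t)) (pres t)) ; hitL = hitL }
  where open Labelling L
... | no ne with merge _ _ ne
... | b , z , eq = record { ψ = ψ' ; labs = labs' ; labs-nd = nodup nd' ; many = many' ; pres = pres' ; hitL = hit' }
  where
  open Labelling L
  ψ' : Fin n → Lab n
  ψ' i = subL b z (ψ i)
  Ψ' : ∀ p → Ψ ψ' p ≡ subL b z (Ψ ψ p)
  Ψ' (i , c) = sym (subL-shift b z c (ψ i))
  labs' = filterB (λ x → not (b ==F x)) labs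
  occ' : ∀ i → occ i labs' ≡ ∑ labs (λ x → ⟦ not (b ==F x) ⟧ * ⟦ i ==F x ⟧)
  occ' i = ∑-filterB _ labs _
  le1 : ∀ a x → ⟦ a ⟧ * x ≤ x
  le1 true x = ≤-reflexive (*-identityˡ x)
  le1 false x = z≤n
  nd' : ∀ i → occ i labs' ≤ 1
  nd' i = ≤-trans (≤-reflexive (occ' i)) (≤-trans (∑-mono labs (λ x → le1 (not (b ==F x)) _)) (at labs-nd i))
  many' : n ≤ length labs' + suc k
  many' = begin
    n ≤⟨ many ⟩
    length labs + k ≡⟨ cong (_+ k) (sym (∑-1 labs)) ⟩
    ∑ labs (λ _ → 1) + k ≡⟨ cong (_+ k) (trans (∑-cong labs (λ x → split (b ==F x))) (∑-+ labs _ _)) ⟩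
    occ b labs + ∑ labs (λ x → ⟦ not (b ==F x) ⟧) + k ≡⟨ cong (λ y → occ b labs + y + k) (sym (countB-∑ _ labs)) ⟩
    occ b labs + length labs' + k ≤⟨ +-monoˡ-≤ k (+-monoˡ-≤ (length labs') (at labs-nd b)) ⟩
    suc (length labs' + k) ≡⟨ sym (+-suc (length labs') k) ⟩
    length labs' + suc k ∎
    where
    open ≤-Reasoning
    split : ∀ b → 1 ≡ ⟦ b ⟧ + ⟦ not b ⟧
    split true = refl
    split false = refl
  pres' : ∀ t → Ψ ψ' (app (r · w) t) ≡ Ψ ψ' t
  pres' t = trans (cong (Ψ ψ') (app-· r w t)) (trans (h ψ' (trans (Ψ' p) (trans eq (sym (Ψ' q)))) (app w t))
    (trans (Ψ' (app w t)) (trans (cong (subL b z) (pres t)) (sym (Ψ' t)))))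
  hit' : ∀ a → 1 ≤ occ a labs' → ∃₂ λ i s → ψ' i ≡ just (a , s)
  hit' a le with a ≟F b
  ... | yes refl = ⊥-elim (1+n≰n (≤-trans le (≤-reflexive (trans (occ' b) (∑-zero labs (λ x → z' (b ==F x)))))))
    where
    z' : ∀ c → ⟦ not c ⟧ * ⟦ c ⟧ ≡ 0
    z' true = refl
    z' false = refl
  ... | no a≢b with hitL a (≤-trans le (≤-trans (≤-reflexive (occ' a)) (∑-mono labs (λ x → le1 (not (b ==F x)) _))))
  ... | i , s , e = i , s , trans (cong (subL b z) e) h'
    where h' : subL b z (just (a , s)) ≡ just (a , s)
          h' rewrite ==F-≢ a≢b = refl

occ-allFin : ∀ (i : Fin n) → occ i (allFin n) ≡ 1
occ-allFin {n} i = trans (∑-cong (allFin n) (λ x → cong ⟦_⟧ (bool-⇔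
   (λ e → ⌊⌋-yes (x ≟F i) (sym (==F-true e))) (λ e → ⌊⌋-yes (i ≟F x) (sym (⌊⌋-true (x ≟F i) e)))))) (allFin-Enum n i)

labelling : ∀ k {w : RawW n} → w ∈ productsOf k → Labelling w k
labelling {n} zero (here refl) = record
  { ψ = λ i → just (i , false) ; labs = allFin n ; labs-nd = nodup (λ i → ≤-reflexive (occ-allFin i))
  ; many = ≤-reflexive (sym (trans (+-identityʳ _) (LP.length-tabulate {n = n} id)))
  ; pres = λ p → cong (Ψ (λ i → just (i , false))) (app-id p) ; hitL = λ a _ → a , false , refl }
labelling (suc k) m with prod-unstep k m
... | r , w' , rf , m' , refl = labelling-step rf (labelling k m')

ρ-cover : ∀ {w : RawW n} {cs} → Full w cs → ρ (letters cs) + ∑ cs (λ z → ⟦ not (proj₂ (letter z)) ⟧) ≡ n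
ρ-cover {n} {w} {cs} fl = trans (go cs) (trans (length-occ (verts cs)) (trans (sumF-cong (cover fl)) (trans (sumF-const {n} 1) (*-identityʳ n))))
  where
  one : ∀ g f → (g + ⟦ f ⟧) + ⟦ not f ⟧ ≡ suc g
  one g true = trans (+-identityʳ _) (+-comm g 1)
  one g false = trans (cong (_+ 1) (+-identityʳ g)) (+-comm g 1)
  go : ∀ cs → ρ (letters cs) + ∑ cs (λ z → ⟦ not (proj₂ (letter z)) ⟧) ≡ length (verts cs)
  go [] = refl
  go (z@(v , us , f) ∷ cs) = trans (interchange (length us + ⟦ f ⟧) _ ⟦ not f ⟧ _) (trans (cong₂ _+_ (one (length us) f) (go cs)) (sym (length-verts-cons z cs)))

-- A type B cycle carries no variable, because its label equals its own negative; a type A cycle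
-- carries at most one. So the variables number at most the type A cycles, of which there are n -
-- `ρ`.
lower : ∀ {w : RawW n} {cs} → Full w cs → ∀ k → w ∈ productsOf k → ρ (letters cs) ≤ k
lower {n} {w} {cs} fl k m = +-cancelʳ-≤ (∑ cs (λ z → ⟦ isA z ⟧)) _ _
  (≤-trans (≤-reflexive (ρ-cover fl)) (≤-trans many (≤-trans (≤-reflexive (+-comm (length labs) k)) (+-monoʳ-≤ k labs≤))))
  where
  open Labelling (labelling k m)
  isA : Cycle n → Bool
  isA z = not (proj₂ (letter z))
  tag : Cycle n → Fin n → Bool
  tag (v , _) a with ψ v
  ... | nothing = false
  ... | just (b , _) = b ==F a
  chain-pres : ∀ p us e → Chain w p us e → ∀ {i} → i ∈ (proj₁ p ∷ map proj₁ us) → ∃ λ b → Ψ ψ (i , b) ≡ Ψ ψ p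
  chain-pres p us e c (here refl) = proj₂ p , refl
  chain-pres p (y ∷ us) e (c , cs) (there mm) with chain-pres y us e cs mm
  ... | b , q = b , trans q (trans (cong (Ψ ψ) (sym c)) (pres p))
  chain-end : ∀ p us e → Chain w p us e → Ψ ψ e ≡ Ψ ψ p
  chain-end p [] e c = trans (cong (Ψ ψ) (sym c)) (pres p)
  chain-end p (y ∷ us) e (c , cs) = trans (chain-end y us e cs) (trans (cong (Ψ ψ) (sym c)) (pres p))
  unshift : ∀ b (x : Lab n) {y} → shift b x ≡ y → x ≡ shift b y
  unshift b x refl = sym (trans (shift-shift b b x) (trans (cong (λ c → shift c x) (xor-self b)) (shift-false x)))
  good : ∀ z → IsCyc w z → ∀ {i a s} → i ∈ vs z → ψ i ≡ just (a , s) → 1 ≤ ⟦ isA z ∧ tag z a ⟧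
  good z@(v , us , f) c {i} {a} {s} mi e with chain-pres (v , false) us (v , f) c mi
  ... | b , q with unshift false (ψ v) (sym (trans (cong (shift b) (sym e)) q))
  ... | ev with f | chain-end (v , false) us (v , f) c
  ... | false | _ rewrite ev | ==F-refl a = s≤s z≤n
  ... | true | ee rewrite ev = ⊥-elim (x≢ ((s xor b) xor false) (cong proj₂ (MP.just-injective ee)))
    where x≢ : ∀ x → x xor true ≢ x xor false
          x≢ true ()
          x≢ false ()
  find : ∀ cs' → All (IsCyc w) cs' → ∀ {i a s} → i ∈ verts cs' → ψ i ≡ just (a , s) → 1 ≤ ∑ cs' (λ z → ⟦ isA z ∧ tag z a ⟧)
  find (z ∷ cs') (c ∷ al) {i} {a} mi e with ∈-++⁻ (vs z) mi
  ... | inj₁ x = ≤-trans (good z c x e) (m≤m+n _ _)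
  ... | inj₂ y = ≤-trans (find cs' al y e) (m≤n+m _ ⟦ isA z ∧ tag z a ⟧)
  tag-le : ∀ z → ∑ labs (λ a → ⟦ tag z a ⟧) ≤ 1
  tag-le (v , _) with ψ v
  ... | nothing = ≤-trans (≤-reflexive (∑-0 labs)) z≤n
  ... | just (b , _) = at labs-nd b
  le-∈ : ∀ xs → (∀ a → a ∈ xs → 1 ≤ ∑ cs (λ z → ⟦ isA z ∧ tag z a ⟧)) → length xs ≤ ∑ xs (λ a → ∑ cs (λ z → ⟦ isA z ∧ tag z a ⟧))
  le-∈ [] h = z≤n
  le-∈ (x ∷ xs) h = +-mono-≤ (h x (here refl)) (le-∈ xs (λ a mm → h a (there mm)))
  labs≤ : length labs ≤ ∑ cs (λ z → ⟦ isA z ⟧)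
  labs≤ = begin
    length labs ≤⟨ le-∈ labs (λ a mm → let (i , s , e) = hitL a (∈⇒occ mm) in find cs (cycF fl) (occ⇒∈ (≤-reflexive (sym (cover fl i)))) e) ⟩
    ∑ labs (λ a → ∑ cs (λ z → ⟦ isA z ∧ tag z a ⟧)) ≡⟨ ∑-swap labs cs _ ⟩
    ∑ cs (λ z → ∑ labs (λ a → ⟦ isA z ∧ tag z a ⟧)) ≡⟨ ∑-cong cs (λ z → trans (∑-cong labs (λ a → ⟦∧⟧ (isA z) (tag z a))) (∑-*ˡ labs ⟦ isA z ⟧ _)) ⟩
    ∑ cs (λ z → ⟦ isA z ⟧ * ∑ labs (λ a → ⟦ tag z a ⟧)) ≤⟨ ∑-mono cs (λ z → ≤-trans (*-monoʳ-≤ ⟦ isA z ⟧ (tag-le z)) (≤-reflexive (*-identityʳ _))) ⟩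
    ∑ cs (λ z → ⟦ isA z ⟧) ∎
    where open ≤-Reasoning

ℓT-letters : ∀ {w : RawW n} {cs} → Full w cs → ℓT w ≡ ρ (letters cs)
ℓT-letters {n} {w} {cs} fl = firstTrue-at id (suc n) _ n (ρ (letters cs)) (s≤s (≤-trans (m≤m+n _ _) (≤-reflexive (ρ-cover fl))))
  (true-any (eqW w) (upper w cs (cycF fl) (nd (Full⇒Part fl)) (λ i m → ⊥-elim (m (occ⇒∈ (≤-reflexive (sym (cover fl i))))))) (eqW-refl w))
  (λ s lt → not-true (λ e → let (w' , m , q) = any-true (productsOf s) (eqW w) e in
      <⇒≱ lt (lower fl s (subst (_∈ productsOf s) (sym (eqW-true w w' q)) m))))

-- Transitive tuples and the vertices that their cycles can meet

prodV : Vec (RawW n) M → RawW n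
prodV f = prodW (toList f)

closed-prod : ∀ (f : Vec (RawW n) M) (S : Fin n → Set) → (∀ c i → S i → S (proj₁ (lookup (lookup f c) i))) →
              ∀ i → S i → S (proj₁ (lookup (prodV f) i))
closed-prod [] S cl i s = subst S (cong proj₁ (trans (sym (app-id (i , false))) (app-lookup idW i))) s
closed-prod (w ∷ f) S cl i s = subst S (cong proj₁ (trans (sym (app-· w (prodV f) (i , false))) (app-lookup (w · prodV f) i)))
  (cl zero _ (closed-prod f S (cl ∘ suc) i s))

prod-Perm : ∀ (f : Vec (RawW n) M) → (∀ c → Perm (lookup f c)) → Perm (prodV f)
prod-Perm [] pm = id-Perm
prod-Perm (w ∷ f) pm = ·-Perm (pm zero) (prod-Perm f (pm ∘ suc))

Transitive : RawW (suc n) → Set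
Transitive P = ∀ j → ∃ λ t → proj₁ (iterW t P (zero , false)) ≡ j

size : List Letter → ℕ
size ls = ∑ ls proj₁

push : Fin M → Cycle n → Vec (List (Cycle n)) M → Vec (List (Cycle n)) M
push c z st = st [ c ]%= (z ∷_)

push-same : ∀ (c : Fin M) (z : Cycle n) st → lookup (push c z st) c ≡ z ∷ lookup st c
push-same c z st = VP.lookup∘updateAt c st

push-other : ∀ {c c' : Fin M} (z : Cycle n) st → c' ≢ c → lookup (push c z st) c' ≡ lookup st c'
push-other {c = c} {c'} z st ne = VP.lookup∘updateAt′ c' c ne st

sumF-upd : ∀ {f g : Fin M → ℕ} c → (∀ c' → c' ≢ c → f c' ≡ g c') → sumF f + g c ≡ sumF g + f c
sumF-upd {suc M} {f} {g} zero h = begin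
  f zero + sumF (f ∘ suc) + g zero ≡⟨ cong (λ x → f zero + x + g zero) (sumF-cong (λ i → h (suc i) (λ ()))) ⟩
  f zero + sumF (g ∘ suc) + g zero ≡⟨ +-comm _ (g zero) ⟩
  g zero + (f zero + sumF (g ∘ suc)) ≡⟨ cong (g zero +_) (+-comm (f zero) _) ⟩
  g zero + (sumF (g ∘ suc) + f zero) ≡⟨ sym (+-assoc (g zero) _ (f zero)) ⟩
  g zero + sumF (g ∘ suc) + f zero ∎ where open ≡-Reasoning
sumF-upd {suc M} {f} {g} (suc c) h = begin
  f zero + sumF (f ∘ suc) + g (suc c) ≡⟨ +-assoc (f zero) _ _ ⟩
  f zero + (sumF (f ∘ suc) + g (suc c)) ≡⟨ cong₂ _+_ (h zero (λ ())) (sumF-upd c (λ c' ne → h (suc c') (λ { refl → ne refl }))) ⟩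
  g zero + (sumF (g ∘ suc) + f (suc c)) ≡⟨ sym (+-assoc (g zero) _ _) ⟩
  g zero + sumF (g ∘ suc) + f (suc c) ∎ where open ≡-Reasoning

total : Vec (List (Cycle n)) M → ℕ
total st = sumF (λ c → size (letters (lookup st c)))

total-push : ∀ (c : Fin M) v us (fl : Bool) (st : Vec (List (Cycle n)) M) → total (push c (v , us , fl) st) ≡ length us + total st
total-push c v us fl st = +-cancelʳ-≡ (size (letters (lookup st c))) _ _
  (trans (sumF-upd c (λ c' ne → cong (size ∘ letters) (push-other (v , us , fl) st ne)))
  (trans (cong (λ x → total st + size (letters x)) (push-same c (v , us , fl) st))
  (trans (sym (+-assoc (total st) (length us) _)) (cong (_+ size (letters (lookup st c))) (+-comm (total st) (length us))))))

unrevealed : Vec (List (Cycle n)) M → ℕ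
unrevealed {n} st = sumF (λ c → n ∸ length (verts (lookup st c)))

unrevealed-push : ∀ (c : Fin M) (z : Cycle n) (st : Vec (List (Cycle n)) M) → Nodup (verts (z ∷ lookup st c)) → unrevealed (push c z st) < unrevealed st
unrevealed-push {n = n} c z st nd = +-cancelʳ-< (n ∸ length (verts (lookup st c))) _ _
  (≤-trans (≤-reflexive (cong suc (sumF-upd c (λ c' ne → cong (λ x → n ∸ length (verts x)) (push-other z st ne)))))
    (≤-trans (≤-reflexive (sym (+-suc (unrevealed st) _))) (+-monoʳ-≤ (unrevealed st)
      (subst (λ x → n ∸ length (verts x) < n ∸ length (verts (lookup st c))) (sym (push-same c z st))
        (∸-monoʳ-< (≤-trans (s≤s (m≤n+m _ (length (proj₁ (proj₂ z))))) (≤-reflexive (sym (length-verts-cons z (lookup st c))))) (nodup-length nd))))))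

Parts : Vec (RawW n) M → Vec (List (Cycle n)) M → Set
Parts f st = ∀ c → Part (lookup f c) (lookup st c)

parts-push : ∀ {f : Vec (RawW n) M} {st} c z → Parts f st → Part (lookup f c) (z ∷ lookup st c) → Parts f (push c z st)
parts-push {f = f} {st} c z ps p c' with c' ≟F c
... | yes refl = subst (Part (lookup f c)) (sym (push-same c z st)) p
... | no ne = subst (Part (lookup f c')) (sym (push-other z st ne)) (ps c')

Within : Vec (List (Cycle n)) M → List (Fin n) → Set
Within st D = ∀ c i → i ∈ verts (lookup st c) → i ∈ D

within-push : ∀ {st : Vec (List (Cycle n)) M} {D D'} c v us (fl : Bool) → Within st D → v ∈ D' →
  (∀ i → i ∈ map proj₁ us → i ∈ D') → (∀ i → i ∈ D → i ∈ D') → Within (push c (v , us , fl) st) D'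
within-push {st = st} {D} {D'} c v us fl wi vD usD inc c' i m with c' ≟F c
... | no ne = inc i (wi c' i (subst (λ x → i ∈ verts x) (push-other (v , us , fl) st ne) m))
... | yes refl with ∈-++⁻ (vs (v , us , fl)) (subst (λ x → i ∈ verts x) (push-same c (v , us , fl) st) m)
... | inj₁ (here refl) = vD
... | inj₁ (there x) = usD i x
... | inj₂ y = inc i (wi c i y)

closed-all : ∀ (f : Vec (RawW (suc n)) M) st D → Parts f st → Transitive (prodV f) → zero ∈ D → Within st D →
  (∀ c i → i ∈ D → i ∈ verts (lookup st c)) → ∀ j → j ∈ D
closed-all f st D ps tr z wi fu j with tr j
... | t , e = subst (_∈ D) e (iter-closed (prodV f) (_∈ D) (closed-prod f (_∈ D)
  (λ c i m → wi c _ (verts-closed (lookup f c) (lookup st c) (cyc (ps c)) (fu c i m)))) t (zero , false) z)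

length-all : ∀ (D : List (Fin n)) → (∀ j → j ∈ D) → n ≤ length D
length-all {n} D all = ≤-trans (≤-reflexive (sym (trans (sumF-const {n} 1) (*-identityʳ n))))
  (≤-trans (sumF-mono (λ j → ∈⇒occ (all j))) (≤-reflexive (sym (length-occ D))))

pending? : ∀ (st : Vec (List (Cycle n)) M) D → Dec (∃₂ λ c i → i ∈ D × i ∉ verts (lookup st c))
pending? st D = any? (λ c → any? (λ i → (i ∈? D) ×-dec (¬? (i ∈? verts (lookup st c)))))

-- In `bound` the length of `D` counts repetitions, and `D` only has to contain the vertices met.
-- This is what `fresh` exploits: it feeds in a list from which a repeated vertex has been struck
-- out, and gets a contradiction.
record Completion {n M} (f : Vec (RawW (suc n)) M) (st : Vec (List (Cycle (suc n))) M) (D : List (Fin (suc n))) : Set where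
  field
    cs : Fin M → List (Cycle (suc n))
    fulls : ∀ c → Full (lookup f c) (cs c)
    bound : total st + suc n ≤ sumF (λ c → size (letters (cs c))) + length D

length-news : ∀ (us : List (Pt n)) (D : List (Fin n)) → length (map proj₁ us ++ D) ≡ length us + length D
length-news us D = trans (LP.length-++ (map proj₁ us)) (cong (_+ length D) (LP.length-map proj₁ us))

module _ {n M : ℕ} (f : Vec (RawW (suc n)) M) (pm : ∀ c → Perm (lookup f c)) (tr : Transitive (prodV f)) where

  ext-done : ∀ st D → Parts f st → zero ∈ D → Within st D → ¬ (∃₂ λ c i → i ∈ D × i ∉ verts (lookup st c)) → Completion f st D
  ext-done st D ps zD wi ¬p = record
    { cs = lookup st
    ; fulls = λ c → full (cyc (ps c)) (λ i → ≤-antisym (at (nd (ps c)) i) (∈⇒occ (covered c i (allD i))))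
    ; bound = +-monoʳ-≤ (total st) (length-all D allD) }
    where
    covered : ∀ c i → i ∈ D → i ∈ verts (lookup st c)
    covered c i m = decidable-stable (i ∈? verts (lookup st c)) (λ ne → ¬p (c , i , m , ne))
    allD : ∀ j → j ∈ D
    allD = closed-all f st D ps tr zD wi covered

  ext-pop : ∀ st D c v us fl → Completion f (push c (v , us , fl) st) (map proj₁ us ++ D) → Completion f st D
  ext-pop st D c v us fl C = record { cs = cs ; fulls = fulls ; bound = +-cancelˡ-≤ (length us) _ _ (begin
    length us + (total st + suc n) ≡⟨ sym (+-assoc (length us) _ _) ⟩
    length us + total st + suc n ≡⟨ cong (_+ suc n) (sym (total-push c v us fl st)) ⟩
    total (push c (v , us , fl) st) + suc n ≤⟨ bound ⟩
    S + length (map proj₁ us ++ D) ≡⟨ cong (S +_) (length-news us D) ⟩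
    S + (length us + length D) ≡⟨ sym (+-assoc S _ _) ⟩
    S + length us + length D ≡⟨ cong (_+ length D) (+-comm S (length us)) ⟩
    length us + S + length D ≡⟨ +-assoc (length us) S _ ⟩
    length us + (S + length D) ∎) }
    where
    open ≤-Reasoning
    open Completion C
    S = sumF (λ c → size (letters (cs c)))

  -- Each revealed cycle with g further points meets at most g new vertices, and transitivity forces every vertex to be met.
  ext : ∀ k st D → Parts f st → zero ∈ D → Within st D → unrevealed st ≤ k → Completion f st D

  ext-at : ∀ k st D → Parts f st → zero ∈ D → Within st D → unrevealed st ≤ k →
    ∀ c v → v ∈ D → (∃₂ λ us fl → Part (lookup f c) ((v , us , fl) ∷ lookup st c)) → Completion f st D

  ext-if : ∀ k st D → Parts f st → zero ∈ D → Within st D → unrevealed st ≤ k →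
    Dec (∃₂ λ c i → i ∈ D × i ∉ verts (lookup st c)) → Completion f st D
  ext-if k st D ps zD wi le (no ¬p) = ext-done st D ps zD wi ¬p
  ext-if k st D ps zD wi le (yes (c , v , vD , v∉)) = ext-at k st D ps zD wi le c v vD (follow (pm c) (lookup st c) (ps c) v v∉)

  ext k st D ps zD wi le = ext-if k st D ps zD wi le (pending? st D)

  ext-at zero st D ps zD wi le c v vD (us , fl , pt) =
    ⊥-elim (n≮0 (≤-trans (unrevealed-push c (v , us , fl) st (nd pt)) le))
  ext-at (suc k) st D ps zD wi le c v vD (us , fl , pt) =
    ext-pop st D c v us fl (ext k (push c (v , us , fl) st) (map proj₁ us ++ D)
       (parts-push {f = f} {st} c (v , us , fl) ps pt) (∈-++⁺ʳ (map proj₁ us) zD)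
       (within-push {st = st} {D} c v us fl wi (∈-++⁺ʳ (map proj₁ us) vD) (λ i m → ∈-++⁺ˡ m) (λ i m → ∈-++⁺ʳ (map proj₁ us) m))
       (s≤s⁻¹ (≤-trans (unrevealed-push c (v , us , fl) st (nd pt)) le)))

-- The parity of the number of bars

odd : ℕ → Bool
odd zero = false
odd (suc k) = not (odd k)

not-xor : ∀ a b → not (a xor b) ≡ not a xor b
not-xor true b = BP.not-involutive b
not-xor false b = refl

odd-+ : ∀ a b → odd (a + b) ≡ odd a xor odd b
odd-+ zero b = refl
odd-+ (suc a) b = trans (cong not (odd-+ a b)) (not-xor (odd a) (odd b))

odd-⟦⟧ : ∀ b → odd ⟦ b ⟧ ≡ b
odd-⟦⟧ true = refl
odd-⟦⟧ false = refl

xor-interchange : ∀ a b c d → (a xor b) xor (c xor d) ≡ (a xor c) xor (b xor d)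
xor-interchange a b c d = trans (BP.xor-assoc a b _) (trans (cong (a xor_) (trans (sym (BP.xor-assoc b c d))
  (trans (cong (_xor d) (BP.xor-comm b c)) (BP.xor-assoc c b d)))) (sym (BP.xor-assoc a c _)))

odd-sum-xor : ∀ {k} (f g : Fin k → Bool) → odd (sumF (λ i → ⟦ f i xor g i ⟧)) ≡ odd (sumF (λ i → ⟦ f i ⟧)) xor odd (sumF (λ i → ⟦ g i ⟧))
odd-sum-xor {zero} f g = refl
odd-sum-xor {suc k} f g = begin
  odd (⟦ f zero xor g zero ⟧ + S₁) ≡⟨ odd-+ ⟦ f zero xor g zero ⟧ S₁ ⟩
  odd ⟦ f zero xor g zero ⟧ xor odd S₁ ≡⟨ cong₂ _xor_ (odd-⟦⟧ (f zero xor g zero)) (odd-sum-xor (f ∘ suc) (g ∘ suc)) ⟩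
  (f zero xor g zero) xor (odd S₂ xor odd S₃) ≡⟨ xor-interchange (f zero) (g zero) (odd S₂) (odd S₃) ⟩
  (f zero xor odd S₂) xor (g zero xor odd S₃) ≡⟨ sym (cong₂ (λ x y → (x xor odd S₂) xor (y xor odd S₃)) (odd-⟦⟧ (f zero)) (odd-⟦⟧ (g zero))) ⟩
  (odd ⟦ f zero ⟧ xor odd S₂) xor (odd ⟦ g zero ⟧ xor odd S₃) ≡⟨ sym (cong₂ _xor_ (odd-+ ⟦ f zero ⟧ S₂) (odd-+ ⟦ g zero ⟧ S₃)) ⟩
  odd (⟦ f zero ⟧ + S₂) xor odd (⟦ g zero ⟧ + S₃) ∎
  where
  open ≡-Reasoning
  S₁ = sumF (λ i → ⟦ f (suc i) xor g (suc i) ⟧)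
  S₂ = sumF (λ i → ⟦ f (suc i) ⟧)
  S₃ = sumF (λ i → ⟦ g (suc i) ⟧)

sgn : RawW n → Bool
sgn w = odd (sumF (λ i → ⟦ proj₂ (lookup w i) ⟧))

sumF-perm : ∀ {b : RawW n} → Perm b → ∀ (F : Fin n → ℕ) → sumF (λ i → F (proj₁ (lookup b i))) ≡ sumF F
sumF-perm {n} {b} pm F = trans (sym (∑-allFin {n} _)) (trans (∑-reindex _≟F_ (allFin n) (allFin-Enum n)
  (λ i → proj₁ (lookup b i)) (λ j → proj₁ (surj {w = b} pm j))
  (λ i → inj pm _ _ (proj₂ (surj {w = b} pm _))) (λ j → proj₂ (surj {w = b} pm j)) F) (∑-allFin {n} F))

-- Bars add modulo 2 along the composite, and since b permutes the vertices, each bar of a is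
-- counted once.
sgn-· : ∀ {a b : RawW n} → Perm b → sgn (a · b) ≡ sgn a xor sgn b
sgn-· {n} {a} {b} pm = begin
  sgn (a · b) ≡⟨ cong odd (sumF-cong (λ i → cong (λ p → ⟦ proj₂ p ⟧) (VP.lookup∘tabulate (λ i → app a (lookup b i)) i))) ⟩
  odd (sumF (λ i → ⟦ proj₂ (lookup a (proj₁ (lookup b i))) xor proj₂ (lookup b i) ⟧))
    ≡⟨ odd-sum-xor (λ i → proj₂ (lookup a (proj₁ (lookup b i)))) (λ i → proj₂ (lookup b i)) ⟩
  odd (sumF (λ i → ⟦ proj₂ (lookup a (proj₁ (lookup b i))) ⟧)) xor sgn b
    ≡⟨ cong (λ x → odd x xor sgn b) (sumF-perm pm (λ j → ⟦ proj₂ (lookup a j) ⟧)) ⟩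
  sgn a xor sgn b ∎ where open ≡-Reasoning

sgn-id : sgn (idW {n}) ≡ false
sgn-id {n} = cong odd (trans (sumF-cong {n} (λ i → cong (λ p → ⟦ proj₂ p ⟧) (VP.lookup∘tabulate (λ i → (i , false)) i))) (trans (sumF-const {n} 0) (*-zeroʳ n)))

nB : List Letter → ℕ
nB ls = ∑ ls (λ ℓ → ⟦ proj₂ ℓ ⟧)

-- Each step changes the sign by the bar of the vertex that it leaves, so the bars along a path
-- telescope to the signs of its ends.
sgn-chain : ∀ (w : RawW n) p us e → Chain w p us e → odd (∑ (proj₁ p ∷ map proj₁ us) (λ i → ⟦ proj₂ (lookup w i) ⟧)) ≡ proj₂ p xor proj₂ e
sgn-chain w (i , b) [] e refl = begin
  odd (⟦ s ⟧ + 0) ≡⟨ cong odd (+-identityʳ ⟦ s ⟧) ⟩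
  odd ⟦ s ⟧ ≡⟨ odd-⟦⟧ s ⟩
  s ≡⟨ sym (trans (BP.xor-comm b (s xor b)) (trans (BP.xor-assoc s b b) (trans (cong (s xor_) (xor-self b)) (BP.xor-identityʳ s)))) ⟩
  b xor (s xor b) ∎
  where
  open ≡-Reasoning
  s = proj₂ (lookup w i)
sgn-chain w (i , b) (y ∷ us) e (refl , cs) = begin
  odd (⟦ s ⟧ + S) ≡⟨ odd-+ ⟦ s ⟧ S ⟩
  odd ⟦ s ⟧ xor odd S ≡⟨ cong₂ _xor_ (odd-⟦⟧ s) (sgn-chain w _ us e cs) ⟩
  s xor ((s xor b) xor proj₂ e) ≡⟨ sym (BP.xor-assoc s (s xor b) (proj₂ e)) ⟩
  (s xor (s xor b)) xor proj₂ e ≡⟨ cong (_xor proj₂ e) (trans (sym (BP.xor-assoc s s b)) (cong (_xor b) (xor-self s))) ⟩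
  b xor proj₂ e ∎
  where
  open ≡-Reasoning
  s = proj₂ (lookup w i)
  S = ∑ (proj₁ (app w (i , b)) ∷ map proj₁ us) (λ i → ⟦ proj₂ (lookup w i) ⟧)

sgn-full : ∀ {w : RawW n} {cs} → Full w cs → sgn w ≡ odd (nB (letters cs))
sgn-full {n} {w} {cs} fl = trans (cong odd (sym (∑-complete (verts cs) (cover fl) _))) (go cs (cycF fl))
  where
  go : ∀ cs → All (IsCyc w) cs → odd (∑ (verts cs) (λ i → ⟦ proj₂ (lookup w i) ⟧)) ≡ odd (nB (letters cs))
  go [] [] = refl
  go (z@(v , us , f) ∷ cs) (c ∷ a) = trans (cong odd (∑-++ (vs z) (verts cs) F)) (trans (odd-+ (∑ (vs z) F) (∑ (verts cs) F))
    (trans (cong₂ _xor_ (trans (sgn-chain w (v , false) us (v , f) c) (sym (odd-⟦⟧ f))) (go cs a)) (sym (odd-+ ⟦ f ⟧ (nB (letters cs))))))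
    where
    F : Fin n → ℕ
    F i = ⟦ proj₂ (lookup w i) ⟧

sgn-prod : ∀ (f : Vec (RawW n) M) (k : Fin M → ℕ) → (∀ c → Perm (lookup f c)) → (∀ c → sgn (lookup f c) ≡ odd (k c)) →
  sgn (prodV f) ≡ odd (sumF k)
sgn-prod {n} [] k pm e = sgn-id {n}
sgn-prod (w ∷ f) k pm e = trans (sgn-· {a = w} (prod-Perm f (pm ∘ suc))) (trans (cong₂ _xor_ (e zero) (sgn-prod f (k ∘ suc) (pm ∘ suc) (e ∘ suc)))
  (sym (odd-+ (k zero) _)))

-- Realising a partial exploration by an actual tuple

-- Isolates one factor as the context a · (w · b), so that the effect of replacing it can be
-- followed in the product. The two sides fix whatever all the other factors fix.
split-prod : ∀ (f : Vec (RawW n) M) c → ∃₂ λ a b → (∀ w → prodV (f [ c ]≔ w) ≡ a · (w · b)) ×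
  (∀ i → (∀ c' → c' ≢ c → app (lookup f c') (i , false) ≡ (i , false)) → app a (i , false) ≡ (i , false) × app b (i , false) ≡ (i , false)) ×
  ((∀ c' → Perm (lookup f c')) → Perm a × Perm b)
split-prod (x ∷ f) zero = idW , prodV f , (λ w → sym (·-idˡ (w · prodV f))) ,
  (λ i h → app-id (i , false) , go f i (λ c → h (suc c) (λ ()))) , (λ pm → id-Perm , prod-Perm f (pm ∘ suc))
  where
  go : ∀ {M} (f : Vec (RawW _) M) i → (∀ c → app (lookup f c) (i , false) ≡ (i , false)) → app (prodV f) (i , false) ≡ (i , false)
  go [] i h = app-id (i , false)
  go (x ∷ f) i h = trans (app-· x (prodV f) (i , false)) (trans (cong (app x) (go f i (h ∘ suc))) (h zero))
split-prod (x ∷ f) (suc c) with split-prod f c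
... | a , b , e , fx , pm = x · a , b , (λ w → trans (cong (x ·_) (e w)) (sym (·-assoc x a (w · b)))) ,
  (λ i h → let (p , q) = fx i (λ c' ne → h (suc c') (λ { refl → ne refl })) in
     trans (app-· x a (i , false)) (trans (cong (app x) p) (h zero (λ ()))) , q) ,
  (λ ps → ·-Perm (ps zero) (proj₁ (pm (ps ∘ suc))) , proj₂ (pm (ps ∘ suc)))

fix-any : ∀ (w : RawW n) i → app w (i , false) ≡ (i , false) → ∀ b → app w (i , b) ≡ (i , b)
fix-any w i e b = trans (app-fin w i b) (cong (_⊕ b) e)

-- Inserting the vertex j into one factor, just before v, inserts it into the orbit of zero under the product.
insert-trans : ∀ {P P' a b w : RawW (suc n)} v j s → v ≢ j → Perm a → Perm b → Perm w →
  P ≡ a · (w · b) → P' ≡ a · ((swapW v j s · w) · b) →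
  (∀ β → app a (j , β) ≡ (j , β)) → (∀ β → app b (j , β) ≡ (j , β)) → (∀ β → app w (j , β) ≡ (j , β)) →
  j ≢ zero → (D : List (Fin (suc n))) → (∀ i → i ∉ D → proj₁ (app (w · b) (i , false)) ≡ i) → v ∈ D →
  (∀ i → i ∈ D → ∃ λ t → proj₁ (iterW t P (zero , false)) ≡ i) →
  ∀ i → i ∈ (j ∷ D) → ∃ λ t → proj₁ (iterW t P' (zero , false)) ≡ i
insert-trans {n} {P} {P'} {a} {b} {w} v j s v≢j pa pb pw refl refl fa fb fw j≢0 D out vD tr = concl
  where
  r = swapW v j s
  R : Fin (suc n) → Set
  R i = ∃ λ t → proj₁ (iterW t P' (zero , false)) ≡ i
  π π' : Fin (suc n) → Fin (suc n)
  π i = proj₁ (app P (i , false))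
  π' i = proj₁ (app P' (i , false))
  R-step : ∀ i → R i → R (π' i)
  R-step i (t , refl) = suc t , refl
  Pe : ∀ i → app P (i , false) ≡ app a (app w (app b (i , false)))
  Pe i = trans (app-· a (w · b) (i , false)) (cong (app a) (app-· w b (i , false)))
  P'e : ∀ i → app P' (i , false) ≡ app a (app r (app w (app b (i , false))))
  P'e i = trans (app-· a ((r · w) · b) (i , false)) (cong (app a) (trans (app-· (r · w) b (i , false)) (app-· r w (app b (i , false)))))
  mid : Fin (suc n) → Pt (suc n)
  mid i = app w (app b (i , false))
  π-mid : ∀ i → π i ≡ proj₁ (app a (mid i))
  π-mid i = cong proj₁ (Pe i)
  π'-mid : ∀ i → π' i ≡ proj₁ (app a (app r (mid i)))
  π'-mid i = cong proj₁ (P'e i)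
  sim-v : ∀ i → proj₁ (mid i) ≡ v → π' i ≡ j
  sim-v i e = trans (π'-mid i) (trans (cong (λ p → proj₁ (app a (app r p))) (cong (_, proj₂ (mid i)) e))
    (trans (cong (λ p → proj₁ (app a p)) (swap-i v j s (proj₂ (mid i)))) (cong proj₁ (fa (s xor proj₂ (mid i))))))
  mid-j : mid j ≡ (j , false)
  mid-j = trans (cong (app w) (fb false)) (fw false)
  sim-j : π' j ≡ proj₁ (lookup a v)
  sim-j = trans (π'-mid j) (trans (cong (λ p → proj₁ (app a (app r p))) mid-j) (cong (λ p → proj₁ (app a p)) (swap-j v j s false v≢j)))
  mid-≢j : ∀ i → i ≢ j → proj₁ (mid i) ≢ j
  mid-≢j i ne e = ne (Perm-inj₁ pb (i , false) (j , false) (Perm-inj₁ pw (app b (i , false)) (app b (j , false)) (trans e (sym (cong proj₁ mid-j)))))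
  -- One step of P becomes one step of P', or two steps by way of j when the old step runs through
  -- v.
  sim : ∀ i → i ≢ j → R i → R (π i)
  sim i ne ri with proj₁ (mid i) ≟F v
  ... | no nv = subst R (trans (π'-mid i) (trans (cong (λ p → proj₁ (app a p)) (swap-k v j s (mid i) nv (mid-≢j i ne))) (sym (π-mid i)))) (R-step i ri)
  ... | yes ev = subst R (trans sim-j (trans (cong (λ x → proj₁ (lookup a x)) (sym ev)) (sym (π-mid i))))
                   (R-step j (subst R (sim-v i ev) (R-step i ri)))
  never-j : ∀ t → proj₁ (iterW t P (zero , false)) ≢ j
  never-j zero e = j≢0 (sym e)
  never-j (suc t) e = never-j t (Perm-inj₁ pb x (j , false) (Perm-inj₁ pw (app b x) (app b (j , false))
      (trans (Perm-inj₁ pa y (j , false) (trans (cong proj₁ (sym (trans (app-· a (w · b) x) (cong (app a) (app-· w b x)))))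
        (trans e (sym (cong proj₁ (fa false)))))) (sym (cong proj₁ mid-j)))))
    where
    x = iterW t P (zero , false)
    y = app w (app b x)
  reach : ∀ t → R (proj₁ (iterW t P (zero , false)))
  reach zero = 0 , refl
  reach (suc t) = sim _ (never-j t) (reach t)
  inD : ∀ i → i ∈ D → R i
  inD i m with tr i m
  ... | t , refl = reach t
  concl : ∀ i → i ∈ (j ∷ D) → R i
  concl i (there m) = inD i m
  -- The new vertex is the image under P' of the y that w · b sends over v. This y lies in `D`,
  -- since w · b fixes the vertices off `D` while v is in `D`.
  concl i (here refl) with surj (·-Perm pw pb) v
  ... | y , e with y ∈? D
  ... | no ny = ⊥-elim (ny (subst (_∈ D) (trans (sym e) (trans (sym (cong proj₁ (app-lookup (w · b) y))) (out y ny))) vD))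
  ... | yes yD = subst R (sim-v y (trans (cong proj₁ (trans (sym (app-· w b (y , false))) (app-lookup (w · b) y))) e)) (R-step y (inD y yD))

-- A partial exploration: the cycles st revealed so far, the vertices D met so far, and a tuple f realising them.
record LiveSt {n M} (st : Vec (List (Cycle (suc n))) M) (D : List (Fin (suc n))) (f : Vec (RawW (suc n)) M) : Set where
  field
    perms : ∀ c → Perm (lookup f c)
    parts : Parts f st
    fixes : ∀ c → Fixes (lookup f c) (lookup st c)
    zD : zero ∈ D
    ndD : Nodup D
    within : Within st D
    trans-on : ∀ i → i ∈ D → ∃ λ t → proj₁ (iterW t (prodV f) (zero , false)) ≡ i
    count : length D ≡ suc (total st)

open LiveSt

look-≔ : ∀ (f : Vec A M) c x c' → (c' ≡ c × lookup (f [ c ]≔ x) c' ≡ x) ⊎ (c' ≢ c × lookup (f [ c ]≔ x) c' ≡ lookup f c')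
look-≔ f c x c' with c' ≟F c
... | yes refl = inj₁ (refl , VP.lookup∘update c f x)
... | no ne = inj₂ (ne , VP.lookup∘update′ ne f x)

-- The realising factor fixes every vertex off its revealed cycles, so v already is a cycle of
-- length 1 and only the bookkeeping changes.
open-cycle : ∀ {st : Vec (List (Cycle (suc n))) M} {D f} → LiveSt st D f → ∀ c v → v ∈ D → v ∉ verts (lookup st c) →
  LiveSt (push c (v , [] , false) st) D f
open-cycle {st = st} {D} {f} L c v vD v∉ = record
  { perms = perms L
  ; parts = parts-push {f = f} {st} c z (parts L) (part (fixes L c v v∉ ∷ cyc (parts L c)) (nodup-cons v∉ (nd (parts L c))))
  ; fixes = fx ; zD = zD L ; ndD = ndD L
  ; within = within-push {st = st} {D} c v [] false (within L) vD (λ i ()) (λ i m → m)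
  ; trans-on = trans-on L ; count = trans (count L) (cong suc (sym (total-push c v [] false st))) }
  where
  z = (v , [] , false)
  fx : ∀ c' → Fixes (lookup f c') (lookup (push c z st) c')
  fx c' i m with c' ≟F c
  ... | yes refl = fixes L c i (λ q → m (subst (λ x → i ∈ verts x) (sym (push-same c z st)) (there q)))
  ... | no ne = fixes L c' i (λ q → m (subst (λ x → i ∈ verts x) (sym (push-other z st ne)) q))

-- The swap diverts the closing step from v to (j, s), and sends (j, s), which `w` fixes, on to v.
chain-snoc : ∀ (w : RawW n) v j s p us → v ≢ j → Chain w p us (v , false) → (∀ y → y ∈ us → proj₁ y ≢ v × proj₁ y ≢ j) →
  app w (j , false) ≡ (j , false) → Chain (swapW v j s · w) p (us ++ (j , s) ∷ []) (v , false)
chain-snoc w v j s p [] v≢j c h fj = trans (app-· (swapW v j s) w p) (trans (cong (app (swapW v j s)) c)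
    (trans (swap-i v j s false) (cong (j ,_) (BP.xor-identityʳ s)))) ,
  trans (app-· (swapW v j s) w (j , s)) (trans (cong (app (swapW v j s)) (fix-any w j fj s)) (trans (swap-j v j s s v≢j) (cong (v ,_) (xor-self s))))
chain-snoc w v j s p (y ∷ us) v≢j (c , cs) h fj = trans (app-· (swapW v j s) w p) (trans (cong (app (swapW v j s)) c)
    (swap-k v j s y (proj₁ (h y (here refl))) (proj₂ (h y (here refl))))) ,
  chain-snoc w v j s y us v≢j cs (λ z m → h z (there m)) fj

map-snoc : ∀ (us : List (Pt n)) u → map proj₁ (us ++ u ∷ []) ≡ map proj₁ us ++ proj₁ u ∷ []
map-snoc us u = LP.map-++ proj₁ us (u ∷ [])

-- A single reflection on the left inserts j just before the return to v. The flag stays false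
-- meanwhile: `close-B` adds the bar of a type B cycle at the very end, so one way of inserting is
-- enough.
extend : ∀ {st : Vec (List (Cycle (suc n))) M} {D f} c v us j s → LiveSt (push c (v , us , false) st) D f → v ∈ D → j ∉ D →
  ∃ λ f' → LiveSt (push c (v , us ++ (j , s) ∷ [] , false) st) (j ∷ D) f'
extend {n} {M} {st} {D} {f} c v us j s L vD j∉ = f' , record
  { perms = pm' ; parts = ps' ; fixes = fx' ; zD = there (zD L) ; ndD = nodup-cons j∉ (ndD L)
  ; within = wi' ; trans-on = tr' ; count = ct' }
  where
  z = (v , us , false)
  z' = (v , us ++ (j , s) ∷ [] , false)
  st₁ = push c z st
  st₂ = push c z' st
  w = lookup f c
  r = swapW v j s
  w' = r · w
  f' = f [ c ]≔ w'
  v≢j : v ≢ j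
  v≢j refl = j∉ vD
  rf : Refl r
  rf = swp v j s v≢j
  j∉c : ∀ c' → j ∉ verts (lookup st₁ c')
  j∉c c' m = j∉ (within L c' j m)
  fixj : ∀ c' → app (lookup f c') (j , false) ≡ (j , false)
  fixj c' = fixes L c' j (j∉c c')
  pt₁ : Part w (z ∷ lookup st c)
  pt₁ = subst (Part w) (push-same c z st) (parts L c)
  j∉₁ : j ∉ verts (z ∷ lookup st c)
  j∉₁ m = j∉c c (subst (λ x → j ∈ verts x) (sym (push-same c z st)) m)
  pm' : ∀ c' → Perm (lookup f' c')
  pm' c' with look-≔ f c w' c'
  ... | inj₁ (refl , e) = subst Perm (sym e) (·-Perm (Refl-Perm rf) (perms L c))
  ... | inj₂ (ne , e) = subst Perm (sym e) (perms L c')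
  mem : ∀ {i} → i ∈ verts (z' ∷ lookup st c) → i ≡ j ⊎ i ∈ verts (z ∷ lookup st c)
  mem {i} m with ∈-++⁻ (vs z') m
  ... | inj₂ y = inj₂ (∈-++⁺ʳ (vs z) y)
  ... | inj₁ (here e) = inj₂ (here e)
  ... | inj₁ (there x) with ∈-++⁻ (map proj₁ us) (subst (i ∈_) (map-snoc us (j , s)) x)
  ... | inj₁ a = inj₂ (there (∈-++⁺ˡ a))
  ... | inj₂ (here e) = inj₁ e
  memc : ∀ {i} → i ∈ verts (z ∷ lookup st c) → i ∈ verts (z' ∷ lookup st c)
  memc {i} m with ∈-++⁻ (vs z) m
  ... | inj₂ y = ∈-++⁺ʳ (vs z') y
  ... | inj₁ (here e) = here e
  ... | inj₁ (there x) = there (∈-++⁺ˡ (subst (i ∈_) (sym (map-snoc us (j , s))) (∈-++⁺ˡ x)))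
  memj : j ∈ verts (z' ∷ lookup st c)
  memj = there (∈-++⁺ˡ (subst (j ∈_) (sym (map-snoc us (j , s))) (∈-++⁺ʳ (map proj₁ us) (here refl))))
  occ-z' : ∀ i → occ i (verts (z' ∷ lookup st c)) ≡ ⟦ i ==F j ⟧ + occ i (verts (z ∷ lookup st c))
  occ-z' i = begin
    occ i (v ∷ map proj₁ (us ++ (j , s) ∷ []) ++ V) ≡⟨ cong (λ l → occ i (v ∷ l ++ V)) (map-snoc us (j , s)) ⟩
    a + occ i ((map proj₁ us ++ j ∷ []) ++ V) ≡⟨ cong (a +_) (trans (occ-++ i (map proj₁ us ++ j ∷ []) V) (cong (_+ occ i V) (occ-++ i (map proj₁ us) (j ∷ [])))) ⟩
    a + ((occ i (map proj₁ us) + (δⱼ + 0)) + occ i V) ≡⟨ cong (λ x → a + ((occ i (map proj₁ us) + x) + occ i V)) (+-identityʳ δⱼ) ⟩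
    a + ((occ i (map proj₁ us) + δⱼ) + occ i V) ≡⟨ cong (λ x → a + (x + occ i V)) (+-comm (occ i (map proj₁ us)) δⱼ) ⟩
    a + ((δⱼ + occ i (map proj₁ us)) + occ i V) ≡⟨ cong (a +_) (+-assoc δⱼ _ _) ⟩
    a + (δⱼ + (occ i (map proj₁ us) + occ i V)) ≡⟨ sym (+-assoc a δⱼ _) ⟩
    (a + δⱼ) + (occ i (map proj₁ us) + occ i V) ≡⟨ cong (_+ (occ i (map proj₁ us) + occ i V)) (+-comm a δⱼ) ⟩
    (δⱼ + a) + (occ i (map proj₁ us) + occ i V) ≡⟨ +-assoc δⱼ a _ ⟩
    δⱼ + (a + (occ i (map proj₁ us) + occ i V)) ≡⟨ cong (λ x → δⱼ + (a + x)) (sym (occ-++ i (map proj₁ us) V)) ⟩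
    δⱼ + occ i (v ∷ map proj₁ us ++ V) ∎
    where
    open ≡-Reasoning
    V = verts (lookup st c)
    a = ⟦ i ==F v ⟧
    δⱼ = ⟦ i ==F j ⟧
  nd₂ : Nodup (verts (z' ∷ lookup st c))
  nd₂ = nodup (λ i → ≤-trans (≤-reflexive (occ-z' i)) (at (nodup-cons j∉₁ (nd pt₁)) i))
  head-cyc : IsCyc w z
  head-cyc with cyc pt₁
  ... | q ∷ _ = q
  tail-cyc : All (IsCyc w) (lookup st c)
  tail-cyc with cyc pt₁
  ... | _ ∷ q = q
  pt₂ : Part w' (z' ∷ lookup st c)
  pt₂ = part (chain-snoc w v j s (v , false) us v≢j head-cyc
        (λ y m → (λ e → nodup-head (nd pt₁) (∈-++⁺ˡ (subst (_∈ map proj₁ us) e (∈-map⁺ proj₁ m)))) ,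
                 (λ e → j∉₁ (there (∈-++⁺ˡ (subst (_∈ map proj₁ us) e (∈-map⁺ proj₁ m)))))) (fixj c)
      ∷ cycs-left w r (lookup st c) tail-cyc (λ p m → swap-k v j s p
          (λ e → nodup-disj {xs = vs z} (nd pt₁) (here e) m) (λ e → j∉₁ (subst (_∈ verts (z ∷ lookup st c)) e (∈-++⁺ʳ (vs z) m))))) nd₂
  ps' : Parts f' st₂
  ps' c' with look-≔ f c w' c'
  ... | inj₁ (refl , e) = subst₂ Part (sym e) (sym (push-same c z' st)) pt₂
  ... | inj₂ (ne , e) = subst₂ Part (sym e) (trans (push-other z st ne) (sym (push-other z' st ne))) (parts L c')
  fx' : ∀ c' → Fixes (lookup f' c') (lookup st₂ c')
  fx' c' i m with look-≔ f c w' c'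
  ... | inj₂ (ne , e) = trans (cong (λ x → app x (i , false)) e)
        (fixes L c' i (λ q → m (subst (λ x → i ∈ verts x) (trans (push-other z st ne) (sym (push-other z' st ne))) q)))
  ... | inj₁ (refl , e) = trans (cong (λ x → app x (i , false)) e) (trans (app-· r w (i , false)) (trans (cong (app r) (fixes L c i
          (λ q → m' (memc (subst (λ x → i ∈ verts x) (push-same c z st) q)))))
        (swap-k v j s (i , false) (λ q → m' (here q)) (λ q → m' (subst (_∈ verts (z' ∷ lookup st c)) (sym q) memj)))))
    where
    m' : i ∉ verts (z' ∷ lookup st c)
    m' q = m (subst (λ x → i ∈ verts x) (sym (push-same c z' st)) q)
  wi' : Within st₂ (j ∷ D)
  wi' c' i m with c' ≟F c
  ... | no ne = there (within L c' i (subst (λ x → i ∈ verts x) (trans (push-other z' st ne) (sym (push-other z st ne))) m))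
  ... | yes refl with mem (subst (λ x → i ∈ verts x) (push-same c z' st) m)
  ... | inj₁ refl = here refl
  ... | inj₂ q = there (within L c i (subst (λ x → i ∈ verts x) (sym (push-same c z st)) q))
  j≢0 : j ≢ zero
  j≢0 refl = j∉ (zD L)
  out : ∀ i → i ∉ D → ∀ c' → app (lookup f c') (i , false) ≡ (i , false)
  out i m c' = fixes L c' i (λ q → m (within L c' i q))
  tr' : ∀ i → i ∈ (j ∷ D) → ∃ λ t → proj₁ (iterW t (prodV f') (zero , false)) ≡ i
  tr' with split-prod f c
  ... | a , b , e , fx , pm = insert-trans {P = prodV f} {prodV f'} {a} {b} {w} v j s v≢j (proj₁ (pm (perms L))) (proj₂ (pm (perms L))) (perms L c)
      (trans (cong prodV (sym (VP.[]≔-lookup f c))) (e w)) (e w')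
      (fix-any a j (proj₁ (fx j (λ c' _ → fixj c')))) (fix-any b j (proj₂ (fx j (λ c' _ → fixj c')))) (fix-any w j (fixj c))
      j≢0 D (λ i m → cong proj₁ (trans (app-· w b (i , false)) (trans (cong (app w) (proj₂ (fx i (λ c' _ → out i m c')))) (out i m c)))) vD (trans-on L)
  ct' : length (j ∷ D) ≡ suc (total st₂)
  ct' = cong suc (trans (count L) (trans (cong suc (total-push c v us false st)) (sym (trans (total-push c v (us ++ (j , s) ∷ []) false st)
     (cong (_+ total st) (trans (LP.length-++ us) (+-comm (length us) 1)))))))

-- A bar at v changes no unsigned image, hence none of the orbits that were reached.
close-B : ∀ {st : Vec (List (Cycle (suc n))) M} {D f} c v us → LiveSt (push c (v , us , false) st) D f →
  ∃ λ f' → LiveSt (push c (v , us , true) st) D f'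
close-B {n} {M} {st} {D} {f} c v us L = f' , record
  { perms = pm' ; parts = ps' ; fixes = fx' ; zD = zD L ; ndD = ndD L ; within = wi' ; trans-on = tr'
  ; count = trans (count L) (cong suc (trans (total-push c v us false st) (sym (total-push c v us true st)))) }
  where
  z = (v , us , false)
  z' = (v , us , true)
  w = lookup f c
  r = barW v
  w' = r · w
  f' = f [ c ]≔ w'
  pt₁ : Part w (z ∷ lookup st c)
  pt₁ = subst (Part w) (push-same c z st) (parts L c)
  pm' : ∀ c' → Perm (lookup f' c')
  pm' c' with look-≔ f c w' c'
  ... | inj₁ (refl , e) = subst Perm (sym e) (·-Perm (Refl-Perm (brr v)) (perms L c))
  ... | inj₂ (ne , e) = subst Perm (sym e) (perms L c')
  pt₂ : Part w' (z' ∷ lookup st c)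
  pt₂ with cyc pt₁
  ... | q ∷ qs = part (chain-left w r (v , false) us (v , false) (v , true) q
       (λ y m → bar-k v y (λ e → nodup-head (nd pt₁) (∈-++⁺ˡ (subst (_∈ map proj₁ us) e (∈-map⁺ proj₁ m))))) (bar-i v false)
       ∷ cycs-left w r (lookup st c) qs (λ p m → bar-k v p (λ e → nodup-disj {xs = vs z} (nd pt₁) (here e) m))) (nd pt₁)
  ps' : Parts f' (push c z' st)
  ps' c' with look-≔ f c w' c'
  ... | inj₁ (refl , e) = subst₂ Part (sym e) (sym (push-same c z' st)) pt₂
  ... | inj₂ (ne , e) = subst₂ Part (sym e) (trans (push-other z st ne) (sym (push-other z' st ne))) (parts L c')
  fx' : ∀ c' → Fixes (lookup f' c') (lookup (push c z' st) c')
  fx' c' i m with look-≔ f c w' c'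
  ... | inj₂ (ne , e) = trans (cong (λ x → app x (i , false)) e)
        (fixes L c' i (λ q → m (subst (λ x → i ∈ verts x) (trans (push-other z st ne) (sym (push-other z' st ne))) q)))
  ... | inj₁ (refl , e) = trans (cong (λ x → app x (i , false)) e) (trans (app-· r w (i , false)) (trans (cong (app r) (fixes L c i
          (λ q → m' (subst (λ x → i ∈ verts x) (push-same c z st) q))))
        (bar-k v (i , false) (λ q → m' (here q)))))
    where
    m' : i ∉ verts (z ∷ lookup st c)
    m' q = m (subst (λ x → i ∈ verts x) (sym (push-same c z' st)) q)
  wi' : Within (push c z' st) D
  wi' c' i m with c' ≟F c
  ... | no ne = within L c' i (subst (λ x → i ∈ verts x) (trans (push-other z' st ne) (sym (push-other z st ne))) m)
  ... | yes refl = within L c i (subst (λ x → i ∈ verts x) (sym (push-same c z st)) (subst (λ x → i ∈ verts x) (push-same c z' st) m))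
  tr' : ∀ i → i ∈ D → ∃ λ t → proj₁ (iterW t (prodV f') (zero , false)) ≡ i
  tr' i m with split-prod f c | trans-on L i m
  ... | a , b , e , _ | t , h = t , trans (same t) h
    where
    bar₁ : ∀ p → proj₁ (app r p) ≡ proj₁ p
    bar₁ p with proj₁ p ≟F v
    ... | yes q = trans (cong (λ x → proj₁ (app r (x , proj₂ p))) q) (trans (cong proj₁ (bar-i v (proj₂ p))) (sym q))
    ... | no ne = cong proj₁ (bar-k v p ne)
    eP : prodV f ≡ a · (w · b)
    eP = trans (cong prodV (sym (VP.[]≔-lookup f c))) (e w)
    one : ∀ p → proj₁ (app (prodV f') p) ≡ proj₁ (app (prodV f) p)
    one p = begin
      proj₁ (app (prodV f') p) ≡⟨ cong (λ x → proj₁ (app x p)) (e w') ⟩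
      proj₁ (app (a · (w' · b)) p) ≡⟨ cong proj₁ (trans (app-· a (w' · b) p) (cong (app a) (trans (app-· w' b p) (app-· r w (app b p))))) ⟩
      proj₁ (lookup a (proj₁ (app r (app w (app b p))))) ≡⟨ cong (λ x → proj₁ (lookup a x)) (bar₁ (app w (app b p))) ⟩
      proj₁ (app a (app w (app b p))) ≡⟨ sym (cong proj₁ (trans (app-· a (w · b) p) (cong (app a) (app-· w b p)))) ⟩
      proj₁ (app (a · (w · b)) p) ≡⟨ cong (λ x → proj₁ (app x p)) (sym eP) ⟩
      proj₁ (app (prodV f) p) ∎ where open ≡-Reasoning
    same : ∀ t → proj₁ (iterW t (prodV f') (zero , false)) ≡ proj₁ (iterW t (prodV f) (zero , false))
    same zero = refl
    same (suc t) = trans (one (iterW t (prodV f') (zero , false))) (cong (λ x → proj₁ (lookup (prodV f) x)) (same t))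

-- The list grows during the test, so that the new vertices are also compared with one another.
good : List (Fin n) → List (Pt n) → Bool
good D [] = true
good D (u ∷ us) = not ⌊ proj₁ u ∈? D ⌋ ∧ good (proj₁ u ∷ D) us

news : List (Pt n) → List (Fin n) → List (Fin n)
news [] D = D
news (u ∷ us) D = news us (proj₁ u ∷ D)

length-news' : ∀ (us : List (Pt n)) D → length (news us D) ≡ length us + length D
length-news' [] D = refl
length-news' (u ∷ us) D = trans (length-news' us (proj₁ u ∷ D)) (+-suc (length us) (length D))

not-∈ : ∀ {i : Fin n} {D} → not ⌊ i ∈? D ⌋ ≡ true → i ∉ D
not-∈ {i = i} {D} e m rewrite ⌊⌋-yes (i ∈? D) m = BP.not-¬ e refl

extend-all : ∀ {st : Vec (List (Cycle (suc n))) M} c v done us {D f} → LiveSt (push c (v , done , false) st) D f → v ∈ D →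
  good D us ≡ true → ∃ λ f' → LiveSt (push c (v , done ++ us , false) st) (news us D) f'
extend-all {st = st} c v done [] {D} {f} L vD g = f , subst (λ x → LiveSt (push c (v , x , false) st) D f) (sym (LP.++-identityʳ done)) L
extend-all {st = st} c v done (u ∷ us) {D} {f} L vD g with ∧-true {not ⌊ proj₁ u ∈? D ⌋} g
... | g₁ , g₂ with extend {st = st} c v done (proj₁ u) (proj₂ u) L vD (not-∈ g₁)
... | f₁ , L₁ with extend-all {st = st} c v (done ++ u ∷ []) us L₁ (there vD) g₂
... | f₂ , L₂ = f₂ , subst (λ x → LiveSt (push c (v , x , false) st) (news us (proj₁ u ∷ D)) f₂) (LP.++-assoc done (u ∷ []) us) L₂

extend-cycle : ∀ {st : Vec (List (Cycle (suc n))) M} {D f} → LiveSt st D f → ∀ c v us fl → v ∈ D → v ∉ verts (lookup st c) → good D us ≡ true →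
  ∃ λ f' → LiveSt (push c (v , us , fl) st) (news us D) f'
extend-cycle {st = st} L c v us false vD v∉ g = extend-all {st = st} c v [] us (open-cycle L c v vD v∉) vD g
extend-cycle {st = st} L c v us true vD v∉ g = close-B {st = st} c v us (proj₂ (extend-all {st = st} c v [] us (open-cycle L c v vD v∉) vD g))

-- A condition on one factor: p on signed permutations, equivalently a on the list of letters of the cycles.
-- It determines the number K of cycles and the number b of type B cycles.
record Spec (n : ℕ) : Set where
  field
    p : RawW n → Bool
    a : List Letter → Bool
    K m b : ℕ
    K+m : K + m ≡ n
    link : ∀ {w cs} → Perm w → Full w cs → p w ≡ a (letters cs)
    a-perm : ∀ {ls ls'} → ls ↭ ls' → a ls ≡ a ls'
    a-length : ∀ ls → a ls ≡ true → length ls ≡ K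
    a-size : ∀ ls → a ls ≡ true → size ls ≡ m
    a-nB : ∀ ls → a ls ≡ true → nB ls ≡ b

open Spec public

-- The exploration: words of letters and choices of new vertices

Words : ℕ → Set
Words M = Vec (List Letter) M

extW : Fin M → Letter → Words M → Words M
extW c ℓ ws = ws [ c ]%= (ℓ ∷_)

words : Vec (List (Cycle n)) M → Words M
words st = Vec.map letters st

words-push : ∀ c (z : Cycle n) (st : Vec (List (Cycle n)) M) → words (push c z st) ≡ extW c (letter z) (words st)
words-push zero z (x ∷ st) = refl
words-push (suc c) z (x ∷ st) = cong (letters x ∷_) (words-push c z st)

-- A letter (g, f) is opened at a vertex already met and meets g new ones; the `suc` is for the
-- vertex 1.
unmet : ℕ → Words M → ℕ
unmet n ws = n ∸ suc (sumF (λ c → size (lookup ws c)))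

-- The vertices off the revealed cycles of the factor c. This exceeds `unmet` exactly when some
-- vertex already met has no known cycle in this factor, so the words alone decide where to
-- continue.
free : ℕ → Words M → Fin M → ℕ
free n ws c = n ∸ (length (lookup ws c) + size (lookup ws c))

leafValue : ∀ {n M} → (Fin M → Spec n) → Words M → ℕ
leafValue {n} sp ws = if ⌊ unmet n ws Data.Nat.≟ 0 ⌋ then prodF (λ c → ⟦ a (sp c) (lookup ws c) ⟧) else 0

-- The number of ways to complete the words ws in an exploration: a factor c with a vertex that has been met
-- but whose cycle in this factor is still unknown receives its next letter.
mutual
  good# : ∀ {n M} → (Fin M → Spec n) → ℕ → Words M → ℕ
  good# sp zero ws = leafValue sp ws
  good# {n} sp (suc k) ws = good#-at sp k ws (any? (λ c → unmet n ws <? free n ws c))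

  good#-at : ∀ {n M} (sp : Fin M → Spec n) → ℕ → (ws : Words M) → Dec (∃ λ c → unmet n ws < free n ws c) → ℕ
  good#-at sp k ws (no _) = leafValue sp ws
  good#-at {n} sp k ws (yes (c , _)) = ∑ (upTo n) (λ g → ⟦ g ≤ᵇ unmet n ws ⟧ *
    (good# sp k (extW c (g , false) ws) + good# sp k (extW c (g , true) ws)))

-- This is 2^q q!, the number of ways to meet q further vertices in order and with signs.
labels : ℕ → ℕ
labels zero = 1
labels (suc q) = 2 * suc q * labels q

sequences : ℕ → ℕ → ℕ
sequences q zero = 1
sequences q (suc g) = 2 * q * sequences (q ∸ 1) g

-- Choosing g signed vertices and then all the others is choosing all of them. For g > q a factor 2
-- · 0 occurs on the left, and the indicator vanishes on the right.
sequences-labels : ∀ q g → sequences q g * labels (q ∸ g) ≡ ⟦ g ≤ᵇ q ⟧ * labels q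
sequences-labels q zero = refl
sequences-labels zero (suc g) = refl
sequences-labels (suc q) (suc g) = trans (*-assoc (2 * suc q) (sequences q g) _) (trans (cong (2 * suc q *_) (sequences-labels q g))
  (trans (sym (*-assoc (2 * suc q) ⟦ g ≤ᵇ q ⟧ (labels q))) (trans (cong (_* labels q) (*-comm (2 * suc q) ⟦ g ≤ᵇ q ⟧))
  (trans (*-assoc ⟦ g ≤ᵇ q ⟧ (2 * suc q) (labels q)) (cong (λ x → ⟦ x ⟧ * (2 * suc q * labels q)) (h g))))))
  where
  h : ∀ g → (g ≤ᵇ q) ≡ (suc g ≤ᵇ suc q)
  h zero = refl
  h (suc g) = refl

∑-allPts : ∀ n (F : Fin n → ℕ) → ∑ (allPts n) (λ u → F (proj₁ u)) ≡ 2 * sumF F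
∑-allPts n F = trans (∑-concatMap _ (allFin n) _) (trans (∑-cong (allFin n) (λ i → refl)) (trans (∑-*ˡ (allFin n) 2 F) (cong (2 *_) (∑-allFin {n} F))))

sum-not-∈ : ∀ {D : List (Fin n)} → Nodup D → sumF (λ i → ⟦ not ⌊ i ∈? D ⌋ ⟧) + length D ≡ n
sum-not-∈ {n} {D} nd = trans (cong (sumF (λ i → ⟦ not ⌊ i ∈? D ⌋ ⟧) +_) (length-occ D)) (trans (sym (sumF-+ (λ i → ⟦ not ⌊ i ∈? D ⌋ ⟧) (λ i → occ i D)))
  (trans (sumF-cong h) (trans (sumF-const {n} 1) (*-identityʳ n))))
  where
  h : ∀ i → ⟦ not ⌊ i ∈? D ⌋ ⟧ + occ i D ≡ 1
  h i with i ∈? D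
  ... | yes m = ≤-antisym (at nd i) (∈⇒occ m)
  ... | no m = cong suc (∉⇒occ m)

count-good : ∀ g (D : List (Fin n)) → Nodup D → ∑ (allLists g (allPts n)) (λ us → ⟦ good D us ⟧) ≡ sequences (n ∸ length D) g
count-good zero D nd = refl
count-good {n} (suc g) D nd = begin
  ∑ (allLists (suc g) (allPts n)) (λ us → ⟦ good D us ⟧) ≡⟨ ∑-allLists-suc g (allPts n) _ ⟩
  ∑ (allPts n) (λ u → ∑ (allLists g (allPts n)) (λ us → ⟦ not ⌊ proj₁ u ∈? D ⌋ ∧ good (proj₁ u ∷ D) us ⟧))
    ≡⟨ ∑-cong (allPts n) (λ u → trans (∑-cong (allLists g (allPts n)) (λ us → ⟦∧⟧ (not ⌊ proj₁ u ∈? D ⌋) _))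
         (trans (∑-*ˡ (allLists g (allPts n)) ⟦ not ⌊ proj₁ u ∈? D ⌋ ⟧ _)
           (⟦⟧*-cong (not ⌊ proj₁ u ∈? D ⌋) (λ e → trans (count-good g (proj₁ u ∷ D) (nodup-cons (not-∈ e) nd))
             (cong (λ x → sequences x g) (trans (cong (n ∸_) (+-comm 1 (length D))) (sym (∸-+-assoc n (length D) 1)))))))) ⟩
  ∑ (allPts n) (λ u → ⟦ not ⌊ proj₁ u ∈? D ⌋ ⟧ * sequences (n ∸ length D ∸ 1) g) ≡⟨ ∑-*ʳ (allPts n) _ _ ⟩
  ∑ (allPts n) (λ u → ⟦ not ⌊ proj₁ u ∈? D ⌋ ⟧) * sequences (n ∸ length D ∸ 1) g
    ≡⟨ cong (_* sequences (n ∸ length D ∸ 1) g) (trans (∑-allPts n (λ i → ⟦ not ⌊ i ∈? D ⌋ ⟧)) (cong (2 *_)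
        (trans (sym (m+n∸n≡m _ (length D))) (cong (_∸ length D) (sum-not-∈ nd))))) ⟩
  2 * (n ∸ length D) * sequences (n ∸ length D ∸ 1) g ∎
  where open ≡-Reasoning

∑-upTo-pick : ∀ n k (x : ℕ) → k < n → ∑ (upTo n) (λ g → ⟦ g ≡ᵇ k ⟧ * x) ≡ x
∑-upTo-pick n k x lt = go id n k lt (λ i → refl)
  where
  zeros : ∀ (h : ℕ → ℕ) n → (∀ i → ⟦ h i ≡ᵇ k ⟧ ≡ 0) → ∑ (applyUpTo h n) (λ g → ⟦ g ≡ᵇ k ⟧ * x) ≡ 0
  zeros h zero e = refl
  zeros h (suc n) e rewrite e 0 = zeros (h ∘ suc) n (e ∘ suc)
  go : ∀ (h : ℕ → ℕ) n j → j < n → (∀ i → ⟦ h i ≡ᵇ k ⟧ ≡ ⟦ i ≡ᵇ j ⟧) → ∑ (applyUpTo h n) (λ g → ⟦ g ≡ᵇ k ⟧ * x) ≡ x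
  go h (suc n) zero lt e rewrite e 0 = trans (cong (x + 0 +_) (zeros (h ∘ suc) n (e ∘ suc))) (trans (+-identityʳ _) (+-identityʳ x))
  go h (suc n) (suc j) (s≤s lt) e rewrite e 0 = go (h ∘ suc) n j lt (e ∘ suc)

∑-lists-pick : ∀ g (us₀ : List (Pt n)) (F : List (Pt n) → ℕ) → (∀ us → us ≢ us₀ → F us ≡ 0) →
  ∑ (allLists g (allPts n)) F ≡ ⟦ g ≡ᵇ length us₀ ⟧ * F us₀
∑-lists-pick zero [] F h = refl
∑-lists-pick zero (u ∷ us) F h = trans (+-identityʳ _) (h [] (λ ()))
∑-lists-pick {n} (suc g) [] F h = ∑-lists-zeroʳ
  where
  ∑-lists-zeroʳ : ∑ (allLists (suc g) (allPts n)) F ≡ 0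
  ∑-lists-zeroʳ = trans (∑-allLists-suc g (allPts n) F) (∑-zero (allPts n) (λ u → ∑-zero (allLists g (allPts n)) (λ us → h (u ∷ us) (λ ()))))
∑-lists-pick {n} (suc g) (u₀ ∷ us₀) F h = trans (∑-allLists-suc g (allPts n) F)
  (trans (∑-only _≟P_ (allPts n) (allPts-Enum n) u₀ (λ u → ∑ (allLists g (allPts n)) (λ us → F (u ∷ us)))
     (λ u ne → ∑-zero (allLists g (allPts n)) (λ us → h (u ∷ us) (ne ∘ LP.∷-injectiveˡ))))
   (∑-lists-pick g us₀ (λ us → F (u₀ ∷ us)) (λ us ne → h (u₀ ∷ us) (ne ∘ LP.∷-injectiveʳ))))

all-All : ∀ {P : A → Set} (P? : ∀ x → Dec (P x)) xs → all (λ x → ⌊ P? x ⌋) xs ≡ true → All P xs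
all-All P? [] e = []
all-All P? (x ∷ xs) e = ⌊⌋-true (P? x) (proj₁ (∧-true e)) ∷ all-All P? xs (proj₂ (∧-true {⌊ P? x ⌋} e))

All-all : ∀ {P : A → Set} (P? : ∀ x → Dec (P x)) {xs} → All P xs → all (λ x → ⌊ P? x ⌋) xs ≡ true
All-all P? [] = refl
All-all P? (x ∷ xs) = ∧-intro (⌊⌋-yes (P? _) x) (All-all P? xs)

nodup-subset-< : ∀ {xs ys : List (Fin n)} {i} → Nodup xs → (∀ j → j ∈ xs → j ∈ ys) → i ∈ ys → i ∉ xs → length xs < length ys
nodup-subset-< {n} {xs} {ys} {i} nd sub m nm = ≤-trans (≤-reflexive (cong suc (length-occ xs)))
  (≤-trans (strict (λ j → occ j xs) (λ j → occ j ys) i (λ j → le j) (≤-trans (s≤s (≤-reflexive (∉⇒occ nm))) (∈⇒occ m))) (≤-reflexive (sym (length-occ ys))))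
  where
  le : ∀ j → occ j xs ≤ occ j ys
  le j with j ∈? xs
  ... | yes q = ≤-trans (at nd j) (∈⇒occ (sub j q))
  ... | no q = ≤-trans (≤-reflexive (∉⇒occ q)) z≤n
  strict : ∀ {k} (f g : Fin k → ℕ) i → (∀ j → f j ≤ g j) → f i < g i → sumF f < sumF g
  strict f g zero l s = +-mono-<-≤ s (sumF-mono (l ∘ suc))
  strict f g (suc i) l s = +-mono-≤-< (l zero) (strict (f ∘ suc) (g ∘ suc) i (l ∘ suc) s)

good-intro : ∀ (us : List (Pt n)) D → Nodup (map proj₁ us) → (∀ i → i ∈ map proj₁ us → i ∉ D) → good D us ≡ true
good-intro [] D nd h = refl
good-intro (u ∷ us) D nd h = ∧-intro (cong not (⌊⌋-no (proj₁ u ∈? D) (h (proj₁ u) (here refl))))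
  (good-intro us (proj₁ u ∷ D) (nodup-++ʳ {xs = proj₁ u ∷ []} nd)
    (λ { i m (here refl) → nodup-head nd m ; i m (there q) → h i (there m) q }))

good-∉ : ∀ (us : List (Pt n)) D → good D us ≡ true → ∀ i → i ∈ map proj₁ us → i ∉ D
good-∉ (u ∷ us) D g i (here refl) = not-∈ (proj₁ (∧-true {not ⌊ proj₁ u ∈? D ⌋} g))
good-∉ (u ∷ us) D g i (there m) q = good-∉ us (proj₁ u ∷ D) (proj₂ (∧-true {not ⌊ proj₁ u ∈? D ⌋} g)) i m (there q)

length-verts : ∀ (cs : List (Cycle n)) → length (verts cs) ≡ length (letters cs) + size (letters cs)
length-verts [] = refl
length-verts (z@(v , us , f) ∷ cs) = trans (length-verts-cons z cs) (cong suc (trans (cong (length us +_) (length-verts cs))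
  (trans (sym (+-assoc (length us) (length (letters cs)) _)) (trans (cong (_+ size (letters cs)) (+-comm (length us) (length (letters cs)))) (+-assoc (length (letters cs)) (length us) _)))))

lookup-words : ∀ (st : Vec (List (Cycle n)) M) c → lookup (words st) c ≡ letters (lookup st c)
lookup-words st c = VP.lookup-map c letters st

∑-lists-length : ∀ g (xs : List A) (F : List A → ℕ → ℕ) → ∑ (allLists g xs) (λ us → F us (length us)) ≡ ∑ (allLists g xs) (λ us → F us g)
∑-lists-length zero xs F = refl
∑-lists-length (suc g) xs F = trans (∑-allLists-suc g xs _) (trans (∑-cong xs (λ x → ∑-lists-length g xs (λ us k → F (x ∷ us) (suc k)))) (sym (∑-allLists-suc g xs _)))

-- The shape of the product enters through two implications only: transitivity excludes repetitions
-- while exploring, and at the end transitivity and odd sign give the required cycle back.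
module Exploration {N M : ℕ} (sp : Fin M → Spec (suc N)) (Σb : sumF (λ c → b (sp c)) ≡ 1) (Σm : sumF (λ c → m (sp c)) ≡ N)
  (longB : RawW (suc N) → Bool) (long⇒ : ∀ {P} → longB P ≡ true → Transitive P)
  (long⇐ : ∀ {P} → Perm P → Transitive P → sgn P ≡ true → longB P ≡ true) where

  nn : ℕ
  nn = suc N

  St : Set
  St = Vec (List (Cycle nn)) M

  _≟T_ : DecidableEquality (Vec (RawW nn) M)
  _≟T_ = VP.≡-dec (_≟V_ {nn} {nn})

  tuples : List (Vec (RawW nn) M)
  tuples = allVecs M (allVecs nn (allPts nn))

  tuples-Enum : Enum _≟T_ tuples
  tuples-Enum = allVecs-Enum _≟V_ (allVecs nn (allPts nn)) (RawW-Enum nn) M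

  agreeB : St → Vec (RawW nn) M → Bool
  agreeB st f = all (λ c → all (λ z → ⌊ isCyc? (lookup f c) z ⌋) (lookup st c)) (allFin M)

  suppB : Vec (RawW nn) M → Bool
  suppB f = all (λ c → isSignedPerm (lookup f c) ∧ p (sp c) (lookup f c)) (allFin M) ∧ longB (prodV f)

  X : St → Vec (RawW nn) M → Bool
  X st f = agreeB st f ∧ suppB f

  cnt : St → ℕ
  cnt st = ∑ tuples (λ f → ⟦ X st f ⟧)

  agree⇒ : ∀ st f → agreeB st f ≡ true → ∀ c → All (IsCyc (lookup f c)) (lookup st c)
  agree⇒ st f e c = all-All (isCyc? (lookup f c)) (lookup st c) (all-fin _ e c)

  agree⇐ : ∀ st f → (∀ c → All (IsCyc (lookup f c)) (lookup st c)) → agreeB st f ≡ true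
  agree⇐ st f h = fin-all _ (λ c → All-all (isCyc? (lookup f c)) (h c))

  X-push : ∀ st f c z → X (push c z st) f ≡ ⌊ isCyc? (lookup f c) z ⌋ ∧ X st f
  X-push st f c z = trans (cong (_∧ suppB f) h) (BP.∧-assoc ⌊ isCyc? (lookup f c) z ⌋ (agreeB st f) (suppB f))
    where
    h : agreeB (push c z st) f ≡ ⌊ isCyc? (lookup f c) z ⌋ ∧ agreeB st f
    h = bool-⇔ to from
      where
      to : agreeB (push c z st) f ≡ true → ⌊ isCyc? (lookup f c) z ⌋ ∧ agreeB st f ≡ true
      to e = ∧-intro (⌊⌋-yes (isCyc? (lookup f c) z) (All.head q)) (agree⇐ st f rest)
        where
        q : All (IsCyc (lookup f c)) (z ∷ lookup st c)
        q = subst (All (IsCyc (lookup f c))) (push-same c z st) (agree⇒ (push c z st) f e c)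
        rest : ∀ c' → All (IsCyc (lookup f c')) (lookup st c')
        rest c' with c' ≟F c
        ... | yes refl = All.tail q
        ... | no ne = subst (All (IsCyc (lookup f c'))) (push-other z st ne) (agree⇒ (push c z st) f e c')
      from : ⌊ isCyc? (lookup f c) z ⌋ ∧ agreeB st f ≡ true → agreeB (push c z st) f ≡ true
      from e with ∧-true {⌊ isCyc? (lookup f c) z ⌋} e
      ... | e₁ , e₂ = agree⇐ (push c z st) f rest
        where
        rest : ∀ c' → All (IsCyc (lookup f c')) (lookup (push c z st) c')
        rest c' with c' ≟F c
        ... | yes refl = subst (All (IsCyc (lookup f c))) (sym (push-same c z st)) (⌊⌋-true (isCyc? (lookup f c) z) e₁ ∷ agree⇒ st f e₂ c)
        ... | no ne = subst (All (IsCyc (lookup f c'))) (sym (push-other z st ne)) (agree⇒ st f e₂ c')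

  record Supp (f : Vec (RawW nn) M) : Set where
    field
      sperm : ∀ c → Perm (lookup f c)
      spec : ∀ c → p (sp c) (lookup f c) ≡ true
      strans : Transitive (prodV f)

  supp⇒ : ∀ f → suppB f ≡ true → Supp f
  supp⇒ f e with ∧-true {all (λ c → isSignedPerm (lookup f c) ∧ p (sp c) (lookup f c)) (allFin M)} e
  ... | e₁ , e₂ = record
    { sperm = λ c → isSignedPerm⇒Perm (lookup f c) (proj₁ (∧-true {isSignedPerm (lookup f c)} (all-fin _ e₁ c)))
    ; spec = λ c → proj₂ (∧-true {isSignedPerm (lookup f c)} (all-fin _ e₁ c))
    ; strans = long⇒ e₂ }

  unmet-live : ∀ {st : St} {D : List (Fin nn)} {f : Vec (RawW nn) M} → LiveSt st D f → unmet nn (words st) ≡ nn ∸ length D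
  unmet-live {st} L = cong (nn ∸_) (trans (cong suc (sumF-cong (λ c → cong size (lookup-words st c)))) (sym (count L)))

  free-live : ∀ (st : St) (c : Fin M) → free nn (words st) c ≡ nn ∸ length (verts (lookup st c))
  free-live st c = cong (nn ∸_) (trans (cong₂ _+_ (cong length (lookup-words st c)) (cong size (lookup-words st c))) (sym (length-verts (lookup st c))))

  -- The cycle through v avoids the vertices already met, since the sizes add up to N only.
  fresh : ∀ {st : St} {D : List (Fin nn)} {f̂ : Vec (RawW nn) M} → LiveSt st D f̂ → ∀ f → X st f ≡ true → ∀ c v us fl → v ∈ D → Part (lookup f c) ((v , us , fl) ∷ lookup st c) → good D us ≡ true
  fresh {st} {D} L f e c v us fl vD pt = good-intro us D (nodup-++ˡ {ys = verts (lookup st c)} (nodup-++ʳ {xs = v ∷ []} (nd pt))) (λ i m q → clash i m q)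
    where
    agr : ∀ c → All (IsCyc (lookup f c)) (lookup st c)
    agr = agree⇒ st f (proj₁ (∧-true {agreeB st f} e))
    S : Supp f
    S = supp⇒ f (proj₂ (∧-true {agreeB st f} e))
    open Supp S
    ps : Parts f st
    ps c' = part (agr c') (nd (parts L c'))
    clash : ∀ i → i ∈ map proj₁ us → i ∈ D → ⊥
    clash i m q with ∈-∃++ m
    ... | as , bs , eq = 1+n≰n (+-cancelˡ-≤ (length D″) (suc N) N (≤-trans (≤-reflexive (cong (_+ suc N) (sym (trans (total-push c v us fl st) lens))))
        (≤-trans bound (≤-reflexive (trans (cong (_+ length D″) sizes) (+-comm N (length D″)))))))
      where
      -- One copy of the repeated vertex is left out. `D″` still contains every vertex met, but its
      -- length is the total size of the revealed cycles, one less than `bound` allows when all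
      -- sizes add up to N.
      D″ = (as ++ bs) ++ D
      st' = push c (v , us , fl) st
      inc : ∀ j → j ∈ map proj₁ us → j ∈ D″
      inc j mj with ∈-++⁻ as (subst (j ∈_) eq mj)
      ... | inj₁ x = ∈-++⁺ˡ (∈-++⁺ˡ x)
      ... | inj₂ (here refl) = ∈-++⁺ʳ (as ++ bs) q
      ... | inj₂ (there x) = ∈-++⁺ˡ (∈-++⁺ʳ as x)
      C : Completion f st' D″
      C = ext f sperm strans _ st' D″ (parts-push {f = f} {st} c (v , us , fl) ps pt) (∈-++⁺ʳ (as ++ bs) (zD L))
            (within-push {st = st} {D} c v us fl (within L) (∈-++⁺ʳ (as ++ bs) vD) inc (λ j mj → ∈-++⁺ʳ (as ++ bs) mj)) ≤-refl
      open Completion C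
      sizes : sumF (λ c → size (letters (cs c))) ≡ N
      sizes = trans (sumF-cong (λ c → a-size (sp c) _ (trans (sym (link (sp c) (sperm c) (fulls c))) (spec c)))) Σm
      lens : length us + total st ≡ length D″
      lens = sym (suc-injective (begin
        suc (length ((as ++ bs) ++ D)) ≡⟨ cong suc (LP.length-++ (as ++ bs)) ⟩
        suc (length (as ++ bs)) + length D ≡⟨ cong (_+ length D) (trans (cong suc (LP.length-++ as)) (sym (+-suc (length as) (length bs)))) ⟩
        length as + length (i ∷ bs) + length D ≡⟨ cong (_+ length D) (trans (sym (LP.length-++ as)) (trans (cong length (sym eq)) (LP.length-map proj₁ us))) ⟩
        length us + length D ≡⟨ cong (length us +_) (count L) ⟩
        length us + suc (total st) ≡⟨ +-suc (length us) (total st) ⟩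
        suc (length us + total st) ∎))
        where open ≡-Reasoning

  flag-sum : ∀ (F : Bool → ℕ) fl → F (not fl) ≡ 0 → F fl ≡ 1 → F false + F true ≡ 1
  flag-sum F true e₀ e₁ = cong₂ _+_ e₀ e₁
  flag-sum F false e₀ e₁ = cong₂ _+_ e₁ e₀

  ends : St → Fin M → Fin nn → List (Fin nn) → Vec (RawW nn) M → List (Pt nn) → ℕ
  ends st c v D f us = ⟦ good D us ⟧ * (⟦ X (push c (v , us , false) st) f ⟧ + ⟦ X (push c (v , us , true) st) f ⟧)

  -- An admissible tuple has exactly one cycle through v in the factor c, and by `fresh` its further
  -- vertices are new; so exactly one term on the right is 1.
  one-cycle : ∀ {st : St} {D : List (Fin nn)} {f̂ : Vec (RawW nn) M} → LiveSt st D f̂ → ∀ f c v → v ∈ D → v ∉ verts (lookup st c) →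
    ⟦ X st f ⟧ ≡ ∑ (upTo nn) (λ g → ∑ (allLists g (allPts nn)) (ends st c v D f))
  one-cycle {st} {D} {f̂} L f c v vD v∉ = by (X st f) refl
    where
    push-false : X st f ≡ false → ∀ z → X (push c z st) f ≡ false
    push-false e z = trans (X-push st f c z) (trans (cong (⌊ isCyc? (lookup f c) z ⌋ ∧_) e) (BP.∧-zeroʳ _))
    by : ∀ x → X st f ≡ x → ⟦ X st f ⟧ ≡ ∑ (upTo nn) (λ g → ∑ (allLists g (allPts nn)) (ends st c v D f))
    by false e = trans (cong ⟦_⟧ e) (sym (∑-zero (upTo nn) (λ g → ∑-zero (allLists g (allPts nn)) (λ us →
       trans (cong (⟦ good D us ⟧ *_) (cong₂ (λ x y → ⟦ x ⟧ + ⟦ y ⟧) (push-false e (v , us , false)) (push-false e (v , us , true)))) (*-zeroʳ ⟦ good D us ⟧)))))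
    by true e = found (follow (Supp.sperm S c) (lookup st c) (part (agr c) (nd (parts L c))) v v∉)
      where
      S : Supp f
      S = supp⇒ f (proj₂ (∧-true {agreeB st f} e))
      agr : ∀ c → All (IsCyc (lookup f c)) (lookup st c)
      agr = agree⇒ st f (proj₁ (∧-true {agreeB st f} e))
      found : (∃₂ λ us fl → Part (lookup f c) ((v , us , fl) ∷ lookup st c)) →
        ⟦ X st f ⟧ ≡ ∑ (upTo nn) (λ g → ∑ (allLists g (allPts nn)) (ends st c v D f))
      found (us₀ , fl₀ , pt) = sym (begin
        ∑ (upTo nn) (λ g → ∑ (allLists g (allPts nn)) (ends st c v D f)) ≡⟨ ∑-cong (upTo nn) (λ g → ∑-lists-pick g us₀ (ends st c v D f) other) ⟩
        ∑ (upTo nn) (λ g → ⟦ g ≡ᵇ length us₀ ⟧ * ends st c v D f us₀) ≡⟨ ∑-upTo-pick nn (length us₀) _ (cycle-size (v , us₀ , fl₀) (nodup-++ˡ {ys = verts (lookup st c)} (nd pt))) ⟩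
        ends st c v D f us₀ ≡⟨ cong₂ (λ x y → ⟦ x ⟧ * y) gd (flag-sum (λ fl → ⟦ X (push c (v , us₀ , fl) st) f ⟧) fl₀ f₀ f₁) ⟩
        1 ≡⟨ cong ⟦_⟧ (sym e) ⟩
        ⟦ X st f ⟧ ∎)
        where
        open ≡-Reasoning
        gd : good D us₀ ≡ true
        gd = fresh L f e c v us₀ fl₀ vD pt
        ic₀ : IsCyc (lookup f c) (v , us₀ , fl₀)
        ic₀ = All.head (cyc pt)
        v∉₀ : v ∉ map proj₁ us₀
        v∉₀ q = good-∉ us₀ D gd v q vD
        f₁ : ⟦ X (push c (v , us₀ , fl₀) st) f ⟧ ≡ 1
        f₁ = cong ⟦_⟧ (trans (X-push st f c _) (∧-intro (⌊⌋-yes (isCyc? (lookup f c) (v , us₀ , fl₀)) ic₀) e))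
        uniq : ∀ us fl → good D us ≡ true → X (push c (v , us , fl) st) f ≡ true → us ≡ us₀ × fl ≡ fl₀
        uniq us fl g x = chain-unique (lookup f c) v (v , false) us us₀ fl fl₀ (λ q → good-∉ us D g v q vD) v∉₀
          (⌊⌋-true (isCyc? (lookup f c) (v , us , fl)) (proj₁ (∧-true {⌊ isCyc? (lookup f c) (v , us , fl) ⌋} (trans (sym (X-push st f c _)) x)))) ic₀
        f₀ : ⟦ X (push c (v , us₀ , not fl₀) st) f ⟧ ≡ 0
        f₀ = cong ⟦_⟧ (not-true (λ x → BP.not-¬ {not fl₀} {fl₀} (proj₂ (uniq us₀ (not fl₀) gd x)) refl))
        other : ∀ us → us ≢ us₀ → ends st c v D f us ≡ 0
        other us ne = trans (⟦⟧*-cong (good D us) (λ g → cong₂ (λ x y → ⟦ x ⟧ + ⟦ y ⟧)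
            (not-true (λ x → ne (proj₁ (uniq us false g x)))) (not-true (λ x → ne (proj₁ (uniq us true g x)))))) (*-zeroʳ ⟦ good D us ⟧)

  cnt-step : ∀ {st : St} {D : List (Fin nn)} {f̂ : Vec (RawW nn) M} → LiveSt st D f̂ → ∀ c v → v ∈ D → v ∉ verts (lookup st c) →
    cnt st ≡ ∑ (upTo nn) (λ g → ∑ (allLists g (allPts nn)) (λ us → ⟦ good D us ⟧ * (cnt (push c (v , us , false) st) + cnt (push c (v , us , true) st))))
  cnt-step {st} {D} L c v vD v∉ = begin
    ∑ tuples (λ f → ⟦ X st f ⟧) ≡⟨ ∑-cong tuples (λ f → one-cycle L f c v vD v∉) ⟩
    ∑ tuples (λ f → ∑ (upTo nn) (λ g → ∑ (allLists g (allPts nn)) (ends st c v D f))) ≡⟨ ∑-swap tuples (upTo nn) _ ⟩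
    ∑ (upTo nn) (λ g → ∑ tuples (λ f → ∑ (allLists g (allPts nn)) (ends st c v D f)))
      ≡⟨ ∑-cong (upTo nn) (λ g → trans (∑-swap tuples (allLists g (allPts nn)) _) (∑-cong (allLists g (allPts nn)) (λ us →
          trans (∑-*ˡ tuples ⟦ good D us ⟧ _) (cong (⟦ good D us ⟧ *_) (∑-+ tuples _ _))))) ⟩
    ∑ (upTo nn) (λ g → ∑ (allLists g (allPts nn)) (λ us → ⟦ good D us ⟧ * (cnt (push c (v , us , false) st) + cnt (push c (v , us , true) st)))) ∎
    where open ≡-Reasoning

  -- Every vertex met now lies on a revealed cycle of every factor, so `D` is closed under all of
  -- them. If a vertex is still unmet, transitivity rules out any tuple; otherwise the cycles
  -- determine the tuple, which must be the realisation `f̂`.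
  stopped : ∀ {st : St} {D : List (Fin nn)} {f̂ : Vec (RawW nn) M} → LiveSt st D f̂ → (∀ c → free nn (words st) c ≤ unmet nn (words st)) →
    cnt st ≡ labels (unmet nn (words st)) * leafValue sp (words st)
  stopped {st} {D} {f̂} L h = by (unmet nn (words st)) refl
    where
    le : ∀ c → nn ∸ length (verts (lookup st c)) ≤ nn ∸ length D
    le c = subst₂ _≤_ (free-live st c) (unmet-live L) (h c)
    covered : ∀ c i → i ∈ D → i ∈ verts (lookup st c)
    covered c i iD = decidable-stable (i ∈? verts (lookup st c)) (λ ne → <⇒≱
      (∸-monoʳ-< (nodup-subset-< (nd (parts L c)) (within L c) iD ne) (nodup-length (ndD L))) (le c))
    by : ∀ q → unmet nn (words st) ≡ q → cnt st ≡ labels (unmet nn (words st)) * leafValue sp (words st)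
    by (suc q) e = trans (∑-zero tuples none) (sym (trans (cong (labels (unmet nn (words st)) *_) lv0) (*-zeroʳ (labels (unmet nn (words st))))))
      where
      lv0 : leafValue sp (words st) ≡ 0
      lv0 rewrite e = refl
      none : ∀ f → ⟦ X st f ⟧ ≡ 0
      none f = cong ⟦_⟧ (not-true (λ x → n≮0 (≤-trans (≤-reflexive (sym e)) (≤-trans (≤-reflexive (unmet-live L))
        (≤-reflexive (m≤n⇒m∸n≡0 (length-all D (closed-all f st D (λ c → part (agree⇒ st f (proj₁ (∧-true {agreeB st f} x)) c) (nd (parts L c)))
          (Supp.strans (supp⇒ f (proj₂ (∧-true {agreeB st f} x)))) (zD L) (within L) covered))))))))
    by zero e = begin
      cnt st ≡⟨ ∑-only _≟T_ tuples tuples-Enum f̂ (λ f → ⟦ X st f ⟧) (λ f ne → cong ⟦_⟧ (not-true (λ x → ne (same f (agree⇒ st f (proj₁ (∧-true {agreeB st f} x))))))) ⟩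
      ⟦ X st f̂ ⟧ ≡⟨ cong (λ x → ⟦ x ∧ suppB f̂ ⟧) (agree⇐ st f̂ (λ c → cyc (parts L c))) ⟩
      ⟦ suppB f̂ ⟧ ≡⟨ value (all (λ c → isSignedPerm (lookup f̂ c) ∧ p (sp c) (lookup f̂ c)) (allFin M)) refl ⟩
      prodF (λ c → ⟦ a (sp c) (lookup (words st) c) ⟧) ≡⟨ sym lv ⟩
      leafValue sp (words st) ≡⟨ sym (*-identityˡ _) ⟩
      1 * leafValue sp (words st) ≡⟨ cong (λ x → labels x * leafValue sp (words st)) (sym e) ⟩
      labels (unmet nn (words st)) * leafValue sp (words st) ∎
      where
      open ≡-Reasoning
      lv : leafValue sp (words st) ≡ prodF (λ c → ⟦ a (sp c) (lookup (words st) c) ⟧)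
      lv rewrite e = refl
      allD : ∀ i → i ∈ D
      allD i = occ⇒∈ (≤-reflexive (sym (nodup-full D (ndD L) (m∸n≡0⇒m≤n (trans (sym (unmet-live L)) e)) i)))
      allV : ∀ c i → i ∈ verts (lookup st c)
      allV c i = covered c i (allD i)
      fulls : ∀ c → Full (lookup f̂ c) (lookup st c)
      fulls c = full (cyc (parts L c)) (λ i → ≤-antisym (at (nd (parts L c)) i) (∈⇒occ (allV c i)))
      same : ∀ f → (∀ c → All (IsCyc (lookup f c)) (lookup st c)) → f ≡ f̂
      same f ag = vec-ext (λ c → full-unique (lookup f c) (lookup f̂ c) (lookup st c) (ag c) (cyc (parts L c)) (allV c))
      pa : ∀ c → p (sp c) (lookup f̂ c) ≡ a (sp c) (lookup (words st) c)
      pa c = trans (link (sp c) (perms L c) (fulls c)) (cong (a (sp c)) (sym (lookup-words st c)))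
      value : ∀ x → all (λ c → isSignedPerm (lookup f̂ c) ∧ p (sp c) (lookup f̂ c)) (allFin M) ≡ x →
        ⟦ suppB f̂ ⟧ ≡ prodF (λ c → ⟦ a (sp c) (lookup (words st) c) ⟧)
      value true ev = trans (cong₂ (λ x y → ⟦ x ∧ y ⟧) ev lng) (sym (trans (prodF-cong (λ c → cong ⟦_⟧ (acc c))) (trans (prodF-const {M} 1) (^-zeroˡ M))))
        where
        acc : ∀ c → a (sp c) (lookup (words st) c) ≡ true
        acc c = trans (sym (pa c)) (proj₂ (∧-true {isSignedPerm (lookup f̂ c)} (all-fin _ ev c)))
        lng : longB (prodV f̂) ≡ true
        lng = long⇐ (prod-Perm f̂ (perms L)) (λ j → trans-on L j (allD j))
          (trans (sgn-prod f̂ (λ c → b (sp c)) (perms L) (λ c → trans (sgn-full (fulls c)) (cong odd (trans (cong nB (sym (lookup-words st c))) (a-nB (sp c) _ (acc c))))))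
            (cong odd Σb))
      value false ev = trans (cong (λ x → ⟦ x ∧ longB (prodV f̂) ⟧) ev) (sym (zero-prod (λ c → a (sp c) (lookup (words st) c)) (λ acc →
          BP.not-¬ (trans (sym ev) (fin-all _ (λ c → ∧-intro (Perm⇒isSignedPerm (lookup f̂ c) (perms L c)) (trans (pa c) (acc c))))) refl)))
        where
        zero-prod : ∀ {k} (g : Fin k → Bool) → ¬ (∀ c → g c ≡ true) → prodF (λ c → ⟦ g c ⟧) ≡ 0
        zero-prod {zero} g ne = ⊥-elim (ne (λ ()))
        zero-prod {suc k} g ne with g zero in eq
        ... | false = refl
        ... | true = trans (+-identityʳ _) (zero-prod (g ∘ suc) (λ h → ne (λ { zero → eq ; (suc c) → h c })))

  -- A letter of size g comes with `sequences q g` choices of vertices and leaves `labels (q ∸ g)`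
  -- for the rest. The product is `labels q` for every g, so the vertex labels factor out and a
  -- recursion on words remains.
  explore : ∀ k {st : St} {D : List (Fin nn)} {f̂ : Vec (RawW nn) M} → LiveSt st D f̂ → unrevealed st ≤ k → cnt st ≡ labels (unmet nn (words st)) * good# sp k (words st)

  explore-at : ∀ k {st : St} {D : List (Fin nn)} {f̂ : Vec (RawW nn) M} → LiveSt st D f̂ → unrevealed st ≤ suc k → (d : Dec (∃ λ c → unmet nn (words st) < free nn (words st) c)) →
    cnt st ≡ labels (unmet nn (words st)) * good#-at sp k (words st) d

  explore zero {st} L le = stopped L (λ c → ≤-trans (≤-reflexive (free-live st c)) (≤-trans (sumF-single (λ c → nn ∸ length (verts (lookup st c))) c) (≤-trans le z≤n)))
  explore (suc k) {st} L le = explore-at k L le (any? (λ c → unmet nn (words st) <? free nn (words st) c))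

  explore-at k {st} L le (no ¬p) = stopped L (λ c → ≮⇒≥ (λ lt → ¬p (c , lt)))
  explore-at k {st} {D} {f̂} L le (yes (c , lt)) = from (any? (λ i → occ i (verts (lookup st c)) <? occ i D))
    where
    q = unmet nn (words st)
    ws = words st
    from : Dec (∃ λ i → occ i (verts (lookup st c)) < occ i D) → cnt st ≡ labels q * good#-at sp k ws (yes (c , lt))
    from (no ¬p) = ⊥-elim (<⇒≱ (subst₂ _<_ (unmet-live L) (free-live st c) lt) (∸-monoʳ-≤ nn (≤-trans (≤-reflexive (length-occ D))
      (≤-trans (sumF-mono (λ i → ≮⇒≥ (λ l → ¬p (i , l)))) (≤-reflexive (sym (length-occ (verts (lookup st c)))))))))
    from (yes (v , ol)) = begin
      cnt st ≡⟨ cnt-step L c v vD v∉ ⟩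
      ∑ (upTo nn) (λ g → ∑ (allLists g (allPts nn)) (λ us → ⟦ good D us ⟧ * (cnt (push c (v , us , false) st) + cnt (push c (v , us , true) st))))
        ≡⟨ ∑-cong (upTo nn) (λ g → trans (lists-length g) (trans (∑-*ʳ (allLists g (allPts nn)) (labels (q ∸ g) * Y g) _)
            (trans (cong (_* (labels (q ∸ g) * Y g)) (trans (count-good g D (ndD L)) (cong (λ x → sequences x g) (sym (unmet-live L)))))
              (trans (sym (*-assoc (sequences q g) (labels (q ∸ g)) (Y g))) (trans (cong (_* Y g) (sequences-labels q g))
                (trans (cong (_* Y g) (*-comm ⟦ g ≤ᵇ q ⟧ (labels q))) (*-assoc (labels q) ⟦ g ≤ᵇ q ⟧ (Y g)))))))) ⟩
      ∑ (upTo nn) (λ g → labels q * (⟦ g ≤ᵇ q ⟧ * Y g)) ≡⟨ ∑-*ˡ (upTo nn) (labels q) _ ⟩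
      labels q * ∑ (upTo nn) (λ g → ⟦ g ≤ᵇ q ⟧ * Y g) ∎
      where
      open ≡-Reasoning
      vD : v ∈ D
      vD = occ⇒∈ (≤-trans (s≤s z≤n) ol)
      v∉ : v ∉ verts (lookup st c)
      v∉ m = <⇒≱ ol (≤-trans (at (ndD L) v) (∈⇒occ m))
      Y : ℕ → ℕ
      Y g = good# sp k (extW c (g , false) ws) + good# sp k (extW c (g , true) ws)
      one : ∀ us fl → good D us ≡ true → cnt (push c (v , us , fl) st) ≡ labels (q ∸ length us) * good# sp k (extW c (length us , fl) ws)
      one us fl g with extend-cycle L c v us fl vD v∉ g
      ... | f' , L' = trans (explore k L' (s≤s⁻¹ (≤-trans (unrevealed-push c (v , us , fl) st (subst (λ x → Nodup (verts x)) (push-same c _ st) (nd (parts L' c)))) le)))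
           (cong₂ (λ x y → labels x * good# sp k y) (trans (unmet-live L') (trans (cong (nn ∸_) (trans (length-news' us D) (+-comm (length us) (length D))))
             (trans (sym (∸-+-assoc nn (length D) (length us))) (cong (_∸ length us) (sym (unmet-live L))))))
             (words-push c (v , us , fl) st))
      term : ∀ us → ⟦ good D us ⟧ * (cnt (push c (v , us , false) st) + cnt (push c (v , us , true) st)) ≡ ⟦ good D us ⟧ * (labels (q ∸ length us) * Y (length us))
      term us = ⟦⟧*-cong (good D us) (λ g → trans (cong₂ _+_ (one us false g) (one us true g)) (sym (*-distribˡ-+ (labels (q ∸ length us)) _ _)))
      lists-length : ∀ g → ∑ (allLists g (allPts nn)) (λ us → ⟦ good D us ⟧ * (cnt (push c (v , us , false) st) + cnt (push c (v , us , true) st)))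
        ≡ ∑ (allLists g (allPts nn)) (λ us → ⟦ good D us ⟧ * (labels (q ∸ g) * Y g))
      lists-length g = trans (∑-cong (allLists g (allPts nn)) term) (∑-lists-length g (allPts nn) (λ us k → ⟦ good D us ⟧ * (labels (q ∸ k) * Y k)))

-- Counting the words for which the exploration meets everything

alphabet : ℕ → List Letter
alphabet n = concatMap (λ g → (g , false) ∷ (g , true) ∷ []) (upTo n)

∑-alphabet : ∀ n (F : Letter → ℕ) → ∑ (alphabet n) F ≡ ∑ (upTo n) (λ g → F (g , false) + F (g , true))
∑-alphabet n F = trans (∑-concatMap _ (upTo n) F) (∑-cong (upTo n) (λ g → cong (F (g , false) +_) (+-identityʳ _)))

∑-≡0⇒ : ∀ (xs : List A) (f : A → ℕ) → ∑ xs f ≡ 0 → ∀ {x} → x ∈ xs → f x ≡ 0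
∑-≡0⇒ (x ∷ xs) f e (here refl) = m+n≡0⇒m≡0 (f x) e
∑-≡0⇒ (x ∷ xs) f e (there m) = ∑-≡0⇒ xs f (m+n≡0⇒n≡0 (f x) e) m

size-++ : ∀ (v ls : List Letter) → size (v ++ ls) ≡ size v + size ls
size-++ v ls = ∑-++ v ls proj₁

-- Permutation invariance spreads the sizes evenly over the letters, so the first letter carries the mean.
module _ (As : List Letter) where

  sizeSum : ℕ → (List Letter → ℕ) → ℕ
  sizeSum k h = ∑ (allLists k As) (λ v → size v * h v)

  firstSum : ℕ → (List Letter → ℕ) → ℕ
  firstSum k h = ∑ As (λ ℓ → proj₁ ℓ * ∑ (allLists k As) (λ v → h (ℓ ∷ v)))

  mean : ∀ k (h : List Letter → ℕ) → (∀ {u v} → u ↭ v → h u ≡ h v) → sizeSum (suc k) h ≡ suc k * firstSum k h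
  mean k h inv = begin
    sizeSum (suc k) h ≡⟨ ∑-allLists-suc k As _ ⟩
    ∑ As (λ x → ∑ (allLists k As) (λ v → (proj₁ x + size v) * h (x ∷ v)))
      ≡⟨ ∑-cong As (λ x → trans (∑-cong (allLists k As) (λ v → *-distribʳ-+ (h (x ∷ v)) (proj₁ x) (size v)))
          (trans (∑-+ (allLists k As) _ _) (cong (_+ sizeSum k (λ v → h (x ∷ v))) (∑-*ˡ (allLists k As) (proj₁ x) _)))) ⟩
    ∑ As (λ x → proj₁ x * ∑ (allLists k As) (λ v → h (x ∷ v)) + sizeSum k (λ v → h (x ∷ v))) ≡⟨ ∑-+ As _ _ ⟩
    firstSum k h + ∑ As (λ x → sizeSum k (λ v → h (x ∷ v))) ≡⟨ cong (firstSum k h +_) (rest k) ⟩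
    firstSum k h + k * firstSum k h ∎
    where
    open ≡-Reasoning
    rest : ∀ k → ∑ As (λ x → sizeSum k (λ v → h (x ∷ v))) ≡ k * firstSum k h
    rest zero = ∑-zero As (λ x → refl)
    rest (suc k) = begin
      ∑ As (λ x → sizeSum (suc k) (λ v → h (x ∷ v))) ≡⟨ ∑-cong As (λ x → mean k (λ v → h (x ∷ v)) (λ p → inv (↭-prep x p))) ⟩
      ∑ As (λ x → suc k * firstSum k (λ v → h (x ∷ v))) ≡⟨ ∑-*ˡ As (suc k) _ ⟩
      suc k * ∑ As (λ x → ∑ As (λ y → proj₁ y * ∑ (allLists k As) (λ v → h (x ∷ y ∷ v)))) ≡⟨ cong (suc k *_) (trans (∑-swap As As _)
         (∑-cong As (λ y → trans (∑-*ˡ As (proj₁ y) _) (cong (proj₁ y *_) (trans (∑-cong As (λ x → ∑-cong (allLists k As) (λ v → inv (↭-swap x y ↭-refl))))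
            (sym (∑-allLists-suc k As (λ v → h (y ∷ v))))))))) ⟩
      suc k * firstSum (suc k) h ∎

-- The number of ways to complete the word `ls`; as in `push`, later letters stand further in front,
-- which `a-perm` makes immaterial.
weight : Spec n → List Letter → ℕ
weight {n} s ls = ∑ (allLists (K s ∸ length ls) (alphabet n)) (λ v → ⟦ a s (v ++ ls) ⟧)

module _ (s : Spec n) where

  weight-leaf : ∀ ls → K s ≤ length ls → weight s ls ≡ ⟦ a s ls ⟧
  weight-leaf ls le rewrite m≤n⇒m∸n≡0 le = +-identityʳ _

  weight-step : ∀ ls → length ls < K s → weight s ls ≡ ∑ (alphabet n) (λ ℓ → weight s (ℓ ∷ ls))
  weight-step ls lt = trans (cong (λ k → ∑ (allLists k (alphabet n)) (λ v → ⟦ a s (v ++ ls) ⟧)) (+-∸-assoc 1 lt))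
    (trans (∑-allLists-suc (K s ∸ suc (length ls)) (alphabet n) _) (∑-cong (alphabet n) (λ ℓ → ∑-cong (allLists (K s ∸ suc (length ls)) (alphabet n))
      (λ v → cong ⟦_⟧ (a-perm s (↭-sym (↭-shift ℓ v ls)))))))

  weight-ext : ∀ ls → weight s ls ≢ 0 → ∃ λ v → a s (v ++ ls) ≡ true
  weight-ext ls ne with ∑-pos (allLists (K s ∸ length ls) (alphabet n)) (λ v → ⟦ a s (v ++ ls) ⟧) ne
  ... | v , h with a s (v ++ ls) in eq
  ... | true = v , eq
  ... | false = ⊥-elim (h refl)

  weight-size : ∀ ls → weight s ls ≢ 0 → size ls ≤ m s
  weight-size ls ne = let (v , e) = weight-ext ls ne in
    ≤-trans (m≤n+m (size ls) (size v)) (≤-reflexive (trans (sym (size-++ v ls)) (a-size s _ e)))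

  weight-length : ∀ ls → weight s ls ≢ 0 → length ls ≤ K s
  weight-length ls ne = let (v , e) = weight-ext ls ne in
    ≤-trans (m≤n+m (length ls) (length v)) (≤-reflexive (trans (sym (LP.length-++ v)) (a-length s _ e)))

  weight-last : ∀ ls → K s ≤ length ls → weight s ls ≢ 0 → a s ls ≡ true
  weight-last ls le ne with a s ls in eq
  ... | true = refl
  ... | false = ⊥-elim (ne (trans (weight-leaf ls le) (cong ⟦_⟧ eq)))

  -- This is `mean`, where the total size of the missing letters is the same, m - size ls, for all
  -- accepted words.
  weight-mean : ∀ ls → length ls < K s →
    (K s ∸ length ls) * ∑ (alphabet n) (λ ℓ → proj₁ ℓ * weight s (ℓ ∷ ls)) ≡ (m s ∸ size ls) * weight s ls
  weight-mean ls lt = begin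
    (K s ∸ length ls) * ∑ (alphabet n) (λ ℓ → proj₁ ℓ * weight s (ℓ ∷ ls)) ≡⟨ cong₂ _*_ (+-∸-assoc 1 lt) (∑-cong (alphabet n) (λ ℓ → cong (proj₁ ℓ *_)
        (∑-cong (allLists k (alphabet n)) (λ v → cong ⟦_⟧ (a-perm s (↭-shift ℓ v ls)))))) ⟩
    suc k * firstSum (alphabet n) k h ≡⟨ sym (mean (alphabet n) k h (λ p → cong ⟦_⟧ (a-perm s (++⁺ʳ ls p)))) ⟩
    sizeSum (alphabet n) (suc k) h ≡⟨ ∑-cong (allLists (suc k) (alphabet n)) (λ v → trans (*-comm (size v) (h v)) (trans (⟦⟧*-cong (a s (v ++ ls)) (λ e →
        trans (sym (m+n∸n≡m (size v) (size ls))) (cong (_∸ size ls) (trans (sym (size-++ v ls)) (a-size s _ e))))) (*-comm (h v) (m s ∸ size ls)))) ⟩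
    ∑ (allLists (suc k) (alphabet n)) (λ v → (m s ∸ size ls) * h v) ≡⟨ ∑-*ˡ (allLists (suc k) (alphabet n)) (m s ∸ size ls) h ⟩
    (m s ∸ size ls) * ∑ (allLists (suc k) (alphabet n)) h ≡⟨ cong (λ j → (m s ∸ size ls) * ∑ (allLists j (alphabet n)) h) (sym (+-∸-assoc 1 lt)) ⟩
    (m s ∸ size ls) * weight s ls ∎
    where
    open ≡-Reasoning
    k = K s ∸ suc (length ls)
    h : List Letter → ℕ
    h v = ⟦ a s (v ++ ls) ⟧

  weight-0 : ∀ ls g fl → g < n → weight s ls ≡ 0 → weight s ((g , fl) ∷ ls) ≡ 0
  weight-0 ls g fl lt e with length ls <? K s
  ... | yes l = one fl
    where
    both : weight s ((g , false) ∷ ls) + weight s ((g , true) ∷ ls) ≡ 0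
    both = ∑-≡0⇒ (upTo n) (λ g → weight s ((g , false) ∷ ls) + weight s ((g , true) ∷ ls))
      (trans (sym (∑-alphabet n (λ ℓ → weight s (ℓ ∷ ls)))) (trans (sym (weight-step ls l)) e)) (∈-upTo⁺ lt)
    one : ∀ fl → weight s ((g , fl) ∷ ls) ≡ 0
    one false = m+n≡0⇒m≡0 _ both
    one true = m+n≡0⇒n≡0 (weight s ((g , false) ∷ ls)) both
  ... | no ¬l = trans (weight-leaf ((g , fl) ∷ ls) (≤-trans (≮⇒≥ ¬l) (n≤1+n _))) (cong ⟦_⟧ (not-true (λ t → ¬l (≤-reflexive (a-length s _ t)))))

-- ∑_c m_c ∏_{c' ≠ c} U_{c'}
mixed : (U m : Fin M → ℕ) → ℕ
mixed {zero} U m = 0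
mixed {suc M} U m = m zero * prodF (U ∘ suc) + U zero * mixed (U ∘ suc) (m ∘ suc)

prodF-split : ∀ (f : Fin M → ℕ) c → ∃ λ P → ∀ g → (∀ c' → c' ≢ c → g c' ≡ f c') → prodF g ≡ g c * P
prodF-split {suc M} f zero = prodF (f ∘ suc) , λ g h → cong (g zero *_) (prodF-cong (λ i → h (suc i) (λ ())))
prodF-split {suc M} f (suc c) with prodF-split (f ∘ suc) c
... | P , e = f zero * P , λ g h → trans (cong₂ _*_ (h zero (λ ())) (e (g ∘ suc) (λ c' ne → h (suc c') (λ { refl → ne refl }))))
  (lem (f zero) (g (suc c)) P)
  where
  lem : ∀ x y z → x * (y * z) ≡ y * (x * z)
  lem = solve-∀

-- Both `prodF` and `mixed` are linear in the entries at c. The coefficients P and R depend on the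
-- other entries alone, so the same ones serve before and after a letter is added in the factor c.
mixed-split : ∀ (U m : Fin M → ℕ) c → ∃₂ λ P R → ∀ U' m' → (∀ c' → c' ≢ c → U' c' ≡ U c') → (∀ c' → c' ≢ c → m' c' ≡ m c') →
  prodF U' ≡ U' c * P × mixed U' m' ≡ m' c * P + U' c * R
mixed-split {suc M} U m zero = prodF (U ∘ suc) , mixed (U ∘ suc) (m ∘ suc) , λ U' m' hU hm →
  cong (U' zero *_) (prodF-cong (λ i → hU (suc i) (λ ()))) ,
  cong₂ (λ x y → m' zero * x + U' zero * y) (prodF-cong (λ i → hU (suc i) (λ ()))) (mixed-cong _ _ _ _ (λ i → hU (suc i) (λ ())) (λ i → hm (suc i) (λ ())))
  where
  mixed-cong : ∀ {M} (U U' m m' : Fin M → ℕ) → (∀ i → U i ≡ U' i) → (∀ i → m i ≡ m' i) → mixed U m ≡ mixed U' m'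
  mixed-cong {zero} U U' m m' e f = refl
  mixed-cong {suc M} U U' m m' e f = cong₂ _+_ (cong₂ _*_ (f zero) (prodF-cong (e ∘ suc))) (cong₂ _*_ (e zero) (mixed-cong _ _ _ _ (e ∘ suc) (f ∘ suc)))
mixed-split {suc M} U m (suc c) with mixed-split (U ∘ suc) (m ∘ suc) c
... | P , R , e = U zero * P , m zero * P + U zero * R , λ U' m' hU hm →
  let (p , q) = e (U' ∘ suc) (m' ∘ suc) (λ c' ne → hU (suc c') (λ { refl → ne refl })) (λ c' ne → hm (suc c') (λ { refl → ne refl })) in
  trans (cong₂ _*_ (hU zero (λ ())) p) (lem₁ (U zero) (U' (suc c)) P) ,
  trans (cong₂ (λ x y → x * prodF (U' ∘ suc) + y * mixed (U' ∘ suc) (m' ∘ suc)) (hm zero (λ ())) (hU zero (λ ())))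
    (trans (cong₂ (λ x y → m zero * x + U zero * y) p q) (lem₂ (m zero) (U zero) (U' (suc c)) (m' (suc c)) P R))
  where
  lem₁ : ∀ x y z → x * (y * z) ≡ y * (x * z)
  lem₁ = solve-∀
  lem₂ : ∀ m₀ U₀ u μ P R → m₀ * (u * P) + U₀ * (μ * P + u * R) ≡ μ * (U₀ * P) + u * (m₀ * P + U₀ * R)
  lem₂ = solve-∀

mixed-0 : ∀ (U m : Fin M → ℕ) → (∀ c → m c ≡ 0) → mixed U m ≡ 0
mixed-0 {zero} U m e = refl
mixed-0 {suc M} U m e rewrite e zero | mixed-0 (U ∘ suc) (m ∘ suc) (e ∘ suc) = *-zeroʳ (U zero)

-- Multiplied by q, each summand of `mixed` regains its missing factor and becomes m_c times the
-- full product.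
mixed-const : ∀ (U m : Fin M → ℕ) q → (∀ c → U c ≡ q) → q * mixed U m ≡ sumF m * prodF U
mixed-const {zero} U m q e = *-zeroʳ q
mixed-const {suc M} U m q e = begin
  q * (m zero * P + U zero * X) ≡⟨ *-distribˡ-+ q (m zero * P) (U zero * X) ⟩
  q * (m zero * P) + q * (U zero * X) ≡⟨ cong₂ (λ x y → x * (m zero * P) + y) (sym (e zero)) (trans (lem q (U zero) X) (cong (U zero *_) (mixed-const (U ∘ suc) (m ∘ suc) q (e ∘ suc)))) ⟩
  U zero * (m zero * P) + U zero * (sumF (m ∘ suc) * P) ≡⟨ lem₂ (U zero) (m zero) (sumF (m ∘ suc)) P ⟩
  (m zero + sumF (m ∘ suc)) * (U zero * P) ∎
  where
  open ≡-Reasoning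
  P = prodF (U ∘ suc)
  X = mixed (U ∘ suc) (m ∘ suc)
  lem : ∀ x y z → x * (y * z) ≡ y * (x * z)
  lem = solve-∀
  lem₂ : ∀ u m s P → u * (m * P) + u * (s * P) ≡ (m + s) * (u * P)
  lem₂ = solve-∀

prodF-0 : ∀ (f : Fin M → ℕ) c → f c ≡ 0 → prodF f ≡ 0
prodF-0 f zero e rewrite e = refl
prodF-0 f (suc c) e rewrite prodF-0 (f ∘ suc) c e = *-zeroʳ (f zero)

sumF-∸ : ∀ (f g : Fin M → ℕ) → (∀ c → g c ≤ f c) → sumF (λ c → f c ∸ g c) + sumF g ≡ sumF f
sumF-∸ f g le = trans (sym (sumF-+ (λ c → f c ∸ g c) g)) (sumF-cong (λ c → m∸n+n≡m (le c)))

∑-mean : ∀ (As : List Letter) (x y w : Letter → ℕ) μ → (∀ ℓ → x ℓ * w ℓ + y ℓ * w ℓ ≡ μ * w ℓ) →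
  ∑ As (λ ℓ → x ℓ * w ℓ) + ∑ As (λ ℓ → y ℓ * w ℓ) ≡ μ * ∑ As w
∑-mean As x y w μ h = trans (sym (∑-+ As (λ ℓ → x ℓ * w ℓ) (λ ℓ → y ℓ * w ℓ))) (trans (∑-cong As h) (∑-*ˡ As μ w))

-- The hypothesis is affine in d, so its sum over the letters involves only Σ w and Σ d w. These are
-- known from `weight-step` and `weight-mean`, whatever the condition on the factor is.
∑-linear : ∀ (As : List Letter) (w X d : Letter → ℕ) K κ P R ω →
  (∀ ℓ → K * κ * X ℓ + (d ℓ * P + (K + d ℓ) * R) * (w ℓ * ω) ≡ (K + d ℓ) * P * (w ℓ * ω)) →
  let A = ∑ As (λ ℓ → d ℓ * w ℓ) ; W = ∑ As w in
  K * κ * ∑ As X + (A * P + (K * W + A) * R) * ω ≡ (K * W + A) * P * ω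
∑-linear [] w X d K κ P R ω h = lem K κ P R ω
  where
  lem : ∀ K κ P R ω → K * κ * 0 + (0 * P + (K * 0 + 0) * R) * ω ≡ (K * 0 + 0) * P * ω
  lem = solve-∀
∑-linear (ℓ ∷ As) w X d K κ P R ω h = trans (lem₁ K κ P R ω (w ℓ) (X ℓ) (d ℓ) (∑ As w) (∑ As X) (∑ As (λ ℓ → d ℓ * w ℓ)))
  (trans (cong₂ _+_ (h ℓ) (∑-linear As w X d K κ P R ω h)) (lem₂ K P ω (w ℓ) (d ℓ) (∑ As w) (∑ As (λ ℓ → d ℓ * w ℓ))))
  where
  lem₁ : ∀ K κ P R ω w x d W X A → K * κ * (x + X) + ((d * w + A) * P + (K * (w + W) + (d * w + A)) * R) * ω
    ≡ (K * κ * x + (d * P + (K + d) * R) * (w * ω)) + (K * κ * X + (A * P + (K * W + A) * R) * ω)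
  lem₁ = solve-∀
  lem₂ : ∀ K P ω w d W A → (K + d) * P * (w * ω) + (K * W + A) * P * ω ≡ (K * (w + W) + (d * w + A)) * P * ω
  lem₂ = solve-∀

extW-same : ∀ (c : Fin M) ℓ ws → lookup (extW c ℓ ws) c ≡ ℓ ∷ lookup ws c
extW-same c ℓ ws = VP.lookup∘updateAt c ws

extW-other : ∀ {c c' : Fin M} ℓ ws → c' ≢ c → lookup (extW c ℓ ws) c' ≡ lookup ws c'
extW-other {c = c} {c'} ℓ ws ne = VP.lookup∘updateAt′ c' c ne ws

module Count {N M : ℕ} (sp : Fin M → Spec (suc N)) (Σm : sumF (λ c → m (sp c)) ≡ N) where

  nn = suc N

  -- What remains in the factor c: completions of its word, letters, size, and vertices off the
  -- revealed cycles.
  W K' m' U : Words M → Fin M → ℕ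
  W ws c = weight (sp c) (lookup ws c)
  K' ws c = K (sp c) ∸ length (lookup ws c)
  m' ws c = m (sp c) ∸ size (lookup ws c)
  U ws c = K' ws c + m' ws c

  q : Words M → ℕ
  q ws = unmet nn ws

  leaf-0 : ∀ ws c → W ws c ≡ 0 → leafValue sp ws ≡ 0
  leaf-0 ws c e with ⌊ q ws Data.Nat.≟ 0 ⌋
  ... | false = refl
  ... | true = prodF-0 (λ c → ⟦ a (sp c) (lookup ws c) ⟧) c (cong ⟦_⟧ (not-true (λ t →
        1+n≢0 (trans (sym (trans (weight-leaf (sp c) (lookup ws c) (≤-reflexive (sym (a-length (sp c) _ t)))) (cong ⟦_⟧ t))) e))))

  good-0 : ∀ k ws c → W ws c ≡ 0 → good# sp k ws ≡ 0
  good-0-at : ∀ k ws c → W ws c ≡ 0 → ∀ d → good#-at sp k ws d ≡ 0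
  good-0 zero ws c e = leaf-0 ws c e
  good-0 (suc k) ws c e = good-0-at k ws c e (any? (λ c → unmet nn ws <? free nn ws c))
  good-0-at k ws c e (no _) = leaf-0 ws c e
  good-0-at k ws c e (yes (c₁ , _)) = trans (∑-cong∈ (upTo nn) {g = λ _ → 0} (λ g g∈ →
      trans (cong (⟦ g ≤ᵇ unmet nn ws ⟧ *_) (cong₂ _+_ (one g false (∈-upTo⁻ g∈)) (one g true (∈-upTo⁻ g∈)))) (*-zeroʳ ⟦ g ≤ᵇ unmet nn ws ⟧))) (∑-0 (upTo nn))
    where
    one : ∀ g fl → g < nn → good# sp k (extW c₁ (g , fl) ws) ≡ 0
    one g fl lt with c ≟F c₁
    ... | no ne = good-0 k _ c (trans (cong (weight (sp c)) (extW-other (g , fl) ws ne)) e)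
    ... | yes refl = good-0 k _ c (trans (cong (weight (sp c)) (extW-same c (g , fl) ws)) (weight-0 (sp c) (lookup ws c) g fl lt e))

  -- By `pos` the truncated subtractions in `K'` and `m'` are exact. The reason behind `enough` is
  -- that an unmet vertex is on no revealed cycle of any factor.
  record Ok (ws : Words M) : Set where
    field
      pos : ∀ c → W ws c ≢ 0
      enough : ∀ c → q ws ≤ U ws c

  module OkFacts {ws : Words M} (ok : Ok ws) where
    open Ok ok
    lenK : ∀ c → length (lookup ws c) ≤ K (sp c)
    lenK c = weight-length (sp c) (lookup ws c) (pos c)
    sizem : ∀ c → size (lookup ws c) ≤ m (sp c)
    sizem c = weight-size (sp c) (lookup ws c) (pos c)
    free≡ : ∀ c → free nn ws c ≡ U ws c
    free≡ c = trans (cong (_∸ (length (lookup ws c) + size (lookup ws c))) (trans (sym (K+m (sp c)))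
        (trans (cong₂ _+_ (sym (m∸n+n≡m (lenK c))) (sym (m∸n+n≡m (sizem c)))) (interchange (K' ws c) (length (lookup ws c)) (m' ws c) (size (lookup ws c))))))
        (m+n∸n≡m (U ws c) (length (lookup ws c) + size (lookup ws c)))
    Σm' : sumF (m' ws) ≡ q ws
    Σm' = trans (sym (m+n∸n≡m (sumF (m' ws)) S)) (cong (_∸ S) (trans (sumF-∸ (λ c → m (sp c)) (λ c → size (lookup ws c)) sizem) Σm))
      where S = sumF (λ c → size (lookup ws c))

  -- The second equation is ∏ K' · G = (∏ U - `mixed`) ∏ W, written without subtraction. It says
  -- nothing about G once some K' is 0. The first clause fills this gap, because all vertices are
  -- met as soon as a word receives its last letter.
  Goal : ℕ → Words M → Set
  Goal k ws = (q ws ≡ 0 → good# sp k ws ≡ prodF (W ws)) ×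
    prodF (K' ws) * good# sp k ws + mixed (U ws) (m' ws) * prodF (W ws) ≡ prodF (U ws) * prodF (W ws)

  at-zero : ∀ ws → Ok ws → q ws ≡ 0 → ∀ G → G ≡ prodF (W ws) →
    prodF (K' ws) * G + mixed (U ws) (m' ws) * prodF (W ws) ≡ prodF (U ws) * prodF (W ws)
  at-zero ws ok e G eG = trans (cong₂ (λ x y → prodF (K' ws) * x + y * prodF (W ws)) eG (mixed-0 (U ws) (m' ws) z))
    (trans (+-identityʳ _) (cong (_* prodF (W ws)) (prodF-cong (λ c → sym (trans (cong (K' ws c +_) (z c)) (+-identityʳ _))))))
    where
    open OkFacts ok
    z : ∀ c → m' ws c ≡ 0
    z c = n≤0⇒n≡0 (≤-trans (sumF-single (m' ws) c) (≤-reflexive (trans Σm' e)))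

  -- If q > 0 the exploration has failed and G is 0; then every U equals q by `enough` and Σ m' = q,
  -- so `mixed` equals ∏ U. If q = 0 all words are complete.
  leaf-goal : ∀ ws → Ok ws → (∀ c → U ws c ≤ q ws) → ∀ G → G ≡ leafValue sp ws →
    (q ws ≡ 0 → G ≡ prodF (W ws)) × prodF (K' ws) * G + mixed (U ws) (m' ws) * prodF (W ws) ≡ prodF (U ws) * prodF (W ws)
  leaf-goal ws ok le G eG = first , by (q ws) refl
    where
    open Ok ok
    open OkFacts ok
    first : q ws ≡ 0 → G ≡ prodF (W ws)
    first e = trans eG (trans lv (prodF-cong (λ c → sym (weight-leaf (sp c) (lookup ws c) (m∸n≡0⇒m≤n (n≤0⇒n≡0 (≤-trans (m≤m+n (K' ws c) (m' ws c)) (≤-trans (le c) (≤-reflexive e)))))))))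
      where
      lv : leafValue sp ws ≡ prodF (λ c → ⟦ a (sp c) (lookup ws c) ⟧)
      lv rewrite e = refl
    by : ∀ r → q ws ≡ r → prodF (K' ws) * G + mixed (U ws) (m' ws) * prodF (W ws) ≡ prodF (U ws) * prodF (W ws)
    by zero e = at-zero ws ok e G (first e)
    by (suc r) e = trans (cong (λ x → prodF (K' ws) * x + mixed (U ws) (m' ws) * prodF (W ws)) (trans eG lv))
      (trans (cong (_+ mixed (U ws) (m' ws) * prodF (W ws)) (*-zeroʳ (prodF (K' ws))))
        (cong (_* prodF (W ws)) (*-cancelˡ-≡ _ _ (suc r) (trans (cong (_* mixed (U ws) (m' ws)) (sym e))
           (trans (mixed-const (U ws) (m' ws) (q ws) (λ c → ≤-antisym (le c) (enough c))) (cong (_* prodF (U ws)) (trans Σm' e)))))))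
      where
      lv : leafValue sp ws ≡ 0
      lv rewrite e = refl

  -- One step in the factor c: w ℓ is the weight after the letter ℓ, and X ℓ the number of good completions.
  module Step (k : ℕ) (ws : Words M) (ok : Ok ws) (c : Fin M) (lt : q ws < U ws c)
    (ih : ∀ ws' → Ok ws' → sumF (U ws') ≤ k → Goal k ws') (fuel : sumF (U ws) ≤ suc k) where
    open Ok ok
    open OkFacts ok

    ls = lookup ws c
    s = sp c

    w : Letter → ℕ
    w ℓ = weight s (ℓ ∷ ls)

    X : Letter → ℕ
    X ℓ = good# sp k (extW c ℓ ws)

    m'≤q : m' ws c ≤ q ws
    m'≤q = ≤-trans (sumF-single (m' ws) c) (≤-reflexive Σm')

    -- A complete word has no size left either, so its U would be 0, against q < U.
    K'>0 : length ls < K s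
    K'>0 = ≰⇒> (λ le → <⇒≱ lt (≤-trans (≤-reflexive (cong₂ _+_ (m≤n⇒m∸n≡0 le)
      (m≤n⇒m∸n≡0 (≤-reflexive (sym (a-size s ls (weight-last s ls le (pos c)))))))) z≤n))

    split-W = prodF-split (W ws) c
    split-K = prodF-split (K' ws) c
    split-U = mixed-split (U ws) (m' ws) c
    ω = proj₁ split-W
    κ = proj₁ split-K
    P = proj₁ split-U
    R = proj₁ (proj₂ split-U)

    W-off : ∀ ℓ c' → c' ≢ c → W (extW c ℓ ws) c' ≡ W ws c'
    W-off ℓ c' ne = cong (weight (sp c')) (extW-other ℓ ws ne)
    K-off : ∀ ℓ c' → c' ≢ c → K' (extW c ℓ ws) c' ≡ K' ws c'
    K-off ℓ c' ne = cong (λ x → K (sp c') ∸ length x) (extW-other ℓ ws ne)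
    m-off : ∀ ℓ c' → c' ≢ c → m' (extW c ℓ ws) c' ≡ m' ws c'
    m-off ℓ c' ne = cong (λ x → m (sp c') ∸ size x) (extW-other ℓ ws ne)
    U-off : ∀ ℓ c' → c' ≢ c → U (extW c ℓ ws) c' ≡ U ws c'
    U-off ℓ c' ne = cong₂ _+_ (K-off ℓ c' ne) (m-off ℓ c' ne)

    W-on : ∀ ℓ → W (extW c ℓ ws) c ≡ w ℓ
    W-on ℓ = cong (weight s) (extW-same c ℓ ws)
    K-on : ∀ ℓ → K' (extW c ℓ ws) c ≡ K' ws c ∸ 1
    K-on ℓ = trans (cong (λ x → K s ∸ length x) (extW-same c ℓ ws)) (trans (cong (K s ∸_) (+-comm 1 (length ls))) (sym (∸-+-assoc (K s) (length ls) 1)))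
    m-on : ∀ g fl → m' (extW c (g , fl) ws) c ≡ m' ws c ∸ g
    m-on g fl = trans (cong (λ x → m s ∸ size x) (extW-same c (g , fl) ws)) (trans (cong (m s ∸_) (+-comm g (size ls))) (sym (∸-+-assoc (m s) (size ls) g)))

    q-on : ∀ g fl → q (extW c (g , fl) ws) ≡ q ws ∸ g
    q-on g fl = trans (cong (N ∸_) e) (sym (∸-+-assoc N (sumF (λ c → size (lookup ws c))) g))
      where
      e : sumF (λ c' → size (lookup (extW c (g , fl) ws) c')) ≡ sumF (λ c → size (lookup ws c)) + g
      e = +-cancelʳ-≡ (size ls) _ _ (trans (sumF-upd c (λ c' ne → cong size (extW-other (g , fl) ws ne)))
        (trans (cong (λ x → sumF (λ c → size (lookup ws c)) + size x) (extW-same c (g , fl) ws)) (sym (+-assoc (sumF (λ c → size (lookup ws c))) g (size ls)))))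

    g≤m' : ∀ g fl → w (g , fl) ≢ 0 → g ≤ m' ws c
    g≤m' g fl ne = ≤-trans (≤-reflexive (sym (m+n∸n≡m g (size ls)))) (∸-monoˡ-≤ (size ls) (weight-size s ((g , fl) ∷ ls) ne))

    ok' : ∀ g fl → w (g , fl) ≢ 0 → Ok (extW c (g , fl) ws)
    ok' g fl ne = record { pos = ps ; enough = en }
      where
      ps : ∀ c' → W (extW c (g , fl) ws) c' ≢ 0
      ps c' with c' ≟F c
      ... | yes refl = λ e → ne (trans (sym (W-on (g , fl))) e)
      ... | no nc = λ e → pos c' (trans (sym (W-off (g , fl) c' nc)) e)
      en : ∀ c' → q (extW c (g , fl) ws) ≤ U (extW c (g , fl) ws) c'
      en c' with c' ≟F c
      ... | no nc = ≤-trans (≤-reflexive (q-on g fl)) (≤-trans (m∸n≤m (q ws) g) (≤-trans (enough c') (≤-reflexive (sym (U-off (g , fl) c' nc)))))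
      ... | yes refl = ≤-trans (≤-reflexive (q-on g fl)) (≤-trans (∸-monoˡ-≤ g q≤) (≤-reflexive (trans (+-∸-assoc (K' ws c ∸ 1) (g≤m' g fl ne)) (sym (cong₂ _+_ (K-on (g , fl)) (m-on g fl))))))
        where
        q≤ : q ws ≤ (K' ws c ∸ 1) + m' ws c
        q≤ = s≤s⁻¹ (≤-trans lt (≤-reflexive (cong (_+ m' ws c) (sym (m+[n∸m]≡n {1} (m<n⇒0<n∸m K'>0))))))

    fuel' : ∀ g fl → w (g , fl) ≢ 0 → sumF (U (extW c (g , fl) ws)) ≤ k
    fuel' g fl ne = s≤s⁻¹ (≤-trans (+-cancelʳ-< (U ws c) _ _ (≤-trans (≤-reflexive (cong suc (sumF-upd c (U-off (g , fl)))))
        (≤-trans (≤-reflexive (sym (+-suc (sumF (U ws)) _))) (+-monoʳ-≤ (sumF (U ws)) drops)))) fuel)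
      where
      drops : U (extW c (g , fl) ws) c < U ws c
      drops = ≤-trans (s≤s (+-mono-≤ (≤-reflexive (K-on (g , fl))) (≤-trans (≤-reflexive (m-on g fl)) (m∸n≤m (m' ws c) g))))
         (≤-reflexive (cong (_+ m' ws c) (m+[n∸m]≡n {1} (m<n⇒0<n∸m K'>0))))

    W≡ : prodF (W ws) ≡ W ws c * ω
    W≡ = proj₂ split-W (W ws) (λ _ _ → refl)
    Wℓ≡ : ∀ ℓ → prodF (W (extW c ℓ ws)) ≡ w ℓ * ω
    Wℓ≡ ℓ = trans (proj₂ split-W (W (extW c ℓ ws)) (W-off ℓ)) (cong (_* ω) (W-on ℓ))

    X-0 : ∀ ℓ → w ℓ ≡ 0 → X ℓ ≡ 0
    X-0 ℓ e = good-0 k (extW c ℓ ws) c (trans (W-on ℓ) e)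

    Σ[_] : (Letter → ℕ) → ℕ
    Σ[ F ] = ∑ (alphabet nn) F

    total-X : good#-at sp k ws (yes (c , subst (q ws <_) (sym (free≡ c)) lt)) ≡ Σ[ X ]
    total-X = trans (∑-cong (upTo nn) h) (sym (∑-alphabet nn X))
      where
      big : ∀ g fl → (g ≤ᵇ q ws) ≡ false → X (g , fl) ≡ 0
      big g fl e with w (g , fl) Data.Nat.≟ 0
      ... | yes z = X-0 (g , fl) z
      ... | no ne = ⊥-elim (subst (λ b → Data.Bool.T b → ⊥) (sym e) (λ t → t) (≤⇒≤ᵇ (≤-trans (g≤m' g fl ne) m'≤q)))
      h : ∀ g → ⟦ g ≤ᵇ q ws ⟧ * (X (g , false) + X (g , true)) ≡ X (g , false) + X (g , true)
      h g with g ≤ᵇ q ws in eq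
      ... | true = *-identityˡ _
      ... | false = sym (cong₂ _+_ (big g false eq) (big g true eq))

    sum-w : Σ[ w ] ≡ W ws c
    sum-w = sym (weight-step s ls K'>0)

    -- If the exploration has met everything after each possible letter, the letters contribute their weights.
    zero-case : (∀ g fl → w (g , fl) ≢ 0 → q ws ∸ g ≡ 0) → Σ[ X ] ≡ prodF (W ws)
    zero-case h = trans (∑-cong (alphabet nn) one) (trans (∑-*ʳ (alphabet nn) ω w) (trans (cong (_* ω) sum-w) (sym W≡)))
      where
      one : ∀ ℓ → X ℓ ≡ w ℓ * ω
      one (g , fl) with w (g , fl) Data.Nat.≟ 0
      ... | yes z = trans (X-0 (g , fl) z) (cong (_* ω) (sym z))
      ... | no ne = trans (proj₁ (ih (extW c (g , fl) ws) (ok' g fl ne) (fuel' g fl ne)) (trans (q-on g fl) (h g fl ne))) (Wℓ≡ (g , fl))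

    K₁ = K' ws c ∸ 1
    K'≡ : K' ws c ≡ suc K₁
    K'≡ = sym (m+[n∸m]≡n {1} (m<n⇒0<n∸m K'>0))

    κ≡ : prodF (K' ws) ≡ suc K₁ * κ
    κ≡ = trans (proj₂ split-K (K' ws) (λ _ _ → refl)) (cong (_* κ) K'≡)
    Pr≡ : prodF (U ws) ≡ (suc K₁ + m' ws c) * P
    Pr≡ = trans (proj₁ (proj₂ (proj₂ split-U) (U ws) (m' ws) (λ _ _ → refl) (λ _ _ → refl))) (cong (λ x → (x + m' ws c) * P) K'≡)
    Mx≡ : mixed (U ws) (m' ws) ≡ m' ws c * P + (suc K₁ + m' ws c) * R
    Mx≡ = trans (proj₂ (proj₂ (proj₂ split-U) (U ws) (m' ws) (λ _ _ → refl) (λ _ _ → refl))) (cong (λ x → m' ws c * P + (x + m' ws c) * R) K'≡)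

    equation : ∀ g fl → K₁ * κ * X (g , fl) + ((m' ws c ∸ g) * P + (K₁ + (m' ws c ∸ g)) * R) * (w (g , fl) * ω)
      ≡ (K₁ + (m' ws c ∸ g)) * P * (w (g , fl) * ω)
    equation g fl with w (g , fl) Data.Nat.≟ 0
    ... | yes z = trans (cong₂ (λ x y → K₁ * κ * x + ((m' ws c ∸ g) * P + (K₁ + (m' ws c ∸ g)) * R) * (y * ω)) (X-0 (g , fl) z) z)
        (trans (cong₂ _+_ (*-zeroʳ (K₁ * κ)) (*-zeroʳ ((m' ws c ∸ g) * P + (K₁ + (m' ws c ∸ g)) * R)))
          (sym (trans (cong (λ y → (K₁ + (m' ws c ∸ g)) * P * (y * ω)) z) (*-zeroʳ ((K₁ + (m' ws c ∸ g)) * P)))))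
    ... | no ne = begin
      K₁ * κ * X (g , fl) + ((m' ws c ∸ g) * P + (K₁ + (m' ws c ∸ g)) * R) * (w (g , fl) * ω)
        ≡⟨ cong₂ (λ x y → x * X (g , fl) + y * (w (g , fl) * ω)) (sym kk) (sym mm) ⟩
      prodF (K' ws') * X (g , fl) + mixed (U ws') (m' ws') * (w (g , fl) * ω) ≡⟨ cong (λ x → prodF (K' ws') * X (g , fl) + mixed (U ws') (m' ws') * x) (sym (Wℓ≡ (g , fl))) ⟩
      prodF (K' ws') * X (g , fl) + mixed (U ws') (m' ws') * prodF (W ws') ≡⟨ proj₂ (ih ws' (ok' g fl ne) (fuel' g fl ne)) ⟩
      prodF (U ws') * prodF (W ws') ≡⟨ cong₂ _*_ uu (Wℓ≡ (g , fl)) ⟩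
      (K₁ + (m' ws c ∸ g)) * P * (w (g , fl) * ω) ∎
      where
      open ≡-Reasoning
      ws' = extW c (g , fl) ws
      sp' = proj₂ (proj₂ split-U) (U ws') (m' ws') (U-off (g , fl)) (m-off (g , fl))
      uc : U ws' c ≡ K₁ + (m' ws c ∸ g)
      uc = cong₂ _+_ (K-on (g , fl)) (m-on g fl)
      kk : prodF (K' ws') ≡ K₁ * κ
      kk = trans (proj₂ split-K (K' ws') (K-off (g , fl))) (cong (_* κ) (K-on (g , fl)))
      mm : mixed (U ws') (m' ws') ≡ (m' ws c ∸ g) * P + (K₁ + (m' ws c ∸ g)) * R
      mm = trans (proj₂ sp') (cong₂ (λ x y → x * P + y * R) (m-on g fl) uc)
      uu : prodF (U ws') ≡ (K₁ + (m' ws c ∸ g)) * P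
      uu = trans (proj₁ sp') (cong (_* P) uc)

    avg : ℕ
    avg = Σ[ (λ ℓ → (m' ws c ∸ proj₁ ℓ) * w ℓ) ]

    -- The complement of `weight-mean`: if a letter takes on average the share 1 / (K₁ + 1) of the
    -- remaining size, then K₁ / (K₁ + 1) of it is left over.
    avg-mean : suc K₁ * avg ≡ K₁ * (m' ws c * W ws c)
    avg-mean = +-cancelʳ-≡ (m' ws c * W ws c) _ _ (begin
      suc K₁ * avg + m' ws c * W ws c ≡⟨ cong (suc K₁ * avg +_) (trans (sym (weight-mean s ls K'>0)) (cong (_* G₁) K'≡)) ⟩
      suc K₁ * avg + suc K₁ * G₁ ≡⟨ sym (*-distribˡ-+ (suc K₁) avg G₁) ⟩
      suc K₁ * (avg + G₁) ≡⟨ cong (suc K₁ *_) (trans (∑-mean (alphabet nn) (λ ℓ → m' ws c ∸ proj₁ ℓ) proj₁ w (m' ws c) one) (cong (m' ws c *_) sum-w)) ⟩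
      suc K₁ * (m' ws c * W ws c) ≡⟨ +-comm (m' ws c * W ws c) _ ⟩
      K₁ * (m' ws c * W ws c) + m' ws c * W ws c ∎)
      where
      open ≡-Reasoning
      G₁ = Σ[ (λ ℓ → proj₁ ℓ * w ℓ) ]
      one : ∀ ℓ → (m' ws c ∸ proj₁ ℓ) * w ℓ + proj₁ ℓ * w ℓ ≡ m' ws c * w ℓ
      one (g , fl) with w (g , fl) Data.Nat.≟ 0
      ... | yes z rewrite z = trans (cong₂ _+_ (*-zeroʳ (m' ws c ∸ g)) (*-zeroʳ g)) (sym (*-zeroʳ (m' ws c)))
      ... | no ne = trans (sym (*-distribʳ-+ (w (g , fl)) (m' ws c ∸ g) g)) (cong (_* w (g , fl)) (m∸n+n≡m (g≤m' g fl ne)))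

    summed : K₁ * κ * Σ[ X ] + (avg * P + (K₁ * W ws c + avg) * R) * ω ≡ (K₁ * W ws c + avg) * P * ω
    summed = subst (λ x → K₁ * κ * Σ[ X ] + (avg * P + (K₁ * x + avg) * R) * ω ≡ (K₁ * x + avg) * P * ω) sum-w
      (∑-linear (alphabet nn) w X (λ ℓ → m' ws c ∸ proj₁ ℓ) K₁ κ P R ω (λ ℓ → equation (proj₁ ℓ) (proj₂ ℓ)))

    last-case : K₁ ≡ 0 → (∀ g fl → w (g , fl) ≢ 0 → g ≡ m' ws c)
    last-case e g fl ne = sym (trans (cong (_∸ size ls) (sym (a-size s ((g , fl) ∷ ls) (weight-last s ((g , fl) ∷ ls) lenK' ne)))) (m+n∸n≡m g (size ls)))
      where
      lenK' : K s ≤ suc (length ls)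
      lenK' = ≤-trans (≤-reflexive (trans (sym (m∸n+n≡m (<⇒≤ K'>0))) (cong (_+ length ls) (trans K'≡ (cong suc e))))) ≤-refl

    first : q ws ≡ 0 → Σ[ X ] ≡ prodF (W ws)
    first e = zero-case (λ g fl ne → trans (cong (_∸ g) e) (0∸n≡0 g))

    second : ∀ j → K₁ ≡ j → prodF (K' ws) * Σ[ X ] + mixed (U ws) (m' ws) * prodF (W ws) ≡ prodF (U ws) * prodF (W ws)
    -- The last letter of this word takes all of m', and q ≤ m', so everything gets met and
    -- `zero-case` gives the sum. As Σ m' = q, the other m' vanish; hence R = 0, and P is the
    -- product of the other K'.
    second zero e = begin
      prodF (K' ws) * Σ[ X ] + mixed (U ws) (m' ws) * ΠW ≡⟨ cong₂ (λ x y → x * y + mixed (U ws) (m' ws) * ΠW) eK (zero-case (λ g fl ne → trans (cong (q ws ∸_) (last-case e g fl ne)) (m≤n⇒m∸n≡0 q≤m'))) ⟩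
      P * ΠW + mixed (U ws) (m' ws) * ΠW ≡⟨ cong (λ x → P * ΠW + x * ΠW) (trans Mx≡ (cong₂ (λ x y → m' ws c * P + (suc x + m' ws c) * y) e eR)) ⟩
      P * ΠW + (m' ws c * P + (1 + m' ws c) * 0) * ΠW ≡⟨ lem P ΠW (m' ws c) ⟩
      (1 + m' ws c) * P * ΠW ≡⟨ cong (_* ΠW) (sym (trans Pr≡ (cong (λ x → (suc x + m' ws c) * P) e))) ⟩
      prodF (U ws) * ΠW ∎
      where
      open ≡-Reasoning
      ΠW = prodF (W ws)
      lem : ∀ P w μ → P * w + (μ * P + (1 + μ) * 0) * w ≡ (1 + μ) * P * w
      lem = solve-∀
      q≤m' : q ws ≤ m' ws c
      q≤m' = s≤s⁻¹ (≤-trans lt (≤-reflexive (cong (_+ m' ws c) (trans K'≡ (cong suc e)))))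
      others : ∀ c' → c' ≢ c → m' ws c' ≡ 0
      others c' ne = n≤0⇒n≡0 (+-cancelˡ-≤ (m' ws c) _ _ (≤-trans (two c' ne) (≤-trans (≤-reflexive Σm') (≤-trans q≤m' (≤-reflexive (sym (+-identityʳ _)))))))
        where
        two : ∀ c' → c' ≢ c → m' ws c + m' ws c' ≤ sumF (m' ws)
        two c' ne = pair (m' ws) c c' (λ q → ne (sym q))
          where
          pair : ∀ {M} (f : Fin M → ℕ) i j → i ≢ j → f i + f j ≤ sumF f
          pair f zero zero ne = ⊥-elim (ne refl)
          pair f zero (suc j) ne = +-monoʳ-≤ (f zero) (sumF-single (f ∘ suc) j)
          pair f (suc i) zero ne = ≤-trans (≤-reflexive (+-comm (f (suc i)) (f zero))) (+-monoʳ-≤ (f zero) (sumF-single (f ∘ suc) i))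
          pair f (suc i) (suc j) ne = ≤-trans (pair (f ∘ suc) i j (ne ∘ cong suc)) (m≤n+m _ (f zero))
      sp' = proj₂ (proj₂ split-U) (K' ws) (λ _ → 0) (λ c' ne → sym (trans (cong (K' ws c' +_) (others c' ne)) (+-identityʳ _))) (λ c' ne → sym (others c' ne))
      eK : prodF (K' ws) ≡ P
      eK = trans (proj₁ sp') (trans (cong (_* P) (trans K'≡ (cong suc e))) (*-identityˡ P))
      eR : R ≡ 0
      eR = trans (sym (*-identityˡ R)) (trans (cong (_* R) (sym (trans K'≡ (cong suc e)))) (trans (sym (proj₂ sp')) (mixed-0 (K' ws) (λ _ → 0) (λ _ → refl))))
    -- `summed` carries K₁ where the goal has K₁ + 1. Multiplying by the nonzero K₁ makes both sides
    -- multiples to which `avg-mean` applies.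
    second (suc j) e = *-cancelˡ-≡ _ _ (suc j) (begin
      suc j * (prodF (K' ws) * G + mixed (U ws) (m' ws) * prodF (W ws)) ≡⟨ cong₂ _*_ (sym e) (cong₂ _+_ (cong (_* G) κ≡) (cong₂ _*_ Mx≡ W≡)) ⟩
      K₁ * (suc K₁ * κ * G + (μ * P + (suc K₁ + μ) * R) * (w₀ * ω)) ≡⟨ lem₁ K₁ κ G μ P R w₀ ω ⟩
      suc K₁ * (K₁ * κ * G) + (K₁ * (μ * w₀) * P + (suc K₁ * (K₁ * w₀) + K₁ * (μ * w₀)) * R) * ω
        ≡⟨ cong (λ x → suc K₁ * (K₁ * κ * G) + (x * P + (suc K₁ * (K₁ * w₀) + x) * R) * ω) (sym avg-mean) ⟩
      suc K₁ * (K₁ * κ * G) + (suc K₁ * avg * P + (suc K₁ * (K₁ * w₀) + suc K₁ * avg) * R) * ω ≡⟨ lem₂ K₁ κ G avg P R w₀ ω ⟩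
      suc K₁ * (K₁ * κ * G + (avg * P + (K₁ * w₀ + avg) * R) * ω) ≡⟨ cong (suc K₁ *_) summed ⟩
      suc K₁ * ((K₁ * w₀ + avg) * P * ω) ≡⟨ lem₃ K₁ avg P w₀ ω ⟩
      (suc K₁ * (K₁ * w₀) + suc K₁ * avg) * P * ω ≡⟨ cong (λ x → (suc K₁ * (K₁ * w₀) + x) * P * ω) avg-mean ⟩
      (suc K₁ * (K₁ * w₀) + K₁ * (μ * w₀)) * P * ω ≡⟨ lem₄ K₁ μ P w₀ ω ⟩
      K₁ * ((suc K₁ + μ) * P * (w₀ * ω)) ≡⟨ cong₂ _*_ e (sym (cong₂ _*_ Pr≡ W≡)) ⟩
      suc j * (prodF (U ws) * prodF (W ws)) ∎)
      where
      open ≡-Reasoning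
      G = Σ[ X ]
      μ = m' ws c
      w₀ = W ws c
      lem₁ : ∀ K κ G μ P R w ω → K * (suc K * κ * G + (μ * P + (suc K + μ) * R) * (w * ω)) ≡ suc K * (K * κ * G) + (K * (μ * w) * P + (suc K * (K * w) + K * (μ * w)) * R) * ω
      lem₁ = solve-∀
      lem₂ : ∀ K κ G avg P R w ω → suc K * (K * κ * G) + (suc K * avg * P + (suc K * (K * w) + suc K * avg) * R) * ω ≡ suc K * (K * κ * G + (avg * P + (K * w + avg) * R) * ω)
      lem₂ = solve-∀
      lem₃ : ∀ K avg P w ω → suc K * ((K * w + avg) * P * ω) ≡ (suc K * (K * w) + suc K * avg) * P * ω
      lem₃ = solve-∀
      lem₄ : ∀ K μ P w ω → (suc K * (K * w) + K * (μ * w)) * P * ω ≡ K * ((suc K + μ) * P * (w * ω))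
      lem₄ = solve-∀

  count-good# : ∀ k ws → Ok ws → sumF (U ws) ≤ k → Goal k ws
  count-good#-at : ∀ k ws → Ok ws → sumF (U ws) ≤ suc k → (d : Dec (∃ λ c → unmet nn ws < free nn ws c)) →
    (q ws ≡ 0 → good#-at sp k ws d ≡ prodF (W ws)) ×
    prodF (K' ws) * good#-at sp k ws d + mixed (U ws) (m' ws) * prodF (W ws) ≡ prodF (U ws) * prodF (W ws)

  count-good# zero ws ok le = leaf-goal ws ok (λ c → ≤-trans (sumF-single (U ws) c) (≤-trans le z≤n)) _ refl
  count-good# (suc k) ws ok le = count-good#-at k ws ok le (any? (λ c → unmet nn ws <? free nn ws c))

  count-good#-at k ws ok le (no ¬p) = leaf-goal ws ok (λ c → ≮⇒≥ (λ lt → ¬p (c , subst (q ws <_) (sym (OkFacts.free≡ ok c)) lt))) _ refl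
  count-good#-at k ws ok le (yes (c , lt)) =
    (λ e → trans S.total-X (S.first e)) , trans (cong (λ x → prodF (K' ws) * x + mixed (U ws) (m' ws) * prodF (W ws)) S.total-X) (S.second S.K₁ refl)
    where
    module S = Step k ws ok c (subst (q ws <_) (OkFacts.free≡ ok c) lt) (λ ws' o f → count-good# k ws' o f) le

-- The Coxeter element and the relabellings that conjugate it

next-lt : ∀ {k} (i j : Fin (suc k)) → toℕ j ≡ suc (toℕ i) → next i ≡ (j , false)
next-lt {suc k} zero j e = cong (_, false) (toℕ-injective (sym e))
next-lt {zero} zero (suc ()) e
next-lt {suc k} (suc i) (suc j) e rewrite next-lt i j (suc-injective e) = refl

next-last : ∀ {k} (i : Fin (suc k)) → toℕ i ≡ k → next i ≡ (zero , true)
next-last {zero} zero e = refl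
next-last {suc k} (suc i) e rewrite next-last i (suc-injective e) = refl

cox-next : ∀ {k} (i : Fin (suc k)) → app (cox (suc k)) (i , false) ≡ next i
cox-next {k} i = trans (app-lookup (cox (suc k)) i) (VP.lookup∘tabulate next i)

iter-cox : ∀ {k} t (i : Fin (suc k)) → toℕ i ≡ t → iterW t (cox (suc k)) (zero , false) ≡ (i , false)
iter-cox zero zero e = refl
iter-cox {k} (suc t) i e = trans (cong (app (cox (suc k))) (iter-cox t j (toℕ-fromℕ< lt))) (trans (cox-next j) (next-lt j i (trans e (cong suc (sym (toℕ-fromℕ< lt))))))
  where
  lt : t < suc k
  lt = ≤-trans (n≤1+n (suc t)) (≤-trans (s≤s (≤-reflexive (sym e))) (toℕ<n i))
  j : Fin (suc k)
  j = fromℕ< lt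

iter-cox-all : ∀ {k} → iterW (suc k) (cox (suc k)) (zero , false) ≡ (zero , true)
iter-cox-all {k} = trans (cong (app (cox (suc k))) (iter-cox k j (toℕ-fromℕ< ≤-refl))) (trans (cox-next j) (next-last j (toℕ-fromℕ< ≤-refl)))
  where
  j : Fin (suc k)
  j = fromℕ< ≤-refl

iter-conj : ∀ (P w c : RawW n) → P · w ≡ w · c → ∀ t p → iterW t P (app w p) ≡ app w (iterW t c p)
iter-conj P w c e zero p = refl
iter-conj P w c e (suc t) p = trans (cong (app P) (iter-conj P w c e t p))
  (trans (sym (app-· P w (iterW t c p))) (trans (cong (λ x → app x (iterW t c p)) e) (app-· w c (iterW t c p))))

-- Relabellings of the points that fix the point 1 (and 1̄).
isLab : RawW (suc n) → Bool
isLab w = isSignedPerm w ∧ eqPt (lookup w zero) (zero , false)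

conjugates : RawW (suc n) → RawW (suc n) → Bool
conjugates {n} P w = isLab w ∧ eqW (P · w) (w · cox (suc n))

-- A relabelling that conjugates c into P must send the i-th vertex to the i-th iterate of 1 under
-- P, so this number is 0 or 1. Testing for a long cycle by it makes the double count in
-- `long-count` immediate.
ν : RawW (suc n) → ℕ
ν {n} P = ∑ (allVecs (suc n) (allPts (suc n))) (λ w → ⟦ conjugates P w ⟧)

record Labels (P w : RawW (suc n)) : Set where
  field
    lperm : Perm w
    lzero : app w (zero , false) ≡ (zero , false)
    lconj : P · w ≡ w · cox (suc n)

labels⇒ : ∀ (P w : RawW (suc n)) → conjugates P w ≡ true → Labels P w
labels⇒ {n} P w e with ∧-true {isLab w} e
... | e₁ , e₂ with ∧-true {isSignedPerm w} e₁
... | e₃ , e₄ = record { lperm = isSignedPerm⇒Perm w e₃ ; lzero = trans (app-lookup w zero) (eqPt-true (lookup w zero) (zero , false) e₄) ; lconj = eqW-true (P · w) (w · cox (suc n)) e₂ }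

labels⇐ : ∀ (P w : RawW (suc n)) → Labels P w → conjugates P w ≡ true
labels⇐ {n} P w L = ∧-intro (∧-intro (Perm⇒isSignedPerm w lperm) (trans (cong (λ x → eqPt x (zero , false)) (trans (sym (app-lookup w zero)) lzero)) (eqPt-refl {suc n} (zero , false))))
   (trans (cong (eqW (P · w)) (sym lconj)) (eqW-refl (P · w)))
  where open Labels L

labels-orbit : ∀ {P w : RawW (suc n)} → Labels P w → ∀ i → app w (i , false) ≡ iterW (toℕ i) P (zero , false)
labels-orbit {n} {P} {w} L i = sym (trans (cong (iterW (toℕ i) P) (sym lzero)) (trans (iter-conj P w (cox (suc n)) lconj (toℕ i) (zero , false)) (cong (app w) (iter-cox (toℕ i) i refl))))
  where open Labels L

ν-1 : ∀ (P w : RawW (suc n)) → Labels P w → ν P ≡ 1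
ν-1 {n} P w L = trans (∑-only _≟V_ (allVecs (suc n) (allPts (suc n))) (RawW-Enum (suc n)) w (λ x → ⟦ conjugates P x ⟧)
  (λ x ne → cong ⟦_⟧ (not-true (λ e → ne (W-ext (λ i → trans (labels-orbit (labels⇒ P x e) i) (sym (labels-orbit L i))))))))
  (cong ⟦_⟧ (labels⇐ P w L))

longB : RawW (suc n) → Bool
longB P = ν P ≡ᵇ 1

labels-of : ∀ (P : RawW (suc n)) → ν P ≢ 0 → ∃ λ w → Labels P w
labels-of {n} P ne with ∑-pos (allVecs (suc n) (allPts (suc n))) (λ w → ⟦ conjugates P w ⟧) ne
... | w , h = w , labels⇒ P w (lem (conjugates P w) refl)
  where
  lem : ∀ b → conjugates P w ≡ b → conjugates P w ≡ true
  lem true e = e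
  lem false e = ⊥-elim (h (cong ⟦_⟧ e))

ν-long : ∀ (P : RawW (suc n)) → ⟦ longB P ⟧ ≡ ν P
ν-long P with ν P Data.Nat.≟ 0
... | yes z rewrite z = refl
... | no ne with labels-of P ne
... | w , L rewrite ν-1 P w L = refl

labels-trans : ∀ {P w : RawW (suc n)} → Labels P w → Transitive P
labels-trans {n} {P} {w} L j with surj (Labels.lperm L) j
... | i , e = toℕ i , trans (cong proj₁ (sym (labels-orbit L i))) e

long⇒ : ∀ {P : RawW (suc n)} → longB P ≡ true → Transitive P
long⇒ {n} {P} e with labels-of P (λ z → 1+n≢0 (trans (sym (≡ᵇ-true (ν P) 1 e)) z))
... | w , L = labels-trans L

-- By transitivity the cycle through 1 covers every vertex, and the odd number of bars makes it a
-- cycle of type B.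
one-long-cycle : ∀ {P : RawW (suc n)} → Perm P → Transitive P → sgn P ≡ true → Ret P zero n true
one-long-cycle {n} {P} pm tr odd-P = go (follow pm [] (part [] (nodup (λ i → z≤n))) zero (λ ()))
  where
  go : (∃₂ λ us fl → Part P ((zero , us , fl) ∷ [])) → Ret P zero n true
  go (us , fl , pt) = subst₂ (Ret P zero) len flag (cycle-ret pm (zero , us , fl) ic ndz (here refl))
    where
    z = (zero , us , fl)
    ic : IsCyc P z
    ic = All.head (cyc pt)
    ndz : Nodup (vs z)
    ndz = nodup-++ˡ {ys = []} (nd pt)
    allz : ∀ j → j ∈ verts (z ∷ [])
    allz j with tr j
    ... | t , e = subst (_∈ verts (z ∷ [])) e (iter-closed P (_∈ verts (z ∷ [])) (λ i → verts-closed P (z ∷ []) (cyc pt)) t (zero , false) (here refl))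
    fl' : Full P (z ∷ [])
    fl' = full (cyc pt) (λ i → ≤-antisym (at (nd pt) i) (∈⇒occ (allz i)))
    flag : fl ≡ true
    flag = trans (sym (odd-⟦⟧ fl)) (trans (cong odd (sym (+-identityʳ ⟦ fl ⟧))) (trans (sym (sgn-full fl')) odd-P))
    len : length us ≡ n
    len = suc-injective (trans (sym (trans (length-verts-cons z []) (+-identityʳ _))) (≤-antisym (nodup-length (nd pt)) (length-all (verts (z ∷ [])) allz)))

long⇐ : ∀ {P : RawW (suc n)} → Perm P → Transitive P → sgn P ≡ true → longB P ≡ true
long⇐ {n} {P} pm tr odd-P = cong (_≡ᵇ 1) (ν-1 P w (record { lperm = mkPerm pw ; lzero = w-at zero ; lconj = W-ext cj }))
  where
  R : Ret P zero n true
  R = one-long-cycle pm tr odd-P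
  w : RawW (suc n)
  w = tabulate (λ i → iterW (toℕ i) P (zero , false))
  w-at : ∀ i → app w (i , false) ≡ iterW (toℕ i) P (zero , false)
  w-at i = trans (app-lookup w i) (VP.lookup∘tabulate (λ i → iterW (toℕ i) P (zero , false)) i)
  noret : ∀ s t → s < t → t < suc n → proj₁ (iterW s P (zero , false)) ≢ proj₁ (iterW t P (zero , false))
  noret s (suc t) (s≤s le) (s≤s lt) e = Ret.miss R (t ∸ s) (≤-trans (s≤s (m∸n≤m t s)) lt) (sym (iter-inj₁ pm s (zero , false) (iterW (suc (t ∸ s)) P (zero , false))
    (trans e (cong proj₁ (trans (cong (λ x → iterW x P (zero , false)) (sym (trans (+-suc s (t ∸ s)) (cong suc (m+[n∸m]≡n le))))) (iter-+ s (suc (t ∸ s)) P (zero , false)))))))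
  pw : ∀ i j → proj₁ (lookup w i) ≡ proj₁ (lookup w j) → i ≡ j
  pw i j e with <-cmp (toℕ i) (toℕ j)
  ... | tri≈ _ q _ = toℕ-injective q
  ... | tri< l _ _ = ⊥-elim (noret (toℕ i) (toℕ j) l (toℕ<n j) (trans (sym (cong proj₁ (w-at i))) (trans e (cong proj₁ (w-at j)))))
  ... | tri> _ _ l = ⊥-elim (noret (toℕ j) (toℕ i) l (toℕ<n i) (trans (sym (cong proj₁ (w-at j))) (trans (sym e) (cong proj₁ (w-at i)))))
  cj : ∀ i → app (P · w) (i , false) ≡ app (w · cox (suc n)) (i , false)
  cj i = trans (app-· P w (i , false)) (trans (cong (app P) (w-at i)) (sym (trans (app-· w (cox (suc n)) (i , false)) (trans (cong (app w) (cox-next i)) (by (m≤n⇒m<n∨m≡n (s≤s⁻¹ (toℕ<n i))))))))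
    where
    by : toℕ i < n ⊎ toℕ i ≡ n → app w (next i) ≡ app P (iterW (toℕ i) P (zero , false))
    by (inj₁ lt) = trans (cong (app w) (next-lt i j (toℕ-fromℕ< (s≤s lt)))) (trans (w-at j) (cong (λ t → iterW t P (zero , false)) (toℕ-fromℕ< (s≤s lt))))
      where
      j : Fin (suc n)
      j = fromℕ< (s≤s lt)
    -- c sends the last vertex to 1̄, which matches the barred return of the orbit of P to 1.
    by (inj₂ e) = trans (cong (app w) (next-last i e)) (trans (app-fin w zero true) (trans (cong (_⊕ true) (w-at zero))
       (sym (trans (cong (λ t → iterW (suc t) P (zero , false)) e) (Ret.hit R)))))

-- Conjugation, and the count of tuples with any long product

conj : (w : RawW n) → Perm w → RawW n → RawW n
conj w pw g = (w · g) · inv w pw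

app-conj : ∀ (w : RawW n) pw g p → app (conj w pw g) (app w p) ≡ app w (app g p)
app-conj w pw g p = trans (app-· (w · g) (inv w pw) _) (trans (app-· w g _) (cong (λ x → app w (app g x)) (app-inv-left w pw p)))

conj-inv : ∀ (w : RawW n) pw g → (inv w pw · conj w pw g) · w ≡ g
conj-inv w pw g = W-ext (λ i → trans (app-· (inv w pw · conj w pw g) w _) (trans (app-· (inv w pw) (conj w pw g) _)
  (trans (cong (app (inv w pw)) (app-conj w pw g _)) (app-inv-left w pw _))))

inv-conj : ∀ (w : RawW n) pw g → conj w pw ((inv w pw · g) · w) ≡ g
inv-conj w pw g = W-ext h
  where
  h : ∀ i → app (conj w pw ((inv w pw · g) · w)) (i , false) ≡ app g (i , false)
  h i = trans (cong (app (conj w pw ((inv w pw · g) · w))) (sym (app-inv-right w pw (i , false))))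
    (trans (app-conj w pw ((inv w pw · g) · w) y) (trans (cong (app w) (trans (app-· (inv w pw · g) w y) (app-· (inv w pw) g (app w y))))
      (trans (app-inv-right w pw _) (cong (app g) (app-inv-right w pw (i , false))))))
    where y = app (inv w pw) (i , false)

conj-Perm : ∀ (w : RawW n) pw g → Perm g → Perm (conj w pw g)
conj-Perm w pw g pg = ·-Perm (·-Perm pw pg) (inv-Perm w pw)

conj-Perm⁻ : ∀ (w : RawW n) pw g → Perm (conj w pw g) → Perm g
conj-Perm⁻ w pw g pc = subst Perm (conj-inv w pw g) (·-Perm (·-Perm (inv-Perm w pw) pc) pw)

conj-prod : ∀ (w : RawW n) pw (f : Vec (RawW n) M) → prodV (Vec.map (conj w pw) f) · w ≡ w · prodV f
conj-prod w pw [] = trans (·-idˡ w) (sym (·-idʳ w))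
conj-prod w pw (g ∷ f) = begin
  (conj w pw g · Q) · w ≡⟨ ·-assoc (conj w pw g) Q w ⟩
  conj w pw g · (Q · w) ≡⟨ cong (conj w pw g ·_) (conj-prod w pw f) ⟩
  conj w pw g · (w · prodV f) ≡⟨ W-ext (λ i → trans (app-· (conj w pw g) (w · prodV f) _) (trans (cong (app (conj w pw g)) (app-· w (prodV f) _))
     (trans (app-conj w pw g _) (trans (cong (app w) (sym (app-· g (prodV f) _))) (sym (app-· w (g · prodV f) _)))))) ⟩
  w · (g · prodV f) ∎
  where
  open ≡-Reasoning
  Q = prodV (Vec.map (conj w pw) f)

-- `w` may send the base vertex to a barred point; shifting the whole image by that bar makes the
-- cycle start unbarred again.
conjC : RawW n → Cycle n → Cycle n
conjC w (v , us , fl) = proj₁ (lookup w v) , map (λ y → app w y ⊕ proj₂ (lookup w v)) us , fl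

chain-conj : ∀ (w : RawW n) pw g p us e β → Chain g p us e → Chain (conj w pw g) (app w p ⊕ β) (map (λ y → app w y ⊕ β) us) (app w e ⊕ β)
chain-conj w pw g p [] e β c = trans (app-⊕ (conj w pw g) (app w p) β) (cong (_⊕ β) (trans (app-conj w pw g p) (cong (app w) c)))
chain-conj w pw g p (y ∷ us) e β (c , cs) = trans (app-⊕ (conj w pw g) (app w p) β) (cong (_⊕ β) (trans (app-conj w pw g p) (cong (app w) c))) ,
  chain-conj w pw g y us e β cs

conj-cyc : ∀ (w : RawW n) pw g z → IsCyc g z → IsCyc (conj w pw g) (conjC w z)
conj-cyc w pw g (v , us , fl) c = subst₂ (λ x y → Chain (conj w pw g) x (map (λ y → app w y ⊕ β) us) y)
   (cong (proj₁ (lookup w v) ,_) (trans (cong (_xor β) (BP.xor-identityʳ β)) (xor-self β)))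
   (cong (proj₁ (lookup w v) ,_) (trans (BP.xor-comm (β xor fl) β) (trans (sym (BP.xor-assoc β β fl)) (cong (_xor fl) (xor-self β)))))
   (chain-conj w pw g (v , false) us (v , fl) β c)
  where β = proj₂ (lookup w v)

conj-letters : ∀ (w : RawW n) cs → letters (map (conjC w) cs) ≡ letters cs
conj-letters w [] = refl
conj-letters w ((v , us , fl) ∷ cs) = cong₂ _∷_ (cong (_, fl) (LP.length-map _ us)) (conj-letters w cs)

conj-full : ∀ (w : RawW n) pw g cs → Full g cs → Full (conj w pw g) (map (conjC w) cs)
conj-full {n} w pw g cs fl = full (go cs (cycF fl)) cov
  where
  go : ∀ cs → All (IsCyc g) cs → All (IsCyc (conj w pw g)) (map (conjC w) cs)
  go [] [] = []
  go (z ∷ cs) (c ∷ a) = conj-cyc w pw g z c ∷ go cs a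
  π : Fin n → Fin n
  π i = proj₁ (lookup w i)
  same : ∀ i x → ⟦ π i ==F π x ⟧ ≡ ⟦ i ==F x ⟧
  same i x = cong ⟦_⟧ (bool-⇔ (λ e → ⌊⌋-yes (i ≟F x) (inj pw i x (==F-true e))) (λ e → ⌊⌋-yes (π i ≟F π x) (cong π (==F-true e))))
  us-occ : ∀ i β us → occ (π i) (map proj₁ (map (λ y → app w y ⊕ β) us)) ≡ occ i (map proj₁ us)
  us-occ i β [] = refl
  us-occ i β (y ∷ us) = cong₂ _+_ (same i (proj₁ y)) (us-occ i β us)
  vocc : ∀ i cs → occ (π i) (verts (map (conjC w) cs)) ≡ occ i (verts cs)
  vocc i [] = refl
  vocc i (z@(v , us , f) ∷ cs) = trans (occ-++ (π i) (vs (conjC w z)) (verts (map (conjC w) cs)))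
    (trans (cong₂ _+_ (cong₂ _+_ (same i v) (us-occ i (proj₂ (lookup w v)) us)) (vocc i cs)) (sym (occ-++ i (vs z) (verts cs))))
  cov : ∀ i → occ i (verts (map (conjC w) cs)) ≡ 1
  cov i with surj pw i
  ... | j , refl = trans (vocc j cs) (cover fl j)

-- A condition sees only the letters of a full list of cycles, and conjugation carries such a list
-- over with the same letters.
spec-conj : ∀ (s : Spec n) (w : RawW n) pw g → isSignedPerm (conj w pw g) ∧ p s (conj w pw g) ≡ isSignedPerm g ∧ p s g
spec-conj s w pw g = by (isSignedPerm g) refl
  where
  by : ∀ b → isSignedPerm g ≡ b → isSignedPerm (conj w pw g) ∧ p s (conj w pw g) ≡ isSignedPerm g ∧ p s g
  by false e = trans (cong (_∧ p s (conj w pw g)) (not-true (λ t → BP.not-¬ (trans (sym e) (Perm⇒isSignedPerm g (conj-Perm⁻ w pw g (isSignedPerm⇒Perm _ t)))) refl))) (sym (cong (_∧ p s g) e))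
  by true e = trans (cong (_∧ p s (conj w pw g)) (Perm⇒isSignedPerm _ (conj-Perm w pw g pg))) (trans same (sym (cong (_∧ p s g) e)))
    where
    pg : Perm g
    pg = isSignedPerm⇒Perm g e
    same : p s (conj w pw g) ≡ p s g
    same with full-exists pg
    ... | cs , fl = trans (link s (conj-Perm w pw g pg) (conj-full w pw g cs fl)) (trans (cong (a s) (conj-letters w cs)) (sym (link s pg fl)))

labCount : ℕ → ℕ
labCount n = ∑ (allVecs (suc n) (allPts (suc n))) (λ w → ⟦ isLab w ⟧)

module Factorisations {N M : ℕ} (sp : Fin M → Spec (suc N)) where

  nn = suc N

  tups : List (Vec (RawW nn) M)
  tups = allVecs M (allVecs nn (allPts nn))

  specB : Vec (RawW nn) M → Bool
  specB f = all (λ c → isSignedPerm (lookup f c) ∧ p (sp c) (lookup f c)) (allFin M)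

  N# : ℕ
  N# = ∑ tups (λ f → ⟦ specB f ∧ eqW (prodV f) (cox nn) ⟧)

  _≟T_ : DecidableEquality (Vec (RawW nn) M)
  _≟T_ = VP.≡-dec (_≟V_ {nn} {nn})

  all-cong : ∀ {k} (g h : Fin k → Bool) → (∀ c → g c ≡ h c) → all g (allFin k) ≡ all h (allFin k)
  all-cong g h e = bool-⇔ (λ t → fin-all h (λ c → trans (sym (e c)) (all-fin g t c))) (λ t → fin-all g (λ c → trans (e c) (all-fin h t c)))

  conj-count : ∀ w → ⟦ isLab w ⟧ * ∑ tups (λ f → ⟦ specB f ⟧ * ⟦ eqW (prodV f · w) (w · cox nn) ⟧) ≡ ⟦ isLab w ⟧ * N#
  conj-count w = ⟦⟧*-cong (isLab w) (λ e → go (isSignedPerm⇒Perm w (proj₁ (∧-true {isSignedPerm w} e))))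
    where
    go : Perm w → ∑ tups (λ f → ⟦ specB f ⟧ * ⟦ eqW (prodV f · w) (w · cox nn) ⟧) ≡ N#
    go pw = trans (sym (∑-reindex _≟T_ tups (allVecs-Enum _≟V_ (allVecs nn (allPts nn)) (RawW-Enum nn) M) φ ψ ψφ φψ (λ f → ⟦ specB f ⟧ * ⟦ eqW (prodV f · w) (w · cox nn) ⟧)))
      (∑-cong tups (λ f → trans (cong₂ (λ x y → ⟦ x ⟧ * ⟦ y ⟧) (sB f) (eB f)) (sym (⟦∧⟧ (specB f) _))))
      where
      φ ψ : Vec (RawW nn) M → Vec (RawW nn) M
      φ = Vec.map (conj w pw)
      ψ = Vec.map (λ g → (inv w pw · g) · w)
      ψφ : ∀ f → ψ (φ f) ≡ f
      ψφ f = trans (sym (VP.map-∘ _ _ f)) (trans (VP.map-cong (conj-inv w pw) f) (VP.map-id f))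
      φψ : ∀ f → φ (ψ f) ≡ f
      φψ f = trans (sym (VP.map-∘ _ _ f)) (trans (VP.map-cong (inv-conj w pw) f) (VP.map-id f))
      sB : ∀ f → specB (φ f) ≡ specB f
      sB f = all-cong _ _ (λ c → trans (cong (λ x → isSignedPerm x ∧ p (sp c) x) (VP.lookup-map c (conj w pw) f)) (spec-conj (sp c) w pw (lookup f c)))
      eB : ∀ f → eqW (prodV (φ f) · w) (w · cox nn) ≡ eqW (prodV f) (cox nn)
      eB f = bool-⇔ (λ t → trans (cong (λ x → eqW x (cox nn)) (cancel (prodV f) (cox nn) (trans (sym (conj-prod w pw f)) (eqW-true (prodV (φ f) · w) (w · cox nn) t)))) (eqW-refl (cox nn)))
        (λ t → trans (cong (λ x → eqW x (w · cox nn)) (trans (conj-prod w pw f) (cong (w ·_) (eqW-true (prodV f) (cox nn) t)))) (eqW-refl (w · cox nn)))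
        where
        cancel : ∀ x y → w · x ≡ w · y → x ≡ y
        cancel x y e = W-ext (λ i → Perm-inj pw _ _ (trans (sym (app-· w x (i , false))) (trans (cong (λ z → app z (i , false)) e) (app-· w y (i , false)))))

  -- Pairs of a tuple and a relabelling conjugating c into its product are counted twice. For a
  -- fixed tuple there is one if its product is long and none otherwise; for a fixed relabelling,
  -- conjugating all factors leaves the tuples with product c.
  long-count : ∑ tups (λ f → ⟦ specB f ∧ longB (prodV f) ⟧) ≡ labCount N * N#
  long-count = begin
    ∑ tups (λ f → ⟦ specB f ∧ longB (prodV f) ⟧) ≡⟨ ∑-cong tups (λ f → trans (⟦∧⟧ (specB f) _) (trans (cong (⟦ specB f ⟧ *_) (ν-long (prodV f))) (sym (∑-*ˡ ws ⟦ specB f ⟧ _)))) ⟩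
    ∑ tups (λ f → ∑ ws (λ w → ⟦ specB f ⟧ * ⟦ conjugates (prodV f) w ⟧)) ≡⟨ ∑-swap tups ws _ ⟩
    ∑ ws (λ w → ∑ tups (λ f → ⟦ specB f ⟧ * ⟦ conjugates (prodV f) w ⟧))
      ≡⟨ ∑-cong ws (λ w → trans (∑-cong tups (λ f → trans (cong (⟦ specB f ⟧ *_) (⟦∧⟧ (isLab w) _)) (lem ⟦ specB f ⟧ ⟦ isLab w ⟧ _))) (trans (∑-*ˡ tups ⟦ isLab w ⟧ _) (conj-count w))) ⟩
    ∑ ws (λ w → ⟦ isLab w ⟧ * N#) ≡⟨ ∑-*ʳ ws N# _ ⟩
    labCount N * N# ∎
    where
    open ≡-Reasoning
    ws = allVecs nn (allPts nn)
    lem : ∀ x y z → x * (y * z) ≡ y * (x * z)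
    lem = solve-∀

module _ {N M : ℕ} (sp : Fin (suc M) → Spec (suc N)) where

  open Factorisations sp

  module _ (Σb : sumF (λ c → b (sp c)) ≡ 1) (Σm : sumF (λ c → m (sp c)) ≡ N) where

    open Exploration sp Σb Σm longB long⇒ long⇐ hiding (nn; _≟T_)
    open Count sp Σm hiding (nn)

    st₀ : Vec (List (Cycle nn)) (suc M)
    st₀ = Vec.replicate (suc M) []

    f₀ : Vec (RawW nn) (suc M)
    f₀ = Vec.replicate (suc M) idW

    at-st₀ : ∀ c → lookup st₀ c ≡ []
    at-st₀ c = VP.lookup-replicate c []

    at-f₀ : ∀ c → lookup f₀ c ≡ idW
    at-f₀ c = VP.lookup-replicate c idW

    at-ws₀ : ∀ c → lookup (words st₀) c ≡ []
    at-ws₀ c = trans (lookup-words st₀ c) (cong letters (at-st₀ c))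

    sumF-zero : ∀ {k} {f : Fin k → ℕ} → (∀ c → f c ≡ 0) → sumF f ≡ 0
    sumF-zero {k} e = trans (sumF-cong e) (trans (sumF-const {k} 0) (*-zeroʳ k))

    live₀ : LiveSt st₀ (zero ∷ []) f₀
    live₀ = record
      { perms = λ c → subst Perm (sym (at-f₀ c)) id-Perm
      ; parts = λ c → subst (Part (lookup f₀ c)) (sym (at-st₀ c)) (part [] (nodup (λ i → z≤n)))
      ; fixes = λ c i m → trans (cong (λ w → app w (i , false)) (at-f₀ c)) (app-id (i , false))
      ; zD = here refl
      ; ndD = nodup-cons (λ ()) (nodup (λ i → z≤n))
      ; within = λ c i m → ⊥-elim (absurd (subst (λ x → i ∈ verts x) (at-st₀ c) m))
      ; trans-on = λ { i (here refl) → 0 , refl }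
      ; count = cong suc (sym (sumF-zero (λ c → cong (size ∘ letters) (at-st₀ c)))) }
      where
      absurd : ∀ {i : Fin nn} → i ∈ [] → ⊥
      absurd ()

    ws₀ : Words (suc M)
    ws₀ = words st₀

    q₀ : unmet nn ws₀ ≡ N
    q₀ = cong (N ∸_) (sumF-zero (λ c → cong size (at-ws₀ c)))

    K₀ : ∀ c → K' ws₀ c ≡ K (sp c)
    K₀ c = cong (λ x → K (sp c) ∸ length x) (at-ws₀ c)

    m₀ : ∀ c → m' ws₀ c ≡ m (sp c)
    m₀ c = cong (λ x → m (sp c) ∸ size x) (at-ws₀ c)

    U₀ : ∀ c → U ws₀ c ≡ nn
    U₀ c = trans (cong₂ _+_ (K₀ c) (m₀ c)) (K+m (sp c))

    W₀ : ∀ c → W ws₀ c ≡ weight (sp c) []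
    W₀ c = cong (weight (sp c)) (at-ws₀ c)

    k₀ : ℕ
    k₀ = nn * suc M

    start : ∑ tups (λ f → ⟦ specB f ∧ longB (prodV f) ⟧) ≡ labels N * good# sp k₀ ws₀
    start = trans (∑-cong tups (λ f → cong (λ x → ⟦ x ∧ suppB f ⟧) (sym (agree⇐ st₀ f (λ c → subst (All (IsCyc (lookup f c))) (sym (at-st₀ c)) [])))))
      (trans (explore k₀ live₀ (≤-trans (sumF-mono {g = λ _ → nn} (λ c → m∸n≤m nn (length (verts (lookup st₀ c))))) (≤-reflexive (trans (sumF-const {suc M} nn) (*-comm (suc M) nn)))))
        (cong (λ x → labels x * good# sp k₀ ws₀) q₀))

    goods : prodF (λ c → K (sp c)) * good# sp k₀ ws₀ ≡ nn ^ M * prodF (λ c → weight (sp c) [])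
    goods = by (any? (λ c → W ws₀ c Data.Nat.≟ 0))
      where
      by : Dec (∃ λ c → W ws₀ c ≡ 0) → prodF (λ c → K (sp c)) * good# sp k₀ ws₀ ≡ nn ^ M * prodF (λ c → weight (sp c) [])
      by (yes (c , e)) = trans (cong (prodF (λ c → K (sp c)) *_) (good-0 k₀ ws₀ c e)) (trans (*-zeroʳ (prodF (λ c → K (sp c))))
        (sym (trans (cong (nn ^ M *_) (prodF-0 (λ c → weight (sp c) []) c (trans (sym (W₀ c)) e))) (*-zeroʳ (nn ^ M)))))
      -- At the start all U equal n and Σ m = N, so n · `mixed` is N ∏ U. Multiplied by n, the
      -- identity reads n ∏ K · G = (n - N) ∏ U ∏ W, where n - N is 1 and ∏ U is n · n^M.
      by (no ¬e) = *-cancelˡ-≡ _ _ nn (+-cancelʳ-≡ (N * prodF (U ws₀) * ΠW) _ _ (begin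
        nn * (prodF (λ c → K (sp c)) * G) + N * prodF (U ws₀) * ΠW ≡⟨ cong₂ (λ x y → nn * (x * G) + y * ΠW) (sym (prodF-cong K₀))
            (trans (cong (_* prodF (U ws₀)) (sym (trans (sumF-cong m₀) Σm))) (sym (mixed-const (U ws₀) (m' ws₀) nn U₀))) ⟩
        nn * (prodF (K' ws₀) * G) + nn * mixed (U ws₀) (m' ws₀) * ΠW ≡⟨ lem₁ nn (prodF (K' ws₀) * G) (mixed (U ws₀) (m' ws₀)) ΠW ⟩
        nn * (prodF (K' ws₀) * G + mixed (U ws₀) (m' ws₀) * ΠW) ≡⟨ cong (λ x → nn * (prodF (K' ws₀) * G + mixed (U ws₀) (m' ws₀) * x)) (sym (prodF-cong W₀)) ⟩
        nn * (prodF (K' ws₀) * G + mixed (U ws₀) (m' ws₀) * prodF (W ws₀)) ≡⟨ cong (nn *_) (proj₂ (count-good# k₀ ws₀ ok fuel)) ⟩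
        nn * (prodF (U ws₀) * prodF (W ws₀)) ≡⟨ cong (λ x → nn * (prodF (U ws₀) * x)) (prodF-cong W₀) ⟩
        nn * (prodF (U ws₀) * ΠW) ≡⟨ lem₂ N (prodF (U ws₀)) ΠW ⟩
        prodF (U ws₀) * ΠW + N * prodF (U ws₀) * ΠW ≡⟨ cong (λ x → x * ΠW + N * prodF (U ws₀) * ΠW) (trans (prodF-cong U₀) (prodF-const {suc M} nn)) ⟩
        nn * nn ^ M * ΠW + N * prodF (U ws₀) * ΠW ≡⟨ cong (_+ N * prodF (U ws₀) * ΠW) (*-assoc nn (nn ^ M) ΠW) ⟩
        nn * (nn ^ M * ΠW) + N * prodF (U ws₀) * ΠW ∎))
        where
        open ≡-Reasoning
        G = good# sp k₀ ws₀
        ΠW = prodF (λ c → weight (sp c) [])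
        lem₁ : ∀ n x y w → n * x + n * y * w ≡ n * (x + y * w)
        lem₁ = solve-∀
        lem₂ : ∀ N u w → suc N * (u * w) ≡ u * w + N * u * w
        lem₂ = solve-∀
        ok : Ok ws₀
        ok = record { pos = λ c e → ¬e (c , e) ; enough = λ c → ≤-trans (≤-reflexive q₀) (≤-trans (n≤1+n N) (≤-reflexive (sym (U₀ c)))) }
        fuel : sumF (U ws₀) ≤ k₀
        fuel = ≤-reflexive (trans (sumF-cong U₀) (trans (sumF-const {suc M} nn) (*-comm (suc M) nn)))

    labelled-count : labCount N * N# * prodF (λ c → K (sp c)) ≡ labels N * (nn ^ M * prodF (λ c → weight (sp c) []))
    labelled-count = begin
      labCount N * N# * ΠK ≡⟨ cong (_* ΠK) (trans (sym long-count) start) ⟩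
      labels N * G * ΠK ≡⟨ trans (*-assoc (labels N) G ΠK) (cong (labels N *_) (trans (*-comm G ΠK) goods)) ⟩
      labels N * (nn ^ M * prodF (λ c → weight (sp c) [])) ∎
      where
      open ≡-Reasoning
      G = good# sp k₀ ws₀
      ΠK = prodF (λ c → K (sp c))

labels-pos : ∀ q → NonZero (labels q)
labels-pos zero = _
labels-pos (suc q) = m*n≢0 (2 * suc q) (labels q) {{_}} {{labels-pos q}}

-- Conditions given by a type or by a rank

_∙_ : ∀ {A : Set} {x y z : A} → x ≡ y → y ≡ z → x ≡ z
_∙_ = trans
infixr 5 _∙_
∑-↭ : ∀ {ls ls' : List A} (f : A → ℕ) → ls ↭ ls' → ∑ ls f ≡ ∑ ls' f
∑-↭ f ↭.refl = refl
∑-↭ f (↭.prep x p) = cong (f x +_) (∑-↭ f p)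
∑-↭ f (↭.swap x y p) = sym (+-assoc (f x) (f y) _) ∙ cong₂ _+_ (+-comm (f x) (f y)) (∑-↭ f p) ∙ +-assoc (f y) (f x) _
∑-↭ f (↭.trans p q) = ∑-↭ f p ∙ ∑-↭ f q

-- The letters A₀ (fixed point), A_{k+1} and B_{k+1}, the latter for k < n.
data InA (n : ℕ) : Letter → Set where
  l0 : InA n (0 , false)
  lA : ∀ (k : Fin n) → InA n (suc (toℕ k) , false)
  lB : ∀ (k : Fin n) → InA n (toℕ k , true)

small⇒InA : ∀ g fl → g < n → InA n (g , fl)
small⇒InA {n} zero false lt = l0
small⇒InA {n} (suc g) false lt = subst (λ x → InA n (suc x , false)) (toℕ-fromℕ< (<⇒≤ lt)) (lA (fromℕ< (<⇒≤ lt)))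
small⇒InA {n} g true lt = subst (λ x → InA n (x , true)) (toℕ-fromℕ< lt) (lB (fromℕ< lt))

⟦≟L⟧ : ∀ g f h f' → ⟦ ⌊ (g , f) ≟L (h , f') ⌋ ⟧ ≡ ⟦ ⌊ g Data.Nat.≟ h ⌋ ⟧ * ⟦ ⌊ f BP.≟ f' ⌋ ⟧
⟦≟L⟧ g f h f' = cong ⟦_⟧ (×-⌊⌋ Data.Nat._≟_ BP._≟_ g f h f') ∙ ⟦∧⟧ ⌊ g Data.Nat.≟ h ⌋ _

⌊≟ℕ⌋ : ∀ (i j : Fin n) → ⌊ toℕ i Data.Nat.≟ toℕ j ⌋ ≡ ⌊ i ≟F j ⌋
⌊≟ℕ⌋ i j = bool-⇔ (λ e → ⌊⌋-yes (i ≟F j) (toℕ-injective (⌊⌋-true (toℕ i Data.Nat.≟ toℕ j) e)))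
  (λ e → ⌊⌋-yes (toℕ i Data.Nat.≟ toℕ j) (cong toℕ (⌊⌋-true (i ≟F j) e)))

⌊suc⌋ : ∀ i j → ⌊ suc i Data.Nat.≟ suc j ⌋ ≡ ⌊ i Data.Nat.≟ j ⌋
⌊suc⌋ i j = bool-⇔ (λ e → ⌊⌋-yes (i Data.Nat.≟ j) (suc-injective (⌊⌋-true (suc i Data.Nat.≟ suc j) e)))
  (λ e → ⌊⌋-yes (suc i Data.Nat.≟ suc j) (cong suc (⌊⌋-true (i Data.Nat.≟ j) e)))

sumF-pick : ∀ (F : Fin n → ℕ) k → sumF (λ j → F j * ⟦ ⌊ j ≟F k ⌋ ⟧) ≡ F k
sumF-pick {n} F k = sym (∑-allFin {n} _) ∙ ∑-cong (allFin n) (λ j → *-comm (F j) _) ∙ ∑-pick _≟F_ (allFin n) (allFin-Enum n) k F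

sumF-zero' : ∀ {k} {f : Fin k → ℕ} → (∀ c → f c ≡ 0) → sumF f ≡ 0
sumF-zero' {k} e = sumF-cong e ∙ sumF-const {k} 0 ∙ *-zeroʳ k

-- The sum of F over a word that contains each letter ℓ exactly c ℓ times.
spread : (n : ℕ) (F c : Letter → ℕ) → ℕ
spread n F c = F (0 , false) * c (0 , false) + (sumF {n} (λ k → F (suc (toℕ k) , false) * c (suc (toℕ k) , false)) + sumF {n} (λ k → F (toℕ k , true) * c (toℕ k , true)))

spread-δ : ∀ (F : Letter → ℕ) {ℓ} → InA n ℓ → spread n F (λ x → ⟦ ⌊ ℓ ≟L x ⌋ ⟧) ≡ F ℓ
spread-δ {n} F l0 = cong₂ _+_ (*-identityʳ _) (cong₂ _+_ (sumF-zero' {n} (λ k → *-zeroʳ (F (suc (toℕ k) , false)))) (sumF-zero' {n} (λ k → cong (F (toℕ k , true) *_) (⟦≟L⟧ 0 false (toℕ k) true ∙ *-zeroʳ ⟦ ⌊ 0 Data.Nat.≟ toℕ k ⌋ ⟧) ∙ *-zeroʳ (F (toℕ k , true))))) ∙ +-identityʳ _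
spread-δ {n} F (lA k) = cong₂ _+_ (*-zeroʳ (F (0 , false))) (cong₂ _+_
    (sumF-cong (λ j → cong (F (suc (toℕ j) , false) *_) (⟦≟L⟧ (suc (toℕ k)) false (suc (toℕ j)) false ∙ *-identityʳ _ ∙ cong ⟦_⟧ (⌊suc⌋ (toℕ k) (toℕ j) ∙ ⌊≟ℕ⌋ k j ∙ flip k j))) ∙ sumF-pick (λ j → F (suc (toℕ j) , false)) k)
    (sumF-zero' {n} (λ j → cong (F (toℕ j , true) *_) (⟦≟L⟧ (suc (toℕ k)) false (toℕ j) true ∙ *-zeroʳ ⟦ ⌊ suc (toℕ k) Data.Nat.≟ toℕ j ⌋ ⟧) ∙ *-zeroʳ (F (toℕ j , true))))) ∙ +-identityʳ _
  where
  flip : ∀ (k j : Fin n) → ⌊ k ≟F j ⌋ ≡ ⌊ j ≟F k ⌋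
  flip k j = bool-⇔ (λ e → ⌊⌋-yes (j ≟F k) (sym (⌊⌋-true (k ≟F j) e))) (λ e → ⌊⌋-yes (k ≟F j) (sym (⌊⌋-true (j ≟F k) e)))
spread-δ {n} F (lB k) = cong₂ _+_ (cong (F (0 , false) *_) (⟦≟L⟧ (toℕ k) true 0 false ∙ *-zeroʳ ⟦ ⌊ toℕ k Data.Nat.≟ 0 ⌋ ⟧) ∙ *-zeroʳ (F (0 , false))) (cong₂ _+_
    (sumF-zero' {n} (λ j → cong (F (suc (toℕ j) , false) *_) (⟦≟L⟧ (toℕ k) true (suc (toℕ j)) false ∙ *-zeroʳ ⟦ ⌊ toℕ k Data.Nat.≟ suc (toℕ j) ⌋ ⟧) ∙ *-zeroʳ (F (suc (toℕ j) , false))))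
    (sumF-cong (λ j → cong (F (toℕ j , true) *_) (⟦≟L⟧ (toℕ k) true (toℕ j) true ∙ *-identityʳ _ ∙ cong ⟦_⟧ (⌊≟ℕ⌋ k j ∙ flip k j))) ∙ sumF-pick (λ j → F (toℕ j , true)) k))
  where
  flip : ∀ (k j : Fin n) → ⌊ k ≟F j ⌋ ≡ ⌊ j ≟F k ⌋
  flip k j = bool-⇔ (λ e → ⌊⌋-yes (j ≟F k) (sym (⌊⌋-true (k ≟F j) e))) (λ e → ⌊⌋-yes (k ≟F j) (sym (⌊⌋-true (j ≟F k) e)))

spread-+ : ∀ n (F c d : Letter → ℕ) → spread n F (λ x → c x + d x) ≡ spread n F c + spread n F d
spread-+ n F c d = cong₂ _+_ (*-distribˡ-+ (F (0 , false)) _ _) (cong₂ _+_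
    (sumF-cong {n} (λ k → *-distribˡ-+ (F (suc (toℕ k) , false)) _ _) ∙ sumF-+ {n} _ _)
    (sumF-cong {n} (λ k → *-distribˡ-+ (F (toℕ k , true)) _ _) ∙ sumF-+ {n} _ _) ∙ interchange (sumF {n} (λ k → F (suc (toℕ k) , false) * c (suc (toℕ k) , false))) _ _ _)
  ∙ interchange (F (0 , false) * c (0 , false)) _ _ _

spread-0 : ∀ n (F : Letter → ℕ) → spread n F (λ _ → 0) ≡ 0
spread-0 n F = cong₂ _+_ (*-zeroʳ (F (0 , false))) (cong₂ _+_ (sumF-zero' {n} (λ k → *-zeroʳ (F (suc (toℕ k) , false)))) (sumF-zero' {n} (λ k → *-zeroʳ (F (toℕ k , true)))))

-- With F the size, the flag or the constant 1, this computes the size, the number of type B cycles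
-- or the length of a word from its multiplicities.
content : ∀ (F : Letter → ℕ) {ls} → All (InA n) ls → ∑ ls F ≡ spread n F (λ ℓ → # ℓ ins ls)
content {n} F [] = sym (spread-0 n F)
content {n} F {ℓ ∷ ls} (i ∷ is) = cong₂ _+_ (sym (spread-δ F i)) (content F is) ∙ sym (spread-+ n F (λ x → ⟦ ⌊ ℓ ≟L x ⌋ ⟧) (λ x → # x ins ls))

full-InA : ∀ {w : RawW n} {cs} → Full w cs → All (InA n) (letters cs)
full-InA {n} {w} {cs} fl = go cs (nd (Full⇒Part fl))
  where
  go : ∀ cs → Nodup (verts cs) → All (InA n) (letters cs)
  go [] _ = []
  go (z@(v , us , f) ∷ cs) ndz = small⇒InA (length us) f (cycle-size z (nodup-++ˡ {ys = verts cs} ndz)) ∷ go cs (nodup-++ʳ {xs = vs z} ndz)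

full-length : ∀ {w : RawW n} {cs} → Full w cs → length (letters cs) + size (letters cs) ≡ n
full-length {n} {w} {cs} fl = sym (length-verts cs) ∙ length-occ (verts cs) ∙ sumF-cong (cover fl) ∙ sumF-const {n} 1 ∙ *-identityʳ n

-- `Spec` demands fixed length, size and flag count for every accepted list of letters, even one
-- that belongs to no signed permutation; so these tests are added to `a₀`. On the letters of a full
-- list of cycles they follow from `a₀`.
mkSpec : (p : RawW n → Bool) (a₀ : List Letter → Bool) (K m b : ℕ) → K + m ≡ n →
  (∀ {ls ls'} → ls ↭ ls' → a₀ ls ≡ a₀ ls') →
  (∀ {w cs} → Perm w → Full w cs → p w ≡ a₀ (letters cs)) →
  (∀ ls → All (InA n) ls → a₀ ls ≡ true → size ls ≡ m × nB ls ≡ b) → Spec n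
mkSpec {n} p a₀ K m b K+m≡n perm link₀ det = record
  { p = p ; a = a' ; K = K ; m = m ; b = b ; K+m = K+m≡n
  ; link = λ {w} {cs} pw fl → link₀ pw fl ∙ bool-⇔ (λ e → let (s , t) = det (letters cs) (full-InA fl) e in
       ∧-intro e (∧-intro (subst (λ x → (length (letters cs) ≡ᵇ x) ≡ true) (+-cancelʳ-≡ m _ _ (cong (length (letters cs) +_) (sym s) ∙ full-length fl ∙ sym K+m≡n)) (≡ᵇ-refl (length (letters cs))))
         (∧-intro (cong (_≡ᵇ m) s ∙ ≡ᵇ-refl m) (cong (_≡ᵇ b) t ∙ ≡ᵇ-refl b)))) (λ e → proj₁ (∧-true e))
  ; a-perm = λ q → cong₂ _∧_ (perm q) (cong₂ _∧_ (cong (_≡ᵇ K) (↭-length q)) (cong₂ _∧_ (cong (_≡ᵇ m) (∑-↭ proj₁ q)) (cong (_≡ᵇ b) (∑-↭ _ q))))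
  ; a-length = λ ls e → ≡ᵇ-true _ _ (proj₁ (∧-true (proj₂ (∧-true {a₀ ls} e))))
  ; a-size = λ ls e → ≡ᵇ-true _ _ (proj₁ (∧-true (proj₂ (∧-true {length ls ≡ᵇ K} (proj₂ (∧-true {a₀ ls} e))))))
  ; a-nB = λ ls e → ≡ᵇ-true _ _ (proj₂ (∧-true {size ls ≡ᵇ m} (proj₂ (∧-true {length ls ≡ᵇ K} (proj₂ (∧-true {a₀ ls} e)))))) }
  where
  a' : List Letter → Bool
  a' ls = a₀ ls ∧ (length ls ≡ᵇ K) ∧ (size ls ≡ᵇ m) ∧ (nB ls ≡ᵇ b)

uB : RawW n → ℕ
uB {n} w = sumF {n} (λ k → bMult w (toℕ k))

nB-content : ∀ {ls} → All (InA n) ls → nB ls ≡ sumF {n} (λ k → # (toℕ k , true) ins ls)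
nB-content {n} {ls} al = content (λ ℓ → ⟦ proj₂ ℓ ⟧) al ∙ cong₂ _+_ (sumF-zero' {n} (λ k → refl)) (sumF-cong {n} (λ k → *-identityˡ _))

uB-letters : ∀ {w : RawW n} → Perm w → ∀ {cs} → Full w cs → uB w ≡ nB (letters cs)
uB-letters {n} pm fl = sumF-cong {n} (λ k → bMult-letters pm fl (toℕ k)) ∙ sym (nB-content (full-InA fl))

ρ-size : ∀ ls → ρ ls ≡ size ls + nB ls
ρ-size ls = ∑-+ ls proj₁ (λ ℓ → ⟦ proj₂ ℓ ⟧)

-- The rank alone leaves the number of cycles open, since it exceeds the size by the number of type
-- B cycles; hence that number is prescribed as well.
rankP : ℕ → ℕ → RawW n → Bool
rankP r b w = (ℓT w ≡ᵇ r) ∧ (uB w ≡ᵇ b)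

ranked : ∀ n r b → r ∸ b ≤ n → Spec n
ranked n r b le = mkSpec (rankP r b) (λ ls → (ρ ls ≡ᵇ r) ∧ (nB ls ≡ᵇ b)) (n ∸ (r ∸ b)) (r ∸ b) b (m∸n+n≡m le)
  (λ q → cong₂ (λ x y → (x ≡ᵇ r) ∧ (y ≡ᵇ b)) (∑-↭ _ q) (∑-↭ _ q))
  (λ pw fl → cong₂ (λ x y → (x ≡ᵇ r) ∧ (y ≡ᵇ b)) (ℓT-letters fl) (uB-letters pw fl))
  (λ ls al e → let (e₁ , e₂) = ∧-true {ρ ls ≡ᵇ r} e ; q = ≡ᵇ-true (nB ls) b e₂ in
     (sym (m+n∸n≡m (size ls) (nB ls)) ∙ cong₂ _∸_ (sym (ρ-size ls) ∙ ≡ᵇ-true (ρ ls) r e₁) q) , q)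

typeB : (A : Fin n → ℕ) → Maybe ℕ → List Letter → Bool
typeB {n} A β ls = all (λ k → (# (suc (toℕ k) , false) ins ls ≡ᵇ A k) ∧ (# (toℕ k , true) ins ls ≡ᵇ bMulOf {n} (ctype A β) (toℕ k))) (allFin n)

flags : Maybe ℕ → ℕ
flags = maybe (λ _ → 1) 0

-- For α outside this range `hasType` would not see the factor B_α at all.
below : ℕ → Maybe ℕ → Set
below n nothing = 0 ≡ 0
below n (just α) = 1 ≤ α × α ≤ n

sum-bMul : ∀ (A : Fin n → ℕ) β (F : ℕ → ℕ) → below n β → sumF {n} (λ k → F (toℕ k) * bMulOf {n} (ctype A β) (toℕ k)) ≡ maybe (λ α → F (α ∸ 1)) 0 β
sum-bMul {n} A nothing F _ = sumF-zero' {n} (λ k → *-zeroʳ (F (toℕ k)))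
sum-bMul {n} A (just (suc α)) F (_ , le) = sumF-cong {n} (λ k → cong (F (toℕ k) *_) (h k)) ∙ sumF-pick (λ k → F (toℕ k)) κ ∙ cong F (toℕ-fromℕ< le)
  where
  κ : Fin n
  κ = fromℕ< le
  h : ∀ k → (if suc α ≡ᵇ suc (toℕ k) then 1 else 0) ≡ ⟦ ⌊ k ≟F κ ⌋ ⟧
  h k with α ≡ᵇ toℕ k in eq
  ... | true = cong ⟦_⟧ (sym (⌊⌋-yes (k ≟F κ) (toℕ-injective (sym (≡ᵇ-true α (toℕ k) eq) ∙ sym (toℕ-fromℕ< le)))))
  ... | false = cong ⟦_⟧ (sym (⌊⌋-no (k ≟F κ) (λ { refl → BP.not-¬ (sym eq ∙ cong (α ≡ᵇ_) (toℕ-fromℕ< le) ∙ ≡ᵇ-refl α) refl })))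

typeB-# : ∀ (A : Fin n → ℕ) β ls → typeB A β ls ≡ true → ∀ k → # (suc (toℕ k) , false) ins ls ≡ A k × # (toℕ k , true) ins ls ≡ bMulOf {n} (ctype A β) (toℕ k)
typeB-# A β ls e k with ∧-true {# (suc (toℕ k) , false) ins ls ≡ᵇ A k} (all-fin _ e k)
... | e₁ , e₂ = ≡ᵇ-true _ _ e₁ , ≡ᵇ-true _ _ e₂

-- The rank with B_α counted as α - 1, because B_α is the letter (α - 1, true). Its complement in n
-- is the number of cycles.
tsize : (A : Fin n → ℕ) → Maybe ℕ → ℕ
tsize {n} A β = sumF {n} (λ k → suc (toℕ k) * A k) + maybe (λ α → α ∸ 1) 0 β

typed-det : ∀ (A : Fin n → ℕ) β → below n β → ∀ ls → All (InA n) ls → typeB A β ls ≡ true → size ls ≡ tsize A β × nB ls ≡ flags β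
typed-det {n} A β bl ls al e =
  (content proj₁ al ∙ cong₂ _+_ (sumF-cong {n} (λ k → cong (suc (toℕ k) *_) (proj₁ (typeB-# A β ls e k))))
     (sumF-cong {n} (λ k → cong (toℕ k *_) (proj₂ (typeB-# A β ls e k))) ∙ sum-bMul A β id bl)) ,
  (nB-content al ∙ sumF-cong {n} (λ k → proj₂ (typeB-# A β ls e k) ∙ sym (*-identityˡ _)) ∙ sum-bMul A β (λ _ → 1) bl)

typed : ∀ n (A : Fin n → ℕ) β → below n β → tsize A β ≤ n → Spec n
typed n A β bl le = mkSpec (λ w → hasType w (ctype A β)) (typeB A β) (n ∸ tsize A β) (tsize A β) (flags β) (m∸n+n≡m le)
  (λ q → all-cong' _ _ (λ k → cong₂ (λ x y → (x ≡ᵇ A k) ∧ (y ≡ᵇ bMulOf {n} (ctype A β) (toℕ k))) (∑-↭ _ q) (∑-↭ _ q)))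
  (λ pw fl → all-cong' _ _ (λ k → cong₂ (λ x y → (x ≡ᵇ A k) ∧ (y ≡ᵇ bMulOf {n} (ctype A β) (toℕ k))) (aMult-letters pw fl (toℕ k)) (bMult-letters pw fl (toℕ k))))
  (typed-det A β bl)
  where
  all-cong' : ∀ {k} (g h : Fin k → Bool) → (∀ c → g c ≡ h c) → all g (allFin k) ≡ all h (allFin k)
  all-cong' g h e = bool-⇔ (λ t → fin-all h (λ c → sym (e c) ∙ all-fin g t c)) (λ t → fin-all g (λ c → e c ∙ all-fin h t c))

-- Words of a given type: multinomial coefficients

factProd-cong : ∀ {k} {f g : Fin k → ℕ} → (∀ i → f i ≡ g i) → factProd f ≡ factProd g
factProd-cong {zero} e = refl
factProd-cong {suc k} e = cong₂ (λ x y → x ! * y) (e zero) (factProd-cong (e ∘ suc))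

lower-at : (Fin M → ℕ) → Fin M → Fin M → ℕ
lower-at φ i j = φ j ∸ ⟦ j ==F i ⟧

factProd-lower : ∀ (φ : Fin M → ℕ) i r → φ i ≡ suc r → factProd φ ≡ suc r * factProd (lower-at φ i)
factProd-lower φ zero r e rewrite e = *-assoc (suc r) (r !) (factProd (φ ∘ suc))
factProd-lower {suc M} φ (suc i) r e = begin
  φ zero ! * factProd (φ ∘ suc) ≡⟨ cong (φ zero ! *_) (factProd-lower (φ ∘ suc) i r e) ⟩
  φ zero ! * (suc r * factProd (lower-at (φ ∘ suc) i)) ≡⟨ lem (φ zero !) (suc r) _ ⟩
  suc r * (φ zero ! * factProd (lower-at (φ ∘ suc) i)) ≡⟨ cong (λ x → suc r * (φ zero ! * x)) (factProd-cong (λ j → cong (λ b → φ (suc j) ∸ ⟦ b ⟧) (same j))) ⟩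
  suc r * factProd (lower-at φ (suc i)) ∎
  where
  open ≡-Reasoning
  lem : ∀ x y z → x * (y * z) ≡ y * (x * z)
  lem = solve-∀
  same : ∀ j → (j ==F i) ≡ (suc j ==F suc i)
  same j with j ≟F i
  ... | yes _ = refl
  ... | no _ = refl

sum-lower : ∀ (φ : Fin M → ℕ) i r → φ i ≡ suc r → suc (sumF (lower-at φ i)) ≡ sumF φ
sum-lower φ i r e = trans (cong (_+ sumF (lower-at φ i)) (sym (sumF-δ i))) (trans (sym (sumF-+ (λ j → ⟦ j ==F i ⟧) (lower-at φ i))) (sumF-cong h))
  where
  h : ∀ j → ⟦ j ==F i ⟧ + (φ j ∸ ⟦ j ==F i ⟧) ≡ φ j
  h j with j ≟F i
  ... | yes refl = m+[n∸m]≡n (≤-trans (s≤s z≤n) (≤-reflexive (sym e)))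
  ... | no _ = refl

hasContent : (Fin M → ℕ) → List (Fin M) → Bool
hasContent φ v = all (λ i → occ i v ≡ᵇ φ i) (allFin _)

arrangements : ℕ → (Fin M → ℕ) → ℕ
arrangements {M} k φ = ∑ (allLists k (allFin M)) (λ v → ⟦ hasContent φ v ⟧)

-- Split by the first letter x: lowering `φ` at x takes the factor φ x out of `factProd φ`, and
-- these factors add up to the length of the word.
arrangements-fact : ∀ k (φ : Fin M → ℕ) → sumF φ ≡ k → arrangements k φ * factProd φ ≡ k !
arrangements-fact {M} zero φ e = cong₂ (λ x y → (⟦ x ⟧ + 0) * y) (fin-all _ (λ i → cong (0 ≡ᵇ_) (z i))) (go φ z)
  where
  z : ∀ i → φ i ≡ 0
  z i = n≤0⇒n≡0 (≤-trans (sumF-single φ i) (≤-reflexive e))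
  go : ∀ {M} (φ : Fin M → ℕ) → (∀ i → φ i ≡ 0) → factProd φ ≡ 1
  go {zero} φ z = refl
  go {suc M} φ z rewrite z zero = trans (+-identityʳ _) (go (φ ∘ suc) (z ∘ suc))
arrangements-fact {M} (suc k) φ e = begin
  arrangements (suc k) φ * factProd φ ≡⟨ cong (_* factProd φ) (∑-allLists-suc k (allFin M) _) ⟩
  ∑ (allFin M) (λ x → ∑ (allLists k (allFin M)) (λ v → ⟦ hasContent φ (x ∷ v) ⟧)) * factProd φ ≡⟨ sym (∑-*ʳ (allFin M) (factProd φ) _) ⟩
  ∑ (allFin M) (λ x → ∑ (allLists k (allFin M)) (λ v → ⟦ hasContent φ (x ∷ v) ⟧) * factProd φ) ≡⟨ ∑-cong (allFin M) first ⟩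
  ∑ (allFin M) (λ x → φ x * k !) ≡⟨ ∑-*ʳ (allFin M) (k !) φ ⟩
  ∑ (allFin M) φ * k ! ≡⟨ cong (_* k !) (trans (∑-allFin {M} φ) e) ⟩
  suc k * k ! ∎
  where
  open ≡-Reasoning
  first : ∀ x → ∑ (allLists k (allFin M)) (λ v → ⟦ hasContent φ (x ∷ v) ⟧) * factProd φ ≡ φ x * k !
  first x with φ x in eq
  ... | zero = cong (_* factProd φ) (∑-zero (allLists k (allFin M)) (λ v → cong ⟦_⟧ (not-true (λ t → 1+n≢0 (bad v t)))))
    where
    bad : ∀ v → hasContent φ (x ∷ v) ≡ true → suc (occ x v) ≡ 0
    bad v t = trans (cong (λ b → ⟦ b ⟧ + occ x v) (sym (⌊⌋-yes (x ≟F x) refl))) (trans (≡ᵇ-true _ _ (all-fin _ t x)) eq)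
  ... | suc r = begin
    ∑ (allLists k (allFin M)) (λ v → ⟦ hasContent φ (x ∷ v) ⟧) * factProd φ
      ≡⟨ cong₂ _*_ (∑-cong (allLists k (allFin M)) (λ v → cong ⟦_⟧ (same v))) (factProd-lower φ x r eq) ⟩
    arrangements k (lower-at φ x) * (suc r * factProd (lower-at φ x)) ≡⟨ lem (arrangements k (lower-at φ x)) (suc r) _ ⟩
    suc r * (arrangements k (lower-at φ x) * factProd (lower-at φ x)) ≡⟨ cong (suc r *_) (arrangements-fact k (lower-at φ x) (suc-injective (trans (sum-lower φ x r eq) e))) ⟩
    suc r * k ! ∎
    where
    lem : ∀ x y z → x * (y * z) ≡ y * (x * z)
    lem = solve-∀
    same : ∀ v → hasContent φ (x ∷ v) ≡ hasContent (lower-at φ x) v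
    same v = bool-⇔ (λ t → fin-all _ (λ i → trans (sym (one i)) (all-fin _ t i))) (λ t → fin-all _ (λ i → trans (one i) (all-fin _ t i)))
      where
      one : ∀ i → (⟦ i ==F x ⟧ + occ i v ≡ᵇ φ i) ≡ (occ i v ≡ᵇ lower-at φ x i)
      one i with i ≟F x
      ... | yes refl rewrite eq = refl
      ... | no _ = refl

-- The division in `multinomial` is exact: the quotient counts the words of content A filled up with
-- M - ΣA copies of one more letter.
multinomial-fact : ∀ {k} M (A : Fin k → ℕ) → sumF A ≤ M → multinomial M A * (factProd A * (M ∸ sumF A) !) ≡ M !
multinomial-fact {k} M A le with sumF A ≤ᵇ M | ≤⇒≤ᵇ le
... | true | _ = trans (cong (_* D) (trans (/-congˡ {{nz}} (sym eq)) (m*n/n≡m x D {{nz}}))) eq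
  where
  D = factProd A * (M ∸ sumF A) !
  nz = m*n≢0 _ _ {{factProd≢0 A}} {{(M ∸ sumF A) !≢0}}
  φ : Fin (suc k) → ℕ
  φ zero = M ∸ sumF A
  φ (suc i) = A i
  x = arrangements M φ
  eq : x * D ≡ M !
  eq = trans (cong (x *_) (*-comm (factProd A) _)) (arrangements-fact M φ (m∸n+n≡m le))

multinomial-0 : ∀ {k} M (A : Fin k → ℕ) → M < sumF A → multinomial M A ≡ 0
multinomial-0 M A lt with sumF A ≤ᵇ M in eq
... | false = refl
... | true = ⊥-elim (<⇒≱ lt (≤ᵇ⇒≤ (sumF A) M (subst T (sym eq) _)))

glue : (Fin n → A) → (Fin n → A) → Fin (n + n) → A
glue {n} f g j = [ f , g ]′ (splitAt n j)

sumF-glue : ∀ m {n} (f : Fin m → ℕ) (g : Fin n → ℕ) → sumF (λ j → [ f , g ]′ (splitAt m j)) ≡ sumF f + sumF g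
sumF-glue zero f g = refl
sumF-glue (suc m) f g = trans (cong (f zero +_) (trans (sumF-cong (λ j → h (splitAt m j))) (sumF-glue m (f ∘ suc) g))) (sym (+-assoc (f zero) _ _))
  where
  h : ∀ s → [ f , g ]′ (Sum.map suc id s) ≡ [ f ∘ suc , g ]′ s
  h (inj₁ _) = refl
  h (inj₂ _) = refl

factProd-glue : ∀ m {n} (f : Fin m → ℕ) (g : Fin n → ℕ) → factProd (λ j → [ f , g ]′ (splitAt m j)) ≡ factProd f * factProd g
factProd-glue zero f g = sym (+-identityʳ _)
factProd-glue (suc m) f g = trans (cong (f zero ! *_) (trans (factProd-cong (λ j → h (splitAt m j))) (factProd-glue m (f ∘ suc) g))) (sym (*-assoc (f zero !) _ _))
  where
  h : ∀ s → [ f , g ]′ (Sum.map suc id s) ≡ [ f ∘ suc , g ]′ s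
  h (inj₁ _) = refl
  h (inj₂ _) = refl

-- Numbers the letters of `InA`, so that words with prescribed multiplicities become the
-- `arrangements` of indices.
spell : ∀ n → Fin (suc (n + n)) → Letter
spell n zero = 0 , false
spell n (suc j) = glue {n} (λ k → suc (toℕ k) , false) (λ k → toℕ k , true) j

spell-InA : ∀ n i → InA n (spell n i)
spell-InA n zero = l0
spell-InA n (suc j) with splitAt n j
... | inj₁ k = lA k
... | inj₂ k = lB k

spell-inj : ∀ n i j → spell n i ≡ spell n j → i ≡ j
spell-inj n zero zero e = refl
spell-inj n zero (suc j) e with splitAt n j
... | inj₁ k with e
... | ()
spell-inj n zero (suc j) e | inj₂ k with e
... | ()
spell-inj n (suc i) zero e with splitAt n i
... | inj₁ k with e
... | ()
spell-inj n (suc i) zero e | inj₂ k with e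
... | ()
spell-inj n (suc i) (suc j) e with splitAt n i | splitAt n j | join-splitAt n n i | join-splitAt n n j
... | inj₁ k | inj₁ l | refl | refl = cong (λ x → suc (x ↑ˡ n)) (toℕ-injective (suc-injective (cong proj₁ e)))
... | inj₂ k | inj₂ l | refl | refl = cong (λ x → suc (n ↑ʳ x)) (toℕ-injective (cong proj₁ e))
... | inj₁ k | inj₂ l | _ | _ with e
... | ()
spell-inj n (suc i) (suc j) e | inj₂ k | inj₁ l | _ | _ with e
... | ()

count-spell : ∀ n i v → # spell n i ins map (spell n) v ≡ occ i v
count-spell n i v = trans (∑-map (spell n) v _) (∑-cong v (λ x → cong ⟦_⟧ (bool-⇔
  (λ e → ⌊⌋-yes (i ≟F x) (sym (spell-inj n x i (⌊⌋-true (spell n x ≟L spell n i) e)))) (λ e → ⌊⌋-yes (spell n x ≟L spell n i) (sym (cong (spell n) (⌊⌋-true (i ≟F x) e)))))))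

spell-all : ∀ n v → All (InA n) (map (spell n) v)
spell-all n [] = []
spell-all n (x ∷ v) = spell-InA n x ∷ spell-all n v

∑-upTo : ∀ n (f : ℕ → ℕ) → ∑ (upTo n) f ≡ sumF {n} (f ∘ toℕ)
∑-upTo n f = go n id
  where
  go : ∀ n (h : ℕ → ℕ) → ∑ (applyUpTo h n) f ≡ sumF {n} (f ∘ h ∘ toℕ)
  go zero h = refl
  go (suc n) h = cong (f (h 0) +_) (go n (h ∘ suc))

sumF-last : ∀ N (f : ℕ → ℕ) → sumF {suc N} (f ∘ toℕ) ≡ sumF {N} (f ∘ toℕ) + f N
sumF-last zero f = +-comm (f 0) 0
sumF-last (suc N) f = trans (cong (f 0 +_) (sumF-last N (f ∘ suc))) (sym (+-assoc (f 0) _ _))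

∑-spell : ∀ N (F : Letter → ℕ) → ∑ (allFin (suc (suc N + suc N))) (F ∘ spell (suc N)) ≡ ∑ (alphabet (suc N)) F + F (suc N , false)
∑-spell N F = begin
  ∑ (allFin (suc (n' + n'))) (F ∘ spell n') ≡⟨ ∑-allFin {suc (n' + n')} (F ∘ spell n') ⟩
  F (0 , false) + sumF {n' + n'} (λ j → F (spell n' (suc j))) ≡⟨ cong (F (0 , false) +_) (trans (sumF-cong {n' + n'} (λ j → h (splitAt n' j))) (sumF-glue n' fA fB)) ⟩
  F (0 , false) + (sumF fA + sumF fB) ≡⟨ cong (λ x → F (0 , false) + (x + sumF fB)) (sumF-last N (λ k → F (suc k , false))) ⟩
  F (0 , false) + (sumF {N} (λ k → F (suc (toℕ k) , false)) + F (n' , false) + sumF fB) ≡⟨ lem (F (0 , false)) (sumF {N} (λ k → F (suc (toℕ k) , false))) (F (n' , false)) (sumF fB) ⟩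
  (sumF {n'} (λ k → F (toℕ k , false)) + sumF fB) + F (n' , false) ≡⟨ cong (_+ F (n' , false)) (sym (trans (∑-alphabet n' F) (trans (∑-upTo n' (λ g → F (g , false) + F (g , true))) (sumF-+ {n'} (λ k → F (toℕ k , false)) fB)))) ⟩
  ∑ (alphabet n') F + F (n' , false) ∎
  where
  open ≡-Reasoning
  n' = suc N
  fA fB : Fin n' → ℕ
  fA k = F (suc (toℕ k) , false)
  fB k = F (toℕ k , true)
  h : ∀ s → F ([ (λ k → suc (toℕ k) , false) , (λ k → toℕ k , true) ]′ s) ≡ [ fA , fB ]′ s
  h (inj₁ _) = refl
  h (inj₂ _) = refl
  lem : ∀ a b c d → a + (b + c + d) ≡ ((a + b) + d) + c
  lem = solve-∀

-- Words containing the letter A_n are too long to be accepted, so adding it to the alphabet is harmless.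
∑-words : ∀ N K (F : List Letter → ℕ) → (∀ v → suc N ≤ size v → F v ≡ 0) →
  ∑ (allLists K (allFin (suc (suc N + suc N)))) (F ∘ map (spell (suc N))) ≡ ∑ (allLists K (alphabet (suc N))) F
∑-words N zero F h = refl
∑-words N (suc K) F h = begin
  ∑ (allLists (suc K) P) (F ∘ map (spell (suc N))) ≡⟨ ∑-allLists-suc K P _ ⟩
  ∑ P (λ x → ∑ (allLists K P) (λ v → F (spell (suc N) x ∷ map (spell (suc N)) v)))
    ≡⟨ ∑-cong P (λ x → ∑-words N K (λ v → F (spell (suc N) x ∷ v)) (λ v le → h (spell (suc N) x ∷ v) (≤-trans le (m≤n+m (size v) (proj₁ (spell (suc N) x)))))) ⟩
  ∑ P (λ x → G (spell (suc N) x)) ≡⟨ ∑-spell N G ⟩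
  ∑ (alphabet (suc N)) G + G (suc N , false) ≡⟨ cong (∑ (alphabet (suc N)) G +_) (∑-zero (allLists K (alphabet (suc N))) (λ v → h ((suc N , false) ∷ v) (m≤m+n (suc N) (size v)))) ⟩
  ∑ (alphabet (suc N)) G + 0 ≡⟨ +-identityʳ _ ⟩
  ∑ (alphabet (suc N)) G ≡⟨ sym (∑-allLists-suc K (alphabet (suc N)) F) ⟩
  ∑ (allLists (suc K) (alphabet (suc N))) F ∎
  where
  open ≡-Reasoning
  P = allFin (suc (suc N + suc N))
  G : Letter → ℕ
  G ℓ = ∑ (allLists K (alphabet (suc N))) (λ v → F (ℓ ∷ v))

weight-start : ∀ (s : Spec n) → weight s [] ≡ ∑ (allLists (K s) (alphabet n)) (λ v → ⟦ a s v ⟧)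
weight-start {n} s = ∑-cong (allLists (K s) (alphabet n)) (λ v → cong (λ x → ⟦ a s x ⟧) (LP.++-identityʳ v))

∑-length : ∀ K (xs : List A) (F G : List A → ℕ) → (∀ v → length v ≡ K → F v ≡ G v) → ∑ (allLists K xs) F ≡ ∑ (allLists K xs) G
∑-length zero xs F G h = cong (_+ 0) (h [] refl)
∑-length (suc K) xs F G h = trans (∑-allLists-suc K xs F) (trans (∑-cong xs (λ x → ∑-length K xs (F ∘ (x ∷_)) (G ∘ (x ∷_)) (λ v e → h (x ∷ v) (cong suc e)))) (sym (∑-allLists-suc K xs G)))

module Typed {N : ℕ} (A : Fin (suc N) → ℕ) (β : Maybe ℕ) (bl : below (suc N) β) (le : tsize A β ≤ N) where

  nn = suc N
  s = typed nn A β bl (≤-trans le (n≤1+n N))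
  L = K s

  bm : Fin nn → ℕ
  bm k = bMulOf {nn} (ctype A β) (toℕ k)

  sum-bm : sumF bm ≡ flags β
  sum-bm = trans (sumF-cong (λ k → sym (*-identityˡ (bm k)))) (sum-bMul A β (λ _ → 1) bl)

  -- Fixed points are not prescribed by the type; they are what is missing from the L cycles.
  φ : Fin (suc (nn + nn)) → ℕ
  φ zero = L ∸ (sumF A + flags β)
  φ (suc j) = glue A bm j

  factProd-bm : factProd bm ≡ 1
  factProd-bm = go bm (λ k → one β k)
    where
    one : ∀ β k → bMulOf {nn} (ctype A β) (toℕ k) ≤ 1
    one nothing k = z≤n
    one (just α) k with α ≡ᵇ suc (toℕ k)
    ... | true = ≤-refl
    ... | false = z≤n
    go : ∀ {k} (f : Fin k → ℕ) → (∀ i → f i ≤ 1) → factProd f ≡ 1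
    go {zero} f h = refl
    go {suc k} f h with f zero | h zero
    ... | zero | _ = trans (+-identityʳ _) (go (f ∘ suc) (h ∘ suc))
    ... | suc zero | _ = trans (+-identityʳ _) (go (f ∘ suc) (h ∘ suc))
    ... | suc (suc _) | s≤s ()

  size-bound : ∀ v → nn ≤ size v → ⟦ a s v ⟧ ≡ 0
  size-bound v lt = cong ⟦_⟧ (not-true (λ t → <⇒≱ (s≤s le) (≤-trans lt (≤-reflexive (a-size s v t)))))

  lengths : ∀ v → typeB A β (map (spell nn) v) ≡ true → length v ≡ occ zero v + (sumF A + flags β)
  lengths v t = trans (sym (LP.length-map (spell nn) v)) (trans (sym (∑-1 (map (spell nn) v))) (trans (content (λ _ → 1) (spell-all nn v))
    (cong₂ _+_ (trans (*-identityˡ _) (count-spell nn zero v)) (cong₂ _+_ (sumF-cong {nn} (λ k → trans (*-identityˡ (# (suc (toℕ k) , false) ins map (spell nn) v)) (proj₁ (typeB-# A β (map (spell nn) v) t k))))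
      (trans (sumF-cong {nn} (λ k → trans (*-identityˡ (# (toℕ k , true) ins map (spell nn) v)) (proj₂ (typeB-# A β (map (spell nn) v) t k)))) sum-bm)))))

  accepted : sumF A + flags β ≤ L → ∀ v → length v ≡ L → a s (map (spell nn) v) ≡ hasContent φ v
  accepted ok v lv = bool-⇔ to from
    where
    to : a s (map (spell nn) v) ≡ true → hasContent φ v ≡ true
    to e = fin-all _ one
      where
      t : typeB A β (map (spell nn) v) ≡ true
      t = proj₁ (∧-true e)
      one : ∀ i → (occ i v ≡ᵇ φ i) ≡ true
      one zero = subst (λ x → (occ zero v ≡ᵇ x) ≡ true) (trans (sym (m+n∸n≡m (occ zero v) (sumF A + flags β))) (cong (_∸ (sumF A + flags β)) (trans (sym (lengths v t)) lv))) (≡ᵇ-refl (occ zero v))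
      one (suc j) = subst (λ x → (occ (suc j) v ≡ᵇ x) ≡ true) (trans (sym (count-spell nn (suc j) v)) (by (splitAt nn j))) (≡ᵇ-refl (occ (suc j) v))
        where
        by : ∀ σ → # [ (λ k → suc (toℕ k) , false) , (λ k → toℕ k , true) ]′ σ ins map (spell nn) v ≡ [ A , bm ]′ σ
        by (inj₁ k) = proj₁ (typeB-# A β (map (spell nn) v) t k)
        by (inj₂ k) = proj₂ (typeB-# A β (map (spell nn) v) t k)
    from : hasContent φ v ≡ true → a s (map (spell nn) v) ≡ true
    from e = ∧-intro t (∧-intro (trans (cong (_≡ᵇ L) (trans (LP.length-map (spell nn) v) lv)) (≡ᵇ-refl L))
      (∧-intro (trans (cong (_≡ᵇ tsize A β) (proj₁ d)) (≡ᵇ-refl (tsize A β))) (trans (cong (_≡ᵇ flags β) (proj₂ d)) (≡ᵇ-refl (flags β)))))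
      where
      at-A : ∀ k → # (suc (toℕ k) , false) ins map (spell nn) v ≡ A k
      at-A k = trans (cong (λ x → # x ins map (spell nn) v) (cong [ _ , _ ]′ (sym (splitAt-↑ˡ nn k nn)))) (trans (count-spell nn (suc (k ↑ˡ nn)) v)
        (trans (≡ᵇ-true (occ (suc (k ↑ˡ nn)) v) (φ (suc (k ↑ˡ nn))) (all-fin (λ i → occ i v ≡ᵇ φ i) e (suc (k ↑ˡ nn)))) (cong [ A , bm ]′ (splitAt-↑ˡ nn k nn))))
      at-B : ∀ k → # (toℕ k , true) ins map (spell nn) v ≡ bm k
      at-B k = trans (cong (λ x → # x ins map (spell nn) v) (cong [ _ , _ ]′ (sym (splitAt-↑ʳ nn nn k)))) (trans (count-spell nn (suc (nn ↑ʳ k)) v)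
        (trans (≡ᵇ-true (occ (suc (nn ↑ʳ k)) v) (φ (suc (nn ↑ʳ k))) (all-fin (λ i → occ i v ≡ᵇ φ i) e (suc (nn ↑ʳ k)))) (cong [ A , bm ]′ (splitAt-↑ʳ nn nn k))))
      t : typeB A β (map (spell nn) v) ≡ true
      t = fin-all _ (λ k → ∧-intro (trans (cong (_≡ᵇ A k) (at-A k)) (≡ᵇ-refl (A k))) (trans (cong (_≡ᵇ bm k) (at-B k)) (≡ᵇ-refl (bm k))))
      d = typed-det A β bl (map (spell nn) v) (spell-all nn v) t

  as-words : weight s [] ≡ ∑ (allLists L (allFin (suc (nn + nn)))) (λ v → ⟦ a s (map (spell nn) v) ⟧)
  as-words = trans (weight-start s) (sym (∑-words N L (λ v → ⟦ a s v ⟧) size-bound))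

  weight-fact : sumF A + flags β ≤ L → weight s [] * ((L ∸ (sumF A + flags β)) ! * factProd A) ≡ L !
  weight-fact ok = trans (cong₂ _*_ (trans as-words (∑-length L _ _ _ (λ v lv → cong ⟦_⟧ (accepted ok v lv))))
      (cong ((L ∸ (sumF A + flags β)) ! *_) (sym (trans (factProd-glue nn A bm) (trans (cong (factProd A *_) factProd-bm) (*-identityʳ _))))))
    (arrangements-fact L φ (trans (cong (φ zero +_) (trans (sumF-glue nn A bm) (cong (sumF A +_) sum-bm))) (m∸n+n≡m ok)))

  weight-none : L < sumF A + flags β → weight s [] ≡ 0
  weight-none lt = trans as-words (trans (∑-length L _ _ (λ _ → 0) (λ v lv → cong ⟦_⟧ (not-true (λ e → <⇒≱ lt
    (≤-trans (m≤n+m _ (occ zero v)) (≤-reflexive (trans (sym (lengths v (proj₁ (∧-true e)))) lv))))))) (∑-0 (allLists L (allFin (suc (nn + nn))))))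

typed-A : ∀ {N} (A : Fin (suc N) → ℕ) (le : tsize A nothing ≤ N) →
  weight (typed (suc N) A nothing refl (≤-trans le (n≤1+n N))) [] ≡ multinomial (suc N ∸ tsize A nothing) A
typed-A {N} A le with sumF A ≤? suc N ∸ tsize A nothing
... | no ¬l = trans (weight-none (≤-trans (≰⇒> ¬l) (≤-reflexive (sym (+-identityʳ _))))) (sym (multinomial-0 (suc N ∸ tsize A nothing) A (≰⇒> ¬l)))
  where open Typed A nothing refl le
... | yes l = *-cancelʳ-≡ _ _ (factProd A * (L ∸ sumF A) !) {{m*n≢0 _ _ {{factProd≢0 A}} {{(L ∸ sumF A) !≢0}}}}
  (trans (cong (weight s [] *_) (trans (*-comm (factProd A) _) (cong (λ x → (L ∸ x) ! * factProd A) (sym (+-identityʳ (sumF A))))))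
    (trans (weight-fact (≤-trans (≤-reflexive (+-identityʳ _)) l)) (sym (multinomial-fact L A l))))
  where open Typed A nothing refl le

-- The type B letter can take any of the `suc (N ∸ tsize A (just α))` places; the other letters then
-- form a word as in `typed-A`, one letter shorter.
typed-B : ∀ {N} (A : Fin (suc N) → ℕ) α (bl : below (suc N) (just α)) (le : tsize A (just α) ≤ N) →
  weight (typed (suc N) A (just α) bl (≤-trans le (n≤1+n N))) [] ≡ suc (N ∸ tsize A (just α)) * multinomial (N ∸ tsize A (just α)) A
typed-B {N} A α bl le with sumF A ≤? N ∸ tsize A (just α)
... | no ¬l = trans (weight-none (≤-trans (≤-reflexive (cong suc L≡)) (≤-trans (s≤s (≰⇒> ¬l)) (≤-reflexive (+-comm 1 (sumF A))))))
      (sym (trans (cong (suc (N ∸ tsize A (just α)) *_) (multinomial-0 (N ∸ tsize A (just α)) A (≰⇒> ¬l))) (*-zeroʳ (suc (N ∸ tsize A (just α))))))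
  where
  open Typed A (just α) bl le
  L≡ : L ≡ suc (N ∸ tsize A (just α))
  L≡ = +-∸-assoc 1 le
... | yes l = *-cancelʳ-≡ _ _ (factProd A * (L' ∸ sumF A) !) {{m*n≢0 _ _ {{factProd≢0 A}} {{(L' ∸ sumF A) !≢0}}}}
  (trans (cong (weight s [] *_) (trans (*-comm (factProd A) _) (cong (λ x → x ! * factProd A) (sym (trans (cong₂ _∸_ L≡ (+-comm (sumF A) 1)) refl)))))
    (trans (weight-fact (≤-trans (≤-reflexive (+-comm (sumF A) 1)) (≤-trans (s≤s l) (≤-reflexive (sym L≡)))))
      (trans (cong _! L≡) (trans (cong (suc L' *_) (sym (multinomial-fact L' A l))) (sym (*-assoc (suc L') (multinomial L' A) _))))))
  where
  open Typed A (just α) bl le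
  L' = N ∸ tsize A (just α)
  L≡ : L ≡ suc L'
  L≡ = +-∸-assoc 1 le

-- Words of a given rank: binomial coefficients

nC0 : ∀ n → n C 0 ≡ 1
nC0 n = trans (nCk≡nC[n∸k] {0} {n} z≤n) (nCn≡1 n)

absorb : ∀ n k → suc k * (suc n C suc k) ≡ suc n * (n C k)
absorb zero zero = refl
absorb zero (suc k) = trans (cong (suc (suc k) *_) (k>n⇒nCk≡0 {1} {suc (suc k)} (s≤s (s≤s z≤n)))) (trans (*-zeroʳ (suc (suc k))) (sym (trans (*-identityˡ _) (k>n⇒nCk≡0 {0} {suc k} (s≤s z≤n)))))
absorb (suc n) zero = begin
  1 * (suc (suc n) C 1) ≡⟨ *-identityˡ _ ⟩
  suc (suc n) C 1 ≡⟨ sym (nCk+nC[k+1]≡[n+1]C[k+1] (suc n) 0) ⟩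
  suc n C 0 + suc n C 1 ≡⟨ cong₂ _+_ (nC0 (suc n)) (trans (sym (*-identityˡ _)) (trans (absorb n zero) (trans (cong (suc n *_) (nC0 n)) (*-identityʳ _)))) ⟩
  suc (suc n) ≡⟨ sym (trans (cong (suc (suc n) *_) (nC0 (suc n))) (*-identityʳ _)) ⟩
  suc (suc n) * (suc n C 0) ∎ where open ≡-Reasoning
absorb (suc n) (suc k) = begin
  suc (suc k) * (suc (suc n) C suc (suc k)) ≡⟨ cong (suc (suc k) *_) (sym (nCk+nC[k+1]≡[n+1]C[k+1] (suc n) (suc k))) ⟩
  suc (suc k) * (c₁ + c₂) ≡⟨ lem₁ (suc k) c₁ c₂ ⟩
  c₁ + (suc k * c₁ + suc (suc k) * c₂) ≡⟨ cong (c₁ +_) (cong₂ _+_ (absorb n k) (absorb n (suc k))) ⟩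
  c₁ + (suc n * (n C k) + suc n * (n C suc k)) ≡⟨ cong (c₁ +_) (trans (sym (*-distribˡ-+ (suc n) (n C k) (n C suc k))) (cong (suc n *_) (nCk+nC[k+1]≡[n+1]C[k+1] n k))) ⟩
  c₁ + suc n * c₁ ∎
  where
  open ≡-Reasoning
  c₁ = suc n C suc k
  c₂ = suc n C suc (suc k)
  lem₁ : ∀ k a b → suc k * (a + b) ≡ a + (k * a + suc k * b)
  lem₁ = solve-∀

choose-out : ∀ N r → r ≤ N → suc N * (N C r) ≡ (suc N ∸ r) * (suc N C r)
choose-out N zero le = cong (suc N *_) (trans (nC0 N) (sym (nC0 (suc N))))
choose-out N (suc r) le = +-cancelʳ-≡ (suc r * (suc N C suc r)) _ _ (begin
  suc N * (N C suc r) + suc r * (suc N C suc r) ≡⟨ cong (suc N * (N C suc r) +_) (absorb N r) ⟩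
  suc N * (N C suc r) + suc N * (N C r) ≡⟨ trans (+-comm _ (suc N * (N C r))) (sym (*-distribˡ-+ (suc N) (N C r) (N C suc r))) ⟩
  suc N * (N C r + N C suc r) ≡⟨ cong₂ _*_ (sym (m∸n+n≡m (≤-trans le (n≤1+n N)))) (nCk+nC[k+1]≡[n+1]C[k+1] N r) ⟩
  (suc N ∸ suc r + suc r) * (suc N C suc r) ≡⟨ *-distribʳ-+ (suc N C suc r) (suc N ∸ suc r) (suc r) ⟩
  (suc N ∸ suc r) * (suc N C suc r) + suc r * (suc N C suc r) ∎)
  where open ≡-Reasoning

-- The hockey stick identity by Pascal's rule, with the range of summation cut down to m by an
-- indicator.
hockey : ∀ k N m → m ≤ N → sumF {suc N} (λ g → ⟦ toℕ g ≤ᵇ m ⟧ * ((k + (m ∸ toℕ g)) C (m ∸ toℕ g))) ≡ (suc k + m) C m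
hockey k N zero le = trans (cong₂ _+_ (trans (*-identityˡ _) (nC0 (k + 0))) (trans (sumF-cong {N} (λ g → refl)) (trans (sumF-const {N} 0) (*-zeroʳ N)))) (sym (nC0 (suc k + 0)))
hockey k (suc N) (suc m) (s≤s le) = begin
  1 * ((k + suc m) C suc m) + sumF {suc N} (λ g → ⟦ suc (toℕ g) ≤ᵇ suc m ⟧ * ((k + (m ∸ toℕ g)) C (m ∸ toℕ g)))
    ≡⟨ cong₂ _+_ (trans (*-identityˡ _) (cong (_C suc m) (+-suc k m))) (trans (sumF-cong {suc N} (λ g → cong (λ b → ⟦ b ⟧ * ((k + (m ∸ toℕ g)) C (m ∸ toℕ g))) (down (toℕ g)))) (hockey k N m le)) ⟩
  (suc k + m) C suc m + (suc k + m) C m ≡⟨ trans (+-comm _ ((suc k + m) C m)) (nCk+nC[k+1]≡[n+1]C[k+1] (suc k + m) m) ⟩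
  suc (suc k + m) C suc m ≡⟨ cong (λ x → suc x C suc m) (sym (+-suc k m)) ⟩
  (suc k + suc m) C suc m ∎
  where
  open ≡-Reasoning
  down : ∀ g → (suc g ≤ᵇ suc m) ≡ (g ≤ᵇ m)
  down zero = refl
  down (suc g) = refl

rankWords : ℕ → ℕ → ℕ → ℕ → ℕ
rankWords n K m b = ∑ (allLists K (alphabet n)) (λ v → ⟦ (size v ≡ᵇ m) ∧ (nB v ≡ᵇ b) ⟧)

strip : ∀ g m x → (g + x ≡ᵇ m) ≡ (g ≤ᵇ m) ∧ (x ≡ᵇ m ∸ g)
strip zero m x = refl
strip (suc g) zero x = refl
strip (suc g) (suc m) x = trans (strip g m x) (cong (_∧ (x ≡ᵇ m ∸ g)) (up g))
  where
  up : ∀ g → (g ≤ᵇ m) ≡ (suc g ≤ᵇ suc m)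
  up zero = refl
  up (suc g) = refl

strip-sum : ∀ n K g m (h : List (ℕ × Bool) → Bool) → ∑ (allLists K (alphabet n)) (λ v → ⟦ (g + size v ≡ᵇ m) ∧ h v ⟧)
  ≡ ⟦ g ≤ᵇ m ⟧ * ∑ (allLists K (alphabet n)) (λ v → ⟦ (size v ≡ᵇ m ∸ g) ∧ h v ⟧)
strip-sum n K g m h = trans (∑-cong (allLists K (alphabet n)) (λ v → trans (cong ⟦_⟧ (trans (cong (_∧ h v) (strip g m (size v))) (BP.∧-assoc (g ≤ᵇ m) _ (h v)))) (⟦∧⟧ (g ≤ᵇ m) _)))
  (∑-*ˡ (allLists K (alphabet n)) ⟦ g ≤ᵇ m ⟧ _)

rankWords-0 : ∀ n K m → rankWords n (suc K) m 0 ≡ ∑ (upTo n) (λ g → ⟦ g ≤ᵇ m ⟧ * rankWords n K (m ∸ g) 0)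
rankWords-0 n K m = trans (∑-allLists-suc K (alphabet n) _) (trans (∑-alphabet n (λ ℓ → ∑ (allLists K (alphabet n)) (λ v → ⟦ (size (ℓ ∷ v) ≡ᵇ m) ∧ (nB (ℓ ∷ v) ≡ᵇ 0) ⟧)))
  (∑-cong (upTo n) (λ g → trans (cong₂ _+_ (strip-sum n K g m (λ v → nB v ≡ᵇ 0)) (∑-zero (allLists K (alphabet n)) (λ v → cong ⟦_⟧ (BP.∧-zeroʳ (g + size v ≡ᵇ m))))) (+-identityʳ _))))

rankWords-1 : ∀ n K m → rankWords n (suc K) m 1 ≡ ∑ (upTo n) (λ g → ⟦ g ≤ᵇ m ⟧ * (rankWords n K (m ∸ g) 1 + rankWords n K (m ∸ g) 0))
rankWords-1 n K m = trans (∑-allLists-suc K (alphabet n) _) (trans (∑-alphabet n (λ ℓ → ∑ (allLists K (alphabet n)) (λ v → ⟦ (size (ℓ ∷ v) ≡ᵇ m) ∧ (nB (ℓ ∷ v) ≡ᵇ 1) ⟧)))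
  (∑-cong (upTo n) (λ g → trans (cong₂ _+_ (strip-sum n K g m (λ v → nB v ≡ᵇ 1)) (strip-sum n K g m (λ v → nB v ≡ᵇ 0))) (sym (*-distribˡ-+ ⟦ g ≤ᵇ m ⟧ (rankWords n K (m ∸ g) 1) (rankWords n K (m ∸ g) 0))))))

-- The flag can be put on any of the K letters of a word without flags.
rankWords-flag : ∀ n K m → rankWords n K m 1 ≡ K * rankWords n K m 0
rankWords-flag n zero m = cong (λ b → ⟦ b ⟧ + 0) (BP.∧-zeroʳ (0 ≡ᵇ m))
rankWords-flag n (suc K) m = trans (rankWords-1 n K m) (trans (∑-cong (upTo n) (λ g → trans (cong (λ x → ⟦ g ≤ᵇ m ⟧ * (x + rankWords n K (m ∸ g) 0)) (rankWords-flag n K (m ∸ g)))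
    (lem ⟦ g ≤ᵇ m ⟧ K (rankWords n K (m ∸ g) 0)))) (trans (∑-*ˡ (upTo n) (suc K) _) (cong (suc K *_) (sym (rankWords-0 n K m)))))
  where
  lem : ∀ x k f → x * (k * f + f) ≡ suc k * (x * f)
  lem = solve-∀

-- These are the weak compositions of m into K + 1 parts; as m ≤ N, no part falls outside the
-- alphabet.
rankWords-C : ∀ N K m → m ≤ N → rankWords (suc N) (suc K) m 0 ≡ (K + m) C m
rankWords-C N zero m le = trans (rankWords-0 (suc N) zero m) (trans (∑-cong (upTo (suc N)) h) (trans (∑-upTo-pick (suc N) m 1 (s≤s le)) (sym (nCn≡1 m))))
  where
  h : ∀ g → ⟦ g ≤ᵇ m ⟧ * rankWords (suc N) 0 (m ∸ g) 0 ≡ ⟦ g ≡ᵇ m ⟧ * 1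
  h g = trans (cong (⟦ g ≤ᵇ m ⟧ *_) (trans (+-identityʳ _) (cong ⟦_⟧ (BP.∧-identityʳ (0 ≡ᵇ m ∸ g))))) (trans (sym (⟦∧⟧ (g ≤ᵇ m) (0 ≡ᵇ m ∸ g)))
    (trans (cong ⟦_⟧ (trans (sym (strip g m 0)) (cong (_≡ᵇ m) (+-identityʳ g)))) (sym (*-identityʳ _))))
rankWords-C N (suc K) m le = trans (rankWords-0 (suc N) (suc K) m) (trans (∑-cong (upTo (suc N)) (λ g → cong (⟦ g ≤ᵇ m ⟧ *_) (rankWords-C N K (m ∸ g) (≤-trans (m∸n≤m m g) le))))
  (trans (∑-upTo (suc N) (λ g → ⟦ g ≤ᵇ m ⟧ * ((K + (m ∸ g)) C (m ∸ g)))) (hockey K N m le)))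

ranked-weight : ∀ n r b (b≤r : b ≤ r) (le : r ∸ b ≤ n) → weight (ranked n r b le) [] ≡ rankWords n (n ∸ (r ∸ b)) (r ∸ b) b
ranked-weight n r b b≤r le = trans (weight-start s) (∑-length (K s) (alphabet n) _ _ (λ v e → cong ⟦_⟧ (bool-⇔
    (λ t → ∧-intro (trans (cong (_≡ᵇ r ∸ b) (a-size s v t)) (≡ᵇ-refl (r ∸ b))) (trans (cong (_≡ᵇ b) (a-nB s v t)) (≡ᵇ-refl b)))
    (λ t → let (t₁ , t₂) = ∧-true {size v ≡ᵇ r ∸ b} t in ∧-intro (∧-intro (trans (cong (_≡ᵇ r) (trans (ρ-size v) (trans (cong₂ _+_ (≡ᵇ-true (size v) (r ∸ b) t₁) (≡ᵇ-true (nB v) b t₂)) (m∸n+n≡m b≤r)))) (≡ᵇ-refl r)) t₂)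
        (∧-intro (trans (cong (_≡ᵇ K s) e) (≡ᵇ-refl (K s))) t)))))
  where s = ranked n r b le

-- Scaled by n, because then the number of words is C(n, r) times n - r, and n - r is the number of
-- cycles, by which the formula for G divides.
ranked-0 : ∀ N r (le : r ≤ N) → suc N * weight (ranked (suc N) r 0 (≤-trans le (n≤1+n N))) [] ≡ (suc N ∸ r) * (suc N C r)
ranked-0 N r le = trans (cong (suc N *_) (trans (ranked-weight (suc N) r 0 z≤n (≤-trans le (n≤1+n N))) (trans (cong (λ k → rankWords (suc N) k r 0) (+-∸-assoc 1 le))
  (trans (rankWords-C N (N ∸ r) r le) (cong (_C r) (m∸n+n≡m le)))))) (choose-out N r le)

ranked-1 : ∀ N r (le : r ≤ N) → suc N * weight (ranked (suc N) (suc r) 1 (≤-trans le (n≤1+n N))) [] ≡ (suc N ∸ r) * (suc r * (suc N C suc r))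
ranked-1 N r le = begin
  suc N * weight (ranked (suc N) (suc r) 1 (≤-trans le (n≤1+n N))) [] ≡⟨ cong (suc N *_) (ranked-weight (suc N) (suc r) 1 (s≤s z≤n) (≤-trans le (n≤1+n N))) ⟩
  suc N * rankWords (suc N) (suc N ∸ r) r 1 ≡⟨ cong (suc N *_) (rankWords-flag (suc N) (suc N ∸ r) r) ⟩
  suc N * ((suc N ∸ r) * rankWords (suc N) (suc N ∸ r) r 0) ≡⟨ cong (λ x → suc N * ((suc N ∸ r) * x)) (trans (cong (λ k → rankWords (suc N) k r 0) (+-∸-assoc 1 le)) (trans (rankWords-C N (N ∸ r) r le) (cong (_C r) (m∸n+n≡m le)))) ⟩
  suc N * ((suc N ∸ r) * (N C r)) ≡⟨ lem (suc N) (suc N ∸ r) (N C r) ⟩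
  (suc N ∸ r) * (suc N * (N C r)) ≡⟨ cong ((suc N ∸ r) *_) (sym (absorb N r)) ⟩
  (suc N ∸ r) * (suc r * (suc N C suc r)) ∎
  where
  open ≡-Reasoning
  lem : ∀ x y z → x * (y * z) ≡ y * (x * z)
  lem = solve-∀

-- The number of relabellings, and the formula for one condition per factor

cox-Perm : ∀ N → Perm (cox (suc N))
cox-Perm N = mkPerm (λ i j e → go i j (trans (cong proj₁ (sym (cox-at i))) (trans e (cong proj₁ (cox-at j)))))
  where
  cox-at : ∀ i → lookup (cox (suc N)) i ≡ next i
  cox-at i = VP.lookup∘tabulate next i
  step : ∀ (i : Fin (suc N)) → (∃ λ k → next i ≡ (k , false) × toℕ k ≡ suc (toℕ i)) ⊎ (next i ≡ (zero , true) × toℕ i ≡ N)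
  step i with m≤n⇒m<n∨m≡n (s≤s⁻¹ (toℕ<n i))
  ... | inj₁ lt = inj₁ (fromℕ< (s≤s lt) , next-lt i _ (toℕ-fromℕ< (s≤s lt)) , toℕ-fromℕ< (s≤s lt))
  ... | inj₂ e = inj₂ (next-last i e , e)
  clash : ∀ {k : Fin (suc N)} {m} → toℕ k ≡ suc m → k ≢ zero
  clash e refl = 1+n≢0 (sym e)
  go : ∀ i j → proj₁ (next i) ≡ proj₁ (next j) → i ≡ j
  go i j e with step i | step j
  ... | inj₁ (k , p , q) | inj₁ (k' , p' , q') = toℕ-injective (suc-injective (trans (sym q) (trans (cong toℕ (trans (sym (cong proj₁ p)) (trans e (cong proj₁ p')))) q')))
  ... | inj₁ (k , p , q) | inj₂ (p' , _) = ⊥-elim (clash q (trans (sym (cong proj₁ p)) (trans e (cong proj₁ p'))))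
  ... | inj₂ (p , _) | inj₁ (k' , p' , q') = ⊥-elim (clash q' (trans (sym (cong proj₁ p')) (trans (sym e) (cong proj₁ p))))
  ... | inj₂ (_ , q) | inj₂ (_ , q') = toℕ-injective (trans q (sym q'))

cox-trans : ∀ N → Transitive (cox (suc N))
cox-trans N j = toℕ j , cong proj₁ (iter-cox (toℕ j) j refl)

coxCycle : ∀ N → Cycle (suc N)
coxCycle N = zero , iters (cox (suc N)) (zero , false) N , true

cox-full : ∀ N → Full (cox (suc N)) (coxCycle N ∷ [])
cox-full N = full (ic ∷ []) (nodup-full (verts (coxCycle N ∷ [])) ndv (≤-reflexive (sym len)))
  where
  c = cox (suc N)
  ic : IsCyc c (coxCycle N)
  ic = subst (Chain c (zero , false) _) iter-cox-all (chain-iters c (zero , false) N)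
  nr : ∀ t → t < N → proj₁ (iterW (suc t) c (zero , false)) ≢ zero
  nr t lt e = 1+n≢0 (trans (sym (toℕ-fromℕ< (s≤s lt))) (cong toℕ (trans (sym (cong proj₁ (iter-cox (suc t) (fromℕ< (s≤s lt)) (toℕ-fromℕ< (s≤s lt))))) e)))
  ndv : Nodup (verts (coxCycle N ∷ []))
  ndv = subst Nodup (sym (LP.++-identityʳ _)) (nodup-iters (cox-Perm N) (zero , false) N nr)
  len : length (verts (coxCycle N ∷ [])) ≡ suc N
  len = trans (length-verts-cons (coxCycle N) []) (trans (+-identityʳ _) (cong suc (length-iters c (zero , false) N)))

cox-sgn : ∀ N → sgn (cox (suc N)) ≡ true
cox-sgn N = sgn-full (cox-full N)

-- The constant is calibrated instead of counted: for a single factor of rank n with one type B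
-- cycle, `labelled-count` involves one factorisation, namely c itself, one cycle and one word.
labCount≡ : ∀ N → labCount N ≡ labels N
labCount≡ N = begin
  labCount N ≡⟨ sym (trans (cong₂ (λ x y → labCount N * x * y) one-tuple (trans (*-identityʳ _) K1)) (trans (*-identityʳ _) (*-identityʳ _))) ⟩
  labCount N * N# * prodF (λ c → K (sp c)) ≡⟨ labelled-count sp refl (+-identityʳ N) ⟩
  labels N * (1 * prodF (λ c → weight (sp c) [])) ≡⟨ cong (labels N *_) (trans (*-identityˡ _) (trans (*-identityʳ _) W1)) ⟩
  labels N * 1 ≡⟨ *-identityʳ _ ⟩
  labels N ∎
  where
  open ≡-Reasoning
  s = ranked (suc N) (suc N) 1 (n≤1+n N)
  sp : Fin 1 → Spec (suc N)
  sp _ = s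
  open Factorisations sp
  K1 : K s ≡ 1
  K1 = m+n∸n≡m 1 N
  W1 : weight s [] ≡ 1
  W1 = *-cancelˡ-≡ _ _ (suc N) (trans (ranked-1 N N ≤-refl) (trans (cong₂ _*_ K1 (cong (suc N *_) (nCn≡1 (suc N)))) (*-identityˡ _)))
  p-cox : p s (cox (suc N)) ≡ true
  p-cox = trans (link s (cox-Perm N) (cox-full N)) (∧-intro (∧-intro (trans (cong (_≡ᵇ suc N) (trans (+-identityʳ _) (trans (+-comm _ 1) (cong suc li)))) (≡ᵇ-refl (suc N))) refl)
    (∧-intro (sym (cong (1 ≡ᵇ_) K1) ⟨≡⟩ refl) (∧-intro (trans (cong (_≡ᵇ N) (trans (+-identityʳ _) li)) (≡ᵇ-refl N)) refl)))
    where
    infixl 4 _⟨≡⟩_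
    _⟨≡⟩_ : ∀ {x y : Bool} {z} → y ≡ x → y ≡ z → x ≡ z
    refl ⟨≡⟩ q = q
    li : length (iters (cox (suc N)) (zero , false) N) ≡ N
    li = length-iters (cox (suc N)) (zero , false) N
  one-tuple : N# ≡ 1
  one-tuple = trans (∑-only _≟T_ tups (allVecs-Enum _≟V_ (allVecs nn (allPts nn)) (RawW-Enum nn) 1) (cox nn ∷ []) _ other)
    (cong ⟦_⟧ (∧-intro (∧-intro (∧-intro (Perm⇒isSignedPerm (cox nn) (cox-Perm N)) p-cox) refl) (trans (cong (λ x → eqW x (cox nn)) (·-idʳ (cox nn))) (eqW-refl (cox nn)))))
    where
    other : ∀ f → f ≢ cox nn ∷ [] → ⟦ specB f ∧ eqW (prodV f) (cox nn) ⟧ ≡ 0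
    other (w ∷ []) ne = cong ⟦_⟧ (trans (cong (specB (w ∷ []) ∧_) (not-true (λ t → ne (cong (_∷ []) (trans (sym (·-idʳ w)) (eqW-true (w · idW) (cox nn) t)))))) (BP.∧-zeroʳ (specB (w ∷ []))))

core : ∀ {N M} (sp : Fin (suc M) → Spec (suc N)) → sumF (λ c → b (sp c)) ≡ 1 → sumF (λ c → m (sp c)) ≡ N →
  Factorisations.N# sp * prodF (λ c → K (sp c)) ≡ suc N ^ M * prodF (λ c → weight (sp c) [])
core {N} sp Σb Σm = *-cancelˡ-≡ _ _ (labels N) {{labels-pos N}} (trans (sym (*-assoc (labels N) _ _))
  (trans (cong (λ x → x * Factorisations.N# sp * prodF (λ c → K (sp c))) (sym (labCount≡ N))) (labelled-count sp Σb Σm)))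

-- Conditions on lists of factors, and the single type B cycle

Pred : ℕ → Set
Pred n = RawW n → Bool

-- The conditions are aligned with the factors one by one, so that concatenated blocks have
-- concatenated conditions; a mismatch of lengths counts as failure.
preds : List (Pred n) → List (RawW n) → Bool
preds [] [] = true
preds [] (_ ∷ _) = false
preds (p ∷ ps) [] = false
preds (p ∷ ps) (w ∷ ws) = p w ∧ preds ps ws

tuples∑ : ℕ → (List (RawW n) → ℕ) → ℕ
tuples∑ {n} k H = ∑ (allLists k (WB n)) H

tuples∑-suc : ∀ k (H : List (RawW n) → ℕ) → tuples∑ (suc k) H ≡ ∑ (allVecs n (allPts n)) (λ w → ⟦ isSignedPerm w ⟧ * tuples∑ k (λ ws → H (w ∷ ws)))
tuples∑-suc {n} k H = trans (∑-allLists-suc k (WB n) H) (∑-filterB isSignedPerm (allVecs n (allPts n)) _)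

tuples∑-cong : ∀ k {H H' : List (RawW n) → ℕ} → (∀ ws → All Perm ws → length ws ≡ k → H ws ≡ H' ws) → tuples∑ k H ≡ tuples∑ k H'
tuples∑-cong zero h = cong (_+ 0) (h [] [] refl)
tuples∑-cong {n} (suc k) {H} {H'} h = trans (tuples∑-suc k H) (trans (∑-cong (allVecs n (allPts n)) (λ w → ⟦⟧*-cong (isSignedPerm w) (λ e →
  tuples∑-cong k (λ ws al l → h (w ∷ ws) (isSignedPerm⇒Perm w e ∷ al) (cong suc l))))) (sym (tuples∑-suc k H')))

isCox : List (RawW n) → ℕ
isCox {n} ws = ⟦ eqW (prodW ws) (cox n) ⟧

all-suc : ∀ {k} (g : Fin (suc k) → Bool) → all g (allFin (suc k)) ≡ g zero ∧ all (g ∘ suc) (allFin k)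
all-suc g = bool-⇔ (λ t → ∧-intro (all-fin g t zero) (fin-all (g ∘ suc) (λ c → all-fin g t (suc c))))
  (λ t → fin-all g (λ { zero → proj₁ (∧-true t) ; (suc c) → all-fin (g ∘ suc) (proj₂ (∧-true {g zero} t)) c }))

vecs-lists : ∀ {M} (P : Fin M → Pred n) (H : List (RawW n) → ℕ) →
  ∑ (allVecs M (allVecs n (allPts n))) (λ f → ⟦ all (λ c → isSignedPerm (lookup f c) ∧ P c (lookup f c)) (allFin M) ⟧ * H (toList f))
  ≡ tuples∑ M (λ ws → ⟦ preds (List.tabulate P) ws ⟧ * H ws)
vecs-lists {M = zero} P H = refl
vecs-lists {n} {suc M} P H = begin
  ∑ (allVecs (suc M) Raw) (λ f → ⟦ fit f ⟧ * H (toList f)) ≡⟨ ∑-allVecs-suc M Raw (λ f → ⟦ fit f ⟧ * H (toList f)) ⟩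
  ∑ Raw (λ w → ∑ (allVecs M Raw) (λ f → ⟦ fit (w ∷ f) ⟧ * H (w ∷ toList f))) ≡⟨ ∑-cong Raw inner ⟩
  ∑ Raw (λ w → ⟦ isSignedPerm w ⟧ * tuples∑ M (λ ws → ⟦ P zero w ∧ preds Ps ws ⟧ * H (w ∷ ws)))
    ≡⟨ sym (tuples∑-suc M (λ ws → ⟦ preds (List.tabulate P) ws ⟧ * H ws)) ⟩
  tuples∑ (suc M) (λ ws → ⟦ preds (List.tabulate P) ws ⟧ * H ws) ∎
  where
  open ≡-Reasoning
  Raw : List (RawW n)
  Raw = allVecs n (allPts n)
  Ps : List (Pred n)
  Ps = List.tabulate (P ∘ suc)
  fit : Vec (RawW n) (suc M) → Bool
  fit f = all (λ c → isSignedPerm (lookup f c) ∧ P c (lookup f c)) (allFin (suc M))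
  fit' : Vec (RawW n) M → Bool
  fit' f = all (λ c → isSignedPerm (lookup f c) ∧ P (suc c) (lookup f c)) (allFin M)
  inner : ∀ w → ∑ (allVecs M Raw) (λ f → ⟦ fit (w ∷ f) ⟧ * H (w ∷ toList f)) ≡ ⟦ isSignedPerm w ⟧ * tuples∑ M (λ ws → ⟦ P zero w ∧ preds Ps ws ⟧ * H (w ∷ ws))
  inner w = begin
    ∑ (allVecs M Raw) (λ f → ⟦ fit (w ∷ f) ⟧ * H (w ∷ toList f))
      ≡⟨ ∑-cong (allVecs M Raw) (λ f → trans (cong (λ x → ⟦ x ⟧ * H (w ∷ toList f)) (all-suc (λ c → isSignedPerm (lookup (w ∷ f) c) ∧ P c (lookup (w ∷ f) c))))
          (trans (cong (_* H (w ∷ toList f)) (⟦∧⟧ (isSignedPerm w ∧ P zero w) (fit' f))) (*-assoc ⟦ isSignedPerm w ∧ P zero w ⟧ ⟦ fit' f ⟧ (H (w ∷ toList f))))) ⟩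
    ∑ (allVecs M Raw) (λ f → ⟦ isSignedPerm w ∧ P zero w ⟧ * (⟦ fit' f ⟧ * H (w ∷ toList f))) ≡⟨ ∑-*ˡ (allVecs M Raw) ⟦ isSignedPerm w ∧ P zero w ⟧ (λ f → ⟦ fit' f ⟧ * H (w ∷ toList f)) ⟩
    ⟦ isSignedPerm w ∧ P zero w ⟧ * ∑ (allVecs M Raw) (λ f → ⟦ fit' f ⟧ * H (w ∷ toList f)) ≡⟨ cong₂ _*_ (⟦∧⟧ (isSignedPerm w) (P zero w)) (vecs-lists (P ∘ suc) (λ ws → H (w ∷ ws))) ⟩
    ⟦ isSignedPerm w ⟧ * ⟦ P zero w ⟧ * rest ≡⟨ *-assoc ⟦ isSignedPerm w ⟧ ⟦ P zero w ⟧ rest ⟩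
    ⟦ isSignedPerm w ⟧ * (⟦ P zero w ⟧ * rest) ≡⟨ cong (⟦ isSignedPerm w ⟧ *_) (sym (∑-*ˡ (allLists M (WB n)) ⟦ P zero w ⟧ (λ ws → ⟦ preds Ps ws ⟧ * H (w ∷ ws)))) ⟩
    ⟦ isSignedPerm w ⟧ * tuples∑ M (λ ws → ⟦ P zero w ⟧ * (⟦ preds Ps ws ⟧ * H (w ∷ ws)))
      ≡⟨ cong (⟦ isSignedPerm w ⟧ *_) (∑-cong (allLists M (WB n)) (λ ws → trans (sym (*-assoc ⟦ P zero w ⟧ ⟦ preds Ps ws ⟧ (H (w ∷ ws)))) (cong (_* H (w ∷ ws)) (sym (⟦∧⟧ (P zero w) (preds Ps ws)))))) ⟩
    ⟦ isSignedPerm w ⟧ * tuples∑ M (λ ws → ⟦ P zero w ∧ preds Ps ws ⟧ * H (w ∷ ws)) ∎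
    where
    rest : ℕ
    rest = tuples∑ M (λ ws → ⟦ preds Ps ws ⟧ * H (w ∷ ws))

prodL : List A → (A → ℕ) → ℕ
prodL [] f = 1
prodL (x ∷ xs) f = f x * prodL xs f

prodL-++ : ∀ (xs ys : List A) f → prodL (xs ++ ys) f ≡ prodL xs f * prodL ys f
prodL-++ [] ys f = sym (+-identityʳ _)
prodL-++ (x ∷ xs) ys f = trans (cong (f x *_) (prodL-++ xs ys f)) (sym (*-assoc (f x) _ _))

prodL-tabulate : ∀ {k} (g : Fin k → A) f → prodL (List.tabulate g) f ≡ prodF (f ∘ g)
prodL-tabulate {k = zero} g f = refl
prodL-tabulate {k = suc k} g f = cong (f (g zero) *_) (prodL-tabulate (g ∘ suc) f)

prodL-lookup : ∀ (xs : List A) f → prodF (λ i → f (List.lookup xs i)) ≡ prodL xs f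
prodL-lookup [] f = refl
prodL-lookup (x ∷ xs) f = cong (f x *_) (prodL-lookup xs f)

sumL-lookup : ∀ (xs : List A) f → sumF (λ i → f (List.lookup xs i)) ≡ ∑ xs f
sumL-lookup [] f = refl
sumL-lookup (x ∷ xs) f = cong (f x +_) (sumL-lookup xs f)

core-list : ∀ {N} (s : Spec (suc N)) (ss : List (Spec (suc N))) → ∑ (s ∷ ss) b ≡ 1 → ∑ (s ∷ ss) m ≡ N →
  tuples∑ (length (s ∷ ss)) (λ ws → ⟦ preds (map p (s ∷ ss)) ws ⟧ * isCox ws) * prodL (s ∷ ss) K ≡ suc N ^ length ss * prodL (s ∷ ss) (λ s → weight s [])
core-list {N} s ss Σb Σm = trans (cong₂ _*_ (sym e) (sym (prodL-lookup (s ∷ ss) K)))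
  (trans (core sp (trans (sumL-lookup (s ∷ ss) b) Σb) (trans (sumL-lookup (s ∷ ss) m) Σm)) (cong (suc N ^ length ss *_) (prodL-lookup (s ∷ ss) (λ s → weight s []))))
  where
  sp : Fin (length (s ∷ ss)) → Spec (suc N)
  sp = List.lookup (s ∷ ss)
  e : Factorisations.N# sp ≡ tuples∑ (length (s ∷ ss)) (λ ws → ⟦ preds (map p (s ∷ ss)) ws ⟧ * isCox ws)
  e = trans (∑-cong (Factorisations.tups sp) (λ f → ⟦∧⟧ (Factorisations.specB sp f) _)) (trans (vecs-lists (p ∘ sp) isCox)
    (cong (λ ps → tuples∑ (length (s ∷ ss)) (λ ws → ⟦ preds ps ws ⟧ * isCox ws)) (trans (sym (LP.map-tabulate sp p)) (cong (map p) (LP.tabulate-lookup (s ∷ ss))))))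

-- The factorisation graph is connected, so the ranks of the |σ| add up to at least n - 1; the sign is odd.
one-B : ∀ {N} (ws : List (RawW (suc N))) → All Perm ws → prodW ws ≡ cox (suc N) → ∑ ws ℓT ≡ suc N → ∑ ws uB ≡ 1
one-B {N} ws al e Σℓ = by (∑ ws uB) refl upper-bound is-odd
  where
  f = Vec.fromList ws
  k = length ws
  look : ∀ (g : RawW (suc N) → ℕ) ws → sumF (λ c → g (lookup (Vec.fromList ws) c)) ≡ ∑ ws g
  look g [] = refl
  look g (w ∷ ws) = cong (g w +_) (look g ws)
  perms' : ∀ ws → All Perm ws → ∀ c → Perm (lookup (Vec.fromList ws) c)
  perms' (w ∷ ws) (x ∷ xs) zero = x
  perms' (w ∷ ws) (x ∷ xs) (suc c) = perms' ws xs c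
  pm : ∀ c → Perm (lookup f c)
  pm = perms' ws al
  pf : prodV f ≡ cox (suc N)
  pf = trans (cong prodW (VP.toList∘fromList ws)) e
  st : Vec (List (Cycle (suc N))) k
  st = Vec.replicate k []
  at-st : ∀ c → lookup st c ≡ []
  at-st c = VP.lookup-replicate c []
  no-∈ : ∀ {i : Fin (suc N)} → i ∈ [] → ⊥
  no-∈ ()
  C : Completion f st (zero ∷ [])
  C = ext f pm (subst Transitive (sym pf) (cox-trans N)) _ st (zero ∷ []) (λ c → subst (Part (lookup f c)) (sym (at-st c)) (part [] (nodup (λ i → z≤n))))
    (here refl) (λ c i q → ⊥-elim (no-∈ (subst (λ x → i ∈ verts x) (at-st c) q))) ≤-refl
  open Completion C
  sizes nBs : ℕ
  sizes = sumF (λ c → size (letters (cs c)))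
  nBs = sumF (λ c → nB (letters (cs c)))
  uB≡ : ∑ ws uB ≡ nBs
  uB≡ = trans (sym (look uB ws)) (sumF-cong (λ c → uB-letters (pm c) (fulls c)))
  ℓ≡ : suc N ≡ sizes + ∑ ws uB
  ℓ≡ = trans (sym Σℓ) (trans (sym (look ℓT ws)) (trans (sumF-cong (λ c → trans (ℓT-letters (fulls c)) (ρ-size (letters (cs c))))) (trans (sumF-+ (λ c → size (letters (cs c))) (λ c → nB (letters (cs c)))) (cong (sizes +_) (sym uB≡)))))
  upper-bound : ∑ ws uB ≤ 1
  upper-bound = +-cancelˡ-≤ sizes _ _ (≤-trans (≤-reflexive (sym ℓ≡)) (≤-trans (m≤n+m (suc N) (total st)) bound))
  is-odd : odd (∑ ws uB) ≡ true
  is-odd = trans (cong odd uB≡) (trans (sym (sgn-prod f (λ c → nB (letters (cs c))) pm (λ c → sgn-full (fulls c)))) (trans (cong sgn pf) (cox-sgn N)))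
  by : ∀ u → ∑ ws uB ≡ u → u ≤ 1 → odd u ≡ true → ∑ ws uB ≡ 1
  by zero q le ()
  by (suc zero) q le o = q
  by (suc (suc u)) q (s≤s ()) o

rk-typed : ∀ {w : RawW n} (A : Fin n → ℕ) β → below n β → Perm w → hasType w (ctype A β) ≡ true → ℓT w ≡ tsize A β + flags β × uB w ≡ flags β
rk-typed {n} {w} A β bl pw e with full-exists pw
... | cs , fl = trans (ℓT-letters fl) (trans (ρ-size (letters cs)) (cong₂ _+_ (proj₁ d) (proj₂ d))) , trans (uB-letters pw fl) (proj₂ d)
  where
  t : typeB A β (letters cs) ≡ true
  t = fin-all _ (λ k → subst₂ (λ x y → (x ≡ᵇ A k) ∧ (y ≡ᵇ bMulOf {n} (ctype A β) (toℕ k)) ≡ true) (aMult-letters pw fl (toℕ k)) (bMult-letters pw fl (toℕ k)) (all-fin _ e k))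
  d = typed-det A β bl (letters cs) (full-InA fl) t

-- Ranked factors and the place of the type B cycle

choice : ℕ → ℕ → ℕ → ℕ
choice n r zero = n C r
choice n r (suc _) = r * (n C r)

-- The contribution of the ranked factors: C(n, r) for each, times r for a factor that carries a
-- type B cycle.
choices : ℕ → List ℕ → List ℕ → ℕ
choices n (r ∷ R) (b ∷ bs) = choice n r b * choices n R bs
choices n _ _ = 1

zeros : ℕ → List ℕ
zeros zero = []
zeros (suc k) = 0 ∷ zeros k

-- Ranks R with flags bs marking the factors that have a type B cycle; such a factor has positive rank.
data Flagged (N : ℕ) : List ℕ → List ℕ → Set where
  nil : Flagged N [] []
  plain : ∀ {r R bs} → r ≤ N → Flagged N R bs → Flagged N (r ∷ R) (0 ∷ bs)
  flag : ∀ {r R bs} → r ≤ N → Flagged N R bs → Flagged N (suc r ∷ R) (1 ∷ bs)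

bspecs : ∀ {R bs} → Flagged N R bs → List (Spec (suc N))
bspecs nil = []
bspecs {N} (plain {r} le v) = ranked (suc N) r 0 (≤-trans le (n≤1+n N)) ∷ bspecs v
bspecs {N} (flag {r} le v) = ranked (suc N) (suc r) 1 (≤-trans le (n≤1+n N)) ∷ bspecs v

bspecs-p : ∀ {R bs} (v : Flagged N R bs) → map p (bspecs v) ≡ List.zipWith rankP R bs
bspecs-p nil = refl
bspecs-p (plain le v) = cong (_ ∷_) (bspecs-p v)
bspecs-p (flag le v) = cong (_ ∷_) (bspecs-p v)

bspecs-length : ∀ {R bs} (v : Flagged N R bs) → length (bspecs v) ≡ length R
bspecs-length nil = refl
bspecs-length (plain le v) = cong suc (bspecs-length v)
bspecs-length (flag le v) = cong suc (bspecs-length v)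

bspecs-b : ∀ {R bs} (v : Flagged N R bs) → ∑ (bspecs v) b ≡ ∑ bs id
bspecs-b nil = refl
bspecs-b (plain le v) = bspecs-b v
bspecs-b (flag le v) = cong suc (bspecs-b v)

bspecs-m : ∀ {R bs} (v : Flagged N R bs) → ∑ (bspecs v) m + ∑ bs id ≡ ∑ R id
bspecs-m nil = refl
bspecs-m (plain {r} le v) = trans (+-assoc r _ _) (cong (r +_) (bspecs-m v))
bspecs-m (flag {r} {R} {bs} le v) = trans (+-suc (r + ∑ (bspecs v) m) _) (cong suc (trans (+-assoc r _ _) (cong (r +_) (bspecs-m v))))

bspecs-K : ∀ {R bs} (v : Flagged N R bs) → NonZero (prodL (bspecs v) K)
bspecs-K nil = _
bspecs-K {N} (plain {r} le v) = m*n≢0 _ _ {{>-nonZero (m<n⇒0<n∸m (s≤s le))}} {{bspecs-K v}}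
bspecs-K {N} (flag {r} le v) = m*n≢0 _ _ {{>-nonZero (m<n⇒0<n∸m (s≤s le))}} {{bspecs-K v}}

-- Each ranked factor raises the power of n by one; by `ranked-0` and `ranked-1` this n turns its
-- weight into its number of cycles times its share of `choices`.
bspecs-weight : ∀ {R bs} (v : Flagged N R bs) → suc N ^ length R * prodL (bspecs v) (λ s → weight s []) ≡ prodL (bspecs v) K * choices (suc N) R bs
bspecs-weight nil = refl
bspecs-weight {N} (plain {r} {R} {bs} le v) = trans (lem (suc N) (suc N ^ length R) (weight (ranked (suc N) r 0 (≤-trans le (n≤1+n N))) []) (prodL (bspecs v) (λ s → weight s []))) (trans (cong₂ _*_ (ranked-0 N r le) (bspecs-weight v)) (*-interchange (suc N ∸ r) (suc N C r) (prodL (bspecs v) K) (choices (suc N) R bs)))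
  where
  lem : ∀ n x w W → n * x * (w * W) ≡ (n * w) * (x * W)
  lem = solve-∀
bspecs-weight {N} (flag {r} {R} {bs} le v) = trans (lem (suc N) (suc N ^ length R) (weight (ranked (suc N) (suc r) 1 (≤-trans le (n≤1+n N))) []) (prodL (bspecs v) (λ s → weight s []))) (trans (cong₂ _*_ (ranked-1 N r le) (bspecs-weight v)) (*-interchange (suc N ∸ r) (suc r * (suc N C suc r)) (prodL (bspecs v) K) (choices (suc N) R bs)))
  where
  lem : ∀ n x w W → n * x * (w * W) ≡ (n * w) * (x * W)
  lem = solve-∀

typedWeight : ∀ N → (Fin (suc N) → ℕ) → Maybe ℕ → ℕ
typedWeight N A nothing = multinomial (suc N ∸ tsize A nothing) A
typedWeight N A (just α) = suc (N ∸ tsize A (just α)) * multinomial (N ∸ tsize A (just α)) A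

typed-weight : ∀ (A : Fin (suc N) → ℕ) β bl (le : tsize A β ≤ N) → weight (typed (suc N) A β bl (≤-trans le (n≤1+n N))) [] ≡ typedWeight N A β
typed-weight A nothing refl le = typed-A A le
typed-weight A (just α) bl le = typed-B A α bl le

rankB : ℕ → Pred n
rankB r w = ℓT w ≡ᵇ r

no-flags : ∀ R (vs : List (RawW n)) → preds (map rankB R) vs ≡ true → ∑ vs uB ≡ 0 → preds (List.zipWith rankP R (zeros (length R))) vs ≡ true
no-flags [] [] e z = refl
no-flags (r ∷ R) (w ∷ vs) e z with ∧-true {rankB r w} e
... | e₁ , e₂ = ∧-intro (∧-intro e₁ (cong (_≡ᵇ 0) (m+n≡0⇒m≡0 (uB w) z))) (no-flags R vs e₂ (m+n≡0⇒n≡0 (uB w) z))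

module Typeds {N d : ℕ} (A : Fin (suc d) → Fin (suc N) → ℕ) (β : Fin (suc d) → Maybe ℕ)
  (bl : ∀ i → below (suc N) (β i)) (le : ∀ i → tsize (A i) (β i) ≤ N) where

  nn = suc N

  tspec : Fin (suc d) → Spec nn
  tspec i = typed nn (A i) (β i) (bl i) (≤-trans (le i) (n≤1+n N))

  TP : List (Pred nn)
  TP = List.tabulate (λ i w → hasType w (ctype (A i) (β i)))

  Σrk : ℕ
  Σrk = sumF (λ i → tsize (A i) (β i)) + sumF (λ i → flags (β i))

  -- This is `core-list` for the typed factors followed by the ranked ones. The cycle numbers of the
  -- ranked factors occur on both sides, are positive, and cancel.
  flagged-count : ∀ {R bs} → Flagged N R bs → Σrk + ∑ R id ≡ nn → sumF (λ i → flags (β i)) + ∑ bs id ≡ 1 →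
    tuples∑ (suc d + length R) (λ ws → ⟦ preds (TP ++ List.zipWith rankP R bs) ws ⟧ * isCox ws) * prodF (λ i → nn ∸ tsize (A i) (β i))
      ≡ nn ^ d * prodF (λ i → typedWeight N (A i) (β i)) * choices nn R bs
  flagged-count {R} {bs} v Σr Σf = *-cancelʳ-≡ _ _ (prodL BS K) {{bspecs-K v}} (begin
    Tn * Kt * prodL BS K ≡⟨ *-assoc Tn Kt _ ⟩
    Tn * (Kt * prodL BS K) ≡⟨ cong₂ _*_ T≡ (sym (trans (prodL-++ TS BS K) (cong (_* prodL BS K) (prodL-tabulate tspec K)))) ⟩
    tuples∑ (length (TS ++ BS)) (λ ws → ⟦ preds (map p (TS ++ BS)) ws ⟧ * isCox ws) * prodL (TS ++ BS) K ≡⟨ core-list (tspec zero) (List.tabulate (tspec ∘ suc) ++ BS) Σb Σm ⟩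
    nn ^ length (List.tabulate (tspec ∘ suc) ++ BS) * prodL (TS ++ BS) w ≡⟨ cong₂ _*_ (trans (cong (nn ^_) (trans (LP.length-++ (List.tabulate (tspec ∘ suc))) (cong₂ _+_ (LP.length-tabulate (tspec ∘ suc)) (bspecs-length v)))) (^-distribˡ-+-* nn d (length R)))
        (trans (prodL-++ TS BS w) (cong (_* prodL BS w) (trans (prodL-tabulate tspec w) (prodF-cong (λ i → typed-weight (A i) (β i) (bl i) (le i)))))) ⟩
    nn ^ d * nn ^ length R * (Wt * prodL BS w) ≡⟨ *-interchange (nn ^ d) (nn ^ length R) Wt (prodL BS w) ⟩
    nn ^ d * Wt * (nn ^ length R * prodL BS w) ≡⟨ cong (nn ^ d * Wt *_) (trans (bspecs-weight v) (*-comm (prodL BS K) _)) ⟩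
    nn ^ d * Wt * (choices nn R bs * prodL BS K) ≡⟨ sym (*-assoc (nn ^ d * Wt) (choices nn R bs) _) ⟩
    nn ^ d * Wt * choices nn R bs * prodL BS K ∎)
    where
    open ≡-Reasoning
    TS BS : List (Spec nn)
    TS = List.tabulate tspec
    BS = bspecs v
    w : Spec nn → ℕ
    w s = weight s []
    Tn = tuples∑ (suc d + length R) (λ ws → ⟦ preds (TP ++ List.zipWith rankP R bs) ws ⟧ * isCox ws)
    Kt = prodF (λ i → nn ∸ tsize (A i) (β i))
    Wt = prodF (λ i → typedWeight N (A i) (β i))
    T≡ : Tn ≡ tuples∑ (length (TS ++ BS)) (λ ws → ⟦ preds (map p (TS ++ BS)) ws ⟧ * isCox ws)
    T≡ = cong₂ (λ k ps → tuples∑ k (λ ws → ⟦ preds ps ws ⟧ * isCox ws)) (sym (trans (LP.length-++ TS) (cong₂ _+_ (LP.length-tabulate tspec) (bspecs-length v))))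
      (sym (trans (LP.map-++ p TS BS) (cong₂ _++_ (LP.map-tabulate tspec p) (bspecs-p v))))
    sum-tab : ∀ {k} (g : Fin k → Spec nn) (f : Spec nn → ℕ) → ∑ (List.tabulate g) f ≡ sumF (f ∘ g)
    sum-tab g f = ∑-tabulate g f
    Σb : ∑ (TS ++ BS) b ≡ 1
    Σb = trans (∑-++ TS BS b) (trans (cong₂ _+_ (sum-tab tspec b) (bspecs-b v)) Σf)
    Σm : ∑ (TS ++ BS) m ≡ N
    Σm = suc-injective (trans (+-comm 1 _) (trans (cong (∑ (TS ++ BS) m +_) (sym Σf)) (trans (cong (_+ (sumF (λ i → flags (β i)) + ∑ bs id)) (trans (∑-++ TS BS m) (cong (_+ ∑ BS m) (sum-tab tspec m))))
      (trans (interchange (sumF (λ i → tsize (A i) (β i))) (∑ BS m) (sumF (λ i → flags (β i))) (∑ bs id)) (trans (cong (Σrk +_) (bspecs-m v)) Σr)))))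

  preds-split : ∀ (ps qs : List (Pred nn)) ws → preds (ps ++ qs) ws ≡ true → ∃₂ λ us vs → ws ≡ us ++ vs × preds ps us ≡ true × preds qs vs ≡ true
  preds-split [] qs ws e = [] , ws , refl , refl , e
  preds-split (p ∷ ps) qs (w ∷ ws) e with ∧-true {p w} e
  ... | e₁ , e₂ with preds-split ps qs ws e₂
  ... | us , vs , refl , e₃ , e₄ = w ∷ us , vs , refl , ∧-intro e₁ e₃ , e₄

  preds-join : ∀ (ps qs : List (Pred nn)) us vs → preds ps us ≡ true → preds (ps ++ qs) (us ++ vs) ≡ preds qs vs
  preds-join [] qs [] vs e = refl
  preds-join (p ∷ ps) qs (w ∷ us) vs e with ∧-true {p w} e
  ... | e₁ , e₂ = trans (cong (_∧ preds (ps ++ qs) (us ++ vs)) e₁) (preds-join ps qs us vs e₂)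

  TP-sums : ∀ us → All Perm us → preds TP us ≡ true → ∑ us ℓT ≡ Σrk × ∑ us uB ≡ sumF (λ i → flags (β i))
  TP-sums us al e = trans (proj₁ r) (sumF-+ (λ i → tsize (A i) (β i)) (λ i → flags (β i))) , proj₂ r
    where
    go : ∀ {k} (A : Fin k → Fin nn → ℕ) (β : Fin k → Maybe ℕ) → (∀ i → below nn (β i)) → ∀ us → All Perm us →
      preds (List.tabulate (λ i w → hasType w (ctype (A i) (β i)))) us ≡ true →
      ∑ us ℓT ≡ sumF (λ i → tsize (A i) (β i) + flags (β i)) × ∑ us uB ≡ sumF (λ i → flags (β i))
    go {zero} A β bl [] al e = refl , refl
    go {suc k} A β bl (w ∷ us) (pw ∷ al) e =
      let (e₁ , e₂) = ∧-true {hasType w (ctype (A zero) (β zero))} e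
          (a₁ , a₂) = rk-typed (A zero) (β zero) (bl zero) pw e₁
          (b₁ , b₂) = go (A ∘ suc) (β ∘ suc) (bl ∘ suc) us al e₂
      in cong₂ _+_ a₁ b₁ , cong₂ _+_ a₂ b₂
    r = go A β bl us al e

  ranks-sum : ∀ R (vs : List (RawW nn)) → preds (map rankB R) vs ≡ true → ∑ vs ℓT ≡ ∑ R id
  ranks-sum [] [] e = refl
  ranks-sum (r ∷ R) (w ∷ vs) e with ∧-true {rankB r w} e
  ... | e₁ , e₂ = cong₂ _+_ (≡ᵇ-true (ℓT w) r e₁) (ranks-sum R vs e₂)

  forget : ∀ R bs (vs : List (RawW nn)) → length bs ≡ length R → preds (List.zipWith rankP R bs) vs ≡ true → preds (map rankB R) vs ≡ true
  forget [] [] [] l e = refl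
  forget (r ∷ R) (b ∷ bs) (w ∷ vs) l e with ∧-true {rankP r b w} e
  ... | e₁ , e₂ = ∧-intro (proj₁ (∧-true {rankB r w} e₁)) (forget R bs vs (suc-injective l) e₂)

  split-B : ∀ R ws → All Perm ws → prodW ws ≡ cox nn → Σrk + ∑ R id ≡ nn → preds (TP ++ map rankB R) ws ≡ true →
    ∃₂ λ us vs → ws ≡ us ++ vs × preds TP us ≡ true × preds (map rankB R) vs ≡ true × sumF (λ i → flags (β i)) + ∑ vs uB ≡ 1
  split-B R ws al c Σr e with preds-split TP (map rankB R) ws e
  ... | us , vs , refl , e₁ , e₂ = us , vs , refl , e₁ , e₂ , (begin
    sumF (λ i → flags (β i)) + ∑ vs uB ≡⟨ cong (_+ ∑ vs uB) (sym (proj₂ ts)) ⟩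
    ∑ us uB + ∑ vs uB ≡⟨ sym (∑-++ us vs uB) ⟩
    ∑ (us ++ vs) uB ≡⟨ one-B (us ++ vs) al c (trans (∑-++ us vs ℓT) (trans (cong₂ _+_ (proj₁ ts) (ranks-sum R vs e₂)) Σr)) ⟩
    1 ∎)
    where
    open ≡-Reasoning
    ts : ∑ us ℓT ≡ Σrk × ∑ us uB ≡ sumF (λ i → flags (β i))
    ts = TP-sums us (AllP.++⁻ˡ us al) e₁

zeros-length : ∀ k → length (zeros k) ≡ k
zeros-length zero = refl
zeros-length (suc k) = cong suc (zeros-length k)

∑-zeros : ∀ k → ∑ (zeros k) id ≡ 0
∑-zeros zero = refl
∑-zeros (suc k) = ∑-zeros k

-- The unit vectors of length k, each pointing at the factor that carries the type B cycle.
sel : ℕ → List (List ℕ)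
sel zero = []
sel (suc k) = (1 ∷ zeros k) ∷ map (0 ∷_) (sel k)

sel-facts : ∀ k {bs} → bs ∈ sel k → length bs ≡ k × ∑ bs id ≡ 1
sel-facts (suc k) (here refl) = cong suc (zeros-length k) , cong suc (∑-zeros k)
sel-facts (suc k) (there q) with ∈-map⁻ (0 ∷_) q
... | bs , q' , refl with sel-facts k q'
... | l , s = cong suc l , s

-- Numbers of type B cycles that add up to 1 form a unit vector, and no other pattern of flags fits
-- them.
sel-one : ∀ (R : List ℕ) (vs : List (RawW n)) → preds (map rankB R) vs ≡ true → ∑ vs uB ≡ 1 →
  ∑ (sel (length R)) (λ bs → ⟦ preds (List.zipWith rankP R bs) vs ⟧) ≡ 1
sel-one [] [] e ()
sel-one {n} (r ∷ R) (w ∷ vs) e s with ∧-true {rankB r w} e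
... | e₁ , e₂ = by (uB w) refl
  where
  head-flag : ∀ b → uB w ≡ b → ∀ c → rankP r c w ≡ (b ≡ᵇ c)
  head-flag b q c = cong₂ _∧_ e₁ (cong (_≡ᵇ c) q)
  rest : ∀ x → rankP r 0 w ≡ x → ∑ (map (0 ∷_) (sel (length R))) (λ bs → ⟦ preds (List.zipWith rankP (r ∷ R) bs) (w ∷ vs) ⟧) ≡ ⟦ x ⟧ * ∑ (sel (length R)) (λ bs → ⟦ preds (List.zipWith rankP R bs) vs ⟧)
  rest x q = trans (∑-map (0 ∷_) (sel (length R)) _) (trans (∑-cong (sel (length R)) (λ bs → trans (cong (λ y → ⟦ y ∧ preds (List.zipWith rankP R bs) vs ⟧) q) (⟦∧⟧ x _))) (∑-*ˡ (sel (length R)) ⟦ x ⟧ _))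
  by : ∀ u → uB w ≡ u → ⟦ rankP r 1 w ∧ preds (List.zipWith rankP R (zeros (length R))) vs ⟧ + ∑ (map (0 ∷_) (sel (length R))) (λ bs → ⟦ preds (List.zipWith rankP (r ∷ R) bs) (w ∷ vs) ⟧) ≡ 1
  by zero q = cong₂ _+_ (cong (λ x → ⟦ x ∧ preds (List.zipWith rankP R (zeros (length R))) vs ⟧) (head-flag 0 q 1))
    (trans (rest true (head-flag 0 q 0)) (trans (*-identityˡ _) (sel-one R vs e₂ (trans (cong (_+ ∑ vs uB) (sym q)) s))))
  by (suc zero) q = cong₂ _+_ (cong ⟦_⟧ (∧-intro (head-flag 1 q 1) (no-flags R vs e₂ (suc-injective (trans (cong (_+ ∑ vs uB) (sym q)) s))))) (rest false (head-flag 1 q 0))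
  by (suc (suc u)) q = ⊥-elim (1+n≢0 (suc-injective (trans (cong (_+ ∑ vs uB) (sym q)) s)))

-- Vandermonde's convolution and the blocks

conv : (ℕ → ℕ) → (ℕ → ℕ) → ℕ → ℕ
conv f g zero = f 0 * g 0
conv f g (suc s) = f 0 * g (suc s) + conv (f ∘ suc) g s

conv-cong : ∀ {f f'} g s → (∀ r → f r ≡ f' r) → conv f g s ≡ conv f' g s
conv-cong g zero e = cong (_* g 0) (e 0)
conv-cong g (suc s) e = cong₂ _+_ (cong (_* g (suc s)) (e 0)) (conv-cong g s (e ∘ suc))

conv-+ : ∀ f f' g s → conv (λ r → f r + f' r) g s ≡ conv f g s + conv f' g s
conv-+ f f' g zero = *-distribʳ-+ (g 0) (f 0) (f' 0)
conv-+ f f' g (suc s) = trans (cong₂ _+_ (*-distribʳ-+ (g (suc s)) (f 0) (f' 0)) (conv-+ (f ∘ suc) (f' ∘ suc) g s)) (interchange (f 0 * g (suc s)) _ _ _)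

conv-0 : ∀ g s → conv (λ _ → 0) g s ≡ 0
conv-0 g zero = refl
conv-0 g (suc s) = conv-0 g s

-- Pascal's rule in the first argument splits the convolution into those for s and for s + 1 with k
-- in place of k + 1.
vandermonde : ∀ k l s → conv (k C_) (l C_) s ≡ (k + l) C s
vandermonde zero l zero = trans (cong₂ _*_ (nC0 0) (nC0 l)) (sym (nC0 l))
vandermonde zero l (suc s) = trans (cong₂ _+_ (trans (cong (_* (l C suc s)) (nC0 0)) (*-identityˡ _)) (trans (conv-cong (l C_) s (λ r → k>n⇒nCk≡0 {0} {suc r} (s≤s z≤n))) (conv-0 (l C_) s))) (+-identityʳ _)
vandermonde (suc k) l zero = trans (cong₂ _*_ (nC0 (suc k)) (nC0 l)) (sym (nC0 (suc k + l)))
vandermonde (suc k) l (suc s) = begin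
  (suc k C 0) * (l C suc s) + conv (λ r → suc k C suc r) (l C_) s ≡⟨ cong₂ (λ x y → x * (l C suc s) + y) (trans (nC0 (suc k)) (sym (nC0 k)))
       (trans (conv-cong (l C_) s (λ r → sym (nCk+nC[k+1]≡[n+1]C[k+1] k r))) (conv-+ (k C_) (λ r → k C suc r) (l C_) s)) ⟩
  (k C 0) * (l C suc s) + (conv (k C_) (l C_) s + conv (λ r → k C suc r) (l C_) s) ≡⟨ lem ((k C 0) * (l C suc s)) (conv (k C_) (l C_) s) _ ⟩
  conv (k C_) (l C_) s + conv (k C_) (l C_) (suc s) ≡⟨ cong₂ _+_ (vandermonde k l s) (vandermonde k l (suc s)) ⟩
  (k + l) C s + (k + l) C suc s ≡⟨ nCk+nC[k+1]≡[n+1]C[k+1] (k + l) s ⟩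
  suc (k + l) C suc s ∎
  where
  open ≡-Reasoning
  lem : ∀ x y z → x + (y + z) ≡ y + (x + z)
  lem = solve-∀

∑-conv : ∀ (f g : ℕ → ℕ) D s → s ≤ D → ∑ (upTo (suc D)) (λ r → ⟦ r ≤ᵇ s ⟧ * (f r * g (s ∸ r))) ≡ conv f g s
∑-conv f g D s le = trans (∑-upTo (suc D) (λ r → ⟦ r ≤ᵇ s ⟧ * (f r * g (s ∸ r)))) (go f D s le)
  where
  go : ∀ f D s → s ≤ D → sumF {suc D} (λ r → ⟦ toℕ r ≤ᵇ s ⟧ * (f (toℕ r) * g (s ∸ toℕ r))) ≡ conv f g s
  go f D zero le = trans (cong₂ _+_ (*-identityˡ _) (trans (sumF-cong {D} (λ r → refl)) (trans (sumF-const {D} 0) (*-zeroʳ D)))) (+-identityʳ _)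
  go f (suc D) (suc s) (s≤s le) = cong₂ _+_ (*-identityˡ _) (trans (sumF-cong {suc D} (λ r → cong (λ b → ⟦ b ⟧ * (f (suc (toℕ r)) * g (s ∸ toℕ r))) (down (toℕ r)))) (go (f ∘ suc) D s le))
    where
    down : ∀ r → (suc r ≤ᵇ suc s) ≡ (r ≤ᵇ s)
    down zero = refl
    down (suc r) = refl

-- All lists of k entries up to D; their sum is prescribed by an indicator elsewhere. This keeps D
-- fixed in recursions in which the required sum decreases.
compositions : ℕ → ℕ → List (List ℕ)
compositions k D = allLists k (upTo (suc D))

count-compositions : ∀ n k D s → s ≤ D → ∑ (compositions k D) (λ R → ⟦ ∑ R id ≡ᵇ s ⟧ * prodL R (n C_)) ≡ (k * n) C s
count-compositions n zero D zero le = sym (nC0 0)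
count-compositions n zero D (suc s) le = sym (k>n⇒nCk≡0 {0} {suc s} (s≤s z≤n))
count-compositions n (suc k) D s le = begin
  ∑ (compositions (suc k) D) (λ R → ⟦ ∑ R id ≡ᵇ s ⟧ * prodL R (n C_)) ≡⟨ ∑-allLists-suc k (upTo (suc D)) _ ⟩
  ∑ (upTo (suc D)) (λ r → ∑ (compositions k D) (λ R → ⟦ r + ∑ R id ≡ᵇ s ⟧ * ((n C r) * prodL R (n C_)))) ≡⟨ ∑-cong (upTo (suc D)) one ⟩
  ∑ (upTo (suc D)) (λ r → ⟦ r ≤ᵇ s ⟧ * ((n C r) * ((k * n) C (s ∸ r)))) ≡⟨ ∑-conv (n C_) ((k * n) C_) D s le ⟩
  conv (n C_) ((k * n) C_) s ≡⟨ vandermonde n (k * n) s ⟩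
  (n + k * n) C s ∎
  where
  open ≡-Reasoning
  lem : ∀ a b c d → a * b * (c * d) ≡ a * (c * (b * d))
  lem = solve-∀
  one : ∀ r → ∑ (compositions k D) (λ R → ⟦ r + ∑ R id ≡ᵇ s ⟧ * ((n C r) * prodL R (n C_))) ≡ ⟦ r ≤ᵇ s ⟧ * ((n C r) * ((k * n) C (s ∸ r)))
  one r = begin
    ∑ (compositions k D) (λ R → ⟦ r + ∑ R id ≡ᵇ s ⟧ * ((n C r) * prodL R (n C_)))
      ≡⟨ ∑-cong (compositions k D) (λ R → trans (cong (_* ((n C r) * prodL R (n C_))) (trans (cong ⟦_⟧ (strip r s (∑ R id))) (⟦∧⟧ (r ≤ᵇ s) (∑ R id ≡ᵇ s ∸ r))))
           (lem ⟦ r ≤ᵇ s ⟧ ⟦ ∑ R id ≡ᵇ s ∸ r ⟧ (n C r) (prodL R (n C_)))) ⟩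
    ∑ (compositions k D) (λ R → ⟦ r ≤ᵇ s ⟧ * ((n C r) * (⟦ ∑ R id ≡ᵇ s ∸ r ⟧ * prodL R (n C_)))) ≡⟨ trans (∑-*ˡ (compositions k D) ⟦ r ≤ᵇ s ⟧ _) (cong (⟦ r ≤ᵇ s ⟧ *_) (∑-*ˡ (compositions k D) (n C r) _)) ⟩
    ⟦ r ≤ᵇ s ⟧ * ((n C r) * ∑ (compositions k D) (λ R → ⟦ ∑ R id ≡ᵇ s ∸ r ⟧ * prodL R (n C_))) ≡⟨ cong (λ x → ⟦ r ≤ᵇ s ⟧ * ((n C r) * x)) (count-compositions n k D (s ∸ r) (≤-trans (m∸n≤m s r) le)) ⟩
    ⟦ r ≤ᵇ s ⟧ * ((n C r) * ((k * n) C (s ∸ r))) ∎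

-- Only the list of the actual absolute lengths can fit, and it lies in the range of `compositions`
-- once its sum is at most D.
rank-list : ∀ (ws : List (RawW n)) D s → s ≤ D →
  ⟦ sum (map ℓT ws) ≡ᵇ s ⟧ ≡ ∑ (compositions (length ws) D) (λ R → ⟦ ∑ R id ≡ᵇ s ⟧ * ⟦ preds (map rankB R) ws ⟧)
rank-list [] D s le = sym (trans (+-identityʳ _) (*-identityʳ _))
rank-list {n} (w ∷ ws) D s le = sym (begin
  ∑ (compositions (suc (length ws)) D) (λ R → ⟦ ∑ R id ≡ᵇ s ⟧ * ⟦ preds (map rankB R) (w ∷ ws) ⟧) ≡⟨ ∑-allLists-suc (length ws) (upTo (suc D)) _ ⟩
  ∑ (upTo (suc D)) (λ r → ∑ (compositions (length ws) D) (λ R → ⟦ r + ∑ R id ≡ᵇ s ⟧ * ⟦ rankB r w ∧ preds (map rankB R) ws ⟧)) ≡⟨ ∑-cong (upTo (suc D)) one ⟩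
  ∑ (upTo (suc D)) (λ r → ⟦ r ≡ᵇ ℓT w ⟧ * (⟦ r ≤ᵇ s ⟧ * ⟦ sum (map ℓT ws) ≡ᵇ s ∸ r ⟧)) ≡⟨ ∑-cong (upTo (suc D)) (λ r → ⟦⟧*-cong (r ≡ᵇ ℓT w) (λ e → cong (λ x → ⟦ x ≤ᵇ s ⟧ * ⟦ sum (map ℓT ws) ≡ᵇ s ∸ x ⟧) (≡ᵇ-true r (ℓT w) e))) ⟩
  ∑ (upTo (suc D)) (λ r → ⟦ r ≡ᵇ ℓT w ⟧ * (⟦ ℓT w ≤ᵇ s ⟧ * ⟦ sum (map ℓT ws) ≡ᵇ s ∸ ℓT w ⟧)) ≡⟨ last ⟩
  ⟦ ℓT w ≤ᵇ s ⟧ * ⟦ sum (map ℓT ws) ≡ᵇ s ∸ ℓT w ⟧ ≡⟨ sym (trans (cong ⟦_⟧ (strip (ℓT w) s (sum (map ℓT ws)))) (⟦∧⟧ (ℓT w ≤ᵇ s) _)) ⟩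
  ⟦ ℓT w + sum (map ℓT ws) ≡ᵇ s ⟧ ∎)
  where
  open ≡-Reasoning
  lem : ∀ a b c d → a * b * (c * d) ≡ c * (a * (b * d))
  lem = solve-∀
  one : ∀ r → ∑ (compositions (length ws) D) (λ R → ⟦ r + ∑ R id ≡ᵇ s ⟧ * ⟦ rankB r w ∧ preds (map rankB R) ws ⟧) ≡ ⟦ r ≡ᵇ ℓT w ⟧ * (⟦ r ≤ᵇ s ⟧ * ⟦ sum (map ℓT ws) ≡ᵇ s ∸ r ⟧)
  one r = begin
    ∑ (compositions (length ws) D) (λ R → ⟦ r + ∑ R id ≡ᵇ s ⟧ * ⟦ rankB r w ∧ preds (map rankB R) ws ⟧)
      ≡⟨ ∑-cong (compositions (length ws) D) (λ R → trans (cong₂ _*_ (trans (cong ⟦_⟧ (strip r s (∑ R id))) (⟦∧⟧ (r ≤ᵇ s) _)) (trans (⟦∧⟧ (rankB r w) _) (cong (λ b → ⟦ b ⟧ * ⟦ preds (map rankB R) ws ⟧) (≡ᵇ-sym (ℓT w) r))))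
           (lem ⟦ r ≤ᵇ s ⟧ ⟦ ∑ R id ≡ᵇ s ∸ r ⟧ ⟦ r ≡ᵇ ℓT w ⟧ ⟦ preds (map rankB R) ws ⟧)) ⟩
    ∑ (compositions (length ws) D) (λ R → ⟦ r ≡ᵇ ℓT w ⟧ * (⟦ r ≤ᵇ s ⟧ * (⟦ ∑ R id ≡ᵇ s ∸ r ⟧ * ⟦ preds (map rankB R) ws ⟧)))
      ≡⟨ trans (∑-*ˡ (compositions (length ws) D) ⟦ r ≡ᵇ ℓT w ⟧ _) (cong (⟦ r ≡ᵇ ℓT w ⟧ *_) (∑-*ˡ (compositions (length ws) D) ⟦ r ≤ᵇ s ⟧ _)) ⟩
    ⟦ r ≡ᵇ ℓT w ⟧ * (⟦ r ≤ᵇ s ⟧ * ∑ (compositions (length ws) D) (λ R → ⟦ ∑ R id ≡ᵇ s ∸ r ⟧ * ⟦ preds (map rankB R) ws ⟧))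
      ≡⟨ cong (λ x → ⟦ r ≡ᵇ ℓT w ⟧ * (⟦ r ≤ᵇ s ⟧ * x)) (sym (rank-list ws D (s ∸ r) (≤-trans (m∸n≤m s r) le))) ⟩
    ⟦ r ≡ᵇ ℓT w ⟧ * (⟦ r ≤ᵇ s ⟧ * ⟦ sum (map ℓT ws) ≡ᵇ s ∸ r ⟧) ∎
  X : ℕ
  X = ⟦ ℓT w ≤ᵇ s ⟧ * ⟦ sum (map ℓT ws) ≡ᵇ s ∸ ℓT w ⟧
  last : ∑ (upTo (suc D)) (λ r → ⟦ r ≡ᵇ ℓT w ⟧ * X) ≡ X
  last with ℓT w ≤? D
  ... | yes l = ∑-upTo-pick (suc D) (ℓT w) X (s≤s l)
  ... | no ¬l = trans (∑-zero (upTo (suc D)) (λ r → trans (cong (⟦ r ≡ᵇ ℓT w ⟧ *_) X0) (*-zeroʳ ⟦ r ≡ᵇ ℓT w ⟧))) (sym X0)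
    where
    X0 : X ≡ 0
    X0 = cong (λ b → ⟦ b ⟧ * ⟦ sum (map ℓT ws) ≡ᵇ s ∸ ℓT w ⟧) (not-true (λ t → ¬l (≤-trans (≤ᵇ⇒≤ (ℓT w) s (subst T (sym t) _)) le)))

-- Φ sees the concatenation of the rank lists of the blocks; the i-th block has ms i factors of total rank ss i.
blockSum : (l : ℕ) (ms ss : Fin l → ℕ) → (List ℕ → ℕ) → ℕ
blockSum zero ms ss Φ = Φ []
blockSum (suc l) ms ss Φ = ∑ (compositions (ms zero) (ss zero)) (λ R → ⟦ ∑ R id ≡ᵇ ss zero ⟧ * blockSum l (ms ∘ suc) (ss ∘ suc) (λ R' → Φ (R ++ R')))

blockSum-cong : ∀ l ms ss {Φ Φ' : List ℕ → ℕ} → (∀ R → ∑ R id ≡ sumF ss → Φ R ≡ Φ' R) → blockSum l ms ss Φ ≡ blockSum l ms ss Φ'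
blockSum-cong zero ms ss h = h [] refl
blockSum-cong (suc l) ms ss h = ∑-cong (compositions (ms zero) (ss zero)) (λ R → ⟦⟧*-cong (∑ R id ≡ᵇ ss zero) (λ e →
  blockSum-cong l (ms ∘ suc) (ss ∘ suc) (λ R' q → h (R ++ R') (trans (∑-++ R R' id) (cong₂ _+_ (≡ᵇ-true _ _ e) q)))))

blockSum-ext : ∀ l ms ss {Φ Φ' : List ℕ → ℕ} → (∀ R → Φ R ≡ Φ' R) → blockSum l ms ss Φ ≡ blockSum l ms ss Φ'
blockSum-ext l ms ss h = blockSum-cong l ms ss (λ R _ → h R)

blockSum-* : ∀ l ms ss k (Φ : List ℕ → ℕ) → blockSum l ms ss (λ R → k * Φ R) ≡ k * blockSum l ms ss Φ
blockSum-* zero ms ss k Φ = refl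
blockSum-* (suc l) ms ss k Φ = trans (∑-cong (compositions (ms zero) (ss zero)) (λ R → trans (cong (⟦ ∑ R id ≡ᵇ ss zero ⟧ *_) (blockSum-* l (ms ∘ suc) (ss ∘ suc) k (λ R' → Φ (R ++ R'))))
  (lem ⟦ ∑ R id ≡ᵇ ss zero ⟧ k _))) (∑-*ˡ (compositions (ms zero) (ss zero)) k _)
  where
  lem : ∀ x y z → x * (y * z) ≡ y * (x * z)
  lem = solve-∀

blockSum-∑ : ∀ l ms ss (xs : List A) (Φ : A → List ℕ → ℕ) → blockSum l ms ss (λ R → ∑ xs (λ x → Φ x R)) ≡ ∑ xs (λ x → blockSum l ms ss (Φ x))
blockSum-∑ zero ms ss xs Φ = refl
blockSum-∑ (suc l) ms ss xs Φ = trans (∑-cong (compositions (ms zero) (ss zero)) (λ R → trans (cong (⟦ ∑ R id ≡ᵇ ss zero ⟧ *_) (blockSum-∑ l (ms ∘ suc) (ss ∘ suc) xs (λ x R' → Φ x (R ++ R'))))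
  (sym (∑-*ˡ xs ⟦ ∑ R id ≡ᵇ ss zero ⟧ _)))) (∑-swap (compositions (ms zero) (ss zero)) xs _)

-- The blocks are independent of one another, and within a block Vandermonde's convolution sums over
-- the ranks.
blockSum-C : ∀ n l ms ss → blockSum l ms ss (λ R → prodL R (n C_)) ≡ prodF (λ i → (ms i * n) C ss i)
blockSum-C n zero ms ss = refl
blockSum-C n (suc l) ms ss = trans (∑-cong (compositions (ms zero) (ss zero)) (λ R → trans (cong (⟦ ∑ R id ≡ᵇ ss zero ⟧ *_)
    (trans (blockSum-ext l (ms ∘ suc) (ss ∘ suc) (λ R' → prodL-++ R R' (n C_))) (trans (blockSum-* l (ms ∘ suc) (ss ∘ suc) (prodL R (n C_)) _) (cong (prodL R (n C_) *_) (blockSum-C n l (ms ∘ suc) (ss ∘ suc))))))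
    (sym (*-assoc ⟦ ∑ R id ≡ᵇ ss zero ⟧ _ _))))
  (trans (∑-*ʳ (compositions (ms zero) (ss zero)) (prodF (λ i → (ms (suc i) * n) C ss (suc i))) (λ R → ⟦ ∑ R id ≡ᵇ ss zero ⟧ * prodL R (n C_))) (cong (_* prodF (λ i → (ms (suc i) * n) C ss (suc i))) (count-compositions n (ms zero) (ss zero) (ss zero) ≤-refl)))

tuples∑-++ : ∀ k j (H : List (RawW n) → ℕ) → tuples∑ (k + j) H ≡ tuples∑ k (λ us → tuples∑ j (λ vs → H (us ++ vs)))
tuples∑-++ zero j H = sym (+-identityʳ _)
tuples∑-++ {n} (suc k) j H = trans (∑-allLists-suc (k + j) (WB n) H) (trans (∑-cong (WB n) (λ w → tuples∑-++ k j (λ ws → H (w ∷ ws)))) (sym (∑-allLists-suc k (WB n) _)))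

preds-++ : ∀ (ps qs : List (Pred n)) us vs → length us ≡ length ps → preds (ps ++ qs) (us ++ vs) ≡ preds ps us ∧ preds qs vs
preds-++ [] qs [] vs l = refl
preds-++ (p ∷ ps) qs (u ∷ us) vs l = trans (cong (p u ∧_) (preds-++ ps qs us vs (suc-injective l))) (sym (BP.∧-assoc (p u) _ _))

preds-∑ : ∀ (ps qs : List (Pred n)) (H : List (RawW n) → ℕ) →
  tuples∑ (length ps + length qs) (λ ws → ⟦ preds (ps ++ qs) ws ⟧ * H ws) ≡ tuples∑ (length ps) (λ us → ⟦ preds ps us ⟧ * tuples∑ (length qs) (λ vs → ⟦ preds qs vs ⟧ * H (us ++ vs)))
preds-∑ {n} ps qs H = trans (tuples∑-++ (length ps) (length qs) _) (tuples∑-cong (length ps) (λ us _ l → trans (∑-cong (allLists (length qs) (WB n)) (λ vs →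
  trans (cong (_* H (us ++ vs)) (trans (cong ⟦_⟧ (preds-++ ps qs us vs l)) (⟦∧⟧ (preds ps us) (preds qs vs)))) (*-assoc ⟦ preds ps us ⟧ _ _))) (∑-*ˡ (allLists (length qs) (WB n)) ⟦ preds ps us ⟧ _)))

blocks-∑ : ∀ l ms ss (H : List (RawW n) → ℕ) → ∑ (enumBlocks {n} l ms) (λ τs → ⟦ blocksOK l ss τs ⟧ * H (concat τs))
  ≡ blockSum l ms ss (λ R → tuples∑ (length R) (λ vs → ⟦ preds (map rankB R) vs ⟧ * H vs))
blocks-∑ zero ms ss H = refl
blocks-∑ {n} (suc l) ms ss H = begin
  ∑ (enumBlocks (suc l) ms) (λ τs → ⟦ blocksOK (suc l) ss τs ⟧ * H (concat τs)) ≡⟨ trans (∑-concatMap _ (allLists (ms zero) (WB n)) _) (∑-cong (allLists (ms zero) (WB n)) (λ bl → ∑-map (bl ∷_) (enumBlocks l (ms ∘ suc)) _)) ⟩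
  tuples∑ (ms zero) (λ bl → ∑ (enumBlocks l (ms ∘ suc)) (λ τs → ⟦ (sum (map ℓT bl) ≡ᵇ ss zero) ∧ blocksOK l (ss ∘ suc) τs ⟧ * H (bl ++ concat τs))) ≡⟨ tuples∑-cong (ms zero) (λ bl _ l → one bl l) ⟩
  tuples∑ (ms zero) (λ bl → ∑ Rs (λ R → ⟦ ∑ R id ≡ᵇ ss zero ⟧ * blockSum l (ms ∘ suc) (ss ∘ suc) (λ R' → ⟦ preds (map rankB R) bl ⟧ * inner R' bl))) ≡⟨ ∑-swap (allLists (ms zero) (WB n)) Rs _ ⟩
  ∑ Rs (λ R → tuples∑ (ms zero) (λ bl → ⟦ ∑ R id ≡ᵇ ss zero ⟧ * blockSum l (ms ∘ suc) (ss ∘ suc) (λ R' → ⟦ preds (map rankB R) bl ⟧ * inner R' bl)))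
    ≡⟨ ∑-cong Rs (λ R → trans (∑-*ˡ (allLists (ms zero) (WB n)) ⟦ ∑ R id ≡ᵇ ss zero ⟧ _) (cong (⟦ ∑ R id ≡ᵇ ss zero ⟧ *_) (sym (blockSum-∑ l (ms ∘ suc) (ss ∘ suc) (allLists (ms zero) (WB n)) (λ bl R' → ⟦ preds (map rankB R) bl ⟧ * inner R' bl))))) ⟩
  ∑ Rs (λ R → ⟦ ∑ R id ≡ᵇ ss zero ⟧ * blockSum l (ms ∘ suc) (ss ∘ suc) (λ R' → tuples∑ (ms zero) (λ bl → ⟦ preds (map rankB R) bl ⟧ * inner R' bl)))
    ≡⟨ trans (∑-lists-len (ms zero) (upTo (suc (ss zero))) (λ R k → ⟦ ∑ R id ≡ᵇ ss zero ⟧ * blockSum l (ms ∘ suc) (ss ∘ suc) (λ R' → tuples∑ k (λ bl → ⟦ preds (map rankB R) bl ⟧ * inner R' bl))))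
        (∑-cong Rs (λ R → cong (⟦ ∑ R id ≡ᵇ ss zero ⟧ *_) (blockSum-ext l (ms ∘ suc) (ss ∘ suc) (λ R' → sym (join R R'))))) ⟩
  ∑ Rs (λ R → ⟦ ∑ R id ≡ᵇ ss zero ⟧ * blockSum l (ms ∘ suc) (ss ∘ suc) (λ R' → tuples∑ (length (R ++ R')) (λ vs → ⟦ preds (map rankB (R ++ R')) vs ⟧ * H vs))) ∎
  where
  open ≡-Reasoning
  Rs : List (List ℕ)
  Rs = compositions (ms zero) (ss zero)
  inner : List ℕ → List (RawW n) → ℕ
  inner R' bl = tuples∑ (length R') (λ vs → ⟦ preds (map rankB R') vs ⟧ * H (bl ++ vs))
  ∑-lists-len : ∀ {A : Set} k (xs : List A) (F : List A → ℕ → ℕ) → ∑ (allLists k xs) (λ R → F R k) ≡ ∑ (allLists k xs) (λ R → F R (length R))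
  ∑-lists-len k xs F = sym (∑-lists-length k xs F)
  join : ∀ R R' → tuples∑ (length (R ++ R')) (λ vs → ⟦ preds (map rankB (R ++ R')) vs ⟧ * H vs) ≡ tuples∑ (length R) (λ bl → ⟦ preds (map rankB R) bl ⟧ * inner R' bl)
  join R R' = trans (cong₂ (λ k ps → tuples∑ k (λ vs → ⟦ preds ps vs ⟧ * H vs)) (trans (LP.length-++ R) (sym (cong₂ _+_ (LP.length-map rankB R) (LP.length-map rankB R')))) (LP.map-++ rankB R R'))
    (trans (preds-∑ (map rankB R) (map rankB R') H) (cong₂ (λ k j → tuples∑ k (λ us → ⟦ preds (map rankB R) us ⟧ * tuples∑ j (λ vs → ⟦ preds (map rankB R') vs ⟧ * H (us ++ vs)))) (LP.length-map rankB R) (LP.length-map rankB R')))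
  one : ∀ bl → length bl ≡ ms zero → ∑ (enumBlocks l (ms ∘ suc)) (λ τs → ⟦ (sum (map ℓT bl) ≡ᵇ ss zero) ∧ blocksOK l (ss ∘ suc) τs ⟧ * H (bl ++ concat τs))
    ≡ ∑ Rs (λ R → ⟦ ∑ R id ≡ᵇ ss zero ⟧ * blockSum l (ms ∘ suc) (ss ∘ suc) (λ R' → ⟦ preds (map rankB R) bl ⟧ * inner R' bl))
  one bl len = begin
    ∑ (enumBlocks l (ms ∘ suc)) (λ τs → ⟦ (sum (map ℓT bl) ≡ᵇ ss zero) ∧ blocksOK l (ss ∘ suc) τs ⟧ * H (bl ++ concat τs))
      ≡⟨ trans (∑-cong (enumBlocks l (ms ∘ suc)) (λ τs → trans (cong (_* H (bl ++ concat τs)) (⟦∧⟧ (sum (map ℓT bl) ≡ᵇ ss zero) _)) (*-assoc ⟦ sum (map ℓT bl) ≡ᵇ ss zero ⟧ _ _))) (∑-*ˡ (enumBlocks l (ms ∘ suc)) ⟦ sum (map ℓT bl) ≡ᵇ ss zero ⟧ _) ⟩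
    ⟦ sum (map ℓT bl) ≡ᵇ ss zero ⟧ * ∑ (enumBlocks l (ms ∘ suc)) (λ τs → ⟦ blocksOK l (ss ∘ suc) τs ⟧ * H (bl ++ concat τs)) ≡⟨ cong₂ _*_ (trans (rank-list bl (ss zero) (ss zero) ≤-refl) (cong (λ k → ∑ (compositions k (ss zero)) (λ R → ⟦ ∑ R id ≡ᵇ ss zero ⟧ * ⟦ preds (map rankB R) bl ⟧)) len)) (blocks-∑ l (ms ∘ suc) (ss ∘ suc) (λ vs → H (bl ++ vs))) ⟩
    ∑ Rs (λ R → ⟦ ∑ R id ≡ᵇ ss zero ⟧ * ⟦ preds (map rankB R) bl ⟧) * Y ≡⟨ sym (∑-*ʳ Rs Y (λ R → ⟦ ∑ R id ≡ᵇ ss zero ⟧ * ⟦ preds (map rankB R) bl ⟧)) ⟩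
    ∑ Rs (λ R → ⟦ ∑ R id ≡ᵇ ss zero ⟧ * ⟦ preds (map rankB R) bl ⟧ * Y) ≡⟨ ∑-cong Rs (λ R → trans (*-assoc ⟦ ∑ R id ≡ᵇ ss zero ⟧ _ Y) (cong (⟦ ∑ R id ≡ᵇ ss zero ⟧ *_) (sym (blockSum-* l (ms ∘ suc) (ss ∘ suc) ⟦ preds (map rankB R) bl ⟧ (λ R' → inner R' bl))))) ⟩
    ∑ Rs (λ R → ⟦ ∑ R id ≡ᵇ ss zero ⟧ * blockSum l (ms ∘ suc) (ss ∘ suc) (λ R' → ⟦ preds (map rankB R) bl ⟧ * inner R' bl)) ∎
    where
    Y : ℕ
    Y = blockSum l (ms ∘ suc) (ss ∘ suc) (λ R' → inner R' bl)

allVecs-lists : ∀ k (xs : List A) (H : List A → ℕ) → ∑ (allVecs k xs) (H ∘ toList) ≡ ∑ (allLists k xs) H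
allVecs-lists zero xs H = refl
allVecs-lists (suc k) xs H = trans (∑-allVecs-suc k xs _) (trans (∑-cong xs (λ x → allVecs-lists k xs (λ v → H (x ∷ v)))) (sym (∑-allLists-suc k xs H)))

all-preds : ∀ {d} (P : Fin d → Pred n) (σs : Vec (RawW n) d) → all (λ i → P i (lookup σs i)) (allFin d) ≡ preds (List.tabulate P) (toList σs)
all-preds P [] = refl
all-preds P (w ∷ σs) = trans (all-suc (λ i → P i (lookup (w ∷ σs) i))) (cong (P zero w ∧_) (all-preds (P ∘ suc) σs))

-- The formula for G needs a condition on every single factor, so the factorisations are sorted by
-- the ranks of all factors in the blocks.
num-blocks : ∀ n d (T : Fin d → CType n) l ms ss → numFactorisations n d T l ms ss ≡
  blockSum l ms ss (λ R → tuples∑ (d + length R) (λ ws → ⟦ preds (List.tabulate (λ i w → hasType w (T i)) ++ map rankB R) ws ⟧ * isCox ws))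
num-blocks n d T l ms ss = begin
  numFactorisations n d T l ms ss ≡⟨ trans (countB-∑ _ (concatMap (λ σs → map (σs ,_) (enumBlocks l ms)) (allVecs d (WB n)))) (trans (∑-concatMap _ (allVecs d (WB n)) _) (∑-cong (allVecs d (WB n)) (λ σs → ∑-map {A = List (List (RawW n))} {B = Vec (RawW n) d × List (List (RawW n))} (σs ,_) (enumBlocks l ms) _))) ⟩
  ∑ (allVecs d (WB n)) (λ σs → ∑ (enumBlocks l ms) (λ τs → ⟦ eqW (prodW (toList σs ++ concat τs)) (cox n) ∧ all (λ i → hasType (lookup σs i) (T i)) (allFin d) ∧ blocksOK l ss τs ⟧))
    ≡⟨ ∑-cong (allVecs d (WB n)) (λ σs → trans (∑-cong (enumBlocks l ms) (λ τs → reorder (eqW (prodW (toList σs ++ concat τs)) (cox n)) (all (λ i → hasType (lookup σs i) (T i)) (allFin d)) (blocksOK l ss τs)))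
         (trans (∑-*ˡ (enumBlocks l ms) ⟦ all (λ i → hasType (lookup σs i) (T i)) (allFin d) ⟧ _) (cong₂ _*_ (cong ⟦_⟧ (all-preds (λ i w → hasType w (T i)) σs)) (blocks-∑ l ms ss (λ vs → isCox (toList σs ++ vs)))))) ⟩
  ∑ (allVecs d (WB n)) (λ σs → ⟦ preds TP (toList σs) ⟧ * blockSum l ms ss (λ R → tuples∑ (length R) (λ vs → ⟦ preds (map rankB R) vs ⟧ * isCox (toList σs ++ vs))))
    ≡⟨ allVecs-lists d (WB n) (λ us → ⟦ preds TP us ⟧ * blockSum l ms ss (λ R → tuples∑ (length R) (λ vs → ⟦ preds (map rankB R) vs ⟧ * isCox (us ++ vs)))) ⟩
  tuples∑ d (λ us → ⟦ preds TP us ⟧ * blockSum l ms ss (λ R → tuples∑ (length R) (λ vs → ⟦ preds (map rankB R) vs ⟧ * isCox (us ++ vs))))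
    ≡⟨ trans (∑-cong (allLists d (WB n)) (λ us → sym (blockSum-* l ms ss ⟦ preds TP us ⟧ _))) (sym (blockSum-∑ l ms ss (allLists d (WB n)) _)) ⟩
  blockSum l ms ss (λ R → tuples∑ d (λ us → ⟦ preds TP us ⟧ * tuples∑ (length R) (λ vs → ⟦ preds (map rankB R) vs ⟧ * isCox (us ++ vs)))) ≡⟨ blockSum-ext l ms ss (λ R → sym (join R)) ⟩
  blockSum l ms ss (λ R → tuples∑ (d + length R) (λ ws → ⟦ preds (TP ++ map rankB R) ws ⟧ * isCox ws)) ∎
  where
  open ≡-Reasoning
  TP : List (Pred n)
  TP = List.tabulate (λ i w → hasType w (T i))
  reorder : ∀ a b c → ⟦ a ∧ b ∧ c ⟧ ≡ ⟦ b ⟧ * (⟦ c ⟧ * ⟦ a ⟧)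
  reorder true true true = refl
  reorder true true false = refl
  reorder true false c = refl
  reorder false true true = refl
  reorder false true false = refl
  reorder false false c = refl
  lenTP : length TP ≡ d
  lenTP = LP.length-tabulate (λ i w → hasType w (T i))
  join : ∀ R → tuples∑ (d + length R) (λ ws → ⟦ preds (TP ++ map rankB R) ws ⟧ * isCox ws) ≡ tuples∑ d (λ us → ⟦ preds TP us ⟧ * tuples∑ (length R) (λ vs → ⟦ preds (map rankB R) vs ⟧ * isCox (us ++ vs)))
  join R = trans (cong (λ k → tuples∑ k (λ ws → ⟦ preds (TP ++ map rankB R) ws ⟧ * isCox ws)) (sym (cong₂ _+_ lenTP (LP.length-map rankB R))))
    (trans (preds-∑ TP (map rankB R) isCox) (cong₂ (λ k j → tuples∑ k (λ us → ⟦ preds TP us ⟧ * tuples∑ j (λ vs → ⟦ preds (map rankB R) vs ⟧ * isCox (us ++ vs)))) lenTP (LP.length-map rankB R)))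

-- A flagged factor of rank 0 does not exist.
data Vacuous : List ℕ → List ℕ → Set where
  here₀ : ∀ {R bs} → Vacuous (0 ∷ R) (1 ∷ bs)
  later : ∀ {r R bs} → Vacuous R bs → Vacuous (r ∷ R) (0 ∷ bs)

flagged-zeros : ∀ R → ∑ R id ≤ N → Flagged N R (zeros (length R))
flagged-zeros [] le = nil
flagged-zeros (r ∷ R) le = plain (≤-trans (m≤m+n r _) le) (flagged-zeros R (≤-trans (m≤n+m _ r) le))

vacuous-zero : ∀ R {bs} → bs ∈ sel (length R) → ∑ R id ≡ 0 → Vacuous R bs
vacuous-zero (r ∷ R) (here refl) e rewrite m+n≡0⇒m≡0 r e = here₀
vacuous-zero (r ∷ R) (there q) e with ∈-map⁻ (0 ∷_) q
... | bs , q' , refl = later (vacuous-zero R q' (m+n≡0⇒n≡0 r e))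

-- An unflagged entry above N exhausts the total n, so the flagged entry that comes later has rank
-- 0.
flagged-or-vacuous : ∀ R {bs} → bs ∈ sel (length R) → ∑ R id ≤ suc N → Flagged N R bs ⊎ Vacuous R bs
flagged-or-vacuous (zero ∷ R) (here refl) le = inj₂ here₀
flagged-or-vacuous (suc r ∷ R) (here refl) (s≤s le) = inj₁ (flag (≤-trans (m≤m+n r _) le) (flagged-zeros R (≤-trans (m≤n+m _ r) le)))
flagged-or-vacuous {N} (r ∷ R) (there q) le with ∈-map⁻ (0 ∷_) q
... | bs , q' , refl with r ≤? N
... | no ¬l = inj₂ (later (vacuous-zero R q' (n≤0⇒n≡0 (+-cancelˡ-≤ (suc N) _ _ (≤-trans (+-monoˡ-≤ (∑ R id) (≰⇒> ¬l)) (≤-trans le (≤-reflexive (sym (+-identityʳ (suc N))))))))))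
... | yes l with flagged-or-vacuous R q' (≤-trans (m≤n+m _ r) le)
... | inj₁ v = inj₁ (plain l v)
... | inj₂ z = inj₂ (later z)

choices-vacuous : ∀ n {R bs} → Vacuous R bs → choices n R bs ≡ 0
choices-vacuous n here₀ = refl
choices-vacuous n (later {r} v) = trans (cong ((n C r) *_) (choices-vacuous n v)) (*-zeroʳ (n C r))

preds-vacuous : ∀ {R bs} (vs : List (RawW n)) → All Perm vs → Vacuous R bs → preds (List.zipWith rankP R bs) vs ≡ true → ⊥
preds-vacuous (w ∷ vs) (pw ∷ _) here₀ e with ∧-true {rankP 0 1 w} e
... | e₁ , _ with ∧-true {ℓT w ≡ᵇ 0} e₁ | full-exists pw
... | e₂ , e₃ | cs , fl = 1+n≢0 (m+n≡0⇒n≡0 (size (letters cs)) (trans (cong (size (letters cs) +_) (trans (sym (≡ᵇ-true (uB w) 1 e₃)) (uB-letters pw fl)))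
  (trans (sym (ρ-size (letters cs))) (trans (sym (ℓT-letters fl)) (≡ᵇ-true (ℓT w) 0 e₂)))))
preds-vacuous (w ∷ vs) (_ ∷ al) (later {r} v) e = preds-vacuous vs al v (proj₂ (∧-true {rankP r 0 w} e))

choices-zeros : ∀ n R → choices n R (zeros (length R)) ≡ prodL R (n C_)
choices-zeros n [] = refl
choices-zeros n (r ∷ R) = cong ((n C r) *_) (choices-zeros n R)

-- The source of the factor n - Σ rk T_i in part (ii): it is the total rank of the block factors,
-- one of which carries the type B cycle.
choices-sel : ∀ n R → ∑ (sel (length R)) (choices n R) ≡ ∑ R id * prodL R (n C_)
choices-sel n [] = refl
choices-sel n (r ∷ R) = trans (cong₂ _+_ (cong (r * (n C r) *_) (choices-zeros n R)) (trans (∑-map (0 ∷_) (sel (length R)) _) (trans (∑-*ˡ (sel (length R)) (n C r) _) (cong ((n C r) *_) (choices-sel n R)))))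
  (lem r (n C r) (∑ R id) (prodL R (n C_)))
  where
  lem : ∀ r c s p → r * c * p + c * (s * p) ≡ (r + s) * (c * p)
  lem = solve-∀

-- Assembling the two formulas

prodF-at : ∀ {d} (f g : Fin d → ℕ) j x → f j ≡ x → g j ≡ 1 → (∀ i → i ≢ j → f i ≡ g i) → prodF f ≡ x * prodF g
prodF-at f g j x fj gj off with prodF-split g j
... | P , h = trans (h f off) (cong₂ _*_ fj (sym (trans (h g (λ _ _ → refl)) (trans (cong (_* P) gj) (*-identityˡ P)))))

module Assembly {N d : ℕ} (A : Fin (suc d) → Fin (suc N) → ℕ) (β : Fin (suc d) → Maybe ℕ)
  (bl : ∀ i → below (suc N) (β i)) (le : ∀ i → tsize (A i) (β i) ≤ N) where

  open Typeds A β bl le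

  #R : List ℕ → ℕ
  #R R = tuples∑ (suc d + length R) (λ ws → ⟦ preds (TP ++ map rankB R) ws ⟧ * isCox ws)

  #F : List ℕ → List ℕ → ℕ
  #F R bs = tuples∑ (suc d + length R) (λ ws → ⟦ preds (TP ++ List.zipWith rankP R bs) ws ⟧ * isCox ws)

  forget-all : ∀ R bs ws → length bs ≡ length R → preds (TP ++ List.zipWith rankP R bs) ws ≡ true → preds (TP ++ map rankB R) ws ≡ true
  forget-all R bs ws l e with preds-split TP (List.zipWith rankP R bs) ws e
  ... | us , vs , refl , e₁ , e₂ = trans (preds-join TP (map rankB R) us vs e₁) (forget R bs vs l e₂)

  -- The typed factors already account for the one type B cycle granted by `one-B`, so the ranked
  -- factors have none.
  with-type-B : sumF (λ i → flags (β i)) ≡ 1 → ∀ R → Σrk + ∑ R id ≡ nn → #R R ≡ #F R (zeros (length R))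
  with-type-B Σf R Σr = tuples∑-cong (suc d + length R) (λ ws al _ → h ws al (eqW (prodW ws) (cox nn)) refl)
    where
    h : ∀ ws → All Perm ws → ∀ x → eqW (prodW ws) (cox nn) ≡ x → ⟦ preds (TP ++ map rankB R) ws ⟧ * isCox ws ≡ ⟦ preds (TP ++ List.zipWith rankP R (zeros (length R))) ws ⟧ * isCox ws
    h ws al false q = trans (cong (⟦ preds (TP ++ map rankB R) ws ⟧ *_) (cong ⟦_⟧ q)) (trans (*-zeroʳ ⟦ preds (TP ++ map rankB R) ws ⟧)
      (sym (trans (cong (⟦ preds (TP ++ List.zipWith rankP R (zeros (length R))) ws ⟧ *_) (cong ⟦_⟧ q)) (*-zeroʳ ⟦ preds (TP ++ List.zipWith rankP R (zeros (length R))) ws ⟧))))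
    h ws al true q = cong (λ b → ⟦ b ⟧ * isCox ws) (bool-⇔ to (forget-all R (zeros (length R)) ws (zeros-length (length R))))
      where
      to : preds (TP ++ map rankB R) ws ≡ true → preds (TP ++ List.zipWith rankP R (zeros (length R))) ws ≡ true
      to e with split-B R ws al (eqW-true (prodW ws) (cox nn) q) Σr e
      ... | us , vs , refl , e₁ , e₂ , s = trans (preds-join TP (List.zipWith rankP R (zeros (length R))) us vs e₁)
          (no-flags R vs e₂ (suc-injective (trans (cong (_+ ∑ vs uB) (sym Σf)) s)))

  -- Here the type B cycle must lie in exactly one ranked factor, and the sum runs over the
  -- possibilities.
  without-type-B : sumF (λ i → flags (β i)) ≡ 0 → ∀ R → Σrk + ∑ R id ≡ nn → #R R ≡ ∑ (sel (length R)) (#F R)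
  without-type-B Σf R Σr = trans (tuples∑-cong (suc d + length R) (λ ws al _ → h ws al (eqW (prodW ws) (cox nn)) refl (preds (TP ++ map rankB R) ws) refl))
      (∑-swap (allLists (suc d + length R) (WB nn)) (sel (length R)) (λ ws bs → ⟦ preds (TP ++ List.zipWith rankP R bs) ws ⟧ * isCox ws))
    where
    h : ∀ ws → All Perm ws → ∀ x → eqW (prodW ws) (cox nn) ≡ x → ∀ y → preds (TP ++ map rankB R) ws ≡ y →
      ⟦ preds (TP ++ map rankB R) ws ⟧ * isCox ws ≡ ∑ (sel (length R)) (λ bs → ⟦ preds (TP ++ List.zipWith rankP R bs) ws ⟧ * isCox ws)
    h ws al false q y e = trans (cong (⟦ preds (TP ++ map rankB R) ws ⟧ *_) (cong ⟦_⟧ q)) (trans (*-zeroʳ ⟦ preds (TP ++ map rankB R) ws ⟧)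
      (sym (∑-zero (sel (length R)) (λ bs → trans (cong (⟦ preds (TP ++ List.zipWith rankP R bs) ws ⟧ *_) (cong ⟦_⟧ q)) (*-zeroʳ ⟦ preds (TP ++ List.zipWith rankP R bs) ws ⟧)))))
    h ws al true q false e = trans (cong (λ b → ⟦ b ⟧ * isCox ws) e) (sym (trans (∑-cong∈ (sel (length R)) {g = λ _ → 0} (λ bs m → cong (λ b → ⟦ b ⟧ * isCox ws)
      (not-true (λ t → BP.not-¬ (trans (sym e) (forget-all R bs ws (proj₁ (sel-facts (length R) m)) t)) refl)))) (∑-0 (sel (length R)))))
    h ws al true q true e with split-B R ws al (eqW-true (prodW ws) (cox nn) q) Σr e
    ... | us , vs , refl , e₁ , e₂ , s = trans (cong (λ b → ⟦ b ⟧ * isCox (us ++ vs)) e) (sym (trans (∑-*ʳ (sel (length R)) (isCox (us ++ vs)) _)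
        (cong (_* isCox (us ++ vs)) (trans (∑-cong (sel (length R)) (λ bs → cong ⟦_⟧ (preds-join TP (List.zipWith rankP R bs) us vs e₁)))
          (sel-one R vs e₂ (trans (cong (_+ ∑ vs uB) (sym Σf)) s))))))

  Kt Wt : ℕ
  Kt = prodF (λ i → nn ∸ tsize (A i) (β i))
  Wt = prodF (λ i → typedWeight N (A i) (β i))

  rank-list-B : sumF (λ i → flags (β i)) ≡ 1 → ∀ R → Σrk + ∑ R id ≡ nn → #R R * Kt ≡ nn ^ d * Wt * prodL R (nn C_)
  rank-list-B Σf R Σr = trans (cong (_* Kt) (with-type-B Σf R Σr)) (trans (flagged-count (flagged-zeros R bound) Σr (trans (cong (sumF (λ i → flags (β i)) +_) (∑-zeros (length R))) (trans (+-identityʳ _) Σf)))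
    (cong (nn ^ d * Wt *_) (choices-zeros nn R)))
    where
    bound : ∑ R id ≤ N
    bound = s≤s⁻¹ (≤-trans (+-monoˡ-≤ (∑ R id) (≤-trans (≤-reflexive (sym Σf)) (m≤n+m _ (sumF (λ i → tsize (A i) (β i)))))) (≤-reflexive Σr))

  rank-list-A : sumF (λ i → flags (β i)) ≡ 0 → ∀ R → Σrk + ∑ R id ≡ nn → #R R * Kt ≡ nn ^ d * Wt * (∑ R id * prodL R (nn C_))
  rank-list-A Σf R Σr = trans (cong (_* Kt) (without-type-B Σf R Σr)) (trans (sym (∑-*ʳ (sel (length R)) Kt (#F R))) (trans (∑-cong∈ (sel (length R)) one)
    (trans (∑-*ˡ (sel (length R)) (nn ^ d * Wt) (choices nn R)) (cong (nn ^ d * Wt *_) (choices-sel nn R)))))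
    where
    one : ∀ bs → bs ∈ sel (length R) → #F R bs * Kt ≡ nn ^ d * Wt * choices nn R bs
    one bs q with flagged-or-vacuous {N} R q (≤-trans (m≤n+m _ Σrk) (≤-reflexive Σr))
    ... | inj₁ v = flagged-count v Σr (trans (cong (_+ ∑ bs id) Σf) (proj₂ (sel-facts (length R) q)))
    ... | inj₂ z = trans (cong (_* Kt) none) (sym (trans (cong (nn ^ d * Wt *_) (choices-vacuous nn z)) (*-zeroʳ (nn ^ d * Wt))))
      where
      none : #F R bs ≡ 0
      none = trans (tuples∑-cong (suc d + length R) {H' = λ _ → 0} (λ ws al _ → cong (λ b → ⟦ b ⟧ * isCox ws) (not-true (λ e → bad ws al e)))) (∑-0 (allLists (suc d + length R) (WB nn)))
        where
        bad : ∀ ws → All Perm ws → preds (TP ++ List.zipWith rankP R bs) ws ≡ true → ⊥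
        bad ws al e with preds-split TP (List.zipWith rankP R bs) ws e
        ... | us , vs , refl , e₁ , e₂ = preds-vacuous vs (AllP.++⁻ʳ us al) z e₂

part-i : ∀ N d (j : Fin (suc d)) α (A : Fin (suc d) → Fin (suc N) → ℕ) l (ms ss : Fin l → ℕ) →
  let T = λ i → ctype (A i) (if i ==F j then just α else nothing) in
  1 ≤ α → sumF (λ i → rk (T i)) + sumF ss ≡ suc N →
  numFactorisations (suc N) (suc d) T l ms ss * prodF (λ i → if i ==F j then 1 else suc N ∸ rk (T i))
  ≡ suc N ^ d * multinomial (suc N ∸ rk (T j)) (A j) * prodF (λ i → if i ==F j then 1 else multinomial (suc N ∸ rk (T i)) (A i)) * prodF (λ i → (ms i * suc N) C ss i)
-- `suc kj`, which is n - rk T_j + 1, is the number of cycles of σ_j. It enters on the left as its K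
-- and on the right as the number of places for the type B letter, so no denominator for j survives.
part-i N d j α A l ms ss 1≤α Σn = *-cancelˡ-≡ _ _ (suc kj) (begin
  suc kj * (num * X) ≡⟨ lem₁ (suc kj) num X ⟩
  num * (suc kj * X) ≡⟨ cong₂ _*_ (num-blocks (suc N) (suc d) Ty l ms ss) (sym Kt≡) ⟩
  blockSum l ms ss #R * Kt ≡⟨ trans (*-comm _ Kt) (sym (blockSum-* l ms ss Kt #R)) ⟩
  blockSum l ms ss (λ R → Kt * #R R) ≡⟨ blockSum-cong l ms ss (λ R e → trans (*-comm Kt (#R R)) (rank-list-B Σf R (trans (cong (_+ ∑ R id) Σrk≡) (trans (cong (sumF (λ i → rk (Ty i)) +_) e) Σn)))) ⟩
  blockSum l ms ss (λ R → nn ^ d * Wt * prodL R (nn C_)) ≡⟨ trans (blockSum-* l ms ss (nn ^ d * Wt) _) (cong (nn ^ d * Wt *_) (blockSum-C nn l ms ss)) ⟩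
  nn ^ d * Wt * Bs ≡⟨ cong (λ w → nn ^ d * w * Bs) Wt≡ ⟩
  nn ^ d * (suc kj * multinomial kj (A j) * Y) * Bs ≡⟨ lem₂ (nn ^ d) (suc kj) (multinomial kj (A j)) Y Bs ⟩
  suc kj * (nn ^ d * multinomial kj (A j) * Y * Bs) ∎)
  where
  open ≡-Reasoning
  lem₁ : ∀ x y z → x * (y * z) ≡ y * (x * z)
  lem₁ = solve-∀
  lem₂ : ∀ x k m y c → x * (k * m * y) * c ≡ k * (x * m * y * c)
  lem₂ = solve-∀
  β : Fin (suc d) → Maybe ℕ
  β i = if i ==F j then just α else nothing
  Ty : Fin (suc d) → CType (suc N)
  Ty i = ctype (A i) (β i)
  num = numFactorisations (suc N) (suc d) Ty l ms ss
  X = prodF (λ i → if i ==F j then 1 else suc N ∸ rk (Ty i))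
  Y = prodF (λ i → if i ==F j then 1 else multinomial (suc N ∸ rk (Ty i)) (A i))
  Bs = prodF (λ i → (ms i * suc N) C ss i)
  kj = suc N ∸ rk (Ty j)
  βj : β j ≡ just α
  βj = cong (λ b → if b then just α else nothing) (==F-refl j)
  βi : ∀ i → i ≢ j → β i ≡ nothing
  βi i ne = cong (λ b → if b then just α else nothing) (==F-≢ ne)
  rk-flags : ∀ i → (∃ λ a → β i ≡ just a × 1 ≤ a) ⊎ β i ≡ nothing
  rk-flags i with i ≟F j
  ... | yes refl = inj₁ (α , refl , 1≤α)
  ... | no ne = inj₂ refl
  rk-size : ∀ i → tsize (A i) (β i) + flags (β i) ≡ rk (Ty i)
  rk-size i = by (β i) (rk-flags i)
    where
    by : ∀ β' → (∃ λ a → β' ≡ just a × 1 ≤ a) ⊎ β' ≡ nothing → tsize (A i) β' + flags β' ≡ rk (ctype (A i) β')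
    by (just zero) (inj₁ (_ , refl , ()))
    by (just (suc a)) (inj₁ _) = trans (+-assoc (sumF (λ k → suc (toℕ k) * A i k)) _ 1) (cong (sumF (λ k → suc (toℕ k) * A i k) +_) (+-comm _ 1))
    by nothing _ = +-identityʳ _
    by (just a) (inj₂ ())
  rk≤ : ∀ i → rk (Ty i) ≤ suc N
  rk≤ i = ≤-trans (sumF-single (λ i → rk (Ty i)) i) (≤-trans (m≤m+n _ _) (≤-reflexive Σn))
  rkj≥1 : 1 ≤ rk (Ty j)
  rkj≥1 = ≤-trans (≤-reflexive (cong flags (sym βj))) (≤-trans (m≤n+m (flags (β j)) (tsize (A j) (β j))) (≤-reflexive (rk-size j)))
  -- T_j has rank at least 1, which keeps the other ranks below n.
  rki< : ∀ i → i ≢ j → rk (Ty i) ≤ N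
  rki< i ne = s≤s⁻¹ (≤-trans (≤-reflexive (+-comm 1 (rk (Ty i)))) (≤-trans (+-monoʳ-≤ (rk (Ty i)) rkj≥1)
    (≤-trans (pair (λ i → rk (Ty i)) i j ne) (≤-trans (m≤m+n _ (sumF ss)) (≤-reflexive Σn)))))
    where
    pair : ∀ {M} (f : Fin M → ℕ) i j → i ≢ j → f i + f j ≤ sumF f
    pair f zero zero ne = ⊥-elim (ne refl)
    pair f zero (suc j) ne = +-monoʳ-≤ (f zero) (sumF-single (f ∘ suc) j)
    pair f (suc i) zero ne = ≤-trans (≤-reflexive (+-comm (f (suc i)) (f zero))) (+-monoʳ-≤ (f zero) (sumF-single (f ∘ suc) i))
    pair f (suc i) (suc j) ne = ≤-trans (pair (f ∘ suc) i j (ne ∘ cong suc)) (m≤n+m _ (f zero))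
  bl : ∀ i → below (suc N) (β i)
  bl i with i ≟F j in eq
  ... | yes refl = 1≤α , ≤-trans (m≤n+m α (sumF (λ k → suc (toℕ k) * A i k))) (subst (λ b → sumF (λ k → suc (toℕ k) * A i k) + maybe (λ a → a) 0 b ≤ suc N) βj (rk≤ j))
  ... | no ne = refl
  le : ∀ i → tsize (A i) (β i) ≤ N
  le i with i ≟F j in eq
  ... | no ne = ≤-trans (≤-trans (≤-reflexive (cong (tsize (A i)) (sym (βi i ne)))) (≤-trans (m≤m+n _ (flags (β i))) (≤-reflexive (rk-size i)))) (rki< i ne)
  ... | yes refl = s≤s⁻¹ (≤-trans (≤-reflexive (trans (+-comm 1 _) (trans (cong₂ (λ b c → tsize (A j) b + flags c) (sym βj) (sym βj)) (rk-size j)))) (rk≤ j))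
  open Assembly A β bl le
  open Typeds A β bl le using (nn; Σrk)
  Σf : sumF (λ i → flags (β i)) ≡ 1
  Σf = trans (sumF-cong h) (sumF-δ j)
    where
    h : ∀ i → flags (β i) ≡ ⟦ i ==F j ⟧
    h i with i ==F j
    ... | true = refl
    ... | false = refl
  Σrk≡ : Σrk ≡ sumF (λ i → rk (Ty i))
  Σrk≡ = trans (sym (sumF-+ (λ i → tsize (A i) (β i)) (λ i → flags (β i)))) (sumF-cong rk-size)
  Nj : N ∸ tsize (A j) (just α) ≡ kj
  Nj = cong (suc N ∸_) (trans (trans (+-comm 1 _) (cong₂ (λ b c → tsize (A j) b + flags c) (sym βj) (sym βj))) (rk-size j))
  tsize-i : ∀ i → i ≢ j → suc N ∸ tsize (A i) (β i) ≡ suc N ∸ rk (Ty i)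
  tsize-i i ne = cong (suc N ∸_) (trans (sym (+-identityʳ _)) (trans (cong (λ b → tsize (A i) (β i) + flags b) (sym (βi i ne))) (rk-size i)))
  lej : tsize (A j) (just α) ≤ N
  lej = subst (λ b → tsize (A j) b ≤ N) βj (le j)
  off1 : ∀ (f : Fin (suc d) → ℕ) → (if j ==F j then 1 else f j) ≡ 1
  off1 f = cong (λ b → if b then 1 else f j) (==F-refl j)
  offi : ∀ (f : Fin (suc d) → ℕ) i → i ≢ j → (if i ==F j then 1 else f i) ≡ f i
  offi f i ne = cong (λ b → if b then 1 else f i) (==F-≢ ne)
  Kt≡ : Kt ≡ suc kj * X
  Kt≡ = prodF-at _ _ j (suc kj) (trans (cong (λ b → suc N ∸ tsize (A j) b) βj) (trans (+-∸-assoc 1 lej) (cong suc Nj)))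
    (off1 (λ i → suc N ∸ rk (Ty i))) (λ i ne → trans (tsize-i i ne) (sym (offi (λ i → suc N ∸ rk (Ty i)) i ne)))
  Wt≡ : Wt ≡ suc kj * multinomial kj (A j) * Y
  Wt≡ = prodF-at _ _ j _ (trans (cong (typedWeight N (A j)) βj) (cong (λ k → suc k * multinomial k (A j)) Nj))
    (off1 (λ i → multinomial (suc N ∸ rk (Ty i)) (A i)))
    (λ i ne → trans (cong (typedWeight N (A i)) (βi i ne)) (trans (cong (λ k → multinomial k (A i)) (trans (cong (λ b → suc N ∸ tsize (A i) b) (sym (βi i ne))) (tsize-i i ne))) (sym (offi (λ i → multinomial (suc N ∸ rk (Ty i)) (A i)) i ne))))

part-ii : ∀ N d (A : Fin (suc d) → Fin (suc N) → ℕ) l (ms ss : Fin l → ℕ) →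
  let T = λ i → ctype (A i) nothing in
  sumF (λ i → rk (T i)) + sumF ss ≡ suc N →
  numFactorisations (suc N) (suc d) T l ms ss * prodF (λ i → suc N ∸ rk (T i))
  ≡ suc N ^ d * (suc N ∸ sumF (λ i → rk (T i))) * prodF (λ i → multinomial (suc N ∸ rk (T i)) (A i)) * prodF (λ i → (ms i * suc N) C ss i)
part-ii N d A l ms ss Σn = by (any? (λ i → suc N ≤? rk (Ty i)))
  where
  open ≡-Reasoning
  Ty : Fin (suc d) → CType (suc N)
  Ty i = ctype (A i) nothing
  nn = suc N
  num = numFactorisations (suc N) (suc d) Ty l ms ss
  Wm = prodF (λ i → multinomial (suc N ∸ rk (Ty i)) (A i))
  Bs = prodF (λ i → (ms i * suc N) C ss i)
  S = sumF (λ i → rk (Ty i))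
  ss≡ : sumF ss ≡ nn ∸ S
  ss≡ = trans (sym (m+n∸m≡n S (sumF ss))) (cong (_∸ S) Σn)
  by : Dec (∃ λ i → suc N ≤ rk (Ty i)) → num * prodF (λ i → nn ∸ rk (Ty i)) ≡ nn ^ d * (nn ∸ S) * Wm * Bs
  -- A type of full rank makes n - rk T_i vanish on the left and n - Σ rk T_i on the right. It is
  -- treated apart because `Assembly` asks for sizes of at most N.
  by (yes (i , big)) = trans (cong (num *_) (prodF-0 (λ i → nn ∸ rk (Ty i)) i (m≤n⇒m∸n≡0 big))) (trans (*-zeroʳ num)
    (sym (trans (cong (λ x → nn ^ d * x * Wm * Bs) (m≤n⇒m∸n≡0 (≤-trans big (sumF-single (λ i → rk (Ty i)) i)))) (cong (λ x → x * Wm * Bs) (*-zeroʳ (nn ^ d))))))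
  by (no ¬big) = begin
    num * Kt ≡⟨ cong (_* Kt) (num-blocks nn (suc d) Ty l ms ss) ⟩
    blockSum l ms ss #R * Kt ≡⟨ trans (*-comm _ Kt) (sym (blockSum-* l ms ss Kt #R)) ⟩
    blockSum l ms ss (λ R → Kt * #R R) ≡⟨ blockSum-cong l ms ss (λ R e → trans (*-comm Kt (#R R)) (trans (rank-list-A Σf R (trans (cong (_+ ∑ R id) Σrk≡) (trans (cong (S +_) e) Σn)))
         (trans (cong (λ x → nn ^ d * Wt * (x * prodL R (nn C_))) (trans e ss≡)) (sym (*-assoc (nn ^ d * Wt) (nn ∸ S) _))))) ⟩
    blockSum l ms ss (λ R → nn ^ d * Wt * (nn ∸ S) * prodL R (nn C_)) ≡⟨ trans (blockSum-* l ms ss (nn ^ d * Wt * (nn ∸ S)) _) (cong (nn ^ d * Wt * (nn ∸ S) *_) (blockSum-C nn l ms ss)) ⟩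
    nn ^ d * Wt * (nn ∸ S) * Bs ≡⟨ lem (nn ^ d) Wt (nn ∸ S) Bs ⟩
    nn ^ d * (nn ∸ S) * Wm * Bs ∎
    where
    lem : ∀ x w s c → x * w * s * c ≡ x * s * w * c
    lem = solve-∀
    open Assembly A (λ _ → nothing) (λ _ → refl) (λ i → s≤s⁻¹ (≰⇒> (λ b → ¬big (i , b))))
    open Typeds A (λ _ → nothing) (λ _ → refl) (λ i → s≤s⁻¹ (≰⇒> (λ b → ¬big (i , b)))) using (Σrk)
    Σf : sumF {suc d} (λ i → 0) ≡ 0
    Σf = trans (sumF-const {suc d} 0) (*-zeroʳ (suc d))
    Σrk≡ : Σrk ≡ S
    Σrk≡ = trans (cong (S +_) Σf) (+-identityʳ S)

theorem9 : ((n d : ℕ) (j : Fin d) (α : ℕ) (A : Fin d → Fin n → ℕ)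
    (l : ℕ) (ms ss : Fin l → ℕ) →
    let T = λ (i : Fin d) → ctype (A i) (if i ==F j then just α else nothing) in
    1 ≤ α →
    sumF (λ i → rk (T i)) + sumF ss ≡ n →
    numFactorisations n d T l ms ss
    * prodF (λ i → if i ==F j then 1 else n ∸ rk (T i))
    ≡ n ^ (d ∸ 1)
    * multinomial (n ∸ rk (T j)) (A j)
    * prodF (λ i → if i ==F j then 1 else multinomial (n ∸ rk (T i)) (A i))
    * prodF (λ i → (ms i * n) C ss i))
    ×
    ((n d : ℕ) → 1 ≤ d → (A : Fin d → Fin n → ℕ)
    (l : ℕ) (ms ss : Fin l → ℕ) →
    let T = λ (i : Fin d) → ctype (A i) nothing in
    sumF (λ i → rk (T i)) + sumF ss ≡ n →
    numFactorisations n d T l ms ss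
    * prodF (λ i → n ∸ rk (T i))
    ≡ n ^ (d ∸ 1)
    * (n ∸ sumF (λ i → rk (T i)))
    * prodF (λ i → multinomial (n ∸ rk (T i)) (A i))
    * prodF (λ i → (ms i * n) C ss i))
theorem9 = first , second
  where
  first : ∀ n d (j : Fin d) α (A : Fin d → Fin n → ℕ) l (ms ss : Fin l → ℕ) → _
  first zero (suc d) j α A l ms ss 1≤α Σn = ⊥-elim (n≮0 (≤-trans 1≤α (≤-trans (≤-reflexive (sym αj)) (≤-trans (sumF-single (λ i → rk (ctype (A i) (if i ==F j then just α else nothing))) j) (≤-trans (m≤m+n _ _) (≤-reflexive Σn))))))
    where
    αj : rk (ctype (A j) (if j ==F j then just α else nothing)) ≡ α
    αj = cong (λ b → rk (ctype (A j) (if b then just α else nothing))) (==F-refl j)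
  first (suc N) (suc d) j α A l ms ss 1≤α Σn = part-i N d j α A l ms ss 1≤α Σn
  second : ∀ n d → 1 ≤ d → (A : Fin d → Fin n → ℕ) → ∀ l (ms ss : Fin l → ℕ) → _
  -- For n = 0 a zero factor stands on either side: on the left n - rk T_i, which occurs because d
  -- is positive, and on the right n - Σ rk T_i.
  second zero (suc d) _ A l ms ss Σn = trans (*-zeroʳ (numFactorisations 0 (suc d) (λ i → ctype (A i) nothing) l ms ss))
    (sym (cong (λ x → x * prodF (λ i → multinomial 0 (A i)) * prodF (λ i → (ms i * 0) C ss i)) (trans (cong (0 ^ d *_) (0∸n≡0 (sumF (λ i → rk (ctype (A i) nothing))))) (*-zeroʳ (0 ^ d)))))
  second (suc N) (suc d) _ A l ms ss Σn = part-ii N d A l ms ss Σn
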